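{- Let $\diamondsuit\in\{\varnothing,\square,\mathrm{v},\mathrm{h}\}$, let $R=(R_1,\dots,R_L)$ be a sequence of partitions, $|R|=\sum_i|R_i|$, and let $\lambda$ be a partition. Then $$K^\diamondsuit_{\lambda;R}(t)=t^{|R|-|\lambda|}\sum_{\substack{\tau\\ |\tau|=|R|}}K^{\varnothing}_{\tau;R}(t)\sum_{\substack{\mu\in\mathcal{P}^\diamondsuit\\ |\mu|=|R|-|\lambda|}}c^\tau_{\lambda\mu},$$ where $\tau$ runs over partitions and $c^\tau_{\lambda\mu}$ is the Littlewood–Richardson coefficient.
   Context: $\Lambda$ is the ring of symmetric functions in $X=x_1+x_2+\cdots$ (rational coefficients, extended by auxiliary indeterminates as needed), with the scalar product for which Schur functions are orthonormal. Plethystic notation: $P[A]$ is obtained from $P\in\Lambda$ by expressing $P$ in power sums and replacing $p_k$ by $p_k[A]$, where $p_k[A]$ raises every indeterminate in $A$ (including $t$) to the $k$-th power and $p_k[A-B]=p_k[A]-p_k[B]$; $\Omega[A]=\exp(\sum_{k\ge1}p_k[A]/k)$. $P^\perp$ is the operator adjoint to multiplication by $P$ (in the $X$ variables); in particular $\Omega[XA]^\perp P[X]=P[X+A]$. The symbols: $\varnothing$, $\square$ (single cell), $\mathrm{h}$ (horizontal domino), $\mathrm{v}$ (vertical domino). Put $f_\varnothing=0$, $f_\square=s_1+s_{(1^2)}$, $f_{\mathrm{h}}=s_2$, $f_{\mathrm{v}}=s_{(1^2)}$; thus $f_\diamondsuit[tX]$ is $0$, $ts_1[X]+t^2s_{(1^2)}[X]$,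 $t^2s_2[X]$, $t^2s_{(1^2)}[X]$ respectively. $\mathcal{P}^\varnothing$ consists of the empty partition only, $\mathcal{P}^\square$ is the set of all partitions, $\mathcal{P}^{\mathrm h}$ the partitions all of whose rows have even length, $\mathcal{P}^{\mathrm v}$ the partitions all of whose columns have even length. Let $s^\diamondsuit_\lambda=\Omega[-f_\diamondsuit]^\perp s_\lambda$, a basis of $\Lambda$. Bernstein's operators $B_r\in\mathrm{End}(\Lambda)$ are defined by $\sum_{r\in\mathbb{Z}}B_rz^r=\Omega[zX]\,\Omega[-z^{ -1}X]^\perp$ (skew, then multiply); $B_\nu=B_{\nu_1}\circ\cdots\circ B_{\nu_n}$ for $\nu\in\mathbb{Z}^n$. The $t$-analogue of $V\in\mathrm{End}(\Lambda)$ is $\widetilde V(P[X])=V^Y(P[tX+(1-t)Y])|_{Y\to X}$, where $V^Y$ is $V$ acting in a second set of variables $Y$ and afterwards $Y$ is replaced by $X$. Let $\widetilde B_{\nu,t^2}$ be the $t$-analogue of $B_\nu$ with $t$ replaced by $t^2$, and $$H^\diamondsuit_\nu=\Omega[f_\diamondsuit[tX]-f_\diamondsuit[X]]^\perp\circ\widetilde B_{\nu,t^2}\circ\Omega[f_\diamondsuit[X]-f_\diamondsuit[tX]]^\perp .$$ A partition $R_i$ is regarded as an element of $\mathbb{Z}^{\ell(R_i)}$, and $K^\diamondsuit_{\lambda;R}(t)$ is defined by $H^\diamondsuit_{R_1}\cdots H^\diamondsuit_{R_L}1=\sum_\lambda K^\diamondsuit_{\lambda;R}(t)\,s^\diamondsuit_\lambda$.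 (If $|\lambda|>|R|$ the right side of the claim is an empty sum, i.e. $0$.) -}

module Defs where

open import Data.Bool.Base using (if_then_else_)
open import Data.Integer.Base as ℤ using (ℤ; +_; -[1+_])
open import Data.List.Base
  using (List; []; _∷_; _++_; map; concatMap; foldr; filter; length; replicate; upTo; downFrom)
open import Data.List.Properties using (≡-dec)
open import Data.List.Relation.Binary.Permutation.Propositional using (↭-sym)
open import Data.List.Relation.Binary.Permutation.Propositional.Properties using (All-resp-↭)
open import Data.List.Relation.Unary.All as All using (All; all?)
open import Data.List.Relation.Unary.All.Properties using (all-filter)
open import Data.List.Relation.Unary.Linked using (Linked)
import Data.List.Sort.InsertionSort as InsertionSort
open import Data.Nat.Base as ℕ using (ℕ; zero; suc; _+_; _∸_; _*_; _<_; _≥_; _⊔_; NonZero; _!)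
open import Data.Nat.ListAction using (sum)
open import Data.Nat.Divisibility using (_∣_; _∣?_)
import Data.Nat.DivMod as ℕ
open import Data.Nat.Properties
  using (_≟_; _≤?_; _<?_; _!≢0; <⇒≱; ≤-decTotalOrder)
open import Data.Product.Base using (_×_; _,_; ∃-syntax)
open import Data.Rational.Base as ℚ using (ℚ; 0ℚ; 1ℚ)
open import Data.Vec.Base as Vec using (Vec; []; _∷_)
open import Function.Base using (_∘_; id)
open import Relation.Binary.Bundles using (DecTotalOrder)
import Relation.Binary.Properties.DecTotalOrder as DecTotalOrderProperties
open import Relation.Binary.PropositionalEquality using (_≡_; refl)
open import Relation.Nullary.Decidable using (Dec; yes; does; dec-false)
open import Relation.Unary using (Decidable)
open import Data.Unit.Base using (⊤; tt)

-- The list a₀ ∷ a₁ ∷ … stands for a₀ + a₁ t + …; trailing zeros are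
-- allowed, so equality is _≋_ rather than _≡_.
ℚ[t] : Set
ℚ[t] = List ℚ

coeffₜ : ℚ[t] → ℕ → ℚ
coeffₜ []      _       = 0ℚ
coeffₜ (a ∷ p) zero    = a
coeffₜ (a ∷ p) (suc n) = coeffₜ p n

infix 4 _≋_
record _≋_ (p q : ℚ[t]) : Set where
  constructor mk≋
  field
    coeffₜ-≡ : ∀ n → coeffₜ p n ≡ coeffₜ q n
open _≋_ public

infixl 6 _+ₜ_ _-ₜ_
infixl 7 _*ₜ_

const : ℚ → ℚ[t]
const a = a ∷ []

0ₜ 1ₜ : ℚ[t]
0ₜ = []
1ₜ = const 1ℚ

t^_ : ℕ → ℚ[t]
t^ n = replicate n 0ℚ ++ 1ₜ

_+ₜ_ : ℚ[t] → ℚ[t] → ℚ[t]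
[]      +ₜ q       = q
(a ∷ p) +ₜ []      = a ∷ p
(a ∷ p) +ₜ (b ∷ q) = (a ℚ.+ b) ∷ (p +ₜ q)

-ₜ_ : ℚ[t] → ℚ[t]
-ₜ_ = map (λ a → ℚ.- a)

_-ₜ_ : ℚ[t] → ℚ[t] → ℚ[t]
p -ₜ q = p +ₜ (-ₜ q)

_*ₜ_ : ℚ[t] → ℚ[t] → ℚ[t]
[]      *ₜ q = []
(a ∷ p) *ₜ q = map (a ℚ.*_) q +ₜ (0ℚ ∷ (p *ₜ q))

_[t↦t^_] : ℚ[t] → (k : ℕ) .{{_ : NonZero k}} → ℚ[t]
[]      [t↦t^ k ] = []
(a ∷ p) [t↦t^ k ] = a ∷ (replicate (ℕ.pred k) 0ℚ ++ (p [t↦t^ k ]))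

∑ : {A : Set} → List A → (A → ℚ[t]) → ℚ[t]
∑ xs f = foldr (λ x acc → f x +ₜ acc) 0ₜ xs

infix 5 ∑
syntax ∑ xs (λ x → e) = ∑[ x ← xs ] e

record Partition : Set where
  constructor mkPartition
  field
    parts      : List ℕ
    decreasing : Linked _≥_ parts
    positive   : All (0 <_) parts
open Partition public

∣_∣ : Partition → ℕ
∣ λ′ ∣ = sum (parts λ′)

_≡ₚ?_ : (λ′ μ : Partition) → Dec (parts λ′ ≡ parts μ)
λ′ ≡ₚ? μ = ≡-dec _≟_ (parts λ′) (parts μ)

≥-decTotalOrder : DecTotalOrder _ _ _
≥-decTotalOrder = DecTotalOrderProperties.≥-decTotalOrder ≤-decTotalOrder

module Descending = InsertionSort ≥-decTotalOrder

open import Data.List.Sort.Base (DecTotalOrder.totalOrder ≥-decTotalOrder)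
  using (module SortingAlgorithm)
open SortingAlgorithm Descending.insertionSort using (sort-↭; sort-↗)

-- The partition obtained from an exponent vector by dropping zeros and
-- sorting.
toPartition : List ℕ → Partition
toPartition α = mkPartition (Descending.sort α⁺) (sort-↗ α⁺)
  (All-resp-↭ (↭-sym (sort-↭ α⁺)) (all-filter (0 <?_) α))
  where α⁺ = filter (0 <?_) α

-- Partitions of n with all parts ≤ m, in decreasing lexicographic order;
-- j is the number of parts equal to suc m.
boundedPartitions : (n m : ℕ) → List (List ℕ)
boundedPartitions zero    zero    = [] ∷ []
boundedPartitions (suc n) zero    = []
boundedPartitions n       (suc m) =
  concatMap (λ j → map (replicate j (suc m) ++_) (boundedPartitions (n ∸ j * suc m) m))
            (filter (λ j → j * suc m ≤? n) (downFrom (suc n)))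

partitionsOf : ℕ → List Partition
partitionsOf n = map toPartition (boundedPartitions n n)

partitionsUpTo : ℕ → List Partition
partitionsUpTo n = concatMap partitionsOf (upTo (suc n))

-- A symmetric formal power series in x₁, x₂, … over ℚ[t], of possibly
-- unbounded degree: F λ is the coefficient of every monomial x^α whose
-- exponent vector α rearranges to λ, i.e. F stands for Σ_λ F(λ) m_λ.
Λ∞ : Set
Λ∞ = Partition → ℚ[t]

record Λ : Set where
  field
    bound    : ℕ
    coeff    : Λ∞
    vanishes : ∀ λ′ → bound < ∣ λ′ ∣ → coeff λ′ ≋ 0ₜ
open Λ public

infix 4 _≈_
record _≈_ (f g : Λ) : Set where
  constructor mk≈
  field
    coeff-≋ : ∀ λ′ → coeff f λ′ ≋ coeff g λ′
open _≈_ public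

truncate : ℕ → Λ∞ → Λ
truncate N F = record
  { bound    = N
  ; coeff    = λ λ′ → if does (∣ λ′ ∣ ≤? N) then F λ′ else 0ₜ
  ; vanishes = vanish
  }
  where
  vanish : ∀ λ′ → N < ∣ λ′ ∣ → (if does (∣ λ′ ∣ ≤? N) then F λ′ else 0ₜ) ≋ 0ₜ
  vanish λ′ N< rewrite dec-false (∣ λ′ ∣ ≤? N) (<⇒≱ N<) = mk≋ λ _ → refl

infixl 6 _⊕_ _⊖_
infixl 7 _⊛_
infixr 8 _⊙_

0∞ 1∞ : Λ∞
0∞ _  = 0ₜ
1∞ λ′ = if does (≡-dec _≟_ (parts λ′) []) then 1ₜ else 0ₜ

_⊕_ _⊖_ _⊛_ : Λ∞ → Λ∞ → Λ∞
(F ⊕ G) λ′ = F λ′ +ₜ G λ′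
(F ⊖ G) λ′ = F λ′ -ₜ G λ′

_⊙_ : ℚ[t] → Λ∞ → Λ∞
(c ⊙ F) λ′ = c *ₜ F λ′

-- All pairs (β , γ) of exponent vectors with β + γ = α.
splittings : List ℕ → List (List ℕ × List ℕ)
splittings []      = ([] , []) ∷ []
splittings (a ∷ α) =
  concatMap (λ i → map (λ (β , γ) → i ∷ β , (a ∸ i) ∷ γ) (splittings α)) (upTo (suc a))

(F ⊛ G) λ′ = ∑ (splittings (parts λ′)) λ (β , γ) → F (toPartition β) *ₜ G (toPartition γ)

_⊛^_ : Λ∞ → ℕ → Λ∞
F ⊛^ zero  = 1∞
F ⊛^ suc m = F ⊛ (F ⊛^ m)

infixl 6 _+Λ_
infixl 7 _*Λ_
infixr 8 _·Λ_

0Λ 1Λ : Λ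
0Λ = truncate 0 0∞
1Λ = truncate 0 1∞

_+Λ_ _*Λ_ : Λ → Λ → Λ
f +Λ g = truncate (bound f ⊔ bound g) (coeff f ⊕ coeff g)
f *Λ g = truncate (bound f + bound g) (coeff f ⊛ coeff g)

_·Λ_ : ℚ[t] → Λ → Λ
c ·Λ f = truncate (bound f) (c ⊙ coeff f)

∑Λ : {A : Set} → List A → (A → Λ) → Λ
∑Λ xs f = foldr (λ x acc → f x +Λ acc) 0Λ xs

infix 5 ∑Λ
syntax ∑Λ xs (λ x → e) = ∑Λ[ x ← xs ] e

homogeneousPart : ℕ → Λ∞ → Λ
homogeneousPart n F = truncate n (λ λ′ → if does (∣ λ′ ∣ ≟ n) then F λ′ else 0ₜ)

-- All μ with λ₁ ≥ μ₁ ≥ λ₂ ≥ μ₂ ≥ …, i.e. those for which λ/μ is a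
-- horizontal strip (as lists of the same length as λ, zeros allowed).
horizontalStrips : List ℕ → List (List ℕ)
horizontalStrips []          = [] ∷ []
horizontalStrips (a ∷ [])    = map (_∷ []) (upTo (suc a))
horizontalStrips (a ∷ b ∷ λ′) =
  concatMap (λ i → map ((b + i) ∷_) (horizontalStrips (b ∷ λ′))) (upTo (suc (a ∸ b)))

-- The number of semistandard tableaux of shape λ and content α, a tableau
-- being the chain of shapes got by stripping off the cells containing its
-- largest letter, then the next largest, ….  The alphabet is ordered so
-- that the letter counted by the head of α is the largest.
kostka : (λ′ α : List ℕ) → ℕ
kostka λ′ []      = if does (sum λ′ ≟ 0) then 1 else 0
kostka λ′ (a ∷ α) =
  sum (map (λ μ → kostka μ α) (filter (λ μ → a + sum μ ≟ sum λ′) (horizontalStrips λ′)))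

s : Partition → Λ
s λ′ = truncate ∣ λ′ ∣ (λ μ → const (+ kostka (parts λ′) (parts μ) ℚ./ 1))

-- Coordinates of f with respect to the Schur functions s_μ, μ running over
-- the given list.  As s_μ = m_μ + (terms m_ν with ν lexicographically
-- smaller), the coordinates are read off one after the other when the list
-- is lexicographically decreasing.
schurElimination : List Partition → Λ∞ → Λ∞
schurElimination []       F λ′ = 0ₜ
schurElimination (μ ∷ μs) F λ′ =
  if does (μ ≡ₚ? λ′) then F μ else schurElimination μs (F ⊖ F μ ⊙ coeff (s μ)) λ′

-- F = Σ_λ schurCoord F λ · s_λ.
schurCoord : Λ∞ → Partition → ℚ[t]
schurCoord F λ′ = schurElimination (partitionsOf ∣ λ′ ∣) F λ′

-- The ℚ[t]-bilinear scalar product making the Schur functions orthonormal;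
-- it makes sense as soon as one of the arguments has bounded degree.
⟨_,_⟩ : Λ → Λ∞ → ℚ[t]
⟨ f , G ⟩ = ∑[ λ′ ← partitionsUpTo (bound f) ] schurCoord (coeff f) λ′ *ₜ schurCoord G λ′

-- The adjoint of multiplication by P:  ⟨ P ^⊥ f , s_λ ⟩ = ⟨ f , P s_λ ⟩.
-- The scalar product vanishes when ∣ λ ∣ exceeds the degree of f.
_^⊥ : Λ∞ → Λ → Λ
(P ^⊥) f = ∑Λ[ λ′ ← partitionsUpTo (bound f) ] (⟨ f , P ⊛ coeff (s λ′) ⟩ ·Λ s λ′)

-- The Littlewood–Richardson coefficient c^τ_{λμ}: the coefficient of s_τ in
-- s_λ s_μ.
LR : (τ λ′ μ : Partition) → ℚ[t]
LR τ λ′ μ = schurCoord (coeff (s λ′) ⊛ coeff (s μ)) τ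

p : ℕ → Λ
p k = truncate k (λ λ′ → if does (≡-dec _≟_ (parts λ′) (k ∷ [])) then 1ₜ else 0ₜ)

-- p_k[A]: every indeterminate of A, including t, is raised to the k-th power.
p[_]_ : (k : ℕ) .{{_ : NonZero k}} → Λ∞ → Λ∞
(p[ k ] A) λ′ =
  if does (all? (k ∣?_) (parts λ′))
  then A (toPartition (map (ℕ._/ k) (parts λ′))) [t↦t^ k ]
  else 0ₜ

-- Σ_{k≥1} p_k[A]/k for A without constant term.  Only k ≤ ∣ λ ∣ can
-- contribute to the coefficient of m_λ.
∑p/k : Λ∞ → Λ∞
∑p/k A λ′ = ∑[ j ← upTo ∣ λ′ ∣ ] const (+ 1 ℚ./ suc j) *ₜ (p[ suc j ] A) λ′

-- exp G for G without constant term, so that G^m has no terms of degree < m.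
exp : Λ∞ → Λ∞
exp G λ′ = ∑[ m ← upTo (suc ∣ λ′ ∣) ] const ((+ 1 ℚ./ m !) {{m !≢0}}) *ₜ (G ⊛^ m) λ′

Ω : Λ∞ → Λ∞
Ω A = exp (∑p/k A)

_[tX] : Λ∞ → Λ∞
(F [tX]) λ′ = t^ ∣ λ′ ∣ *ₜ F λ′

-- Expansion in power sums: the pair (c , μ) stands for c p_{μ₁} p_{μ₂} ….
PowerSumExpression : Set
PowerSumExpression = List (ℚ[t] × List ℕ)

addToEach : ∀ {n} → ℕ → Vec ℕ n → List (Vec ℕ n)
addToEach a []      = []
addToEach a (b ∷ β) = ((a + b) ∷ β) ∷ map (b ∷_) (addToEach a β)

-- The augmented monomial symmetric function, the sum of x_{i₁}^{α₁} x_{i₂}^{α₂} …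
-- over all sequences of distinct indices i₁, i₂, …, in terms of power sums.
-- The recursion is
--   p_a m̃_{(β₁,…,β_n)} = m̃_{(a,β₁,…,β_n)} + Σ_i m̃_{(β₁,…,a+β_i,…,β_n)}.
augmentedMonomial : ∀ n → Vec ℕ n → PowerSumExpression
augmentedMonomial zero    []      = (1ₜ , []) ∷ []
augmentedMonomial (suc n) (a ∷ β) =
  map (λ (c , μ) → c , a ∷ μ) (augmentedMonomial n β)
  ++ map (λ (c , μ) → -ₜ c , μ) (concatMap (augmentedMonomial n) (addToEach a β))

-- 1 / ∏_i m_i!, where m_i is the number of entries equal to i:
-- m_λ = m̃_λ / ∏_i m_i(λ)!.
1/multiplicities! : List ℕ → ℚ
1/multiplicities! []      = 1ℚ
1/multiplicities! (a ∷ α) =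
  (+ 1 ℚ./ suc (length (filter (a ≟_) α))) ℚ.* 1/multiplicities! α

inPowerSums : Λ → PowerSumExpression
inPowerSums f = concatMap term (partitionsUpTo (bound f))
  where
  term : Partition → PowerSumExpression
  term λ′ = map (λ (c , μ) → coeff f λ′ *ₜ const (1/multiplicities! (parts λ′)) *ₜ c , μ)
                (augmentedMonomial _ (Vec.fromList (parts λ′)))

-- Λ_X ⊗ Λ_Y; the list of pairs (a , b) stands for Σ a[X] b[Y].
Λ⊗Λ : Set
Λ⊗Λ = List (Λ × Λ)

-- p_k[qX + (1 - q)Y] = q(t^k) p_k[X] + (1 - q(t^k)) p_k[Y], multiplied over
-- the entries of μ (which are positive in all uses; the entry 0 is vacuous).
p[qX+[1-q]Y] : ℚ[t] → List ℕ → Λ⊗Λ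
p[qX+[1-q]Y] q []          = (1Λ , 1Λ) ∷ []
p[qX+[1-q]Y] q (zero  ∷ μ) = p[qX+[1-q]Y] q μ
p[qX+[1-q]Y] q (suc j ∷ μ) =
  concatMap (λ (a , b) → (qᵏ ·Λ p k *Λ a , b) ∷ (a , (1ₜ -ₜ qᵏ) ·Λ p k *Λ b) ∷ [])
            (p[qX+[1-q]Y] q μ)
  where
  k  = suc j
  qᵏ = q [t↦t^ k ]

_[qX+[1-q]Y]_ : Λ → ℚ[t] → Λ⊗Λ
f [qX+[1-q]Y] q =
  concatMap (λ (c , μ) → map (λ (a , b) → c ·Λ a , b) (p[qX+[1-q]Y] q μ)) (inPowerSums f)

-- The t-analogue of V, with t replaced by q.
tAnalogue : (q : ℚ[t]) → (Λ → Λ) → (Λ → Λ)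
tAnalogue q V f = ∑Λ (f [qX+[1-q]Y] q) λ (a , b) → a *Λ V b

X : Λ∞
X = coeff (p 1)

-- The coefficient of z^i in Ω[zX].
Ω[zX]_ : ℤ → Λ
Ω[zX] (+ n)    = homogeneousPart n (Ω X)
Ω[zX] -[1+ n ] = 0Λ

-- The coefficient of z^{-n} in Ω[-z⁻¹X] is the degree n part of Ω[-X]; its
-- adjoint kills f when n exceeds the degree of f.
B : ℤ → Λ → Λ
B r f = ∑Λ[ n ← upTo (suc (bound f)) ]
  (Ω[zX] (r ℤ.+ + n)) *Λ (coeff (homogeneousPart n (Ω (0∞ ⊖ X))) ^⊥) f

B* : List ℤ → Λ → Λ
B* ν = foldr (λ r V → B r ∘ V) id ν

-- ▭ is the horizontal domino h, ▯ the vertical domino v.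
data Shape : Set where
  ∅ □ ▭ ▯ : Shape

⟦1⟧ ⟦2⟧ ⟦1,1⟧ : Partition
⟦1⟧   = toPartition (1 ∷ [])
⟦2⟧   = toPartition (2 ∷ [])
⟦1,1⟧ = toPartition (1 ∷ 1 ∷ [])

f[_] : Shape → Λ∞
f[ ∅ ] = 0∞
f[ □ ] = coeff (s ⟦1⟧) ⊕ coeff (s ⟦1,1⟧)
f[ ▭ ] = coeff (s ⟦2⟧)
f[ ▯ ] = coeff (s ⟦1,1⟧)

columnLength : Partition → ℕ → ℕ
columnLength λ′ j = length (filter (j <?_) (parts λ′))

-- Column j (counted from 0) is empty when j ≥ ∣ λ ∣.
𝒫 : Shape → Partition → Set
𝒫 ∅ λ′ = parts λ′ ≡ []
𝒫 □ λ′ = ⊤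
𝒫 ▭ λ′ = All (2 ∣_) (parts λ′)
𝒫 ▯ λ′ = All (λ j → 2 ∣ columnLength λ′ j) (upTo ∣ λ′ ∣)

𝒫? : ∀ ◇ → Decidable (𝒫 ◇)
𝒫? ∅ λ′ = ≡-dec _≟_ (parts λ′) []
𝒫? □ λ′ = yes tt
𝒫? ▭ λ′ = all? (2 ∣?_) (parts λ′)
𝒫? ▯ λ′ = all? (λ j → 2 ∣? columnLength λ′ j) (upTo ∣ λ′ ∣)

s◇ : Shape → Partition → Λ
s◇ ◇ λ′ = (Ω (0∞ ⊖ f[ ◇ ]) ^⊥) (s λ′)

H : Shape → List ℤ → Λ → Λ
H ◇ ν = (Ω (f[ ◇ ] [tX] ⊖ f[ ◇ ]) ^⊥) ∘ tAnalogue (t^ 2) (B* ν) ∘ (Ω (f[ ◇ ] ⊖ f[ ◇ ] [tX]) ^⊥)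

toℤs : Partition → List ℤ
toℤs λ′ = map +_ (parts λ′)

H* : Shape → List Partition → Λ
H* ◇ R = foldr (λ Rᵢ g → H ◇ (toℤs Rᵢ) g) 1Λ R

-- The family K^◇_{λ;R}(t), defined by H_{R₁} ⋯ H_{R_L} 1 = Σ_λ K^◇_{λ;R}(t) s^◇_λ,
-- a finite sum.
IsExpansion : Shape → List Partition → (Partition → ℚ[t]) → Set
IsExpansion ◇ R K = ∃[ N ]
  (∀ λ′ → N < ∣ λ′ ∣ → K λ′ ≋ 0ₜ) ×
  H* ◇ R ≈ (∑Λ[ λ′ ← partitionsUpTo N ] K λ′ ·Λ s◇ ◇ λ′)

∥_∥ : List Partition → ℕ
∥ R ∥ = sum (map ∣_∣ R)

-- Write f for f_◇.  Since Ω[f[tX] - f[X]]^⊥ and Ω[f[X] - f[tX]]^⊥ are inverse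
-- to each other, H^◇_{R₁} ⋯ H^◇_{R_L} 1 telescopes to Ω[f[tX] - f[X]]^⊥ applied
-- to the case ◇ = ∅, that is to Σ_τ K^∅_{τ;R}(t) s_τ.  Undoing the operator
-- Ω[-f]^⊥ in s^◇_λ, one finds that K^◇_{λ;R}(t) is the coefficient of s_λ in
-- Ω[f[tX]]^⊥ Σ_τ K^∅_{τ;R}(t) s_τ.  The claim follows from Littlewood's identity
-- Ω[f] = Σ_{μ ∈ 𝒫^◇} s_μ and from the homogeneity of Σ_τ K^∅_{τ;R}(t) s_τ.
--
-- In Littlewood's identity the coefficients of x₁^a x^α on both sides are
-- expressed in the same way by coefficients in one variable less: on the left by
-- solving the differential equation x₁ ∂E/∂x₁ = E · x₁ ∂(log E)/∂x₁, on the right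
-- because adding and removing horizontal strips commute up to removing fewer
-- cells, a reflection of the intervals between interlacing rows.

module Submission where

open import Defs
open import Algebra.Bundles using (CommutativeRing)
import Algebra.Solver.Ring.NaturalCoefficients.Default
open import Data.Bool.Base using (true; false; if_then_else_)
open import Data.Integer.Base as ℤ using (ℤ; +_)
import Data.Integer.Properties as ℤ
open import Data.List.Base using (List; []; _∷_; _++_; map; concatMap; foldr; filter; length; replicate; upTo; downFrom; applyUpTo)
import Data.List.Properties as List
open import Data.List.Properties using (≡-dec)
open import Data.List.Membership.Propositional using (_∈_; lose)
import Data.List.Membership.Propositional.Properties as ∈
open import Data.List.Relation.Binary.Permutation.Propositional using (_↭_; prep; swap; ↭-sym; ↭-trans; ↭-refl; ↭⇒↭ₛ)
import Data.List.Relation.Binary.Permutation.Propositional.Properties as ↭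
import Data.List.Relation.Binary.Pointwise as Pointwise
open import Data.List.Relation.Unary.All as All using (All; []; _∷_; all?)
import Data.List.Relation.Unary.All.Properties as All
open import Data.List.Relation.Unary.Any using (here; there)
open import Data.List.Relation.Unary.AllPairs as AllPairs using (AllPairs; []; _∷_)
import Data.List.Relation.Unary.AllPairs.Properties as AllPairs
open import Data.List.Relation.Unary.Linked as Linked using (Linked; []; [-]; _∷_)
import Data.List.Relation.Unary.Linked.Properties as Linked
import Data.List.Relation.Unary.Sorted.TotalOrder.Properties as Sorted
open import Data.Nat.Base as ℕ using (ℕ; zero; suc; _+_; _∸_; _*_; _≤_; _<_; _≥_; _⊔_; _⊓_; z≤n; s≤s; NonZero; _!)
open import Data.Nat.Divisibility using (_∣?_; divides; divides-refl)
import Data.Nat.Divisibility as ℕ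
import Data.Nat.DivMod as ℕ
import Data.Nat.Induction as ℕ
open import Data.Nat.ListAction using (sum)
open import Data.Nat.ListAction.Properties using (sum-↭; sum-++)
import Data.Nat.Properties as ℕ
open import Data.Nat.Properties using (_≟_; _≤?_; _<?_; _!≢0)
open import Data.Nat.Solver using (module +-*-Solver)
open import Data.Product.Base using (_×_; _,_; ∃-syntax; proj₁; proj₂)
open import Data.Rational.Base as ℚ using (ℚ; 0ℚ; 1ℚ)
import Data.Rational.Properties as ℚ
import Data.Rational.Unnormalised.Base as ℚᵘ
import Data.Rational.Unnormalised.Properties as ℚᵘ
open import Data.Sum.Base using (_⊎_; inj₁; inj₂)
open import Data.Vec.Base as Vec using (Vec; []; _∷_)
open import Function.Base using (_∘_; id)
open import Induction.WellFounded using (Acc; acc)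
open import Level using (0ℓ)
open import Relation.Binary.Bundles using (DecTotalOrder)
open import Relation.Binary.PropositionalEquality using (_≡_; _≢_; refl; sym; trans; cong; cong₂; subst; module ≡-Reasoning)
import Relation.Binary.Reasoning.Setoid as SetoidReasoning
open import Relation.Nullary.Decidable using (Dec; yes; no; does; dec-true; dec-false; _×-dec_)
open import Relation.Nullary.Negation using (¬_; contradiction)
open import Relation.Unary using (Decidable)

-- Splitting a sorted exponent vector yields unsorted ones, so series are moved along `hat` to
-- functions on all exponent vectors. There a product is a Cauchy product in x₁ whose coefficients
-- are products in the remaining variables, and the ring laws, the differential equation and the
-- recursion for Schur functions all become inductions on the number of variables.
--
-- The power of t has one source: Ω[f[tX]] is Ω[f] with its part of degree d multiplied by t^d.
--
-- For Littlewood's identity, the shapes that interlace with two given ones form a product of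
-- intervals, with maxima of rows as lower and minima as upper ends. Reflecting every interval
-- replaces the size p of a shape by some q with p + q known, and exactly this trades the free
-- choice of a longest row for the choice of how much smaller the removed strip is. Evenness of rows
-- is not preserved by such a reflection, because the two ends of an interval may differ in parity;
-- the half rows are reflected instead. With even columns at most one shape can be reached in each
-- direction, and the two sizes are compared directly.

-- The commutative ring ℚ[t]

coeff-+ : ∀ p q n → coeffₜ (p +ₜ q) n ≡ coeffₜ p n ℚ.+ coeffₜ q n
coeff-+ []      q       n       = sym (ℚ.+-identityˡ _)
coeff-+ (a ∷ p) []      n       = sym (ℚ.+-identityʳ _)
coeff-+ (a ∷ p) (b ∷ q) zero    = refl
coeff-+ (a ∷ p) (b ∷ q) (suc n) = coeff-+ p q n

coeff-neg : ∀ p n → coeffₜ (-ₜ p) n ≡ ℚ.- coeffₜ p n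
coeff-neg []      n       = refl
coeff-neg (a ∷ p) zero    = refl
coeff-neg (a ∷ p) (suc n) = coeff-neg p n

coeff-scale : ∀ a q n → coeffₜ (map (a ℚ.*_) q) n ≡ a ℚ.* coeffₜ q n
coeff-scale a []      n       = sym (ℚ.*-zeroʳ a)
coeff-scale a (b ∷ q) zero    = refl
coeff-scale a (b ∷ q) (suc n) = coeff-scale a q n

≋-refl : ∀ {p} → p ≋ p
≋-refl = mk≋ λ _ → refl

≋-sym : ∀ {p q} → p ≋ q → q ≋ p
≋-sym (mk≋ e) = mk≋ λ n → sym (e n)

≋-trans : ∀ {p q r} → p ≋ q → q ≋ r → p ≋ r
≋-trans (mk≋ e) (mk≋ e′) = mk≋ λ n → trans (e n) (e′ n)

≡⇒≋ : ∀ {p q} → p ≡ q → p ≋ q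
≡⇒≋ refl = ≋-refl

+ₜ-cong : ∀ {p p′ q q′} → p ≋ p′ → q ≋ q′ → p +ₜ q ≋ p′ +ₜ q′
+ₜ-cong {p} {p′} {q} {q′} (mk≋ e) (mk≋ e′) = mk≋ λ n →
  trans (coeff-+ p q n) (trans (cong₂ ℚ._+_ (e n) (e′ n)) (sym (coeff-+ p′ q′ n)))

-ₜ-cong : ∀ {p p′} → p ≋ p′ → -ₜ p ≋ -ₜ p′
-ₜ-cong {p} {p′} (mk≋ e) = mk≋ λ n →
  trans (coeff-neg p n) (trans (cong ℚ.-_ (e n)) (sym (coeff-neg p′ n)))

+ₜ-assoc : ∀ p q r → (p +ₜ q) +ₜ r ≋ p +ₜ (q +ₜ r)
+ₜ-assoc p q r = mk≋ λ n → begin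
  coeffₜ ((p +ₜ q) +ₜ r) n                        ≡⟨ coeff-+ (p +ₜ q) r n ⟩
  coeffₜ (p +ₜ q) n ℚ.+ coeffₜ r n                ≡⟨ cong (ℚ._+ _) (coeff-+ p q n) ⟩
  (coeffₜ p n ℚ.+ coeffₜ q n) ℚ.+ coeffₜ r n      ≡⟨ ℚ.+-assoc (coeffₜ p n) (coeffₜ q n) (coeffₜ r n) ⟩
  coeffₜ p n ℚ.+ (coeffₜ q n ℚ.+ coeffₜ r n)      ≡⟨ cong (coeffₜ p n ℚ.+_) (coeff-+ q r n) ⟨
  coeffₜ p n ℚ.+ coeffₜ (q +ₜ r) n                ≡⟨ coeff-+ p (q +ₜ r) n ⟨
  coeffₜ (p +ₜ (q +ₜ r)) n                        ∎
  where open ≡-Reasoning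

+ₜ-comm : ∀ p q → p +ₜ q ≋ q +ₜ p
+ₜ-comm p q = mk≋ λ n →
  trans (coeff-+ p q n) (trans (ℚ.+-comm (coeffₜ p n) (coeffₜ q n)) (sym (coeff-+ q p n)))

+ₜ-identityʳ : ∀ p → p +ₜ 0ₜ ≋ p
+ₜ-identityʳ p = +ₜ-comm p 0ₜ

-ₜ-inverseʳ : ∀ p → p +ₜ (-ₜ p) ≋ 0ₜ
-ₜ-inverseʳ p = mk≋ λ n → trans (coeff-+ p (-ₜ p) n)
  (trans (cong (coeffₜ p n ℚ.+_) (coeff-neg p n)) (ℚ.+-inverseʳ (coeffₜ p n)))

-ₜ-inverseˡ : ∀ p → (-ₜ p) +ₜ p ≋ 0ₜ
-ₜ-inverseˡ p = ≋-trans (+ₜ-comm (-ₜ p) p) (-ₜ-inverseʳ p)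

∷-cong : ∀ {a b p q} → a ≡ b → p ≋ q → a ∷ p ≋ b ∷ q
∷-cong a≡b (mk≋ e) = mk≋ λ { zero → a≡b ; (suc n) → e n }

∷-≋ : ∀ {a b p q} → a ∷ p ≋ b ∷ q → (a ≡ b) × (p ≋ q)
∷-≋ (mk≋ e) = e 0 , mk≋ (e ∘ suc)

scale-cong : ∀ {a b p q} → a ≡ b → p ≋ q → map (a ℚ.*_) p ≋ map (b ℚ.*_) q
scale-cong {a} {p = p} {q} refl (mk≋ e) = mk≋ λ n →
  trans (coeff-scale a p n) (trans (cong (a ℚ.*_) (e n)) (sym (coeff-scale a q n)))

0∷0 : 0ℚ ∷ [] ≋ 0ₜ
0∷0 = mk≋ λ { zero → refl ; (suc _) → refl }

scale-0 : ∀ p → map (0ℚ ℚ.*_) p ≋ 0ₜ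
scale-0 p = mk≋ λ n → trans (coeff-scale 0ℚ p n) (ℚ.*-zeroˡ (coeffₜ p n))

scale-+ : ∀ a p q → map (a ℚ.*_) (p +ₜ q) ≋ map (a ℚ.*_) p +ₜ map (a ℚ.*_) q
scale-+ a p q = mk≋ λ n → begin
  coeffₜ (map (a ℚ.*_) (p +ₜ q)) n                          ≡⟨ coeff-scale a (p +ₜ q) n ⟩
  a ℚ.* coeffₜ (p +ₜ q) n                                   ≡⟨ cong (a ℚ.*_) (coeff-+ p q n) ⟩
  a ℚ.* (coeffₜ p n ℚ.+ coeffₜ q n)                         ≡⟨ ℚ.*-distribˡ-+ a (coeffₜ p n) (coeffₜ q n) ⟩
  a ℚ.* coeffₜ p n ℚ.+ a ℚ.* coeffₜ q n                     ≡⟨ cong₂ ℚ._+_ (coeff-scale a p n) (coeff-scale a q n) ⟨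
  coeffₜ (map (a ℚ.*_) p) n ℚ.+ coeffₜ (map (a ℚ.*_) q) n   ≡⟨ coeff-+ (map (a ℚ.*_) p) (map (a ℚ.*_) q) n ⟨
  coeffₜ (map (a ℚ.*_) p +ₜ map (a ℚ.*_) q) n               ∎
  where open ≡-Reasoning

+-scale : ∀ a b p → map ((a ℚ.+ b) ℚ.*_) p ≋ map (a ℚ.*_) p +ₜ map (b ℚ.*_) p
+-scale a b p = mk≋ λ n → begin
  coeffₜ (map ((a ℚ.+ b) ℚ.*_) p) n                         ≡⟨ coeff-scale (a ℚ.+ b) p n ⟩
  (a ℚ.+ b) ℚ.* coeffₜ p n                                  ≡⟨ ℚ.*-distribʳ-+ (coeffₜ p n) a b ⟩
  a ℚ.* coeffₜ p n ℚ.+ b ℚ.* coeffₜ p n                     ≡⟨ cong₂ ℚ._+_ (coeff-scale a p n) (coeff-scale b p n) ⟨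
  coeffₜ (map (a ℚ.*_) p) n ℚ.+ coeffₜ (map (b ℚ.*_) p) n   ≡⟨ coeff-+ (map (a ℚ.*_) p) (map (b ℚ.*_) p) n ⟨
  coeffₜ (map (a ℚ.*_) p +ₜ map (b ℚ.*_) p) n               ∎
  where open ≡-Reasoning

scale-* : ∀ a b p → map ((a ℚ.* b) ℚ.*_) p ≋ map (a ℚ.*_) (map (b ℚ.*_) p)
scale-* a b p = mk≋ λ n → begin
  coeffₜ (map ((a ℚ.* b) ℚ.*_) p) n           ≡⟨ coeff-scale (a ℚ.* b) p n ⟩
  (a ℚ.* b) ℚ.* coeffₜ p n                    ≡⟨ ℚ.*-assoc a b (coeffₜ p n) ⟩
  a ℚ.* (b ℚ.* coeffₜ p n)                    ≡⟨ cong (a ℚ.*_) (coeff-scale b p n) ⟨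
  a ℚ.* coeffₜ (map (b ℚ.*_) p) n             ≡⟨ coeff-scale a (map (b ℚ.*_) p) n ⟨
  coeffₜ (map (a ℚ.*_) (map (b ℚ.*_) p)) n    ∎
  where open ≡-Reasoning

+ₜ-interchange : ∀ p q r s → (p +ₜ q) +ₜ (r +ₜ s) ≋ (p +ₜ r) +ₜ (q +ₜ s)
+ₜ-interchange p q r s =
  ≋-trans (+ₜ-assoc p q (r +ₜ s))
  (≋-trans (+ₜ-cong (≋-refl {p})
             (≋-trans (≋-sym (+ₜ-assoc q r s))
             (≋-trans (+ₜ-cong (+ₜ-comm q r) (≋-refl {s})) (+ₜ-assoc r q s))))
           (≋-sym (+ₜ-assoc p r (q +ₜ s))))

*ₜ-zeroˡ : ∀ {p} → p ≋ 0ₜ → ∀ q → p *ₜ q ≋ 0ₜ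
*ₜ-zeroˡ {[]}    e q = ≋-refl
*ₜ-zeroˡ {a ∷ p} (mk≋ e) q =
  ≋-trans (+ₜ-cong (≋-trans (scale-cong (e 0) (≋-refl {q})) (scale-0 q))
                   (∷-cong refl (*ₜ-zeroˡ {p} (mk≋ (e ∘ suc)) q))) 0∷0

*ₜ-cong : ∀ {p p′ q q′} → p ≋ p′ → q ≋ q′ → p *ₜ q ≋ p′ *ₜ q′
*ₜ-cong {[]}    {p′}     {q} {q′} e e′ = ≋-sym (*ₜ-zeroˡ (≋-sym e) q′)
*ₜ-cong {a ∷ p} {[]}     {q} {q′} e e′ = *ₜ-zeroˡ e q
*ₜ-cong {a ∷ p} {b ∷ p′} {q} {q′} e e′ =
  +ₜ-cong (scale-cong (proj₁ (∷-≋ e)) e′) (∷-cong refl (*ₜ-cong (proj₂ (∷-≋ e)) e′))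

*ₜ-zeroʳ : ∀ p → p *ₜ 0ₜ ≋ 0ₜ
*ₜ-zeroʳ []      = ≋-refl
*ₜ-zeroʳ (a ∷ p) = ≋-trans (∷-cong refl (*ₜ-zeroʳ p)) 0∷0

*ₜ-distribʳ : ∀ r p q → (p +ₜ q) *ₜ r ≋ p *ₜ r +ₜ q *ₜ r
*ₜ-distribʳ r []      q       = ≋-refl
*ₜ-distribʳ r (a ∷ p) []      = ≋-sym (+ₜ-identityʳ _)
*ₜ-distribʳ r (a ∷ p) (b ∷ q) =
  ≋-trans (+ₜ-cong (+-scale a b r) (∷-cong (sym (ℚ.+-identityˡ 0ℚ)) (*ₜ-distribʳ r p q)))
          (+ₜ-interchange (map (a ℚ.*_) r) (map (b ℚ.*_) r) (0ℚ ∷ (p *ₜ r)) (0ℚ ∷ (q *ₜ r)))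

-- Multiplication recurses on its left factor; this is the mirror image of that recursion, from
-- which commutativity follows by induction.
*ₜ-∷ʳ : ∀ p b q → p *ₜ (b ∷ q) ≋ map (b ℚ.*_) p +ₜ (0ℚ ∷ (p *ₜ q))
*ₜ-∷ʳ []      b q = ≋-sym 0∷0
*ₜ-∷ʳ (a ∷ p) b q = ∷-cong (cong (ℚ._+ 0ℚ) (ℚ.*-comm a b))
  (≋-trans (+ₜ-cong (≋-refl {map (a ℚ.*_) q}) (*ₜ-∷ʳ p b q))
  (≋-trans (≋-sym (+ₜ-assoc (map (a ℚ.*_) q) (map (b ℚ.*_) p) (0ℚ ∷ (p *ₜ q))))
  (≋-trans (+ₜ-cong (+ₜ-comm (map (a ℚ.*_) q) (map (b ℚ.*_) p)) ≋-refl)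
           (+ₜ-assoc (map (b ℚ.*_) p) (map (a ℚ.*_) q) (0ℚ ∷ (p *ₜ q))))))

*ₜ-comm : ∀ p q → p *ₜ q ≋ q *ₜ p
*ₜ-comm []      q = ≋-sym (*ₜ-zeroʳ q)
*ₜ-comm (a ∷ p) q = ≋-trans
  (+ₜ-cong (≋-refl {map (a ℚ.*_) q}) (∷-cong refl (*ₜ-comm p q)))
  (≋-sym (*ₜ-∷ʳ q a p))

*ₜ-distribˡ : ∀ r p q → r *ₜ (p +ₜ q) ≋ r *ₜ p +ₜ r *ₜ q
*ₜ-distribˡ r p q = ≋-trans (*ₜ-comm r (p +ₜ q))
  (≋-trans (*ₜ-distribʳ r p q) (+ₜ-cong (*ₜ-comm p r) (*ₜ-comm q r)))

scale-assoc : ∀ a p q → map (a ℚ.*_) p *ₜ q ≋ map (a ℚ.*_) (p *ₜ q)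
scale-assoc a []      q = ≋-refl
scale-assoc a (b ∷ p) q =
  ≋-trans (+ₜ-cong (scale-* a b q) (∷-cong (sym (ℚ.*-zeroʳ a)) (scale-assoc a p q)))
          (≋-sym (scale-+ a (map (b ℚ.*_) q) (0ℚ ∷ (p *ₜ q))))

*ₜ-assoc : ∀ p q r → (p *ₜ q) *ₜ r ≋ p *ₜ (q *ₜ r)
*ₜ-assoc []      q r = ≋-refl
*ₜ-assoc (a ∷ p) q r =
  ≋-trans (*ₜ-distribʳ r (map (a ℚ.*_) q) (0ℚ ∷ (p *ₜ q)))
  (+ₜ-cong (scale-assoc a q r)
    (≋-trans (+ₜ-cong (scale-0 r) ≋-refl) (∷-cong refl (*ₜ-assoc p q r))))

const-* : ∀ a p → const a *ₜ p ≋ map (a ℚ.*_) p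
const-* a p = ≋-trans (+ₜ-cong (≋-refl {map (a ℚ.*_) p}) 0∷0) (+ₜ-identityʳ _)

*ₜ-identityˡ : ∀ p → 1ₜ *ₜ p ≋ p
*ₜ-identityˡ p = ≋-trans (const-* 1ℚ p)
  (mk≋ λ n → trans (coeff-scale 1ℚ p n) (ℚ.*-identityˡ (coeffₜ p n)))

*ₜ-identityʳ : ∀ p → p *ₜ 1ₜ ≋ p
*ₜ-identityʳ p = ≋-trans (*ₜ-comm p 1ₜ) (*ₜ-identityˡ p)

ℚ[t]-commutativeRing : CommutativeRing 0ℓ 0ℓ
ℚ[t]-commutativeRing = record
  { Carrier = ℚ[t] ; _≈_ = _≋_ ; _+_ = _+ₜ_ ; _*_ = _*ₜ_ ; -_ = -ₜ_ ; 0# = 0ₜ ; 1# = 1ₜ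
  ; isCommutativeRing = record
    { isRing = record
      { +-isAbelianGroup = record
        { isGroup = record
          { isMonoid = record
            { isSemigroup = record
              { isMagma = record
                { isEquivalence = record { refl = ≋-refl ; sym = ≋-sym ; trans = ≋-trans }
                ; ∙-cong = +ₜ-cong }
              ; assoc = +ₜ-assoc }
            ; identity = (λ _ → ≋-refl) , +ₜ-identityʳ }
          ; inverse = -ₜ-inverseˡ , -ₜ-inverseʳ
          ; ⁻¹-cong = -ₜ-cong }
        ; comm = +ₜ-comm }
      ; *-cong = *ₜ-cong
      ; *-assoc = *ₜ-assoc
      ; *-identity = *ₜ-identityˡ , *ₜ-identityʳ
      ; distrib = *ₜ-distribˡ , *ₜ-distribʳ }
    ; *-comm = *ₜ-comm } }

module ℚ[t] = CommutativeRing ℚ[t]-commutativeRing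
module ≋-Reasoning = SetoidReasoning ℚ[t].setoid

+ₜ-congˡ : ∀ p {q q′} → q ≋ q′ → p +ₜ q ≋ p +ₜ q′
+ₜ-congˡ p = +ₜ-cong (≋-refl {p})

+ₜ-congʳ : ∀ q {p p′} → p ≋ p′ → p +ₜ q ≋ p′ +ₜ q
+ₜ-congʳ q e = +ₜ-cong e (≋-refl {q})

*ₜ-congˡ : ∀ p {q q′} → q ≋ q′ → p *ₜ q ≋ p *ₜ q′
*ₜ-congˡ p = *ₜ-cong (≋-refl {p})

*ₜ-congʳ : ∀ q {p p′} → p ≋ p′ → p *ₜ q ≋ p′ *ₜ q
*ₜ-congʳ q e = *ₜ-cong e (≋-refl {q})

*ₜ-zeroʳ′ : ∀ p {q} → q ≋ 0ₜ → p *ₜ q ≋ 0ₜ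
*ₜ-zeroʳ′ p e = ≋-trans (*ₜ-congˡ p e) (*ₜ-zeroʳ p)

+ₜ-0 : ∀ {p q} → p ≋ 0ₜ → q ≋ 0ₜ → p +ₜ q ≋ 0ₜ
+ₜ-0 = +ₜ-cong

module ≋-Solver = Algebra.Solver.Ring.NaturalCoefficients.Default ℚ[t].commutativeSemiring

open ≋-Solver using () renaming (_:+_ to infixl 6 _⊹_; _:*_ to infixl 7 _⊠_; _:=_ to infix 5 _⊜_)

open import Algebra.Properties.CommutativeSemigroup ℚ[t].*-commutativeSemigroup using ()
  renaming (interchange to *ₜ-interchange; x∙yz≈y∙xz to *ₜ-swap)
open import Algebra.Properties.Ring ℚ[t].ring using (-1*x≈-x)

-- Finite sums and indicators

∑-cong : ∀ {A : Set} (xs : List A) {f g : A → ℚ[t]} → (∀ x → f x ≋ g x) → ∑ xs f ≋ ∑ xs g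
∑-cong []       e = ≋-refl
∑-cong (x ∷ xs) e = +ₜ-cong (e x) (∑-cong xs e)

∑-congAll : ∀ {A : Set} {xs : List A} {f g : A → ℚ[t]} → All (λ x → f x ≋ g x) xs → ∑ xs f ≋ ∑ xs g
∑-congAll []       = ≋-refl
∑-congAll (e ∷ es) = +ₜ-cong e (∑-congAll es)

∑-zeroAll : ∀ {A : Set} {xs : List A} {f : A → ℚ[t]} → All (λ x → f x ≋ 0ₜ) xs → ∑ xs f ≋ 0ₜ
∑-zeroAll []       = ≋-refl
∑-zeroAll (e ∷ es) = +ₜ-0 e (∑-zeroAll es)

∑-zero : ∀ {A : Set} (xs : List A) {f : A → ℚ[t]} → (∀ x → f x ≋ 0ₜ) → ∑ xs f ≋ 0ₜ
∑-zero xs e = ∑-zeroAll (All.universal e xs)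

∑-++ : ∀ {A : Set} (xs ys : List A) (f : A → ℚ[t]) → ∑ (xs ++ ys) f ≋ ∑ xs f +ₜ ∑ ys f
∑-++ []       ys f = ≋-refl
∑-++ (x ∷ xs) ys f = ≋-trans (+ₜ-congˡ (f x) (∑-++ xs ys f)) (≋-sym (+ₜ-assoc (f x) (∑ xs f) (∑ ys f)))

∑-map : ∀ {A B : Set} (h : A → B) (xs : List A) (f : B → ℚ[t]) → ∑ (map h xs) f ≋ ∑ xs (f ∘ h)
∑-map h []       f = ≋-refl
∑-map h (x ∷ xs) f = +ₜ-congˡ (f (h x)) (∑-map h xs f)

∑-concatMap : ∀ {A B : Set} (h : A → List B) (xs : List A) (f : B → ℚ[t]) →
  ∑ (concatMap h xs) f ≋ (∑[ x ← xs ] ∑ (h x) f)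
∑-concatMap h []       f = ≋-refl
∑-concatMap h (x ∷ xs) f =
  ≋-trans (∑-++ (h x) (concatMap h xs) f) (+ₜ-congˡ (∑ (h x) f) (∑-concatMap h xs f))

∑-+ : ∀ {A : Set} (xs : List A) (f g : A → ℚ[t]) → (∑[ x ← xs ] f x +ₜ g x) ≋ ∑ xs f +ₜ ∑ xs g
∑-+ []       f g = ≋-refl
∑-+ (x ∷ xs) f g =
  ≋-trans (+ₜ-congˡ (f x +ₜ g x) (∑-+ xs f g)) (+ₜ-interchange (f x) (g x) (∑ xs f) (∑ xs g))

∑-*ˡ : ∀ {A : Set} (xs : List A) (c : ℚ[t]) (f : A → ℚ[t]) → c *ₜ ∑ xs f ≋ (∑[ x ← xs ] c *ₜ f x)
∑-*ˡ []       c f = *ₜ-zeroʳ c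
∑-*ˡ (x ∷ xs) c f =
  ≋-trans (*ₜ-distribˡ c (f x) (∑ xs f)) (+ₜ-congˡ (c *ₜ f x) (∑-*ˡ xs c f))

∑-*ʳ : ∀ {A : Set} (xs : List A) (c : ℚ[t]) (f : A → ℚ[t]) → ∑ xs f *ₜ c ≋ (∑[ x ← xs ] f x *ₜ c)
∑-*ʳ xs c f = ≋-trans (*ₜ-comm (∑ xs f) c)
  (≋-trans (∑-*ˡ xs c f) (∑-cong xs λ x → *ₜ-comm c (f x)))

∑-swap : ∀ {A B : Set} (xs : List A) (ys : List B) (f : A → B → ℚ[t]) →
  (∑[ x ← xs ] ∑[ y ← ys ] f x y) ≋ (∑[ y ← ys ] ∑[ x ← xs ] f x y)
∑-swap []       ys f = ≋-sym (∑-zero ys λ _ → ≋-refl)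
∑-swap (x ∷ xs) ys f = ≋-trans (+ₜ-congˡ (∑ ys (f x)) (∑-swap xs ys f))
  (≋-sym (∑-+ ys (f x) (λ y → ∑ xs λ x → f x y)))

∑-δ : ∀ {A : Set} {xs : List A} {x : A} {f : A → ℚ[t]} → AllPairs _≢_ xs → x ∈ xs →
  (∀ y → y ≢ x → f y ≋ 0ₜ) → ∑ xs f ≋ f x
∑-δ {xs = y ∷ xs} {f = f} (y∉ ∷ u) (here refl) z =
  ≋-trans (+ₜ-congˡ (f y) (∑-zeroAll (All.map (λ y≢ → z _ (y≢ ∘ sym)) y∉))) (+ₜ-identityʳ (f y))
∑-δ {xs = y ∷ xs} {x} {f} (y∉ ∷ u) (there x∈) z =
  ≋-trans (+ₜ-cong (z y (All.lookup y∉ x∈)) (∑-δ u x∈ z)) ≋-refl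

-- The Iverson bracket. Side conditions become factors, so that sums over restricted ranges can be
-- interchanged and factored like any others.
𝟙 : {P : Set} → Dec P → ℚ[t]
𝟙 d = if does d then 1ₜ else 0ₜ

𝟙-yes : ∀ {P : Set} (d : Dec P) → P → 𝟙 d ≋ 1ₜ
𝟙-yes d x rewrite dec-true d x = ≋-refl

𝟙-no : ∀ {P : Set} (d : Dec P) → ¬ P → 𝟙 d ≋ 0ₜ
𝟙-no d x rewrite dec-false d x = ≋-refl

𝟙-⇔ : ∀ {P Q : Set} (d : Dec P) (e : Dec Q) → (P → Q) → (Q → P) → 𝟙 d ≋ 𝟙 e
𝟙-⇔ (yes x) e f g = ≋-sym (𝟙-yes e (f x))
𝟙-⇔ (no ¬x) e f g = ≋-sym (𝟙-no e (¬x ∘ g))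

𝟙-× : ∀ {P Q : Set} (d : Dec P) (e : Dec Q) → 𝟙 (d ×-dec e) ≋ 𝟙 d *ₜ 𝟙 e
𝟙-× (yes _) (yes _) = ≋-sym (*ₜ-identityˡ 1ₜ)
𝟙-× (yes _) (no _)  = ≋-sym (*ₜ-identityˡ 0ₜ)
𝟙-× (no _)  e       = ≋-refl

𝟙-*-cong : ∀ {P : Set} (d : Dec P) {x y} → (P → x ≋ y) → 𝟙 d *ₜ x ≋ 𝟙 d *ₜ y
𝟙-*-cong (yes h) e = *ₜ-congˡ 1ₜ (e h)
𝟙-*-cong (no _)  e = ≋-refl

𝟙-*-zero : ∀ {P : Set} (d : Dec P) {x} → (P → x ≋ 0ₜ) → 𝟙 d *ₜ x ≋ 0ₜ
𝟙-*-zero d e = ≋-trans (𝟙-*-cong d e) (*ₜ-zeroʳ (𝟙 d))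

𝟙-yes* : ∀ {P : Set} (d : Dec P) → P → ∀ x → 𝟙 d *ₜ x ≋ x
𝟙-yes* d h x = ≋-trans (*ₜ-congʳ x (𝟙-yes d h)) (*ₜ-identityˡ x)

𝟙-no* : ∀ {P : Set} (d : Dec P) → ¬ P → ∀ x → 𝟙 d *ₜ x ≋ 0ₜ
𝟙-no* d h x = *ₜ-zeroˡ (𝟙-no d h) x

if-𝟙 : ∀ {P : Set} (d : Dec P) x → (if does d then x else 0ₜ) ≋ 𝟙 d *ₜ x
if-𝟙 (yes _) x = ≋-sym (*ₜ-identityˡ x)
if-𝟙 (no _)  x = ≋-refl

∑-filter : ∀ {A : Set} {P : A → Set} (P? : Decidable P) (xs : List A) (f : A → ℚ[t]) →
  ∑ (filter P? xs) f ≋ (∑[ x ← xs ] 𝟙 (P? x) *ₜ f x)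
∑-filter P? []       f = ≋-refl
∑-filter P? (x ∷ xs) f with P? x
... | yes _ = +ₜ-cong (≋-sym (*ₜ-identityˡ (f x))) (∑-filter P? xs f)
... | no _  = ∑-filter P? xs f

∑-applyUpTo : ∀ {A : Set} (h : ℕ → A) n (f : A → ℚ[t]) → ∑ (applyUpTo h n) f ≡ ∑ (upTo n) (f ∘ h)
∑-applyUpTo h zero    f = refl
∑-applyUpTo h (suc n) f = cong (f (h 0) +ₜ_)
  (trans (∑-applyUpTo (h ∘ suc) n f) (sym (∑-applyUpTo suc n (f ∘ h))))

∑-upTo-suc : ∀ n (f : ℕ → ℚ[t]) → ∑ (upTo (suc n)) f ≋ f 0 +ₜ ∑ (upTo n) (f ∘ suc)
∑-upTo-suc n f = +ₜ-congˡ (f 0) (≡⇒≋ (∑-applyUpTo suc n f))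

∑-upTo-cong : ∀ n {f g : ℕ → ℚ[t]} → (∀ i → i < n → f i ≋ g i) → ∑ (upTo n) f ≋ ∑ (upTo n) g
∑-upTo-cong n e = ∑-congAll (All.applyUpTo⁺₁ id n (λ {i} i<n → e i i<n))

∑-upTo-zero : ∀ n {f : ℕ → ℚ[t]} → (∀ i → i < n → f i ≋ 0ₜ) → ∑ (upTo n) f ≋ 0ₜ
∑-upTo-zero n e = ∑-zeroAll (All.applyUpTo⁺₁ id n (λ {i} i<n → e i i<n))

∑-upTo-≤ : ∀ {m n} (f : ℕ → ℚ[t]) → m ≤ n → (∀ i → m ≤ i → i < n → f i ≋ 0ₜ) →
  ∑ (upTo n) f ≋ ∑ (upTo m) f
∑-upTo-≤ {zero} {n}         f z≤n       z = ∑-upTo-zero n λ i → z i z≤n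
∑-upTo-≤ {suc m} {suc n} f (s≤s m≤n) z = ≋-trans (∑-upTo-suc n f)
  (≋-trans (+ₜ-congˡ (f 0) (∑-upTo-≤ (f ∘ suc) m≤n λ i m≤i i<n → z (suc i) (s≤s m≤i) (s≤s i<n)))
           (≋-sym (∑-upTo-suc m f)))

∑-upTo-δ : ∀ n k {f : ℕ → ℚ[t]} → k < n → (∀ i → i ≢ k → f i ≋ 0ₜ) → ∑ (upTo n) f ≋ f k
∑-upTo-δ (suc n) zero    {f} k<n z = ≋-trans (∑-upTo-suc n f)
  (≋-trans (+ₜ-congˡ (f 0) (∑-zero (upTo n) λ i → z (suc i) λ ())) (+ₜ-identityʳ (f 0)))
∑-upTo-δ (suc n) (suc k) {f} (s≤s k<n) z = ≋-trans (∑-upTo-suc n f)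
  (+ₜ-cong (z 0 λ ()) (∑-upTo-δ n k k<n λ i i≢k → z (suc i) (i≢k ∘ ℕ.suc-injective)))

-- Sums over the pairs with i + j = n

antidiag : ℕ → (ℕ → ℕ → ℚ[t]) → ℚ[t]
antidiag n φ = ∑[ i ← upTo (suc n) ] φ i (n ∸ i)

antidiag-suc : ∀ n φ → antidiag (suc n) φ ≋ φ 0 (suc n) +ₜ antidiag n (λ i j → φ (suc i) j)
antidiag-suc n φ = ∑-upTo-suc (suc n) (λ i → φ i (suc n ∸ i))

antidiag-cong : ∀ n {φ ψ} → (∀ i j → i + j ≡ n → φ i j ≋ ψ i j) → antidiag n φ ≋ antidiag n ψ
antidiag-cong n e = ∑-upTo-cong (suc n) λ { i (s≤s i≤n) → e i (n ∸ i) (ℕ.m+[n∸m]≡n i≤n) }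

antidiag-zero : ∀ n {φ} → (∀ i j → i + j ≡ n → φ i j ≋ 0ₜ) → antidiag n φ ≋ 0ₜ
antidiag-zero n e = ∑-upTo-zero (suc n) λ { i (s≤s i≤n) → e i (n ∸ i) (ℕ.m+[n∸m]≡n i≤n) }

antidiag-last : ∀ n φ → antidiag (suc n) φ ≋ antidiag n (λ i j → φ i (suc j)) +ₜ φ (suc n) 0
antidiag-last zero φ = +ₜ-cong (≋-sym (+ₜ-identityʳ (φ 0 1))) (+ₜ-identityʳ (φ 1 0))
antidiag-last (suc n) φ = begin
  antidiag (2 + n) φ                                       ≈⟨ antidiag-suc (suc n) φ ⟩
  φ 0 (2 + n) +ₜ antidiag (suc n) (λ i j → φ (suc i) j)    ≈⟨ +ₜ-congˡ (φ 0 (2 + n)) (antidiag-last n λ i j → φ (suc i) j) ⟩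
  φ 0 (2 + n) +ₜ (antidiag n (λ i j → φ (suc i) (suc j)) +ₜ φ (2 + n) 0)
    ≈⟨ +ₜ-assoc (φ 0 (2 + n)) (antidiag n λ i j → φ (suc i) (suc j)) (φ (2 + n) 0) ⟨
  φ 0 (2 + n) +ₜ antidiag n (λ i j → φ (suc i) (suc j)) +ₜ φ (2 + n) 0
    ≈⟨ +ₜ-congʳ (φ (2 + n) 0) (antidiag-suc n λ i j → φ i (suc j)) ⟨
  antidiag (suc n) (λ i j → φ i (suc j)) +ₜ φ (2 + n) 0    ∎
  where open ≋-Reasoning

antidiag-comm : ∀ n φ → antidiag n φ ≋ antidiag n (λ i j → φ j i)
antidiag-comm zero    φ = ≋-refl
antidiag-comm (suc n) φ = begin
  antidiag (suc n) φ                                          ≈⟨ antidiag-suc n φ ⟩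
  φ 0 (suc n) +ₜ antidiag n (λ i j → φ (suc i) j)             ≈⟨ +ₜ-comm (φ 0 (suc n)) (antidiag n λ i j → φ (suc i) j) ⟩
  antidiag n (λ i j → φ (suc i) j) +ₜ φ 0 (suc n)             ≈⟨ +ₜ-congʳ (φ 0 (suc n)) (antidiag-comm n λ i j → φ (suc i) j) ⟩
  antidiag n (λ i j → φ (suc j) i) +ₜ φ 0 (suc n)             ≈⟨ antidiag-last n (λ i j → φ j i) ⟨
  antidiag (suc n) (λ i j → φ j i)                            ∎
  where open ≋-Reasoning

antidiag-+ : ∀ n φ ψ → antidiag n (λ i j → φ i j +ₜ ψ i j) ≋ antidiag n φ +ₜ antidiag n ψ
antidiag-+ n φ ψ = ∑-+ (upTo (suc n)) (λ i → φ i (n ∸ i)) (λ i → ψ i (n ∸ i))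

-- Both sides run over the triples with j + l + k = n.
antidiag-assoc : ∀ n (φ : ℕ → ℕ → ℕ → ℚ[t]) →
  antidiag n (λ i k → antidiag i λ j l → φ j l k) ≋ antidiag n (λ j m → antidiag m λ l k → φ j l k)
antidiag-assoc zero    φ = ≋-refl
antidiag-assoc (suc n) φ = begin
  antidiag (suc n) (λ i k → antidiag i λ j l → φ j l k)
    ≈⟨ antidiag-suc n (λ i k → antidiag i λ j l → φ j l k) ⟩
  antidiag 0 (λ j l → φ j l (suc n)) +ₜ antidiag n (λ i k → antidiag (suc i) λ j l → φ j l k)
    ≈⟨ +ₜ-cong (+ₜ-identityʳ (φ 0 0 (suc n))) (≋-trans
        (antidiag-cong n λ i k _ → antidiag-suc i λ j l → φ j l k)
        (antidiag-+ n (λ i k → φ 0 (suc i) k) (λ i k → antidiag i λ j l → φ (suc j) l k))) ⟩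
  φ 0 0 (suc n) +ₜ (antidiag n (λ i k → φ 0 (suc i) k) +ₜ antidiag n (λ i k → antidiag i λ j l → φ (suc j) l k))
    ≈⟨ +ₜ-assoc (φ 0 0 (suc n)) (antidiag n λ i k → φ 0 (suc i) k) (antidiag n λ i k → antidiag i λ j l → φ (suc j) l k) ⟨
  φ 0 0 (suc n) +ₜ antidiag n (λ i k → φ 0 (suc i) k) +ₜ antidiag n (λ i k → antidiag i λ j l → φ (suc j) l k)
    ≈⟨ +ₜ-cong (≋-sym (antidiag-suc n (φ 0))) (antidiag-assoc n (φ ∘ suc)) ⟩
  antidiag (suc n) (φ 0) +ₜ antidiag n (λ j m → antidiag m λ l k → φ (suc j) l k)
    ≈⟨ antidiag-suc n (λ j m → antidiag m λ l k → φ j l k) ⟨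
  antidiag (suc n) (λ j m → antidiag m λ l k → φ j l k) ∎
  where open ≋-Reasoning

-- Natural numbers and their reciprocals in ℚ[t]

fromℚᵘ-+ : ∀ x y → ℚ.fromℚᵘ x ℚ.+ ℚ.fromℚᵘ y ≡ ℚ.fromℚᵘ (x ℚᵘ.+ y)
fromℚᵘ-+ x y = ℚ.toℚᵘ-injective (ℚᵘ.≃-trans (ℚ.toℚᵘ-homo-+ (ℚ.fromℚᵘ x) (ℚ.fromℚᵘ y))
  (ℚᵘ.≃-trans (ℚᵘ.+-cong (ℚ.toℚᵘ-fromℚᵘ x) (ℚ.toℚᵘ-fromℚᵘ y)) (ℚᵘ.≃-sym (ℚ.toℚᵘ-fromℚᵘ (x ℚᵘ.+ y)))))

fromℚᵘ-* : ∀ x y → ℚ.fromℚᵘ x ℚ.* ℚ.fromℚᵘ y ≡ ℚ.fromℚᵘ (x ℚᵘ.* y)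
fromℚᵘ-* x y = ℚ.toℚᵘ-injective (ℚᵘ.≃-trans (ℚ.toℚᵘ-homo-* (ℚ.fromℚᵘ x) (ℚ.fromℚᵘ y))
  (ℚᵘ.≃-trans (ℚᵘ.*-cong (ℚ.toℚᵘ-fromℚᵘ x) (ℚ.toℚᵘ-fromℚᵘ y)) (ℚᵘ.≃-sym (ℚ.toℚᵘ-fromℚᵘ (x ℚᵘ.* y)))))

num : ℕ → ℚ[t]
num n = const (+ n ℚ./ 1)

num-+ : ∀ m n → num (m + n) ≋ num m +ₜ num n
num-+ m n = ∷-cong (sym (trans (fromℚᵘ-+ (ℚᵘ.mkℚᵘ (+ m) 0) (ℚᵘ.mkℚᵘ (+ n) 0))
  (ℚ.fromℚᵘ-cong {ℚᵘ.mkℚᵘ (+ m) 0 ℚᵘ.+ ℚᵘ.mkℚᵘ (+ n) 0} {ℚᵘ.mkℚᵘ (+ (m + n)) 0} (ℚᵘ.*≡* (cong (λ i → i ℤ.* + 1)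
    (trans (cong₂ ℤ._+_ (ℤ.*-identityʳ (+ m)) (ℤ.*-identityʳ (+ n))) (sym (ℤ.pos-+ m n)))))))) ≋-refl

num-0 : num 0 ≋ 0ₜ
num-0 = 0∷0

num-suc : ∀ n x → num (suc n) *ₜ x ≋ x +ₜ num n *ₜ x
num-suc n x = ≋-trans (*ₜ-congʳ x (num-+ 1 n))
  (≋-trans (*ₜ-distribʳ x 1ₜ (num n)) (+ₜ-congʳ (num n *ₜ x) (*ₜ-identityˡ x)))

num-inverse : ∀ k d e .{{_ : NonZero d}} .{{_ : NonZero e}} → k * d ≡ e →
  num k *ₜ const (+ 1 ℚ./ e) ≋ const (+ 1 ℚ./ d)
num-inverse k (suc d) (suc e) kd≡e = ≋-trans (const-* (+ k ℚ./ 1) (const (+ 1 ℚ./ suc e))) (∷-cong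
  (trans (fromℚᵘ-* (ℚᵘ.mkℚᵘ (+ k) 0) (ℚᵘ.mkℚᵘ (+ 1) e)) (ℚ.fromℚᵘ-cong {ℚᵘ.mkℚᵘ (+ k) 0 ℚᵘ.* ℚᵘ.mkℚᵘ (+ 1) e} {ℚᵘ.mkℚᵘ (+ 1) d} (ℚᵘ.*≡* eq))) ≋-refl)
  where
  eq : (+ k ℤ.* + 1) ℤ.* + suc d ≡ + 1 ℤ.* + (1 * suc e)
  eq = trans (cong (ℤ._* + suc d) (ℤ.*-identityʳ (+ k))) (trans (sym (ℤ.pos-* k (suc d)))
    (trans (cong +_ (trans kd≡e (sym (ℕ.*-identityˡ (suc e))))) (sym (ℤ.*-identityˡ _))))

1/! : ℕ → ℚ[t]
1/! m = const ((+ 1 ℚ./ m !) {{m !≢0}})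

1/!-suc : ∀ m → num (suc m) *ₜ 1/! (suc m) ≋ 1/! m
1/!-suc m = num-inverse (suc m) (m !) (suc m !) {{m !≢0}} {{suc m !≢0}} refl

-- Division by positive integers is what makes the solutions of the differential equations below
-- unique.
num-cancel : ∀ n .{{_ : NonZero n}} {x y} → num n *ₜ x ≋ num n *ₜ y → x ≋ y
num-cancel n@(suc _) {x} {y} e = begin
  x                                          ≈⟨ cancel x ⟨
  const (+ 1 ℚ./ n) *ₜ (num n *ₜ x)          ≈⟨ *ₜ-congˡ (const (+ 1 ℚ./ n)) e ⟩
  const (+ 1 ℚ./ n) *ₜ (num n *ₜ y)          ≈⟨ cancel y ⟩
  y                                          ∎
  where
  open ≋-Reasoning
  cancel : ∀ z → const (+ 1 ℚ./ n) *ₜ (num n *ₜ z) ≋ z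
  cancel z = begin
    const (+ 1 ℚ./ n) *ₜ (num n *ₜ z)   ≈⟨ *ₜ-assoc (const (+ 1 ℚ./ n)) (num n) z ⟨
    const (+ 1 ℚ./ n) *ₜ num n *ₜ z     ≈⟨ *ₜ-congʳ z (*ₜ-comm (const (+ 1 ℚ./ n)) (num n)) ⟩
    num n *ₜ const (+ 1 ℚ./ n) *ₜ z     ≈⟨ *ₜ-congʳ z (num-inverse n 1 n (ℕ.*-identityʳ n)) ⟩
    1ₜ *ₜ z                             ≈⟨ *ₜ-identityˡ z ⟩
    z                                   ∎

-- Partitions and exponent vectors

open import Data.List.Sort.Base (DecTotalOrder.totalOrder ≥-decTotalOrder) using (module SortingAlgorithm)
open SortingAlgorithm Descending.insertionSort using (sort-↭)

-- The proof fields are unique because `_≤_` is proof-irrelevant, so partitions may be compared by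
-- their parts alone.
partition-≡ : ∀ {λ′ μ} → parts λ′ ≡ parts μ → λ′ ≡ μ
partition-≡ {mkPartition ps d₁ p₁} {mkPartition .ps d₂ p₂} refl =
  cong₂ (mkPartition ps) (Linked.irrelevant ℕ.≤-irrelevant d₁ d₂) (All.irrelevant ℕ.≤-irrelevant p₁ p₂)

parts-toPartition-↭ : ∀ α → parts (toPartition α) ↭ filter (0 <?_) α
parts-toPartition-↭ α = sort-↭ (filter (0 <?_) α)

decreasing-↭ : ∀ {α β} → Linked _≥_ α → Linked _≥_ β → α ↭ β → α ≡ β
decreasing-↭ α↘ β↘ α↭β = Pointwise.Pointwise-≡⇒≡
  (Sorted.↗↭↗⇒≋ (DecTotalOrder.totalOrder ≥-decTotalOrder) α↘ β↘ (↭⇒↭ₛ α↭β))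

toPartition-parts : ∀ λ′ → toPartition (parts λ′) ≡ λ′
toPartition-parts λ′ = partition-≡ (decreasing-↭ (decreasing (toPartition (parts λ′))) (decreasing λ′)
  (subst (parts (toPartition (parts λ′)) ↭_) (List.filter-all (0 <?_) (positive λ′))
    (parts-toPartition-↭ (parts λ′))))

toPartition-↭ : ∀ {α β} → α ↭ β → toPartition α ≡ toPartition β
toPartition-↭ {α} {β} α↭β = partition-≡ (decreasing-↭ (decreasing (toPartition α)) (decreasing (toPartition β))
  (↭-trans (parts-toPartition-↭ α) (↭-trans (↭.filter-↭ (0 <?_) α↭β) (↭-sym (parts-toPartition-↭ β)))))

sum-filter : ∀ α → sum (filter (0 <?_) α) ≡ sum α
sum-filter []          = refl
sum-filter (zero ∷ α)  = sum-filter α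
sum-filter (suc a ∷ α) = cong (λ n → suc a + n) (sum-filter α)

∣toPartition∣ : ∀ α → ∣ toPartition α ∣ ≡ sum α
∣toPartition∣ α = trans (sum-↭ (parts-toPartition-↭ α)) (sum-filter α)

-- Power series as functions on exponent vectors

-- Unlike in `Λ∞`, the exponents are neither sorted nor freed of zeros; the first one can therefore
-- be split off.
ListFun : Set
ListFun = List ℕ → ℚ[t]

infix 4 _≗_
_≗_ : ListFun → ListFun → Set
f ≗ g = ∀ α → f α ≋ g α

infixl 7 _⋆_
_⋆_ : ListFun → ListFun → ListFun
(f ⋆ g) α = ∑ (splittings α) λ (β , γ) → f β *ₜ g γ

infixr 9 _∷ᶠ_
-- The coefficient of x₁^a, as a series in the remaining variables.
_∷ᶠ_ : ℕ → ListFun → ListFun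
(a ∷ᶠ f) α = f (a ∷ α)

splittings-∷ : ∀ a α (φ : List ℕ → List ℕ → ℚ[t]) →
  ∑ (splittings (a ∷ α)) (λ (β , γ) → φ β γ) ≋
  antidiag a (λ i j → ∑ (splittings α) λ (β , γ) → φ (i ∷ β) (j ∷ γ))
splittings-∷ a α φ = ≋-trans
  (∑-concatMap (λ i → map (λ (β , γ) → i ∷ β , (a ∸ i) ∷ γ) (splittings α)) (upTo (suc a)) (λ (β , γ) → φ β γ))
  (∑-cong (upTo (suc a)) λ i → ∑-map (λ (β , γ) → i ∷ β , (a ∸ i) ∷ γ) (splittings α) (λ (β , γ) → φ β γ))

-- The Cauchy product in x₁. The laws of `⋆` follow from it by induction on the number of variables,
-- each from the law for `antidiag` of the same name.
⋆-∷ : ∀ f g a α → (f ⋆ g) (a ∷ α) ≋ antidiag a (λ i j → ((i ∷ᶠ f) ⋆ (j ∷ᶠ g)) α)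
⋆-∷ f g a α = splittings-∷ a α (λ β γ → f β *ₜ g γ)

All-splittings : (P : List ℕ → List ℕ → List ℕ → Set) → P [] [] [] →
  (∀ {a i j α β γ} → i + j ≡ a → P α β γ → P (a ∷ α) (i ∷ β) (j ∷ γ)) →
  ∀ α → All (λ (β , γ) → P α β γ) (splittings α)
All-splittings P P[] P∷ []      = P[] ∷ []
All-splittings P P[] P∷ (a ∷ α) = All.concat⁺ (All.map⁺ (All.applyUpTo⁺₁ id (suc a) λ { {i} (s≤s i≤a) →
  All.map⁺ (All.map (P∷ (ℕ.m+[n∸m]≡n i≤a)) (All-splittings P P[] P∷ α)) }))

sum-splittings : ∀ α → All (λ (β , γ) → sum β + sum γ ≡ sum α) (splittings α)
sum-splittings = All-splittings (λ α β γ → sum β + sum γ ≡ sum α) refl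
  λ {a} {i} {j} {α} {β} {γ} i+j≡a e → trans (solve 4 (λ i b j c → (i :+ b) :+ (j :+ c) := (i :+ j) :+ (b :+ c)) refl i (sum β) j (sum γ)) (cong₂ _+_ i+j≡a e)
  where open +-*-Solver

length-splittings : ∀ α → All (λ (β , γ) → length β ≡ length α × length γ ≡ length α) (splittings α)
length-splittings = All-splittings (λ α β γ → length β ≡ length α × length γ ≡ length α) (refl , refl)
  λ _ (e , e′) → cong suc e , cong suc e′

⋆-cong : ∀ {f f′ g g′} → f ≗ f′ → g ≗ g′ → f ⋆ g ≗ f′ ⋆ g′
⋆-cong e e′ α = ∑-cong (splittings α) λ (β , γ) → *ₜ-cong (e β) (e′ γ)

⋆-comm : ∀ f g → f ⋆ g ≗ g ⋆ f
⋆-comm f g []      = +ₜ-congʳ 0ₜ (*ₜ-comm (f []) (g []))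
⋆-comm f g (a ∷ α) = begin
  (f ⋆ g) (a ∷ α)                                    ≈⟨ ⋆-∷ f g a α ⟩
  antidiag a (λ i j → ((i ∷ᶠ f) ⋆ (j ∷ᶠ g)) α)       ≈⟨ antidiag-cong a (λ i j _ → ⋆-comm (i ∷ᶠ f) (j ∷ᶠ g) α) ⟩
  antidiag a (λ i j → ((j ∷ᶠ g) ⋆ (i ∷ᶠ f)) α)       ≈⟨ antidiag-comm a (λ i j → ((j ∷ᶠ g) ⋆ (i ∷ᶠ f)) α) ⟩
  antidiag a (λ i j → ((i ∷ᶠ g) ⋆ (j ∷ᶠ f)) α)       ≈⟨ ⋆-∷ g f a α ⟨
  (g ⋆ f) (a ∷ α)                                    ∎
  where open ≋-Reasoning

⋆-∑ˡ : ∀ {A : Set} (xs : List A) (F : A → ListFun) g α →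
  ((λ β → ∑[ x ← xs ] F x β) ⋆ g) α ≋ (∑[ x ← xs ] (F x ⋆ g) α)
⋆-∑ˡ xs F g α = ≋-trans
  (∑-cong (splittings α) λ (β , γ) → ∑-*ʳ xs (g γ) (λ x → F x β))
  (∑-swap (splittings α) xs λ (β , γ) x → F x β *ₜ g γ)

⋆-∑ʳ : ∀ {A : Set} (xs : List A) f (G : A → ListFun) α →
  (f ⋆ (λ β → ∑[ x ← xs ] G x β)) α ≋ (∑[ x ← xs ] (f ⋆ G x) α)
⋆-∑ʳ xs f G α = ≋-trans
  (∑-cong (splittings α) λ (β , γ) → ∑-*ˡ xs (f β) (λ x → G x γ))
  (∑-swap (splittings α) xs λ (β , γ) x → f β *ₜ G x γ)

⋆-+ˡ : ∀ f g h α → ((λ β → f β +ₜ g β) ⋆ h) α ≋ (f ⋆ h) α +ₜ (g ⋆ h) α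
⋆-+ˡ f g h α = ≋-trans
  (∑-cong (splittings α) λ (β , γ) → *ₜ-distribʳ (h γ) (f β) (g β))
  (∑-+ (splittings α) (λ (β , γ) → f β *ₜ h γ) (λ (β , γ) → g β *ₜ h γ))

⋆-*ˡ : ∀ c f g α → ((λ β → c *ₜ f β) ⋆ g) α ≋ c *ₜ (f ⋆ g) α
⋆-*ˡ c f g α = ≋-trans (∑-cong (splittings α) λ (β , γ) → *ₜ-assoc c (f β) (g γ))
  (≋-sym (∑-*ˡ (splittings α) c λ (β , γ) → f β *ₜ g γ))

⋆-*ʳ : ∀ c f g α → (f ⋆ (λ β → c *ₜ g β)) α ≋ c *ₜ (f ⋆ g) α
⋆-*ʳ c f g α = ≋-trans (⋆-comm f (λ β → c *ₜ g β) α)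
  (≋-trans (⋆-*ˡ c g f α) (*ₜ-congˡ c (⋆-comm g f α)))

⋆-zeroˡ : ∀ {f} g → (∀ α → f α ≋ 0ₜ) → ∀ α → (f ⋆ g) α ≋ 0ₜ
⋆-zeroˡ g z α = ∑-zero (splittings α) λ (β , γ) → *ₜ-zeroˡ (z β) (g γ)

⋆-assoc : ∀ f g h → (f ⋆ g) ⋆ h ≗ f ⋆ (g ⋆ h)
⋆-assoc f g h [] = +ₜ-congʳ 0ₜ
  (≋-trans (*ₜ-congʳ (h []) (+ₜ-identityʳ (f [] *ₜ g [])))
  (≋-trans (*ₜ-assoc (f []) (g []) (h []))
           (*ₜ-congˡ (f []) (≋-sym (+ₜ-identityʳ (g [] *ₜ h []))))))
⋆-assoc f g h (a ∷ α) = begin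
  ((f ⋆ g) ⋆ h) (a ∷ α)
    ≈⟨ ⋆-∷ (f ⋆ g) h a α ⟩
  antidiag a (λ i k → ((i ∷ᶠ (f ⋆ g)) ⋆ (k ∷ᶠ h)) α)
    ≈⟨ antidiag-cong a (λ i k _ → ≋-trans
         (⋆-cong {g = k ∷ᶠ h} (⋆-∷ f g i) (λ _ → ≋-refl) α)
         (⋆-∑ˡ (upTo (suc i)) (λ j → (j ∷ᶠ f) ⋆ ((i ∸ j) ∷ᶠ g)) (k ∷ᶠ h) α)) ⟩
  antidiag a (λ i k → antidiag i λ j l → (((j ∷ᶠ f) ⋆ (l ∷ᶠ g)) ⋆ (k ∷ᶠ h)) α)
    ≈⟨ antidiag-cong a (λ i k _ → antidiag-cong i λ j l _ → ⋆-assoc (j ∷ᶠ f) (l ∷ᶠ g) (k ∷ᶠ h) α) ⟩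
  antidiag a (λ i k → antidiag i λ j l → ((j ∷ᶠ f) ⋆ ((l ∷ᶠ g) ⋆ (k ∷ᶠ h))) α)
    ≈⟨ antidiag-assoc a (λ j l k → ((j ∷ᶠ f) ⋆ ((l ∷ᶠ g) ⋆ (k ∷ᶠ h))) α) ⟩
  antidiag a (λ j m → antidiag m λ l k → ((j ∷ᶠ f) ⋆ ((l ∷ᶠ g) ⋆ (k ∷ᶠ h))) α)
    ≈⟨ antidiag-cong a (λ j m _ → ≋-sym (≋-trans
         (⋆-cong {f = j ∷ᶠ f} (λ _ → ≋-refl) (⋆-∷ g h m) α)
         (⋆-∑ʳ (upTo (suc m)) (j ∷ᶠ f) (λ l → (l ∷ᶠ g) ⋆ ((m ∸ l) ∷ᶠ h)) α))) ⟩
  antidiag a (λ j m → ((j ∷ᶠ f) ⋆ (m ∷ᶠ (g ⋆ h))) α)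
    ≈⟨ ⋆-∷ f (g ⋆ h) a α ⟨
  (f ⋆ (g ⋆ h)) (a ∷ α) ∎
  where open ≋-Reasoning

one : ListFun
one α = 𝟙 (sum α ≟ 0)

⋆-identityˡ : ∀ f → one ⋆ f ≗ f
⋆-identityˡ f []      = ≋-trans (+ₜ-identityʳ (1ₜ *ₜ f [])) (*ₜ-identityˡ (f []))
⋆-identityˡ f (a ∷ α) = begin
  (one ⋆ f) (a ∷ α)
    ≈⟨ ⋆-∷ one f a α ⟩
  antidiag a (λ i j → ((i ∷ᶠ one) ⋆ (j ∷ᶠ f)) α)
    ≈⟨ ∑-upTo-δ (suc a) 0 (s≤s z≤n) (λ { zero 0≢0 → contradiction refl 0≢0 ; (suc i) _ →
         ⋆-zeroˡ {suc i ∷ᶠ one} ((a ∸ suc i) ∷ᶠ f) (λ _ → ≋-refl) α }) ⟩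
  ((0 ∷ᶠ one) ⋆ (a ∷ᶠ f)) α
    ≈⟨ ⋆-identityˡ (a ∷ᶠ f) α ⟩
  f (a ∷ α) ∎
  where open ≋-Reasoning

PermInvariant : ListFun → Set
PermInvariant f = ∀ {α β} → α ↭ β → f α ≋ f β

∷ᶠ-perm : ∀ {f} a → PermInvariant f → PermInvariant (a ∷ᶠ f)
∷ᶠ-perm a f↭ α↭β = f↭ (prep a α↭β)

-- Only the transposition of the first two variables needs an argument: once both are split off, the
-- two sums over their exponents can be interchanged.
⋆-perm : ∀ {f g} → PermInvariant f → PermInvariant g → PermInvariant (f ⋆ g)
⋆-perm f↭ g↭ _↭_.refl = ≋-refl
⋆-perm {f} {g} f↭ g↭ (prep {xs = α} {ys = β} a α↭β) = begin
  (f ⋆ g) (a ∷ α)                                ≈⟨ ⋆-∷ f g a α ⟩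
  antidiag a (λ i j → ((i ∷ᶠ f) ⋆ (j ∷ᶠ g)) α)   ≈⟨ antidiag-cong a (λ i j _ → ⋆-perm {i ∷ᶠ f} {j ∷ᶠ g} (∷ᶠ-perm i f↭) (∷ᶠ-perm j g↭) α↭β) ⟩
  antidiag a (λ i j → ((i ∷ᶠ f) ⋆ (j ∷ᶠ g)) β)   ≈⟨ ⋆-∷ f g a β ⟨
  (f ⋆ g) (a ∷ β)                                ∎
  where open ≋-Reasoning
⋆-perm {f} {g} f↭ g↭ (swap {xs = α} {ys = β} a b α↭β) = begin
  (f ⋆ g) (a ∷ b ∷ α)
    ≈⟨ expand a b α ⟩
  antidiag a (λ i j → antidiag b λ k l → ((k ∷ᶠ i ∷ᶠ f) ⋆ (l ∷ᶠ j ∷ᶠ g)) α)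
    ≈⟨ ∑-swap (upTo (suc a)) (upTo (suc b)) (λ i k → ((k ∷ᶠ i ∷ᶠ f) ⋆ ((b ∸ k) ∷ᶠ (a ∸ i) ∷ᶠ g)) α) ⟩
  antidiag b (λ k l → antidiag a λ i j → ((k ∷ᶠ i ∷ᶠ f) ⋆ (l ∷ᶠ j ∷ᶠ g)) α)
    ≈⟨ antidiag-cong b (λ k l _ → antidiag-cong a λ i j _ → ≋-trans
         (⋆-cong (λ γ → f↭ (swap i k ↭-refl)) (λ γ → g↭ (swap j l ↭-refl)) α)
         (⋆-perm {i ∷ᶠ k ∷ᶠ f} {j ∷ᶠ l ∷ᶠ g} (∷ᶠ-perm i (∷ᶠ-perm k f↭)) (∷ᶠ-perm j (∷ᶠ-perm l g↭)) α↭β)) ⟩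
  antidiag b (λ k l → antidiag a λ i j → ((i ∷ᶠ k ∷ᶠ f) ⋆ (j ∷ᶠ l ∷ᶠ g)) β)
    ≈⟨ expand b a β ⟨
  (f ⋆ g) (b ∷ a ∷ β) ∎
  where
  open ≋-Reasoning
  expand : ∀ a b α → (f ⋆ g) (a ∷ b ∷ α) ≋
    antidiag a (λ i j → antidiag b λ k l → ((k ∷ᶠ i ∷ᶠ f) ⋆ (l ∷ᶠ j ∷ᶠ g)) α)
  expand a b α = ≋-trans (⋆-∷ f g a (b ∷ α)) (antidiag-cong a λ i j _ → ⋆-∷ (i ∷ᶠ f) (j ∷ᶠ g) b α)
⋆-perm {f} {g} f↭ g↭ (_↭_.trans p q) = ≋-trans (⋆-perm {f} {g} f↭ g↭ p) (⋆-perm {f} {g} f↭ g↭ q)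

-- These two invariances are what lets a series factor through `toPartition`, which sorts and drops
-- zeros.
record Symmetric (f : ListFun) : Set where
  field
    perm : PermInvariant f
    zeros : ∀ α → f (0 ∷ α) ≋ f α
open Symmetric

∷ᶠ-sym : ∀ {f} a → Symmetric f → Symmetric (a ∷ᶠ f)
∷ᶠ-sym a S = record
  { perm = ∷ᶠ-perm a (perm S)
  ; zeros = λ α → ≋-trans (perm S (swap a 0 ↭-refl)) (zeros S (a ∷ α)) }

⋆-sym : ∀ {f g} → Symmetric f → Symmetric g → Symmetric (f ⋆ g)
⋆-sym {f} {g} S T = record
  { perm = ⋆-perm {f} {g} (perm S) (perm T)
  ; zeros = λ α → ≋-trans (⋆-∷ f g 0 α) (≋-trans (+ₜ-identityʳ _) (⋆-cong (zeros S) (zeros T) α)) }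

sym-filter : ∀ {f} → Symmetric f → ∀ α → f (filter (0 <?_) α) ≋ f α
sym-filter S []          = ≋-refl
sym-filter S (zero ∷ α)  = ≋-trans (sym-filter S α) (≋-sym (zeros S α))
sym-filter S (suc a ∷ α) = sym-filter (∷ᶠ-sym (suc a) S) α

-- Transport between `Λ∞` and functions on exponent vectors

hat : Λ∞ → ListFun
hat F α = F (toPartition α)

hat-parts : ∀ F λ′ → hat F (parts λ′) ≡ F λ′
hat-parts F λ′ = cong F (toPartition-parts λ′)

sym-hat : ∀ F → Symmetric (hat F)
sym-hat F = record { perm = λ α↭β → ≡⇒≋ (cong F (toPartition-↭ α↭β)) ; zeros = λ α → ≋-refl }

sym-toPartition : ∀ {f} → Symmetric f → ∀ α → f (parts (toPartition α)) ≋ f α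
sym-toPartition S α = ≋-trans (perm S (parts-toPartition-↭ α)) (sym-filter S α)

-- By definition `⊛` is the convolution evaluated at sorted vectors. A convolution of symmetric
-- series is symmetric, so its other values agree with those; the ring laws of `⊛` are inherited
-- from `⋆` in this way.
hat-⊛ : ∀ F G → hat (F ⊛ G) ≗ hat F ⋆ hat G
hat-⊛ F G = sym-toPartition (⋆-sym (sym-hat F) (sym-hat G))

infix 4 _≋∞_
_≋∞_ : Λ∞ → Λ∞ → Set
F ≋∞ G = ∀ λ′ → F λ′ ≋ G λ′

hat-cong : ∀ {F G} → F ≋∞ G → hat F ≗ hat G
hat-cong e α = e (toPartition α)

hat-injective : ∀ {F G} → hat F ≗ hat G → F ≋∞ G
hat-injective {F} {G} e λ′ = ≋-trans (≡⇒≋ (sym (hat-parts F λ′))) (≋-trans (e (parts λ′)) (≡⇒≋ (hat-parts G λ′)))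

⊛-cong : ∀ {F F′ G G′} → F ≋∞ F′ → G ≋∞ G′ → F ⊛ G ≋∞ F′ ⊛ G′
⊛-cong e e′ λ′ = ⋆-cong (hat-cong e) (hat-cong e′) (parts λ′)

⊛-comm : ∀ F G → F ⊛ G ≋∞ G ⊛ F
⊛-comm F G λ′ = ⋆-comm (hat F) (hat G) (parts λ′)

⊛-assoc : ∀ F G H → (F ⊛ G) ⊛ H ≋∞ F ⊛ (G ⊛ H)
⊛-assoc F G H λ′ = begin
  ((F ⊛ G) ⊛ H) λ′                       ≈⟨ ⋆-cong {g = hat H} (hat-⊛ F G) (λ _ → ≋-refl) (parts λ′) ⟩
  ((hat F ⋆ hat G) ⋆ hat H) (parts λ′)   ≈⟨ ⋆-assoc (hat F) (hat G) (hat H) (parts λ′) ⟩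
  (hat F ⋆ (hat G ⋆ hat H)) (parts λ′)   ≈⟨ ⋆-cong {f = hat F} (λ _ → ≋-refl) (hat-⊛ G H) (parts λ′) ⟨
  (F ⊛ (G ⊛ H)) λ′                       ∎
  where open ≋-Reasoning

empty-parts : ∀ λ′ → ∣ λ′ ∣ ≡ 0 → parts λ′ ≡ []
empty-parts (mkPartition [] _ _) e = refl
empty-parts (mkPartition (suc a ∷ _) _ (_ ∷ _)) ()
empty-parts (mkPartition (zero ∷ _) _ (() ∷ _)) e

1∞-𝟙 : ∀ λ′ → 1∞ λ′ ≋ 𝟙 (∣ λ′ ∣ ≟ 0)
1∞-𝟙 λ′ = 𝟙-⇔ (≡-dec _≟_ (parts λ′) []) (∣ λ′ ∣ ≟ 0) (cong sum) (empty-parts λ′)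

hat-1∞ : hat 1∞ ≗ one
hat-1∞ α = ≋-trans (1∞-𝟙 (toPartition α)) (≡⇒≋ (cong (λ n → 𝟙 (n ≟ 0)) (∣toPartition∣ α)))

⊛-identityˡ : ∀ F → 1∞ ⊛ F ≋∞ F
⊛-identityˡ F λ′ = ≋-trans (⋆-cong {g = hat F} hat-1∞ (λ _ → ≋-refl) (parts λ′))
  (≋-trans (⋆-identityˡ (hat F) (parts λ′)) (≡⇒≋ (hat-parts F λ′)))

-- Exponentials and derivations

NoConst : ListFun → Set
NoConst g = ∀ α → sum α ≡ 0 → g α ≋ 0ₜ

infixr 8 _⋆^_
_⋆^_ : ListFun → ℕ → ListFun
g ⋆^ zero  = one
g ⋆^ suc m = g ⋆ (g ⋆^ m)

⋆^-cong : ∀ {g h} m → g ≗ h → g ⋆^ m ≗ h ⋆^ m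
⋆^-cong zero    e α = ≋-refl
⋆^-cong (suc m) e α = ⋆-cong e (⋆^-cong m e) α

-- Each of the m factors uses up at least one unit of degree. Hence the finite sum in `expᶠ` leaves
-- out zeros only.
⋆^-vanishes : ∀ {g} → NoConst g → ∀ m α → sum α < m → (g ⋆^ m) α ≋ 0ₜ
⋆^-vanishes {g} g₀ (suc m) α (s≤s ∣α∣≤m) = ∑-zeroAll (All.map
  (λ { {β , γ} e → term β γ e }) (sum-splittings α))
  where
  term : ∀ β γ → sum β + sum γ ≡ sum α → g β *ₜ (g ⋆^ m) γ ≋ 0ₜ
  term β γ e with sum β in eq
  ... | zero  = *ₜ-zeroˡ (g₀ β eq) _
  ... | suc b = *ₜ-zeroʳ′ (g β) (⋆^-vanishes g₀ m γ
    (ℕ.≤-trans (s≤s (ℕ.m≤n+m (sum γ) b)) (ℕ.≤-trans (ℕ.≤-reflexive e) ∣α∣≤m)))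

expᶠ : ListFun → ListFun
expᶠ g α = ∑[ m ← upTo (suc (sum α)) ] 1/! m *ₜ (g ⋆^ m) α

expᶠ-cong : ∀ {g h} → g ≗ h → expᶠ g ≗ expᶠ h
expᶠ-cong e α = ∑-cong (upTo (suc (sum α))) λ m → *ₜ-congˡ (1/! m) (⋆^-cong m e α)

expᶠ-const : ∀ g α → sum α ≡ 0 → expᶠ g α ≋ 1ₜ
expᶠ-const g α e rewrite e = ≋-trans (+ₜ-identityʳ (1/! 0 *ₜ 1ₜ)) (*ₜ-identityˡ 1ₜ)

-- The grading along which a series is differentiated: the total degree for the functional equation
-- of `expᶠ`, the exponent of x₁ for Littlewood's identity.
record Weight : Set where
  field
    weight   : List ℕ → ℕ
    additive : ∀ α → All (λ (β , γ) → weight β + weight γ ≡ weight α) (splittings α)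
    null     : ∀ α → sum α ≡ 0 → weight α ≡ 0

-- D is x^α ↦ w(α) x^α; when w is the exponent of x₁ this is x₁ ∂/∂x₁.
module Derivation (W : Weight) where
  open Weight W

  D : ListFun → ListFun
  D f α = num (weight α) *ₜ f α

  D-cong : ∀ {f g} → f ≗ g → D f ≗ D g
  D-cong e α = *ₜ-congˡ (num (weight α)) (e α)

  D-+ : ∀ f g α → D (λ β → f β +ₜ g β) α ≋ D f α +ₜ D g α
  D-+ f g α = *ₜ-distribˡ (num (weight α)) (f α) (g α)

  D-noConst : ∀ {g} → NoConst g → NoConst (D g)
  D-noConst g₀ α e = *ₜ-zeroʳ′ (num (weight α)) (g₀ α e)

  D-null : ∀ f α → weight α ≡ 0 → D f α ≋ 0ₜ
  D-null f α e = *ₜ-zeroˡ (≋-trans (≡⇒≋ (cong num e)) num-0) (f α)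

  D-⋆ : ∀ f g α → D (f ⋆ g) α ≋ (D f ⋆ g) α +ₜ (f ⋆ D g) α
  D-⋆ f g α = ≋-trans (∑-*ˡ (splittings α) (num (weight α)) (λ (β , γ) → f β *ₜ g γ))
    (≋-trans (∑-congAll (All.map (λ { {β , γ} e → leibniz β γ e }) (additive α)))
             (∑-+ (splittings α) (λ (β , γ) → D f β *ₜ g γ) (λ (β , γ) → f β *ₜ D g γ)))
    where
    open ≋-Reasoning
    leibniz : ∀ β γ → weight β + weight γ ≡ weight α →
      num (weight α) *ₜ (f β *ₜ g γ) ≋ D f β *ₜ g γ +ₜ f β *ₜ D g γ
    leibniz β γ e = begin
      num (weight α) *ₜ (f β *ₜ g γ)
        ≈⟨ *ₜ-congʳ (f β *ₜ g γ) (≋-trans (≡⇒≋ (cong num (sym e))) (num-+ (weight β) (weight γ))) ⟩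
      (num (weight β) +ₜ num (weight γ)) *ₜ (f β *ₜ g γ)
        ≈⟨ ≋-Solver.solve 4 (λ m n x y → (m ⊹ n) ⊠ (x ⊠ y) ⊜ (m ⊠ x) ⊠ y ⊹ x ⊠ (n ⊠ y)) ≋-refl
             (num (weight β)) (num (weight γ)) (f β) (g γ) ⟩
      D f β *ₜ g γ +ₜ f β *ₜ D g γ ∎

  D-one : ∀ α → D one α ≋ 0ₜ
  D-one α with sum α in eq
  ... | zero  = ≋-trans (*ₜ-identityʳ _) (≋-trans (≡⇒≋ (cong num (null α eq))) num-0)
  ... | suc n = *ₜ-zeroʳ (num (weight α))

  D-⋆^ : ∀ g m α → D (g ⋆^ suc m) α ≋ num (suc m) *ₜ (D g ⋆ g ⋆^ m) α
  D-⋆^ g m α = begin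
    D (g ⋆^ suc m) α
      ≈⟨ D-⋆ g (g ⋆^ m) α ⟩
    (D g ⋆ g ⋆^ m) α +ₜ (g ⋆ D (g ⋆^ m)) α
      ≈⟨ +ₜ-congˡ ((D g ⋆ g ⋆^ m) α) (second m) ⟩
    (D g ⋆ g ⋆^ m) α +ₜ num m *ₜ (D g ⋆ g ⋆^ m) α
      ≈⟨ num-suc m ((D g ⋆ g ⋆^ m) α) ⟨
    num (suc m) *ₜ (D g ⋆ g ⋆^ m) α ∎
    where
    open ≋-Reasoning
    second : ∀ m → (g ⋆ D (g ⋆^ m)) α ≋ num m *ₜ (D g ⋆ g ⋆^ m) α
    second zero = ≋-trans (⋆-comm g (D one) α) (≋-trans (⋆-zeroˡ g D-one α)
      (≋-sym (*ₜ-zeroˡ num-0 ((D g ⋆ one) α))))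
    second (suc m) = begin
      (g ⋆ D (g ⋆^ suc m)) α                              ≈⟨ ⋆-cong {f = g} (λ _ → ≋-refl) (D-⋆^ g m) α ⟩
      (g ⋆ (λ β → num (suc m) *ₜ (D g ⋆ g ⋆^ m) β)) α     ≈⟨ ⋆-*ʳ (num (suc m)) g (D g ⋆ g ⋆^ m) α ⟩
      num (suc m) *ₜ (g ⋆ (D g ⋆ g ⋆^ m)) α               ≈⟨ *ₜ-congˡ (num (suc m)) (exchange m) ⟩
      num (suc m) *ₜ (D g ⋆ (g ⋆ g ⋆^ m)) α               ∎
      where
      exchange : ∀ m → (g ⋆ (D g ⋆ g ⋆^ m)) α ≋ (D g ⋆ (g ⋆ g ⋆^ m)) α
      exchange m = ≋-trans (≋-sym (⋆-assoc g (D g) (g ⋆^ m) α))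
        (≋-trans (⋆-cong {g = g ⋆^ m} (⋆-comm g (D g)) (λ _ → ≋-refl) α) (⋆-assoc (D g) g (g ⋆^ m) α))

  -- Termwise, the factor m + 1 cancels against (m + 1)! and shifts the index by one. The shifted
  -- sum is cut off according to α and not to γ; since `D g` has no constant term, γ has smaller
  -- degree than α, and the surplus powers vanish at γ.
  D-exp : ∀ {g} → NoConst g → D (expᶠ g) ≗ D g ⋆ expᶠ g
  D-exp {g} g₀ α = begin
    num (weight α) *ₜ expᶠ g α
      ≈⟨ ∑-*ˡ (upTo (suc n)) (num (weight α)) (λ m → 1/! m *ₜ (g ⋆^ m) α) ⟩
    (∑[ m ← upTo (suc n) ] num (weight α) *ₜ (1/! m *ₜ (g ⋆^ m) α))
      ≈⟨ ∑-cong (upTo (suc n)) (λ m → *ₜ-swap (num (weight α)) (1/! m) ((g ⋆^ m) α)) ⟩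
    (∑[ m ← upTo (suc n) ] 1/! m *ₜ D (g ⋆^ m) α)
      ≈⟨ ∑-upTo-suc n (λ m → 1/! m *ₜ D (g ⋆^ m) α) ⟩
    1/! 0 *ₜ D one α +ₜ (∑[ m ← upTo n ] 1/! (suc m) *ₜ D (g ⋆^ suc m) α)
      ≈⟨ +ₜ-cong (*ₜ-zeroʳ′ (1/! 0) (D-one α)) (∑-cong (upTo n) λ m → begin
           1/! (suc m) *ₜ D (g ⋆^ suc m) α
             ≈⟨ *ₜ-congˡ (1/! (suc m)) (D-⋆^ g m α) ⟩
           1/! (suc m) *ₜ (num (suc m) *ₜ (D g ⋆ g ⋆^ m) α)
             ≈⟨ *ₜ-swap (1/! (suc m)) (num (suc m)) ((D g ⋆ g ⋆^ m) α) ⟩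
           num (suc m) *ₜ (1/! (suc m) *ₜ (D g ⋆ g ⋆^ m) α)
             ≈⟨ *ₜ-assoc (num (suc m)) (1/! (suc m)) ((D g ⋆ g ⋆^ m) α) ⟨
           num (suc m) *ₜ 1/! (suc m) *ₜ (D g ⋆ g ⋆^ m) α
             ≈⟨ *ₜ-congʳ ((D g ⋆ g ⋆^ m) α) (1/!-suc m) ⟩
           1/! m *ₜ (D g ⋆ g ⋆^ m) α
             ≈⟨ ⋆-*ʳ (1/! m) (D g) (g ⋆^ m) α ⟨
           (D g ⋆ (λ γ → 1/! m *ₜ (g ⋆^ m) γ)) α ∎) ⟩
    (∑[ m ← upTo n ] (D g ⋆ (λ γ → 1/! m *ₜ (g ⋆^ m) γ)) α)
      ≈⟨ ⋆-∑ʳ (upTo n) (D g) (λ m γ → 1/! m *ₜ (g ⋆^ m) γ) α ⟨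
    (D g ⋆ (λ γ → ∑[ m ← upTo n ] 1/! m *ₜ (g ⋆^ m) γ)) α
      ≈⟨ ∑-congAll (All.map (λ { {β , γ} e → term β γ e }) (sum-splittings α)) ⟩
    (D g ⋆ expᶠ g) α ∎
    where
    open ≋-Reasoning
    n = sum α
    term : ∀ β γ → sum β + sum γ ≡ n →
      D g β *ₜ (∑[ m ← upTo n ] 1/! m *ₜ (g ⋆^ m) γ) ≋ D g β *ₜ expᶠ g γ
    term β γ e with sum β in eq
    ... | zero  = ≋-trans (*ₜ-zeroˡ (D-noConst g₀ β eq) _) (≋-sym (*ₜ-zeroˡ (D-noConst g₀ β eq) _))
    ... | suc b = *ₜ-congˡ (D g β) (∑-upTo-≤ (λ m → 1/! m *ₜ (g ⋆^ m) γ)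
      (ℕ.≤-trans (s≤s (ℕ.m≤n+m (sum γ) b)) (ℕ.≤-reflexive e))
      λ m ∣γ∣<m _ → *ₜ-zeroʳ′ (1/! m) (⋆^-vanishes g₀ m γ ∣γ∣<m))

  -- Strong induction on the weight n of α. For n > 0 the equation expresses n times the value at α
  -- by values at vectors γ of smaller weight, because A vanishes in weight 0; then n is cancelled.
  -- Weight 0 carries the initial condition.
  D-unique : ∀ {A f f′} → (∀ β → weight β ≡ 0 → A β ≋ 0ₜ) → D f ≗ A ⋆ f → D f′ ≗ A ⋆ f′ →
    (∀ α → weight α ≡ 0 → f α ≋ f′ α) → f ≗ f′
  D-unique {A} {f} {f′} A₀ Df Df′ f₀ α = go α (ℕ.<-wellFounded (weight α))
    where
    go : ∀ α → Acc _<_ (weight α) → f α ≋ f′ α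
    go α (acc rs) with weight α in eq
    ... | zero  = f₀ α eq
    ... | suc n = num-cancel (suc n) (subst (λ k → num k *ₜ f α ≋ num k *ₜ f′ α) eq
      (≋-trans (Df α) (≋-trans
        (∑-congAll (All.map (λ { {β , γ} e → term β γ e }) (additive α))) (≋-sym (Df′ α)))))
      where
      term : ∀ β γ → weight β + weight γ ≡ weight α → A β *ₜ f γ ≋ A β *ₜ f′ γ
      term β γ e with weight β in eqβ
      ... | zero  = ≋-trans (*ₜ-zeroˡ (A₀ β eqβ) (f γ)) (≋-sym (*ₜ-zeroˡ (A₀ β eqβ) (f′ γ)))
      ... | suc b = *ₜ-congˡ (A β) (go γ (rs (ℕ.≤-trans (s≤s (ℕ.m≤n+m (weight γ) b))
        (ℕ.≤-reflexive (trans e eq)))))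

degree : Weight
degree = record { weight = sum ; additive = sum-splittings ; null = λ _ e → e }

module _ where
  open Derivation degree

  ⋆-const : ∀ f g α → sum α ≡ 0 → (∀ β γ → sum β ≡ 0 → sum γ ≡ 0 → f β *ₜ g γ ≋ 1ₜ) → (f ⋆ g) α ≋ 1ₜ
  ⋆-const f g α e h = ≋-trans (∑-congAll {g = λ (β , γ) → one β *ₜ one γ}
      (All.map (λ { {β , γ} e′ → term β γ (trans e′ e) }) (sum-splittings α)))
    (≋-trans (⋆-identityˡ one α) (𝟙-yes (sum α ≟ 0) e))
    where
    term : ∀ β γ → sum β + sum γ ≡ 0 → f β *ₜ g γ ≋ one β *ₜ one γ
    term β γ e = ≋-trans (h β γ β₀ γ₀) (≋-sym (≋-trans
      (*ₜ-cong (𝟙-yes (sum β ≟ 0) β₀) (𝟙-yes (sum γ ≟ 0) γ₀)) (*ₜ-identityˡ 1ₜ)))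
      where
      β₀ = ℕ.m+n≡0⇒m≡0 (sum β) e
      γ₀ = ℕ.m+n≡0⇒n≡0 (sum β) e

  -- Both sides solve D F = D(g + h) ⋆ F for the derivation by total degree and have constant term
  -- 1, which replaces a computation with binomial coefficients.
  expᶠ-+ : ∀ {g h} → NoConst g → NoConst h → expᶠ (λ α → g α +ₜ h α) ≗ expᶠ g ⋆ expᶠ h
  expᶠ-+ {g} {h} g₀ h₀ = D-unique {A = D g+h} (λ β e → D-null g+h β e)
    (D-exp λ α e → +ₜ-0 (g₀ α e) (h₀ α e)) product-rule
    λ α e → ≋-trans (expᶠ-const g+h α e) (≋-sym (⋆-const (expᶠ g) (expᶠ h) α e λ β γ eβ eγ → ≋-trans
        (*ₜ-cong (expᶠ-const g β eβ) (expᶠ-const h γ eγ)) (*ₜ-identityˡ 1ₜ)))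
    where
    open ≋-Reasoning
    g+h : ListFun
    g+h α = g α +ₜ h α
    G = expᶠ g
    H′ = expᶠ h
    product-rule : D (G ⋆ H′) ≗ D g+h ⋆ (G ⋆ H′)
    product-rule α = begin
      D (G ⋆ H′) α
        ≈⟨ D-⋆ G H′ α ⟩
      (D G ⋆ H′) α +ₜ (G ⋆ D H′) α
        ≈⟨ +ₜ-cong (⋆-cong {g = H′} (D-exp g₀) (λ _ → ≋-refl) α) (⋆-cong {f = G} (λ _ → ≋-refl) (D-exp h₀) α) ⟩
      ((D g ⋆ G) ⋆ H′) α +ₜ (G ⋆ (D h ⋆ H′)) α
        ≈⟨ +ₜ-cong (⋆-assoc (D g) G H′ α) (≋-trans (≋-sym (⋆-assoc G (D h) H′ α))
             (≋-trans (⋆-cong {g = H′} (⋆-comm G (D h)) (λ _ → ≋-refl) α) (⋆-assoc (D h) G H′ α))) ⟩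
      (D g ⋆ (G ⋆ H′)) α +ₜ (D h ⋆ (G ⋆ H′)) α
        ≈⟨ ⋆-+ˡ (D g) (D h) (G ⋆ H′) α ⟨
      ((λ β → D g β +ₜ D h β) ⋆ (G ⋆ H′)) α
        ≈⟨ ⋆-cong {g = G ⋆ H′} (D-+ g h) (λ _ → ≋-refl) α ⟨
      (D g+h ⋆ (G ⋆ H′)) α ∎

  expᶠ-0 : ∀ {g} → (∀ α → g α ≋ 0ₜ) → expᶠ g ≗ one
  expᶠ-0 {g} g≋0 = D-unique {A = D g} (λ β e → D-null g β e) (D-exp λ α _ → g≋0 α)
    (λ α → ≋-trans (D-one α) (≋-sym (⋆-zeroˡ one (λ β → *ₜ-zeroʳ′ (num (sum β)) (g≋0 β)) α)))
    λ α e → ≋-trans (expᶠ-const g α e) (≋-sym (𝟙-yes (sum α ≟ 0) e))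

hat-⊛^ : ∀ G m → hat (G ⊛^ m) ≗ hat G ⋆^ m
hat-⊛^ G zero    = hat-1∞
hat-⊛^ G (suc m) α = ≋-trans (hat-⊛ G (G ⊛^ m) α) (⋆-cong {f = hat G} (λ _ → ≋-refl) (hat-⊛^ G m) α)

hat-exp : ∀ G → hat (exp G) ≗ expᶠ (hat G)
hat-exp G α rewrite ∣toPartition∣ α =
  ∑-cong (upTo (suc (sum α))) λ m → *ₜ-congˡ (1/! m) (hat-⊛^ G m α)

-- Multiplication by powers of t and the substitution t ↦ t^k

-- Multiplication by t^n, in the literal form in which `[t↦t^_]` inserts its zeros.
shift : ℕ → ℚ[t] → ℚ[t]
shift n p = replicate n 0ℚ ++ p

shift-cong : ∀ n {p q} → p ≋ q → shift n p ≋ shift n q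
shift-cong zero    e = e
shift-cong (suc n) e = ∷-cong refl (shift-cong n e)

shift-0 : ∀ n → shift n 0ₜ ≋ 0ₜ
shift-0 zero    = ≋-refl
shift-0 (suc n) = ≋-trans (∷-cong refl (shift-0 n)) 0∷0

shift-shift : ∀ m n p → shift m (shift n p) ≡ shift (m + n) p
shift-shift zero    n p = refl
shift-shift (suc m) n p = cong (0ℚ ∷_) (shift-shift m n p)

shift-+ : ∀ n p q → shift n (p +ₜ q) ≋ shift n p +ₜ shift n q
shift-+ zero    p q = ≋-refl
shift-+ (suc n) p q = ∷-cong (sym (ℚ.+-identityˡ 0ℚ)) (shift-+ n p q)

t^-* : ∀ n p → t^ n *ₜ p ≋ shift n p
t^-* zero    p = *ₜ-identityˡ p
t^-* (suc n) p = ≋-trans (+ₜ-congʳ (0ℚ ∷ (t^ n *ₜ p)) (scale-0 p)) (∷-cong refl (t^-* n p))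

t^-+ : ∀ m n → t^ (m + n) ≋ t^ m *ₜ t^ n
t^-+ m n = ≋-sym (≋-trans (t^-* m (t^ n)) (≡⇒≋ (shift-shift m n 1ₜ)))

module _ (k : ℕ) .{{_ : NonZero k}} where
  [t↦t^]-zero : ∀ {p} → p ≋ 0ₜ → p [t↦t^ k ] ≋ 0ₜ
  [t↦t^]-zero {[]}    e = ≋-refl
  [t↦t^]-zero {a ∷ p} (mk≋ e) = ≋-trans
    (∷-cong (e 0) (≋-trans (shift-cong (ℕ.pred k) ([t↦t^]-zero {p} (mk≋ (e ∘ suc)))) (shift-0 (ℕ.pred k)))) 0∷0

  [t↦t^]-cong : ∀ {p q} → p ≋ q → p [t↦t^ k ] ≋ q [t↦t^ k ]
  [t↦t^]-cong {[]}    {q}     e = ≋-sym ([t↦t^]-zero (≋-sym e))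
  [t↦t^]-cong {a ∷ p} {[]}    e = [t↦t^]-zero e
  [t↦t^]-cong {a ∷ p} {b ∷ q} e = ∷-cong (proj₁ (∷-≋ e)) (shift-cong (ℕ.pred k) ([t↦t^]-cong (proj₂ (∷-≋ e))))

  [t↦t^]-+ : ∀ p q → (p +ₜ q) [t↦t^ k ] ≋ p [t↦t^ k ] +ₜ q [t↦t^ k ]
  [t↦t^]-+ []      q       = ≋-refl
  [t↦t^]-+ (a ∷ p) []      = ≋-sym (+ₜ-identityʳ ((a ∷ p) [t↦t^ k ]))
  [t↦t^]-+ (a ∷ p) (b ∷ q) = ∷-cong refl (≋-trans (shift-cong (ℕ.pred k) ([t↦t^]-+ p q))
    (shift-+ (ℕ.pred k) (p [t↦t^ k ]) (q [t↦t^ k ])))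

[t↦t^]-shift : ∀ n k .{{_ : NonZero k}} p → shift n p [t↦t^ k ] ≡ shift (n * k) (p [t↦t^ k ])
[t↦t^]-shift zero    k         p = refl
[t↦t^]-shift (suc n) k@(suc j) p = cong (0ℚ ∷_)
  (trans (cong (shift j) ([t↦t^]-shift n k p)) (shift-shift j (n * k) (p [t↦t^ k ])))

-- Plethysm and Ω

if-cong : ∀ {P : Set} (d : Dec P) {x y : ℚ[t]} → (P → x ≋ y) → (if does d then x else 0ₜ) ≋ (if does d then y else 0ₜ)
if-cong (yes h) e = e h
if-cong (no _)  e = ≋-refl

p[]-cong : ∀ k .{{_ : NonZero k}} {A A′} → A ≋∞ A′ → p[ k ] A ≋∞ p[ k ] A′
p[]-cong k e λ′ = if-cong (all? (k ∣?_) (parts λ′)) λ _ → [t↦t^]-cong k (e _)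

p[]-⊕ : ∀ k .{{_ : NonZero k}} A A′ → p[ k ] (A ⊕ A′) ≋∞ (p[ k ] A) ⊕ (p[ k ] A′)
p[]-⊕ k A A′ λ′ with does (all? (k ∣?_) (parts λ′))
... | true  = [t↦t^]-+ k (A μ) (A′ μ)
  where μ = toPartition (map (ℕ._/ k) (parts λ′))
... | false = ≋-refl

∑p/k-cong : ∀ {A A′} → A ≋∞ A′ → ∑p/k A ≋∞ ∑p/k A′
∑p/k-cong e λ′ = ∑-cong (upTo ∣ λ′ ∣) λ j → *ₜ-congˡ (const (+ 1 ℚ./ suc j)) (p[]-cong (suc j) e λ′)

∑p/k-⊕ : ∀ A A′ → ∑p/k (A ⊕ A′) ≋∞ ∑p/k A ⊕ ∑p/k A′
∑p/k-⊕ A A′ λ′ = ≋-trans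
  (∑-cong (upTo ∣ λ′ ∣) λ j → ≋-trans (*ₜ-congˡ (const (+ 1 ℚ./ suc j)) (p[]-⊕ (suc j) A A′ λ′))
    (*ₜ-distribˡ (const (+ 1 ℚ./ suc j)) ((p[ suc j ] A) λ′) ((p[ suc j ] A′) λ′)))
  (∑-+ (upTo ∣ λ′ ∣) (λ j → const (+ 1 ℚ./ suc j) *ₜ (p[ suc j ] A) λ′) (λ j → const (+ 1 ℚ./ suc j) *ₜ (p[ suc j ] A′) λ′))

∑p/k-noConst : ∀ A → NoConst (hat (∑p/k A))
∑p/k-noConst A α e rewrite trans (∣toPartition∣ α) e = ≋-refl

exp-cong : ∀ {G G′} → G ≋∞ G′ → exp G ≋∞ exp G′
exp-cong {G} {G′} e = hat-injective λ α → ≋-trans (hat-exp G α)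
  (≋-trans (expᶠ-cong (hat-cong e) α) (≋-sym (hat-exp G′ α)))

Ω-cong : ∀ {A A′} → A ≋∞ A′ → Ω A ≋∞ Ω A′
Ω-cong e = exp-cong (∑p/k-cong e)

-- Plethysm by p_k is additive and the exponential turns sums into products. All cancellations
-- between skewing operators rest on this.
Ω-⊕ : ∀ A A′ → Ω (A ⊕ A′) ≋∞ Ω A ⊛ Ω A′
Ω-⊕ A A′ = hat-injective λ α → begin
  hat (Ω (A ⊕ A′)) α                                      ≈⟨ hat-exp (∑p/k (A ⊕ A′)) α ⟩
  expᶠ (hat (∑p/k (A ⊕ A′))) α                            ≈⟨ expᶠ-cong (hat-cong (∑p/k-⊕ A A′)) α ⟩
  expᶠ (hat (∑p/k A ⊕ ∑p/k A′)) α                         ≈⟨ expᶠ-+ (∑p/k-noConst A) (∑p/k-noConst A′) α ⟩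
  (expᶠ (hat (∑p/k A)) ⋆ expᶠ (hat (∑p/k A′))) α          ≈⟨ ⋆-cong (hat-exp (∑p/k A)) (hat-exp (∑p/k A′)) α ⟨
  (hat (Ω A) ⋆ hat (Ω A′)) α                              ≈⟨ hat-⊛ (Ω A) (Ω A′) α ⟨
  hat (Ω A ⊛ Ω A′) α                                      ∎
  where open ≋-Reasoning

Ω-0 : ∀ {A} → A ≋∞ 0∞ → Ω A ≋∞ 1∞
Ω-0 {A} e = hat-injective λ α → ≋-trans (hat-exp (∑p/k A) α)
  (≋-trans (expᶠ-0 (λ β → ∑p/k-0 (toPartition β)) α) (≋-sym (hat-1∞ α)))
  where
  ∑p/k-0 : ∀ λ′ → ∑p/k A λ′ ≋ 0ₜ
  ∑p/k-0 λ′ = ∑-zero (upTo ∣ λ′ ∣) λ j → *ₜ-zeroʳ′ (const (+ 1 ℚ./ suc j)) (≋-trans (p[]-cong (suc j) e λ′)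
    (≋-trans (if-𝟙 (all? (suc j ∣?_) (parts λ′)) 0ₜ) (*ₜ-zeroʳ (𝟙 (all? (suc j ∣?_) (parts λ′))))))

Ω-const : ∀ A λ′ → ∣ λ′ ∣ ≡ 0 → Ω A λ′ ≋ 1ₜ
Ω-const A λ′ e = ≋-trans (≡⇒≋ (sym (hat-parts (Ω A) λ′))) (≋-trans (hat-exp (∑p/k A) (parts λ′))
  (expᶠ-const (hat (∑p/k A)) (parts λ′) e))

-- The substitution X ↦ tX

infixl 8 _[tX]ᶠ
_[tX]ᶠ : ListFun → ListFun
(f [tX]ᶠ) α = t^ (sum α) *ₜ f α

⋆-[tX] : ∀ f g → f [tX]ᶠ ⋆ g [tX]ᶠ ≗ (f ⋆ g) [tX]ᶠ
⋆-[tX] f g α = ≋-trans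
  (∑-congAll (All.map (λ { {β , γ} e → ≋-trans (*ₜ-interchange (t^ sum β) (f β) (t^ sum γ) (g γ))
    (*ₜ-congʳ (f β *ₜ g γ) (≋-trans (≋-sym (t^-+ (sum β) (sum γ))) (≡⇒≋ (cong t^_ e)))) }) (sum-splittings α)))
  (≋-sym (∑-*ˡ (splittings α) (t^ sum α) (λ (β , γ) → f β *ₜ g γ)))

⋆^-[tX] : ∀ g m → (g [tX]ᶠ) ⋆^ m ≗ (g ⋆^ m) [tX]ᶠ
⋆^-[tX] g zero α with sum α in eq
... | zero  = ≋-refl
... | suc n = ≋-sym (*ₜ-zeroʳ (t^ suc n))
⋆^-[tX] g (suc m) α = ≋-trans (⋆-cong {f = g [tX]ᶠ} (λ _ → ≋-refl) (⋆^-[tX] g m) α) (⋆-[tX] g (g ⋆^ m) α)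

expᶠ-[tX] : ∀ g → expᶠ (g [tX]ᶠ) ≗ (expᶠ g) [tX]ᶠ
expᶠ-[tX] g α = ≋-trans
  (∑-cong (upTo (suc (sum α))) λ m → ≋-trans (*ₜ-congˡ (1/! m) (⋆^-[tX] g m α)) (*ₜ-swap (1/! m) (t^ sum α) ((g ⋆^ m) α)))
  (≋-sym (∑-*ˡ (upTo (suc (sum α))) (t^ sum α) λ m → 1/! m *ₜ (g ⋆^ m) α))

hat-[tX] : ∀ F → hat (F [tX]) ≗ hat F [tX]ᶠ
hat-[tX] F α rewrite ∣toPartition∣ α = ≋-refl

sum-/ : ∀ k .{{_ : NonZero k}} {α} → All (k ℕ.∣_) α → sum (map (ℕ._/ k) α) * k ≡ sum α
sum-/ k []                   = refl
sum-/ k (_∷_ {a} {α} k∣a k∣α) = trans (ℕ.*-distribʳ-+ k (a ℕ./ k) (sum (map (ℕ._/ k) α)))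
  (cong₂ _+_ (ℕ.m/n*n≡m k∣a) (sum-/ k k∣α))

-- A monomial of degree m is sent to one of degree m * k; its factor t^m becomes t^(m * k) because
-- p_k raises t to the k-th power as well.
p[]-[tX] : ∀ k .{{_ : NonZero k}} A → p[ k ] (A [tX]) ≋∞ (p[ k ] A) [tX]
p[]-[tX] k A λ′ with all? (k ∣?_) (parts λ′)
... | no _    = ≋-sym (*ₜ-zeroʳ (t^ ∣ λ′ ∣))
... | yes k∣λ = begin
  (t^ m *ₜ A μ) [t↦t^ k ]                 ≈⟨ [t↦t^]-cong k (t^-* m (A μ)) ⟩
  (shift m (A μ)) [t↦t^ k ]               ≡⟨ [t↦t^]-shift m k (A μ) ⟩
  shift (m * k) (A μ [t↦t^ k ])           ≡⟨ cong (λ n → shift n (A μ [t↦t^ k ])) m*k≡n ⟩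
  shift n (A μ [t↦t^ k ])                 ≈⟨ t^-* n (A μ [t↦t^ k ]) ⟨
  t^ n *ₜ (A μ [t↦t^ k ])                 ∎
  where
  open ≋-Reasoning
  μ = toPartition (map (ℕ._/ k) (parts λ′))
  m = ∣ μ ∣
  n = ∣ λ′ ∣
  m*k≡n : m * k ≡ n
  m*k≡n = trans (cong (_* k) (∣toPartition∣ (map (ℕ._/ k) (parts λ′)))) (sum-/ k k∣λ)

∑p/k-[tX] : ∀ A → ∑p/k (A [tX]) ≋∞ (∑p/k A) [tX]
∑p/k-[tX] A λ′ = ≋-trans
  (∑-cong (upTo ∣ λ′ ∣) λ j → ≋-trans (*ₜ-congˡ (const (+ 1 ℚ./ suc j)) (p[]-[tX] (suc j) A λ′))
    (*ₜ-swap (const (+ 1 ℚ./ suc j)) (t^ ∣ λ′ ∣) ((p[ suc j ] A) λ′)))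
  (≋-sym (∑-*ˡ (upTo ∣ λ′ ∣) (t^ ∣ λ′ ∣) (λ j → const (+ 1 ℚ./ suc j) *ₜ (p[ suc j ] A) λ′)))

Ω-[tX] : ∀ A → Ω (A [tX]) ≋∞ (Ω A) [tX]
Ω-[tX] A = hat-injective λ α → begin
  hat (Ω (A [tX])) α                 ≈⟨ hat-exp (∑p/k (A [tX])) α ⟩
  expᶠ (hat (∑p/k (A [tX]))) α       ≈⟨ expᶠ-cong (λ β → ≋-trans (∑p/k-[tX] A (toPartition β)) (hat-[tX] (∑p/k A) β)) α ⟩
  expᶠ (hat (∑p/k A) [tX]ᶠ) α        ≈⟨ expᶠ-[tX] (hat (∑p/k A)) α ⟩
  (expᶠ (hat (∑p/k A)) [tX]ᶠ) α      ≈⟨ *ₜ-congˡ (t^ sum α) (hat-exp (∑p/k A) α) ⟨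
  (hat (Ω A) [tX]ᶠ) α                ≈⟨ hat-[tX] (Ω A) α ⟨
  hat (Ω A [tX]) α                   ∎
  where open ≋-Reasoning

-- Coefficients of the operations on `Λ`

if-then-0 : ∀ {P : Set} (d : Dec P) {x} → (¬ P → x ≋ 0ₜ) → (if does d then x else 0ₜ) ≋ x
if-then-0 (yes _) h = ≋-refl
if-then-0 (no ¬P) h = ≋-sym (h ¬P)

-- The bounds chosen in the operations on `Λ` are large enough for the truncation to lose nothing,
-- so that identities may be checked in `Λ∞`.
coeff-truncate : ∀ N {F} → (∀ λ′ → N < ∣ λ′ ∣ → F λ′ ≋ 0ₜ) → coeff (truncate N F) ≋∞ F
coeff-truncate N F₀ λ′ = if-then-0 (∣ λ′ ∣ ≤? N) λ ≰N → F₀ λ′ (ℕ.≰⇒> ≰N)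

⊛-zero : ∀ {F G} λ′ → (∀ β γ → ∣ β ∣ + ∣ γ ∣ ≡ ∣ λ′ ∣ → F β ≋ 0ₜ ⊎ G γ ≋ 0ₜ) → (F ⊛ G) λ′ ≋ 0ₜ
⊛-zero {F} {G} λ′ h = ∑-zeroAll (All.map (λ { {β , γ} e → term β γ e }) (sum-splittings (parts λ′)))
  where
  term : ∀ β γ → sum β + sum γ ≡ ∣ λ′ ∣ → hat F β *ₜ hat G γ ≋ 0ₜ
  term β γ e with h (toPartition β) (toPartition γ) (trans (cong₂ _+_ (∣toPartition∣ β) (∣toPartition∣ γ)) e)
  ... | inj₁ z = *ₜ-zeroˡ z (hat G γ)
  ... | inj₂ z = *ₜ-zeroʳ′ (hat F β) z

⊛-congʳ-≤ : ∀ F {G G′} λ′ → (∀ μ → ∣ μ ∣ ≤ ∣ λ′ ∣ → G μ ≋ G′ μ) → (F ⊛ G) λ′ ≋ (F ⊛ G′) λ′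
⊛-congʳ-≤ F {G} {G′} λ′ h = ∑-congAll (All.map (λ { {β , γ} e → *ₜ-congˡ (hat F β)
  (h (toPartition γ) (ℕ.≤-trans (ℕ.≤-reflexive (∣toPartition∣ γ)) (ℕ.≤-trans (ℕ.m≤n+m (sum γ) (sum β)) (ℕ.≤-reflexive e)))) })
  (sum-splittings (parts λ′)))

coeff-+Λ : ∀ f g → coeff (f +Λ g) ≋∞ coeff f ⊕ coeff g
coeff-+Λ f g = coeff-truncate _ λ λ′ <∣λ∣ → +ₜ-0
  (vanishes f λ′ (ℕ.≤-<-trans (ℕ.m≤m⊔n (bound f) (bound g)) <∣λ∣))
  (vanishes g λ′ (ℕ.≤-<-trans (ℕ.m≤n⊔m (bound f) (bound g)) <∣λ∣))

coeff-*Λ : ∀ f g → coeff (f *Λ g) ≋∞ coeff f ⊛ coeff g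
coeff-*Λ f g = coeff-truncate _ λ λ′ <∣λ∣ → ⊛-zero {coeff f} {coeff g} λ′ λ β γ e → large λ′ <∣λ∣ β γ e
  where
  large : ∀ λ′ → bound f + bound g < ∣ λ′ ∣ → ∀ β γ → ∣ β ∣ + ∣ γ ∣ ≡ ∣ λ′ ∣ → coeff f β ≋ 0ₜ ⊎ coeff g γ ≋ 0ₜ
  large λ′ <∣λ∣ β γ e with ∣ β ∣ ≤? bound f
  ... | no ≰f = inj₁ (vanishes f β (ℕ.≰⇒> ≰f))
  ... | yes ≤f with ∣ γ ∣ ≤? bound g
  ...   | no ≰g = inj₂ (vanishes g γ (ℕ.≰⇒> ≰g))
  ...   | yes ≤g = contradiction (ℕ.≤-trans (ℕ.≤-reflexive (sym e)) (ℕ.+-mono-≤ ≤f ≤g)) (ℕ.<⇒≱ <∣λ∣)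

coeff-·Λ : ∀ c f → coeff (c ·Λ f) ≋∞ c ⊙ coeff f
coeff-·Λ c f = coeff-truncate (bound f) λ λ′ <∣λ∣ → *ₜ-zeroʳ′ c (vanishes f λ′ <∣λ∣)

coeff-0Λ : coeff 0Λ ≋∞ 0∞
coeff-0Λ = coeff-truncate 0 λ _ _ → ≋-refl

coeff-1Λ : coeff 1Λ ≋∞ 1∞
coeff-1Λ = coeff-truncate 0 λ λ′ 0<∣λ∣ → ≋-trans (1∞-𝟙 λ′) (𝟙-no (∣ λ′ ∣ ≟ 0) λ e → ℕ.<-irrefl (sym e) 0<∣λ∣)

coeff-∑Λ : ∀ {A : Set} (xs : List A) (f : A → Λ) λ′ → coeff (∑Λ xs f) λ′ ≋ (∑[ x ← xs ] coeff (f x) λ′)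
coeff-∑Λ []       f λ′ = coeff-0Λ λ′
coeff-∑Λ (x ∷ xs) f λ′ = ≋-trans (coeff-+Λ (f x) (∑Λ xs f) λ′) (+ₜ-congˡ (coeff (f x) λ′) (coeff-∑Λ xs f λ′))

-- Kostka numbers

κ : (λ′ α : List ℕ) → ℚ[t]
κ λ′ α = num (kostka λ′ α)

num-sum : ∀ {A : Set} (f : A → ℕ) xs → num (sum (map f xs)) ≋ (∑[ x ← xs ] num (f x))
num-sum f []       = num-0
num-sum f (x ∷ xs) = ≋-trans (num-+ (f x) (sum (map f xs))) (+ₜ-congˡ (num (f x)) (num-sum f xs))

κ-[] : ∀ λ′ → κ λ′ [] ≋ 𝟙 (sum λ′ ≟ 0)
κ-[] λ′ with does (sum λ′ ≟ 0)
... | true  = ≋-refl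
... | false = num-0

κ-∷ : ∀ λ′ a α → κ λ′ (a ∷ α) ≋ (∑[ μ ← horizontalStrips λ′ ] 𝟙 (a + sum μ ≟ sum λ′) *ₜ κ μ α)
κ-∷ λ′ a α = ≋-trans
  (num-sum (λ μ → kostka μ α) (filter (λ μ → a + sum μ ≟ sum λ′) (horizontalStrips λ′)))
  (∑-filter (λ μ → a + sum μ ≟ sum λ′) (horizontalStrips λ′) (λ μ → κ μ α))

κ-degree : ∀ λ′ α → sum λ′ ≢ sum α → κ λ′ α ≋ 0ₜ
κ-degree λ′ []      ≢ = ≋-trans (κ-[] λ′) (𝟙-no (sum λ′ ≟ 0) ≢)
κ-degree λ′ (a ∷ α) ≢ = ≋-trans (κ-∷ λ′ a α) (∑-zero (horizontalStrips λ′) term)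
  where
  term : ∀ μ → 𝟙 (a + sum μ ≟ sum λ′) *ₜ κ μ α ≋ 0ₜ
  term μ = 𝟙-*-zero (a + sum μ ≟ sum λ′) λ e →
    κ-degree μ α λ e′ → ≢ (trans (sym e) (cong (λ n → a + n) e′))

coeff-s : ∀ λ′ μ → coeff (s λ′) μ ≋ κ (parts λ′) (parts μ)
coeff-s λ′ = coeff-truncate ∣ λ′ ∣ λ μ λ<μ → κ-degree (parts λ′) (parts μ) (ℕ.<⇒≢ λ<μ)

s-degree : ∀ λ′ μ → ∣ λ′ ∣ ≢ ∣ μ ∣ → coeff (s λ′) μ ≋ 0ₜ
s-degree λ′ μ ≢ = ≋-trans (coeff-s λ′ μ) (κ-degree (parts λ′) (parts μ) ≢)

-- A horizontal strip has at most as many cells as the first row, with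
-- equality only when the smaller shape is the larger one without its first row.
∑-horizontalStrips-tail : ∀ k l b ν (g : ListFun) → l ≤ k + sum ν →
  (∑[ ρ ← horizontalStrips (b ∷ ν) ] 𝟙 (k + sum ρ ≟ l) *ₜ g ρ) ≋ 𝟙 (k + sum ν ≟ l) *ₜ g (ν ++ 0 ∷ [])
∑-horizontalStrips-tail k l b [] g l≤ = ≋-trans
  (∑-map (_∷ []) (upTo (suc b)) (λ ρ → 𝟙 (k + sum ρ ≟ l) *ₜ g ρ))
  (∑-upTo-δ (suc b) 0 (s≤s z≤n) λ i i≢0 → 𝟙-no* (k + (i + 0) ≟ l) (big i i≢0) (g (i ∷ [])))
  where
  big : ∀ i → i ≢ 0 → k + (i + 0) ≢ l
  big zero    i≢0 _ = i≢0 refl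
  big (suc i) _ e = ℕ.<⇒≱ (ℕ.+-monoʳ-< k (s≤s z≤n)) (ℕ.≤-trans (ℕ.≤-reflexive e) l≤)
∑-horizontalStrips-tail k l b (c ∷ ν) g l≤ = begin
  (∑[ ρ ← horizontalStrips (b ∷ c ∷ ν) ] 𝟙 (k + sum ρ ≟ l) *ₜ g ρ)
    ≈⟨ ∑-concatMap (λ i → map ((c + i) ∷_) (horizontalStrips (c ∷ ν))) (upTo (suc (b ∸ c))) (λ ρ → 𝟙 (k + sum ρ ≟ l) *ₜ g ρ) ⟩
  (∑[ i ← upTo (suc (b ∸ c)) ] ∑ (map ((c + i) ∷_) (horizontalStrips (c ∷ ν))) λ ρ → 𝟙 (k + sum ρ ≟ l) *ₜ g ρ)
    ≈⟨ ∑-cong (upTo (suc (b ∸ c))) (λ i → begin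
         ∑ (map ((c + i) ∷_) (horizontalStrips (c ∷ ν))) (λ ρ → 𝟙 (k + sum ρ ≟ l) *ₜ g ρ)
           ≈⟨ ∑-map ((c + i) ∷_) (horizontalStrips (c ∷ ν)) (λ ρ → 𝟙 (k + sum ρ ≟ l) *ₜ g ρ) ⟩
         (∑[ ρ ← horizontalStrips (c ∷ ν) ] 𝟙 (k + (c + i + sum ρ) ≟ l) *ₜ g (c + i ∷ ρ))
           ≈⟨ ∑-cong (horizontalStrips (c ∷ ν)) (λ ρ → *ₜ-congʳ (g (c + i ∷ ρ)) (reassoc k (c + i) (sum ρ))) ⟩
         (∑[ ρ ← horizontalStrips (c ∷ ν) ] 𝟙 (k + (c + i) + sum ρ ≟ l) *ₜ g (c + i ∷ ρ))
           ≈⟨ ∑-horizontalStrips-tail (k + (c + i)) l c ν (λ ρ → g (c + i ∷ ρ)) (l≤′ i) ⟩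
         𝟙 (k + (c + i) + sum ν ≟ l) *ₜ g (c + i ∷ ν ++ 0 ∷ []) ∎) ⟩
  (∑[ i ← upTo (suc (b ∸ c)) ] 𝟙 (k + (c + i) + sum ν ≟ l) *ₜ g (c + i ∷ ν ++ 0 ∷ []))
    ≈⟨ ∑-upTo-δ (suc (b ∸ c)) 0 (s≤s z≤n) (λ i i≢0 → 𝟙-no* (k + (c + i) + sum ν ≟ l) (big i i≢0) (g (c + i ∷ ν ++ 0 ∷ []))) ⟩
  𝟙 (k + (c + 0) + sum ν ≟ l) *ₜ g (c + 0 ∷ ν ++ 0 ∷ [])
    ≡⟨ cong (λ d → 𝟙 (k + d + sum ν ≟ l) *ₜ g (d ∷ ν ++ 0 ∷ [])) (ℕ.+-identityʳ c) ⟩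
  𝟙 (k + c + sum ν ≟ l) *ₜ g (c ∷ ν ++ 0 ∷ [])
    ≈⟨ *ₜ-congʳ (g (c ∷ ν ++ 0 ∷ [])) (reassoc k c (sum ν)) ⟨
  𝟙 (k + (c + sum ν) ≟ l) *ₜ g (c ∷ ν ++ 0 ∷ []) ∎
  where
  open ≋-Reasoning
  reassoc : ∀ k c n → 𝟙 (k + (c + n) ≟ l) ≋ 𝟙 (k + c + n ≟ l)
  reassoc k c n = ≡⇒≋ (cong (λ m → 𝟙 (m ≟ l)) (sym (ℕ.+-assoc k c n)))
  l≤′ : ∀ i → l ≤ k + (c + i) + sum ν
  l≤′ i = ℕ.≤-trans l≤ (ℕ.≤-trans (ℕ.≤-reflexive (sym (ℕ.+-assoc k c (sum ν))))
    (ℕ.+-monoˡ-≤ (sum ν) (ℕ.+-monoʳ-≤ k (ℕ.m≤m+n c i))))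
  big : ∀ i → i ≢ 0 → k + (c + i) + sum ν ≢ l
  big zero    i≢0 _ = i≢0 refl
  big (suc i) _ e = ℕ.<⇒≱ (ℕ.+-monoˡ-< (sum ν) (ℕ.+-monoʳ-< k (ℕ.m<m+n c (s≤s z≤n))))
    (ℕ.≤-trans (ℕ.≤-reflexive e) (ℕ.≤-trans l≤ (ℕ.≤-reflexive (sym (ℕ.+-assoc k c (sum ν))))))

κ-tail : ∀ {a b} ν μ → b ≤ a → κ (b ∷ ν) (a ∷ μ) ≋ 𝟙 (a + sum ν ≟ b + sum ν) *ₜ κ (ν ++ 0 ∷ []) μ
κ-tail {a} {b} ν μ b≤a = ≋-trans (κ-∷ (b ∷ ν) a μ)
  (∑-horizontalStrips-tail a (b + sum ν) b ν (λ ρ → κ ρ μ) (ℕ.+-monoˡ-≤ (sum ν) b≤a))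

infix 4 _≻_
-- A lexicographic order made so that zeros may be appended to the smaller side: removing a strip
-- does not change the number of rows, so the smaller shapes in the recursion for Kostka numbers end
-- in zeros.
data _≻_ : List ℕ → List ℕ → Set where
  empty : ∀ {a μ} → 0 < a → (a ∷ μ) ≻ []
  here  : ∀ {a b μ ν} → b < a → (a ∷ μ) ≻ (b ∷ ν)
  there : ∀ {a μ ν} → μ ≻ ν → (a ∷ μ) ≻ (a ∷ ν)

≻-irrefl : ∀ {μ} → ¬ (μ ≻ μ)
≻-irrefl (here a<a) = ℕ.<-irrefl refl a<a
≻-irrefl (there μ≻μ) = ≻-irrefl μ≻μ

≻-++0 : ∀ {μ ν} → μ ≻ ν → μ ≻ (ν ++ 0 ∷ [])
≻-++0 (empty 0<a) = here 0<a
≻-++0 (here b<a)  = here b<a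
≻-++0 (there μ≻ν) = there (≻-++0 μ≻ν)

-- The cells of the first letter form a horizontal strip and so are at most as many as the first row
-- of ν has. If the first entries agree, the strip has maximal size, its removal leaves the other
-- rows of ν, and the comparison continues there.
κ-≻ : ∀ {μ ν} → μ ≻ ν → κ ν μ ≋ 0ₜ
κ-≻ {a ∷ μ} (empty 0<a) = ≋-trans (κ-∷ [] a μ) (≋-trans (+ₜ-identityʳ _)
  (𝟙-no* (a + 0 ≟ 0) (λ e → ℕ.<⇒≢ 0<a (sym (ℕ.m+n≡0⇒m≡0 a e))) (κ [] μ)))
κ-≻ {a ∷ μ} {b ∷ ν} (here b<a) = ≋-trans (κ-tail ν μ (ℕ.<⇒≤ b<a))
  (𝟙-no* (a + sum ν ≟ b + sum ν) (λ e → ℕ.<⇒≢ b<a (sym (ℕ.+-cancelʳ-≡ (sum ν) a b e))) (κ (ν ++ 0 ∷ []) μ))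
κ-≻ {a ∷ μ} {b ∷ ν} (there μ≻ν) = ≋-trans (κ-tail ν μ ℕ.≤-refl) (*ₜ-zeroʳ′ (𝟙 (a + sum ν ≟ a + sum ν)) (κ-≻ (≻-++0 μ≻ν)))

-- The vector `zs` collects the empty rows that the removal of full first rows leaves behind.
κ-diag : ∀ ν zs → sum zs ≡ 0 → κ (ν ++ zs) ν ≋ 1ₜ
κ-diag []      zs e = ≋-trans (κ-[] zs) (𝟙-yes (sum zs ≟ 0) e)
κ-diag (a ∷ ν) zs e = begin
  κ (a ∷ ν ++ zs) (a ∷ ν)                              ≈⟨ κ-tail (ν ++ zs) ν ℕ.≤-refl ⟩
  𝟙 (a + n ≟ a + n) *ₜ κ ((ν ++ zs) ++ 0 ∷ []) ν       ≈⟨ 𝟙-yes* (a + n ≟ a + n) refl _ ⟩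
  κ ((ν ++ zs) ++ 0 ∷ []) ν                            ≡⟨ cong (λ xs → κ xs ν) (List.++-assoc ν zs (0 ∷ [])) ⟩
  κ (ν ++ (zs ++ 0 ∷ [])) ν                            ≈⟨ κ-diag ν (zs ++ 0 ∷ []) (trans (sum-++ zs (0 ∷ [])) (trans (ℕ.+-identityʳ (sum zs)) e)) ⟩
  1ₜ                                                   ∎
  where
  open ≋-Reasoning
  n = sum (ν ++ zs)

s-diag : ∀ λ′ → coeff (s λ′) λ′ ≋ 1ₜ
s-diag λ′ = ≋-trans (coeff-s λ′ λ′) (≋-trans (≡⇒≋ (cong (λ xs → κ xs (parts λ′)) (sym (List.++-identityʳ (parts λ′)))))
  (κ-diag (parts λ′) [] refl))

-- Enumeration of partitions

boundedPartitions-suc : ∀ n m → boundedPartitions n (suc m) ≡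
  concatMap (λ j → map (replicate j (suc m) ++_) (boundedPartitions (n ∸ j * suc m) m))
            (filter (λ j → j * suc m ≤? n) (downFrom (suc n)))
boundedPartitions-suc zero    m = refl
boundedPartitions-suc (suc n) m = refl

record IsPartition (n m : ℕ) (α : List ℕ) : Set where
  constructor isPartition
  field
    size : sum α ≡ n
    decr : Linked _≥_ α
    pos  : All (0 <_) α
    bdd  : All (_≤ m) α

sum-replicate : ∀ j a α → sum (replicate j a ++ α) ≡ j * a + sum α
sum-replicate zero    a α = refl
sum-replicate (suc j) a α = trans (cong (λ n → a + n) (sum-replicate j a α)) (sym (ℕ.+-assoc a (j * a) (sum α)))

linked-replicate : ∀ j {a α} → All (_≤ a) α → Linked _≥_ α → Linked _≥_ (replicate j a ++ α)
linked-replicate zero          α≤ α↘ = α↘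
linked-replicate (suc zero)    []       α↘ = [-]
linked-replicate (suc zero)    (b≤a ∷ _) α↘ = b≤a ∷ α↘
linked-replicate (suc (suc j)) α≤ α↘ = ℕ.≤-refl ∷ linked-replicate (suc j) α≤ α↘

isPartition-replicate : ∀ {n m} j {α} → j * suc m ≤ n → IsPartition (n ∸ j * suc m) m α →
  IsPartition n (suc m) (replicate j (suc m) ++ α)
isPartition-replicate {n} {m} j {α} ≤n (isPartition e α↘ α>0 α≤m) = isPartition
  (trans (sum-replicate j (suc m) α) (trans (cong (λ k → j * suc m + k) e) (ℕ.m+[n∸m]≡n ≤n)))
  (linked-replicate j (All.map ℕ.m≤n⇒m≤1+n α≤m) α↘)
  (All.++⁺ (All.replicate⁺ j (s≤s z≤n)) α>0)
  (All.++⁺ (All.replicate⁺ j ℕ.≤-refl) (All.map ℕ.m≤n⇒m≤1+n α≤m))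

boundedPartitions-sound : ∀ n m → All (IsPartition n m) (boundedPartitions n m)
boundedPartitions-sound zero    zero    = isPartition refl [] [] [] ∷ []
boundedPartitions-sound (suc n) zero    = []
boundedPartitions-sound n       (suc m) rewrite boundedPartitions-suc n m =
  All.concat⁺ (All.map⁺ (All.map (λ {j} ≤n → All.map⁺ (All.map (isPartition-replicate j ≤n)
      (boundedPartitions-sound (n ∸ j * suc m) m)))
    (All.all-filter (λ j → j * suc m ≤? n) (downFrom (suc n)))))

≻-replicate : ∀ {j j′ a α β} → j′ < j → All (_< a) β → 0 < a → (replicate j a ++ α) ≻ (replicate j′ a ++ β)
≻-replicate {suc j} {zero}   _ []        0<a = empty 0<a
≻-replicate {suc j} {zero}   _ (b<a ∷ _) 0<a = here b<a
≻-replicate {suc j} {suc j′} (s≤s j′<j) β< 0<a = there (≻-replicate j′<j β< 0<a)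

≻-++ˡ : ∀ γ {α β} → α ≻ β → (γ ++ α) ≻ (γ ++ β)
≻-++ˡ []      α≻β = α≻β
≻-++ˡ (_ ∷ γ) α≻β = there (≻-++ˡ γ α≻β)

-- A higher multiplicity of the part m + 1 wins lexicographically, since all other parts are at most
-- m, and `downFrom` lists the multiplicities in decreasing order.
boundedPartitions-≻ : ∀ n m → AllPairs _≻_ (boundedPartitions n m)
boundedPartitions-≻ zero    zero    = [] ∷ []
boundedPartitions-≻ (suc n) zero    = []
boundedPartitions-≻ n       (suc m) rewrite boundedPartitions-suc n m = AllPairs.concat⁺
  (All.map⁺ (All.universal (λ j → AllPairs.map⁺ (AllPairs.map (≻-++ˡ (replicate j (suc m)))
    (boundedPartitions-≻ (n ∸ j * suc m) m))) js))
  (AllPairs.map⁺ (AllPairs.map (λ {j} {j′} j′<j → All.map⁺ (All.universal (λ α → All.map⁺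
      (All.map (λ { (isPartition _ _ _ β≤m) → ≻-replicate {α = α} j′<j (All.map s≤s β≤m) (s≤s z≤n) })
        (boundedPartitions-sound (n ∸ j′ * suc m) m))) _))
    (AllPairs.filter⁺ (λ j → j * suc m ≤? n) (AllPairs.applyDownFrom⁺₁ id (suc n) λ j<i _ → j<i))))
  where js = filter (λ j → j * suc m ≤? n) (downFrom (suc n))

linked-≤-head : ∀ {a b α} → Linked _≥_ (a ∷ α) → a ≤ b → All (_≤ b) (a ∷ α)
linked-≤-head [-]          a≤b = a≤b ∷ []
linked-≤-head (a≥c ∷ α↘) a≤b = a≤b ∷ linked-≤-head α↘ (ℕ.≤-trans a≥c a≤b)

leading-parts : ∀ {n} m α → IsPartition n (suc m) α →
  ∃[ j ] ∃[ β ] (α ≡ replicate j (suc m) ++ β) × IsPartition (sum β) m β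
leading-parts m [] _ = 0 , [] , refl , isPartition refl [] [] []
leading-parts m (a ∷ α) (isPartition e α↘ (a>0 ∷ α>0) (a≤ ∷ α≤)) with a ≟ suc m
... | no a≢ = 0 , a ∷ α , refl , isPartition refl α↘ (a>0 ∷ α>0) (linked-≤-head α↘ (ℕ.≤-pred (ℕ.≤∧≢⇒< a≤ a≢)))
... | yes refl with leading-parts m α (isPartition refl (Linked.tail α↘) α>0 α≤)
...   | j , β , refl , P = suc j , β , refl , P

boundedPartitions-complete : ∀ {n} m {α} → IsPartition n m α → α ∈ boundedPartitions n m
boundedPartitions-complete zero {[]}    (isPartition refl _ _ _) = here refl
boundedPartitions-complete zero {a ∷ α} (isPartition _ _ (a>0 ∷ _) (a≤0 ∷ _)) = contradiction a≤0 (ℕ.<⇒≱ a>0)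
boundedPartitions-complete {n} (suc m) {α} P with leading-parts m α P
... | j , β , refl , Q rewrite boundedPartitions-suc n m =
  ∈.∈-concatMap⁺ (λ j → map (replicate j (suc m) ++_) (boundedPartitions (n ∸ j * suc m) m))
    (lose (∈.∈-filter⁺ (λ j → j * suc m ≤? n) (∈.∈-downFrom⁺ (s≤s (ℕ.≤-trans (ℕ.m≤m*n j (suc m)) ≤n))) ≤n)
      (∈.∈-map⁺ (replicate j (suc m) ++_) (boundedPartitions-complete m
        (subst (λ k → IsPartition k m β) (trans (sym (ℕ.m+n∸m≡n (j * suc m) (sum β))) (cong (_∸ j * suc m) size)) Q))))
  where
  size : j * suc m + sum β ≡ n
  size = trans (sym (sum-replicate j (suc m) β)) (IsPartition.size P)
  ≤n : j * suc m ≤ n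
  ≤n = ℕ.≤-trans (ℕ.m≤m+n (j * suc m) (sum β)) (ℕ.≤-reflexive size)

AllPairs-mapAll : ∀ {A : Set} {P : A → Set} {R S : A → A → Set} → (∀ {x y} → P x → P y → R x y → S x y) →
  ∀ {xs} → All P xs → AllPairs R xs → AllPairs S xs
AllPairs-mapAll h []         []         = []
AllPairs-mapAll h (px ∷ pxs) (rx ∷ rxs) =
  All.zipWith (λ (py , r) → h px py r) (pxs , rx) ∷ AllPairs-mapAll h pxs rxs

parts-toPartition : ∀ {n m α} → IsPartition n m α → parts (toPartition α) ≡ α
parts-toPartition (isPartition _ α↘ α>0 _) = cong parts (toPartition-parts (mkPartition _ α↘ α>0))

partitionsOf-size : ∀ n → All (λ λ′ → ∣ λ′ ∣ ≡ n) (partitionsOf n)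
partitionsOf-size n = All.map⁺ (All.map (λ {α} P → trans (∣toPartition∣ α) (IsPartition.size P)) (boundedPartitions-sound n n))

partitionsOf-≻ : ∀ n → AllPairs (λ λ′ μ → parts λ′ ≻ parts μ) (partitionsOf n)
partitionsOf-≻ n = AllPairs.map⁺ (AllPairs-mapAll
  (λ {α} {β} P Q α≻β → subst (_≻ parts (toPartition β)) (sym (parts-toPartition P)) (subst (α ≻_) (sym (parts-toPartition Q)) α≻β))
  (boundedPartitions-sound n n) (boundedPartitions-≻ n n))

partitionsOf-unique : ∀ n → AllPairs _≢_ (partitionsOf n)
partitionsOf-unique n = AllPairs.map (λ { λ≻μ refl → ≻-irrefl λ≻μ }) (partitionsOf-≻ n)

all-≤-sum : ∀ α → All (_≤ sum α) α
all-≤-sum []      = []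
all-≤-sum (a ∷ α) = ℕ.m≤m+n a (sum α) ∷ All.map (λ b≤ → ℕ.≤-trans b≤ (ℕ.m≤n+m (sum α) a)) (all-≤-sum α)

∈-partitionsOf : ∀ λ′ → λ′ ∈ partitionsOf ∣ λ′ ∣
∈-partitionsOf λ′ = subst (_∈ partitionsOf ∣ λ′ ∣) (toPartition-parts λ′) (∈.∈-map⁺ toPartition
  (boundedPartitions-complete ∣ λ′ ∣ (isPartition refl (decreasing λ′) (positive λ′) (all-≤-sum (parts λ′)))))

partitionsUpTo-unique : ∀ N → AllPairs _≢_ (partitionsUpTo N)
partitionsUpTo-unique N = AllPairs.concat⁺
  (All.map⁺ (All.universal partitionsOf-unique (upTo (suc N))))
  (AllPairs.map⁺ (AllPairs.applyUpTo⁺₁ id (suc N) λ {i} {j} i<j _ →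
    All.map (λ e → All.map (λ { e′ refl → ℕ.<⇒≢ i<j (trans (sym e) e′) }) (partitionsOf-size j)) (partitionsOf-size i)))

∈-partitionsUpTo : ∀ {N} λ′ → ∣ λ′ ∣ ≤ N → λ′ ∈ partitionsUpTo N
∈-partitionsUpTo λ′ ≤N = ∈.∈-concatMap⁺ partitionsOf (lose (∈.∈-upTo⁺ (s≤s ≤N)) (∈-partitionsOf λ′))

∑-partitionsUpTo-δ : ∀ {N} λ′ {φ} → ∣ λ′ ∣ ≤ N → (∀ μ → μ ≢ λ′ → φ μ ≋ 0ₜ) → ∑ (partitionsUpTo N) φ ≋ φ λ′
∑-partitionsUpTo-δ {N} λ′ ≤N = ∑-δ (partitionsUpTo-unique N) (∈-partitionsUpTo λ′ ≤N)

∑-partitionsUpTo-≤ : ∀ {M N φ} → M ≤ N → (∀ μ → M < ∣ μ ∣ → φ μ ≋ 0ₜ) → ∑ (partitionsUpTo N) φ ≋ ∑ (partitionsUpTo M) φ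
∑-partitionsUpTo-≤ {M} {N} {φ} M≤N z = ≋-trans (∑-concatMap partitionsOf (upTo (suc N)) φ)
  (≋-trans (∑-upTo-≤ (λ n → ∑ (partitionsOf n) φ) (s≤s M≤N) λ n M<n _ →
      ∑-zeroAll (All.map (λ e → z _ (ℕ.≤-trans M<n (ℕ.≤-reflexive (sym e)))) (partitionsOf-size n)))
    (≋-sym (∑-concatMap partitionsOf (upTo (suc M)) φ)))

∑-partitionsUpTo-of : ∀ {N n φ} → n ≤ N → (∀ μ → ∣ μ ∣ ≢ n → φ μ ≋ 0ₜ) → ∑ (partitionsUpTo N) φ ≋ ∑ (partitionsOf n) φ
∑-partitionsUpTo-of {N} {n} {φ} n≤N z = ≋-trans (∑-concatMap partitionsOf (upTo (suc N)) φ)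
  (∑-upTo-δ (suc N) n (s≤s n≤N) λ i i≢n → ∑-zeroAll (All.map (λ e → z _ (i≢n ∘ trans (sym e))) (partitionsOf-size i)))

-- Elimination of Schur functions

if-cong₂ : ∀ {P : Set} (d : Dec P) {x x′ y y′ : ℚ[t]} → (P → x ≋ x′) → (¬ P → y ≋ y′) →
  (if does d then x else y) ≋ (if does d then x′ else y′)
if-cong₂ (yes h) e e′ = e h
if-cong₂ (no ¬h) e e′ = e′ ¬h

if-yes : ∀ {P : Set} (d : Dec P) {x y : ℚ[t]} → P → (if does d then x else y) ≋ x
if-yes d h rewrite dec-true d h = ≋-refl

if-no : ∀ {P : Set} (d : Dec P) {x y : ℚ[t]} → ¬ P → (if does d then x else y) ≋ y
if-no d h rewrite dec-false d h = ≋-refl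

-ₜ-1 : ∀ x → -ₜ x ≋ (-ₜ 1ₜ) *ₜ x
-ₜ-1 x = ≋-sym (-1*x≈-x x)

eliminate : Partition → Λ∞ → Λ∞
eliminate μ F = F ⊖ F μ ⊙ coeff (s μ)

eliminate-cong : ∀ μ {F G} ν → F μ ≋ G μ → F ν ≋ G ν → eliminate μ F ν ≋ eliminate μ G ν
eliminate-cong μ ν eμ eν = +ₜ-cong eν (-ₜ-cong (*ₜ-congʳ (coeff (s μ) ν) eμ))

schurElimination-cong : ∀ μs {F G} λ′ → All (λ μ → F μ ≋ G μ) μs → schurElimination μs F λ′ ≋ schurElimination μs G λ′
schurElimination-cong []       λ′ []       = ≋-refl
schurElimination-cong (μ ∷ μs) {F} {G} λ′ (e ∷ es) = if-cong₂ (μ ≡ₚ? λ′) (λ _ → e)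
  λ _ → schurElimination-cong μs λ′ (All.map (λ {ν} → eliminate-cong μ {F} {G} ν e) es)

schurElimination-0 : ∀ μs λ′ → schurElimination μs 0∞ λ′ ≋ 0ₜ
schurElimination-0 []       λ′ = ≋-refl
schurElimination-0 (μ ∷ μs) λ′ = ≋-trans (if-cong₂ (μ ≡ₚ? λ′) {x′ = 0ₜ} {y′ = 0ₜ} (λ _ → ≋-refl) (λ _ → schurElimination-0 μs λ′))
  (≋-trans (if-𝟙 (μ ≡ₚ? λ′) 0ₜ) (*ₜ-zeroʳ (𝟙 (μ ≡ₚ? λ′))))

schurElimination-⊕ : ∀ μs F G λ′ → schurElimination μs (F ⊕ G) λ′ ≋ schurElimination μs F λ′ +ₜ schurElimination μs G λ′
schurElimination-⊕ []       F G λ′ = ≋-refl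
schurElimination-⊕ (μ ∷ μs) F G λ′ = ≋-trans
  (if-cong₂ (μ ≡ₚ? λ′) (λ _ → ≋-refl) λ _ → ≋-trans
    (schurElimination-cong μs λ′ (All.universal linear μs))
    (schurElimination-⊕ μs (eliminate μ F) (eliminate μ G) λ′))
  (if-+ (μ ≡ₚ? λ′))
  where
  open ≋-Reasoning
  if-+ : ∀ {P : Set} (d : Dec P) {x x′ y y′ : ℚ[t]} →
    (if does d then x +ₜ x′ else (y +ₜ y′)) ≋ (if does d then x else y) +ₜ (if does d then x′ else y′)
  if-+ (yes _) = ≋-refl
  if-+ (no _)  = ≋-refl
  linear : ∀ ν → eliminate μ (F ⊕ G) ν ≋ (eliminate μ F ⊕ eliminate μ G) ν
  linear ν = begin
    F ν +ₜ G ν +ₜ (-ₜ ((F μ +ₜ G μ) *ₜ S))                          ≈⟨ +ₜ-congˡ (F ν +ₜ G ν) (-ₜ-1 ((F μ +ₜ G μ) *ₜ S)) ⟩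
    F ν +ₜ G ν +ₜ (-ₜ 1ₜ) *ₜ ((F μ +ₜ G μ) *ₜ S)                    ≈⟨ ≋-Solver.solve 6 (λ a b n c d e → a ⊹ b ⊹ n ⊠ ((c ⊹ d) ⊠ e) ⊜ (a ⊹ n ⊠ (c ⊠ e)) ⊹ (b ⊹ n ⊠ (d ⊠ e))) ≋-refl (F ν) (G ν) (-ₜ 1ₜ) (F μ) (G μ) S ⟩
    F ν +ₜ (-ₜ 1ₜ) *ₜ (F μ *ₜ S) +ₜ (G ν +ₜ (-ₜ 1ₜ) *ₜ (G μ *ₜ S))  ≈⟨ +ₜ-cong (+ₜ-congˡ (F ν) (-ₜ-1 (F μ *ₜ S))) (+ₜ-congˡ (G ν) (-ₜ-1 (G μ *ₜ S))) ⟨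
    F ν +ₜ (-ₜ (F μ *ₜ S)) +ₜ (G ν +ₜ (-ₜ (G μ *ₜ S)))              ∎
    where
    S = coeff (s μ) ν

schurElimination-⊙ : ∀ μs c F λ′ → schurElimination μs (c ⊙ F) λ′ ≋ c *ₜ schurElimination μs F λ′
schurElimination-⊙ []       c F λ′ = ≋-sym (*ₜ-zeroʳ c)
schurElimination-⊙ (μ ∷ μs) c F λ′ = ≋-trans
  (if-cong₂ (μ ≡ₚ? λ′) (λ _ → ≋-refl) λ _ → ≋-trans
    (schurElimination-cong μs λ′ (All.universal linear μs))
    (schurElimination-⊙ μs c (eliminate μ F) λ′))
  (if-* (μ ≡ₚ? λ′))
  where
  open ≋-Reasoning
  if-* : ∀ {P : Set} (d : Dec P) {x y : ℚ[t]} → (if does d then c *ₜ x else c *ₜ y) ≋ c *ₜ (if does d then x else y)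
  if-* (yes _) = ≋-refl
  if-* (no _)  = ≋-refl
  linear : ∀ ν → eliminate μ (c ⊙ F) ν ≋ (c ⊙ eliminate μ F) ν
  linear ν = begin
    c *ₜ F ν +ₜ (-ₜ (c *ₜ F μ *ₜ S))              ≈⟨ +ₜ-congˡ (c *ₜ F ν) (-ₜ-1 (c *ₜ F μ *ₜ S)) ⟩
    c *ₜ F ν +ₜ (-ₜ 1ₜ) *ₜ (c *ₜ F μ *ₜ S)        ≈⟨ ≋-Solver.solve 5 (λ c a n b e → c ⊠ a ⊹ n ⊠ (c ⊠ b ⊠ e) ⊜ c ⊠ (a ⊹ n ⊠ (b ⊠ e))) ≋-refl c (F ν) (-ₜ 1ₜ) (F μ) S ⟩
    c *ₜ (F ν +ₜ (-ₜ 1ₜ) *ₜ (F μ *ₜ S))           ≈⟨ *ₜ-congˡ c (+ₜ-congˡ (F ν) (-ₜ-1 (F μ *ₜ S))) ⟨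
    c *ₜ (F ν +ₜ (-ₜ (F μ *ₜ S)))                 ∎
    where
    S = coeff (s μ) ν

-- Together with `s-diag` this is unitriangularity: once the coefficient of m_μ has been cleared, no
-- later s_ν brings it back.
Triangular : List Partition → Set
Triangular μs = AllPairs (λ μ ν → coeff (s ν) μ ≋ 0ₜ × parts μ ≢ parts ν) μs

-- At the head μ of the list all later Schur functions vanish, so F μ · s_μ alone gives the right
-- value; at a later partition the remainder is expanded by induction.
schurElimination-expansion : ∀ {μs} F {λ′} → Triangular μs → λ′ ∈ μs →
  F λ′ ≋ (∑[ ν ← μs ] schurElimination μs F ν *ₜ coeff (s ν) λ′)
schurElimination-expansion {μ ∷ μs} F {λ′} (Δ ∷ Δs) λ∈ = ≋-trans (go λ∈)
  (≋-sym (+ₜ-cong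
    (*ₜ-congʳ (coeff (s μ) λ′) (if-yes (μ ≡ₚ? μ) refl))
    (∑-congAll (All.map (λ { {ν} (_ , μ≢ν) → *ₜ-congʳ (coeff (s ν) λ′) (if-no (μ ≡ₚ? ν) μ≢ν) }) Δ))))
  where
  open ≋-Reasoning
  E = λ ν → schurElimination μs (eliminate μ F) ν
  go : λ′ ∈ μ ∷ μs → F λ′ ≋ F μ *ₜ coeff (s μ) λ′ +ₜ (∑[ ν ← μs ] E ν *ₜ coeff (s ν) λ′)
  go (here refl) = begin
    F μ                         ≈⟨ *ₜ-identityʳ (F μ) ⟨
    F μ *ₜ 1ₜ                   ≈⟨ *ₜ-congˡ (F μ) (s-diag μ) ⟨
    F μ *ₜ coeff (s μ) μ        ≈⟨ +ₜ-identityʳ (F μ *ₜ coeff (s μ) μ) ⟨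
    F μ *ₜ coeff (s μ) μ +ₜ 0ₜ  ≈⟨ +ₜ-congˡ (F μ *ₜ coeff (s μ) μ) (∑-zeroAll (All.map (λ { {ν} (z , _) → *ₜ-zeroʳ′ (E ν) z }) Δ)) ⟨
    F μ *ₜ coeff (s μ) μ +ₜ (∑[ ν ← μs ] E ν *ₜ coeff (s ν) μ) ∎
  go (there λ∈) = begin
    F λ′                                       ≈⟨ +ₜ-identityʳ (F λ′) ⟨
    F λ′ +ₜ 0ₜ                                 ≈⟨ +ₜ-congˡ (F λ′) (-ₜ-inverseˡ FS) ⟨
    F λ′ +ₜ ((-ₜ FS) +ₜ FS)                    ≈⟨ +ₜ-assoc (F λ′) (-ₜ FS) FS ⟨
    F λ′ +ₜ (-ₜ FS) +ₜ FS                      ≈⟨ +ₜ-comm (eliminate μ F λ′) FS ⟩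
    FS +ₜ eliminate μ F λ′                     ≈⟨ +ₜ-congˡ FS (schurElimination-expansion (eliminate μ F) Δs λ∈) ⟩
    FS +ₜ (∑[ ν ← μs ] E ν *ₜ coeff (s ν) λ′)  ∎
    where FS = F μ *ₜ coeff (s μ) λ′

-- The process leaves s_ν untouched as long as it has not reached ν, because s_ν vanishes at the
-- earlier partitions, and reduces it to 0 at ν.
schurElimination-s : ∀ {μs ν} λ′ → Triangular μs → ν ∈ μs → schurElimination μs (coeff (s ν)) λ′ ≋ 𝟙 (ν ≡ₚ? λ′)
schurElimination-s {μ ∷ μs} λ′ (Δ ∷ Δs) (here refl) = if-cong₂ (μ ≡ₚ? λ′) (λ _ → s-diag μ)
  λ _ → ≋-trans (schurElimination-cong μs {G = 0∞} λ′ (All.universal vanish μs)) (schurElimination-0 μs λ′)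
  where
  vanish : ∀ ν → eliminate μ (coeff (s μ)) ν ≋ 0ₜ
  vanish ν = ≋-trans (+ₜ-congˡ (coeff (s μ) ν) (-ₜ-cong (≋-trans (*ₜ-congʳ (coeff (s μ) ν) (s-diag μ)) (*ₜ-identityˡ (coeff (s μ) ν)))))
    (-ₜ-inverseʳ (coeff (s μ) ν))
schurElimination-s {μ ∷ μs} {ν} λ′ (Δ ∷ Δs) (there ν∈) with All.lookup Δ ν∈
... | sν[μ]≋0 , μ≢ν = ≋-trans
  (if-cong₂ (μ ≡ₚ? λ′) {y′ = 𝟙 (ν ≡ₚ? λ′)} (λ μ≡λ → ≋-trans sν[μ]≋0 (≋-sym (𝟙-no (ν ≡ₚ? λ′) λ ν≡λ → μ≢ν (trans μ≡λ (sym ν≡λ)))))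
    λ _ → ≋-trans (schurElimination-cong μs λ′ (All.universal unchanged μs)) (schurElimination-s λ′ Δs ν∈))
  (if-same (μ ≡ₚ? λ′))
  where
  if-same : ∀ {P : Set} (d : Dec P) {x : ℚ[t]} → (if does d then x else x) ≋ x
  if-same (yes _) = ≋-refl
  if-same (no _)  = ≋-refl
  unchanged : ∀ κ → eliminate μ (coeff (s ν)) κ ≋ coeff (s ν) κ
  unchanged κ = ≋-trans (+ₜ-congˡ (coeff (s ν) κ) (-ₜ-cong (*ₜ-zeroˡ sν[μ]≋0 (coeff (s μ) κ)))) (+ₜ-identityʳ (coeff (s ν) κ))

partitionsOf-triangular : ∀ n → Triangular (partitionsOf n)
partitionsOf-triangular n = AllPairs.map
  (λ {μ} {ν} μ≻ν → ≋-trans (coeff-s ν μ) (κ-≻ μ≻ν) , λ e → ≻-irrefl (subst (_≻ parts ν) e μ≻ν)) (partitionsOf-≻ n)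

-- Schur coordinates

schurCoord-cong : ∀ {F G} λ′ → (∀ μ → ∣ μ ∣ ≡ ∣ λ′ ∣ → F μ ≋ G μ) → schurCoord F λ′ ≋ schurCoord G λ′
schurCoord-cong λ′ e = schurElimination-cong (partitionsOf ∣ λ′ ∣) λ′ (All.map (λ {μ} → e μ) (partitionsOf-size ∣ λ′ ∣))

schurCoord-0 : ∀ {F} λ′ → (∀ μ → ∣ μ ∣ ≡ ∣ λ′ ∣ → F μ ≋ 0ₜ) → schurCoord F λ′ ≋ 0ₜ
schurCoord-0 λ′ e = ≋-trans (schurCoord-cong {G = 0∞} λ′ e) (schurElimination-0 (partitionsOf ∣ λ′ ∣) λ′)

schurCoord-∑ : ∀ {A : Set} (xs : List A) (c : A → ℚ[t]) (F : A → Λ∞) λ′ →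
  schurCoord (λ κ → ∑[ x ← xs ] c x *ₜ F x κ) λ′ ≋ (∑[ x ← xs ] c x *ₜ schurCoord (F x) λ′)
schurCoord-∑ []       c F λ′ = schurElimination-0 (partitionsOf ∣ λ′ ∣) λ′
schurCoord-∑ (x ∷ xs) c F λ′ = ≋-trans
  (schurElimination-⊕ (partitionsOf ∣ λ′ ∣) (c x ⊙ F x) (λ κ → ∑[ x ← xs ] c x *ₜ F x κ) λ′)
  (+ₜ-cong (schurElimination-⊙ (partitionsOf ∣ λ′ ∣) (c x) (F x) λ′) (schurCoord-∑ xs c F λ′))

schurCoord-s : ∀ ν λ′ → schurCoord (coeff (s ν)) λ′ ≋ 𝟙 (ν ≡ₚ? λ′)
schurCoord-s ν λ′ = go (∣ ν ∣ ≟ ∣ λ′ ∣)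
  where
  go : Dec (∣ ν ∣ ≡ ∣ λ′ ∣) → schurCoord (coeff (s ν)) λ′ ≋ 𝟙 (ν ≡ₚ? λ′)
  go (yes e) = schurElimination-s λ′ (partitionsOf-triangular ∣ λ′ ∣) (subst (λ n → ν ∈ partitionsOf n) e (∈-partitionsOf ν))
  go (no ≢)  = ≋-trans (schurCoord-0 λ′ λ μ e → s-degree ν μ λ e′ → ≢ (trans e′ e)) (≋-sym (𝟙-no (ν ≡ₚ? λ′) (≢ ∘ cong sum)))

schur-expansion : ∀ {N} F λ′ → ∣ λ′ ∣ ≤ N → F λ′ ≋ (∑[ μ ← partitionsUpTo N ] schurCoord F μ *ₜ coeff (s μ) λ′)
schur-expansion F λ′ ≤N = ≋-trans
  (schurElimination-expansion F (partitionsOf-triangular ∣ λ′ ∣) (∈-partitionsOf λ′))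
  (≋-trans (∑-congAll (All.map (λ {μ} e → ≡⇒≋ (cong (λ n → schurElimination (partitionsOf n) F μ *ₜ coeff (s μ) λ′) (sym e)))
      (partitionsOf-size ∣ λ′ ∣)))
    (≋-sym (∑-partitionsUpTo-of ≤N λ μ ≢ → *ₜ-zeroʳ′ (schurCoord F μ) (s-degree μ λ′ ≢))))

schurCoord-injective : ∀ {F G} → (∀ λ′ → schurCoord F λ′ ≋ schurCoord G λ′) → F ≋∞ G
schurCoord-injective {F} {G} e λ′ = ≋-trans (schur-expansion F λ′ ℕ.≤-refl)
  (≋-trans (∑-cong (partitionsUpTo ∣ λ′ ∣) λ μ → *ₜ-congʳ (coeff (s μ) λ′) (e μ))
    (≋-sym (schur-expansion G λ′ ℕ.≤-refl)))

partitionsUpTo-size : ∀ N → All (λ λ′ → ∣ λ′ ∣ ≤ N) (partitionsUpTo N)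
partitionsUpTo-size N = All.concat⁺ (All.map⁺ (All.applyUpTo⁺₁ id (suc N) λ { {i} (s≤s i≤N) →
  All.map (λ e → ℕ.≤-trans (ℕ.≤-reflexive e) i≤N) (partitionsOf-size i) }))

∑-𝟙ˡ : ∀ {N} (c : Partition → ℚ[t]) λ′ → ∣ λ′ ∣ ≤ N → (∑[ μ ← partitionsUpTo N ] c μ *ₜ 𝟙 (μ ≡ₚ? λ′)) ≋ c λ′
∑-𝟙ˡ c λ′ ≤N = ≋-trans
  (∑-partitionsUpTo-δ λ′ {λ μ → c μ *ₜ 𝟙 (μ ≡ₚ? λ′)} ≤N λ μ μ≢ → *ₜ-zeroʳ′ (c μ) (𝟙-no (μ ≡ₚ? λ′) (μ≢ ∘ partition-≡)))
  (≋-trans (*ₜ-congˡ (c λ′) (𝟙-yes (λ′ ≡ₚ? λ′) refl)) (*ₜ-identityʳ (c λ′)))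

∑-𝟙-> : ∀ {N} (c : Partition → ℚ[t]) λ′ → N < ∣ λ′ ∣ → (∑[ μ ← partitionsUpTo N ] c μ *ₜ 𝟙 (μ ≡ₚ? λ′)) ≋ 0ₜ
∑-𝟙-> {N} c λ′ N< = ∑-zeroAll (All.map (λ {μ} μ≤N → *ₜ-zeroʳ′ (c μ)
  (𝟙-no (μ ≡ₚ? λ′) λ e → ℕ.<⇒≱ N< (subst (_≤ N) (cong sum e) μ≤N))) (partitionsUpTo-size N))

schurCoord-∑s : ∀ N (c : Partition → ℚ[t]) λ′ → schurCoord (λ κ → ∑[ μ ← partitionsUpTo N ] c μ *ₜ coeff (s μ) κ) λ′ ≋
  (∑[ μ ← partitionsUpTo N ] c μ *ₜ 𝟙 (μ ≡ₚ? λ′))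
schurCoord-∑s N c λ′ = ≋-trans (schurCoord-∑ (partitionsUpTo N) c (coeff ∘ s) λ′)
  (∑-cong (partitionsUpTo N) λ μ → *ₜ-congˡ (c μ) (schurCoord-s μ λ′))

-- Linearity in G. Since Q has no terms of negative degree, the part of degree at most N of G, a
-- finite combination of Schur functions, determines the coordinate at τ.
schurCoord-⊛ : ∀ {N} Q G τ → ∣ τ ∣ ≤ N →
  schurCoord (Q ⊛ G) τ ≋ (∑[ μ ← partitionsUpTo N ] schurCoord G μ *ₜ schurCoord (Q ⊛ coeff (s μ)) τ)
schurCoord-⊛ {N} Q G τ ≤N = ≋-trans
  (schurCoord-cong τ λ κ e → ≋-trans
    (⊛-congʳ-≤ Q κ λ μ ≤κ → schur-expansion G μ (ℕ.≤-trans ≤κ (ℕ.≤-trans (ℕ.≤-reflexive e) ≤N)))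
    (≋-trans (⋆-∑ʳ (partitionsUpTo N) (hat Q) (λ μ → hat (schurCoord G μ ⊙ coeff (s μ))) (parts κ))
      (∑-cong (partitionsUpTo N) λ μ → ⋆-*ʳ (schurCoord G μ) (hat Q) (hat (coeff (s μ))) (parts κ))))
  (schurCoord-∑ (partitionsUpTo N) (schurCoord G) (λ μ → Q ⊛ coeff (s μ)) τ)

schurCoord-⊛s-0 : ∀ P λ′ τ → ∣ τ ∣ < ∣ λ′ ∣ → schurCoord (P ⊛ coeff (s λ′)) τ ≋ 0ₜ
schurCoord-⊛s-0 P λ′ τ τ<λ = schurCoord-0 τ λ μ e → ⊛-zero {P} {coeff (s λ′)} μ λ β γ e′ →
  inj₂ (s-degree λ′ γ λ e″ → ℕ.<⇒≱ τ<λ (ℕ.≤-trans (ℕ.≤-reflexive e″)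
    (ℕ.≤-trans (ℕ.m≤n+m (∣ γ ∣) (∣ β ∣)) (ℕ.≤-reflexive (trans e′ e)))))

schurCoord-bound : ∀ f λ′ → bound f < ∣ λ′ ∣ → schurCoord (coeff f) λ′ ≋ 0ₜ
schurCoord-bound f λ′ b<λ = schurCoord-0 λ′ λ μ e → vanishes f μ (subst (bound f <_) (sym e) b<λ)

-- Adjoints of multiplication operators

coord : Λ → Partition → ℚ[t]
coord f = schurCoord (coeff f)

≈-coord : ∀ {f g} → (∀ λ′ → coord f λ′ ≋ coord g λ′) → f ≈ g
≈-coord e = mk≈ (schurCoord-injective e)

coord-cong : ∀ {f g} → f ≈ g → ∀ λ′ → coord f λ′ ≋ coord g λ′
coord-cong e λ′ = schurCoord-cong λ′ λ μ _ → coeff-≋ e μ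

-- The definition of P^⊥ f stops at the degree of f, and beyond it both sides vanish. The bound M is
-- left free so that several elements can be expanded over one common list of partitions.
coord-⊥ : ∀ {M} P f λ′ → bound f ≤ M →
  coord ((P ^⊥) f) λ′ ≋ (∑[ τ ← partitionsUpTo M ] coord f τ *ₜ schurCoord (P ⊛ coeff (s λ′)) τ)
coord-⊥ {M} P f λ′ b≤M = ≋-trans
  (≋-trans (schurCoord-cong λ′ λ κ _ → ≋-trans
      (coeff-∑Λ (partitionsUpTo b) (λ μ → ⟨ f , P ⊛ coeff (s μ) ⟩ ·Λ s μ) κ)
      (∑-cong (partitionsUpTo b) λ μ → coeff-·Λ ⟨ f , P ⊛ coeff (s μ) ⟩ (s μ) κ))
    (schurCoord-∑s b (λ μ → ⟨ f , P ⊛ coeff (s μ) ⟩) λ′))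
  (≋-trans (go (∣ λ′ ∣ ≤? b)) (≋-sym (∑-partitionsUpTo-≤ b≤M λ τ b<τ → *ₜ-zeroˡ (schurCoord-bound f τ b<τ) _)))
  where
  b = bound f
  go : Dec (∣ λ′ ∣ ≤ b) → (∑[ μ ← partitionsUpTo b ] ⟨ f , P ⊛ coeff (s μ) ⟩ *ₜ 𝟙 (μ ≡ₚ? λ′)) ≋ ⟨ f , P ⊛ coeff (s λ′) ⟩
  go (yes λ≤b) = ∑-𝟙ˡ (λ μ → ⟨ f , P ⊛ coeff (s μ) ⟩) λ′ λ≤b
  go (no λ≰b)  = ≋-trans (∑-𝟙-> (λ μ → ⟨ f , P ⊛ coeff (s μ) ⟩) λ′ (ℕ.≰⇒> λ≰b)) (≋-sym (∑-zeroAll (All.map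
    (λ {τ} τ≤b → *ₜ-zeroʳ′ (coord f τ) (schurCoord-⊛s-0 P λ′ τ (ℕ.≤-<-trans τ≤b (ℕ.≰⇒> λ≰b)))) (partitionsUpTo-size b))))

⊥-cong : ∀ {P P′ f f′} → P ≋∞ P′ → f ≈ f′ → (P ^⊥) f ≈ (P′ ^⊥) f′
⊥-cong {P} {P′} {f} {f′} e e′ = ≈-coord λ λ′ → ≋-trans (coord-⊥ P f λ′ (ℕ.m≤m⊔n (bound f) (bound f′)))
  (≋-trans (∑-cong (partitionsUpTo (bound f ⊔ bound f′)) λ τ → *ₜ-cong (coord-cong e′ τ)
      (schurCoord-cong τ λ μ _ → ⊛-cong {G = coeff (s λ′)} e (λ _ → ≋-refl) μ))
    (≋-sym (coord-⊥ P′ f′ λ′ (ℕ.m≤n⊔m (bound f) (bound f′)))))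

-- A product of matrices: the sum over the intermediate s_μ is the expansion of P s_λ into Schur
-- functions, multiplied by Q.
⊥-∘ : ∀ P Q f → (P ^⊥) ((Q ^⊥) f) ≈ ((Q ⊛ P) ^⊥) f
⊥-∘ P Q f = ≈-coord λ λ′ → begin
  coord ((P ^⊥) ((Q ^⊥) f)) λ′
    ≈⟨ coord-⊥ P ((Q ^⊥) f) λ′ (ℕ.m≤n⊔m (bound f) (bound ((Q ^⊥) f))) ⟩
  (∑[ μ ← Ps ] coord ((Q ^⊥) f) μ *ₜ c λ′ μ)
    ≈⟨ ∑-cong Ps (λ μ → ≋-trans (*ₜ-congʳ (c λ′ μ) (coord-⊥ Q f μ (ℕ.m≤m⊔n (bound f) (bound ((Q ^⊥) f)))))
         (∑-*ʳ Ps (c λ′ μ) (λ τ → coord f τ *ₜ schurCoord (Q ⊛ coeff (s μ)) τ))) ⟩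
  (∑[ μ ← Ps ] ∑[ τ ← Ps ] coord f τ *ₜ schurCoord (Q ⊛ coeff (s μ)) τ *ₜ c λ′ μ)
    ≈⟨ ∑-swap Ps Ps (λ μ τ → coord f τ *ₜ schurCoord (Q ⊛ coeff (s μ)) τ *ₜ c λ′ μ) ⟩
  (∑[ τ ← Ps ] ∑[ μ ← Ps ] coord f τ *ₜ schurCoord (Q ⊛ coeff (s μ)) τ *ₜ c λ′ μ)
    ≈⟨ ∑-congAll (All.map (λ {τ} τ≤M → begin
         (∑[ μ ← Ps ] coord f τ *ₜ schurCoord (Q ⊛ coeff (s μ)) τ *ₜ c λ′ μ)
           ≈⟨ ∑-cong Ps (λ μ → ≋-trans (*ₜ-assoc (coord f τ) (schurCoord (Q ⊛ coeff (s μ)) τ) (c λ′ μ))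
                (*ₜ-congˡ (coord f τ) (*ₜ-comm (schurCoord (Q ⊛ coeff (s μ)) τ) (c λ′ μ)))) ⟩
         (∑[ μ ← Ps ] coord f τ *ₜ (c λ′ μ *ₜ schurCoord (Q ⊛ coeff (s μ)) τ))
           ≈⟨ ∑-*ˡ Ps (coord f τ) (λ μ → c λ′ μ *ₜ schurCoord (Q ⊛ coeff (s μ)) τ) ⟨
         coord f τ *ₜ (∑[ μ ← Ps ] c λ′ μ *ₜ schurCoord (Q ⊛ coeff (s μ)) τ)
           ≈⟨ *ₜ-congˡ (coord f τ) (schurCoord-⊛ Q (P ⊛ coeff (s λ′)) τ τ≤M) ⟨
         coord f τ *ₜ schurCoord (Q ⊛ (P ⊛ coeff (s λ′))) τ
           ≈⟨ *ₜ-congˡ (coord f τ) (schurCoord-cong τ λ κ _ → ⊛-assoc Q P (coeff (s λ′)) κ) ⟨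
         coord f τ *ₜ schurCoord (Q ⊛ P ⊛ coeff (s λ′)) τ ∎) (partitionsUpTo-size M)) ⟩
  (∑[ τ ← Ps ] coord f τ *ₜ schurCoord (Q ⊛ P ⊛ coeff (s λ′)) τ)
    ≈⟨ coord-⊥ (Q ⊛ P) f λ′ (ℕ.m≤m⊔n (bound f) (bound ((Q ^⊥) f))) ⟨
  coord (((Q ⊛ P) ^⊥) f) λ′ ∎
  where
  open ≋-Reasoning
  M  = bound f ⊔ bound ((Q ^⊥) f)
  Ps = partitionsUpTo M
  c : Partition → Partition → ℚ[t]
  c λ′ μ = schurCoord (P ⊛ coeff (s λ′)) μ

⊥-1 : ∀ {P} f → P ≋∞ 1∞ → (P ^⊥) f ≈ f
⊥-1 {P} f e = ≈-coord λ λ′ → ≋-trans (coord-⊥ P f λ′ ℕ.≤-refl)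
  (≋-trans (∑-cong (partitionsUpTo (bound f)) λ τ → *ₜ-congˡ (coord f τ) (≋-trans
      (schurCoord-cong τ λ κ _ → ≋-trans (⊛-cong {G = coeff (s λ′)} e (λ _ → ≋-refl) κ) (⊛-identityˡ (coeff (s λ′)) κ))
      (≋-trans (schurCoord-s λ′ τ) (𝟙-⇔ (λ′ ≡ₚ? τ) (τ ≡ₚ? λ′) sym sym))))
    (go λ′ (∣ λ′ ∣ ≤? bound f)))
  where
  go : ∀ λ′ → Dec (∣ λ′ ∣ ≤ bound f) → (∑[ τ ← partitionsUpTo (bound f) ] coord f τ *ₜ 𝟙 (τ ≡ₚ? λ′)) ≋ coord f λ′
  go λ′ (yes λ≤b) = ∑-𝟙ˡ (coord f) λ′ λ≤b
  go λ′ (no ≰)  = ≋-trans (∑-𝟙-> (coord f) λ′ (ℕ.≰⇒> ≰)) (≋-sym (schurCoord-bound f λ′ (ℕ.≰⇒> ≰)))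

-- Homogeneity of the operators

Homogeneous : ℕ → Λ∞ → Set
Homogeneous n F = ∀ λ′ → ∣ λ′ ∣ ≢ n → F λ′ ≋ 0ₜ

homogeneous-cong : ∀ {n F G} → F ≋∞ G → Homogeneous n G → Homogeneous n F
homogeneous-cong e h λ′ λ≢ = ≋-trans (e λ′) (h λ′ λ≢)

homogeneous-⊛ : ∀ {i j F G} → Homogeneous i F → Homogeneous j G → Homogeneous (i + j) (F ⊛ G)
homogeneous-⊛ {i} {j} {F} {G} hF hG λ′ λ≢ = ⊛-zero {F} {G} λ′ λ β γ e → go β γ e (∣ β ∣ ≟ i)
  where
  go : ∀ β γ → ∣ β ∣ + ∣ γ ∣ ≡ ∣ λ′ ∣ → Dec (∣ β ∣ ≡ i) → F β ≋ 0ₜ ⊎ G γ ≋ 0ₜ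
  go β γ e (no ≢i)  = inj₁ (hF β ≢i)
  go β γ e (yes ≡i) = inj₂ (hG γ λ ≡j → λ≢ (trans (sym e) (cong₂ _+_ ≡i ≡j)))

homogeneous-*Λ : ∀ {i j} f g → Homogeneous i (coeff f) → Homogeneous j (coeff g) → Homogeneous (i + j) (coeff (f *Λ g))
homogeneous-*Λ f g hf hg = homogeneous-cong (coeff-*Λ f g) (homogeneous-⊛ {F = coeff f} {coeff g} hf hg)

homogeneous-·Λ : ∀ {i} c f → Homogeneous i (coeff f) → Homogeneous i (coeff (c ·Λ f))
homogeneous-·Λ c f hf = homogeneous-cong (coeff-·Λ c f) λ λ′ λ≢ → *ₜ-zeroʳ′ c (hf λ′ λ≢)

homogeneous-1Λ : Homogeneous 0 (coeff 1Λ)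
homogeneous-1Λ λ′ λ≢ = ≋-trans (coeff-1Λ λ′) (≋-trans (1∞-𝟙 λ′) (𝟙-no (∣ λ′ ∣ ≟ 0) λ≢))

homogeneous-p : ∀ k → Homogeneous k (coeff (p k))
homogeneous-p k = homogeneous-cong (coeff-truncate k λ λ′ k< → zeroₚ λ′ (ℕ.>⇒≢ k<)) zeroₚ
  where
  zeroₚ : Homogeneous k λ λ′ → if does (≡-dec _≟_ (parts λ′) (k ∷ [])) then 1ₜ else 0ₜ
  zeroₚ λ′ λ≢ = 𝟙-no (≡-dec _≟_ (parts λ′) (k ∷ [])) λ e → λ≢ (trans (cong sum e) (ℕ.+-identityʳ k))

homogeneous-homogeneousPart : ∀ n F → Homogeneous n (coeff (homogeneousPart n F))
homogeneous-homogeneousPart n F = homogeneous-cong (coeff-truncate n λ λ′ n< → part λ′ (ℕ.>⇒≢ n<)) part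
  where
  part : Homogeneous n λ λ′ → if does (∣ λ′ ∣ ≟ n) then F λ′ else 0ₜ
  part λ′ λ≢ = ≋-trans (if-𝟙 (∣ λ′ ∣ ≟ n) (F λ′)) (𝟙-no* (∣ λ′ ∣ ≟ n) λ≢ (F λ′))

Bihomogeneous : ℕ → Λ × Λ → Set
Bihomogeneous n (a , b) = ∃[ i ] ∃[ j ] i + j ≡ n × Homogeneous i (coeff a) × Homogeneous j (coeff b)

p[qX+[1-q]Y]-homogeneous : ∀ q μ → All (Bihomogeneous (sum μ)) (p[qX+[1-q]Y] q μ)
p[qX+[1-q]Y]-homogeneous q []          = (0 , 0 , refl , homogeneous-1Λ , homogeneous-1Λ) ∷ []
p[qX+[1-q]Y]-homogeneous q (zero ∷ μ)  = p[qX+[1-q]Y]-homogeneous q μ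
p[qX+[1-q]Y]-homogeneous q (suc l ∷ μ) = All.concat⁺ (All.map⁺ (All.map
  (λ { {a , b} (i , j , e , ha , hb) →
      (k + i , j , trans (ℕ.+-assoc k i j) (cong (λ n → k + n) e)
        , homogeneous-*Λ (qᵏ ·Λ p k) a (homogeneous-·Λ qᵏ (p k) (homogeneous-p k)) ha , hb)
    ∷ (i , k + j , trans (solve 3 (λ i k j → i :+ (k :+ j) := k :+ (i :+ j)) refl i k j) (cong (λ n → k + n) e)
        , ha , homogeneous-*Λ ((1ₜ -ₜ qᵏ) ·Λ p k) b (homogeneous-·Λ (1ₜ -ₜ qᵏ) (p k) (homogeneous-p k)) hb)
    ∷ [] })
  (p[qX+[1-q]Y]-homogeneous q μ)))
  where
  open +-*-Solver
  k  = suc l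
  qᵏ = q [t↦t^ k ]

addToEach-size : ∀ {n} a (β : Vec ℕ n) → All (λ γ → Vec.sum γ ≡ a + Vec.sum β) (addToEach a β)
addToEach-size a []      = []
addToEach-size a (b ∷ β) = ℕ.+-assoc a b (Vec.sum β) ∷ All.map⁺ (All.map
  (λ e → trans (cong (λ n → b + n) e) (solve 3 (λ b a c → b :+ (a :+ c) := a :+ (b :+ c)) refl b a (Vec.sum β)))
  (addToEach-size a β))
  where open +-*-Solver

augmentedMonomial-size : ∀ n (β : Vec ℕ n) → All (λ (c , μ) → sum μ ≡ Vec.sum β) (augmentedMonomial n β)
augmentedMonomial-size zero    []      = refl ∷ []
augmentedMonomial-size (suc n) (a ∷ β) = All.++⁺
  (All.map⁺ (All.map (cong (λ m → a + m)) (augmentedMonomial-size n β)))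
  (All.map⁺ (All.concat⁺ (All.map⁺ (All.map (λ {γ} e → All.map (λ e′ → trans e′ e) (augmentedMonomial-size n γ))
    (addToEach-size a β)))))

sum-fromList : ∀ α → Vec.sum (Vec.fromList α) ≡ sum α
sum-fromList []      = refl
sum-fromList (a ∷ α) = cong (λ n → a + n) (sum-fromList α)

inPowerSums-homogeneous : ∀ {n} f → Homogeneous n (coeff f) → All (λ (c , μ) → sum μ ≢ n → c ≋ 0ₜ) (inPowerSums f)
inPowerSums-homogeneous f hf = All.concat⁺ (All.map⁺ (All.universal (λ λ′ → All.map⁺ (All.map
  (λ { {c , μ} e λ≢ → *ₜ-zeroˡ (*ₜ-zeroˡ (hf λ′ λ e′ → λ≢ (trans e (trans (sum-fromList (parts λ′)) e′))) (const (1/multiplicities! (parts λ′)))) c })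
  (augmentedMonomial-size _ (Vec.fromList (parts λ′))))) (partitionsUpTo (bound f))))

coeff-·Λ*Λ : ∀ c a b λ′ → coeff ((c ·Λ a) *Λ b) λ′ ≋ c *ₜ (coeff a ⊛ coeff b) λ′
coeff-·Λ*Λ c a b λ′ = ≋-trans (coeff-*Λ (c ·Λ a) b λ′)
  (≋-trans (⊛-cong {G = coeff b} (coeff-·Λ c a) (λ _ → ≋-refl) λ′) (⋆-*ˡ c (hat (coeff a)) (hat (coeff b)) (parts λ′)))

tAnalogue-p : ℚ[t] → (Λ → Λ) → List ℕ → Partition → ℚ[t]
tAnalogue-p q V μ κ = ∑[ (a , b) ← p[qX+[1-q]Y] q μ ] (coeff a ⊛ coeff (V b)) κ

coeff-tAnalogue : ∀ q V f κ → coeff (tAnalogue q V f) κ ≋ (∑[ (c , μ) ← inPowerSums f ] c *ₜ tAnalogue-p q V μ κ)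
coeff-tAnalogue q V f κ = begin
  coeff (tAnalogue q V f) κ
    ≈⟨ coeff-∑Λ (f [qX+[1-q]Y] q) (λ (a , b) → a *Λ V b) κ ⟩
  (∑[ (a , b) ← f [qX+[1-q]Y] q ] coeff (a *Λ V b) κ)
    ≈⟨ ∑-concatMap (λ (c , μ) → map (λ (a , b) → c ·Λ a , b) (p[qX+[1-q]Y] q μ)) (inPowerSums f) (λ (a , b) → coeff (a *Λ V b) κ) ⟩
  (∑[ (c , μ) ← inPowerSums f ] ∑[ (a , b) ← map (λ (a , b) → c ·Λ a , b) (p[qX+[1-q]Y] q μ) ] coeff (a *Λ V b) κ)
    ≈⟨ ∑-cong (inPowerSums f) (λ (c , μ) → ≋-trans
         (∑-map (λ (a , b) → c ·Λ a , b) (p[qX+[1-q]Y] q μ) (λ (a , b) → coeff (a *Λ V b) κ))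
         (≋-trans (∑-cong (p[qX+[1-q]Y] q μ) λ (a , b) → coeff-·Λ*Λ c a (V b) κ)
           (≋-sym (∑-*ˡ (p[qX+[1-q]Y] q μ) c (λ (a , b) → (coeff a ⊛ coeff (V b)) κ))))) ⟩
  (∑[ (c , μ) ← inPowerSums f ] c *ₜ tAnalogue-p q V μ κ) ∎
  where open ≋-Reasoning

∑-inPowerSums : ∀ f (Φ : List ℕ → ℚ[t]) → (∑[ (c , μ) ← inPowerSums f ] c *ₜ Φ μ) ≋
  (∑[ λ′ ← partitionsUpTo (bound f) ] coeff f λ′ *ₜ
    (∑[ (c , μ) ← augmentedMonomial _ (Vec.fromList (parts λ′)) ] const (1/multiplicities! (parts λ′)) *ₜ c *ₜ Φ μ))
∑-inPowerSums f Φ = ≋-trans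
  (∑-concatMap (λ λ′ → map (λ (c , μ) → coeff f λ′ *ₜ const (1/multiplicities! (parts λ′)) *ₜ c , μ)
    (augmentedMonomial _ (Vec.fromList (parts λ′)))) (partitionsUpTo (bound f)) (λ (c , μ) → c *ₜ Φ μ))
  (∑-cong (partitionsUpTo (bound f)) λ λ′ →
    let m = const (1/multiplicities! (parts λ′)); A = augmentedMonomial _ (Vec.fromList (parts λ′)) in ≋-trans
    (∑-map (λ (c , μ) → coeff f λ′ *ₜ m *ₜ c , μ) A (λ (c , μ) → c *ₜ Φ μ))
    (≋-trans (∑-cong A λ (c , μ) → reassoc (coeff f λ′) m c (Φ μ))
      (≋-sym (∑-*ˡ A (coeff f λ′) λ (c , μ) → m *ₜ c *ₜ Φ μ))))
  where
  reassoc : ∀ x m c y → x *ₜ m *ₜ c *ₜ y ≋ x *ₜ (m *ₜ c *ₜ y)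
  reassoc x m c y = ≋-trans (*ₜ-congʳ y (*ₜ-assoc x m c)) (*ₜ-assoc x (m *ₜ c) y)

-- V is applied to products of power sums only, and these do not depend on f; f itself enters
-- linearly, through its coefficients. The result is therefore a fixed linear combination of the
-- coefficients of f, for an arbitrary map V.
tAnalogue-cong : ∀ q V {f g} → f ≈ g → tAnalogue q V f ≈ tAnalogue q V g
tAnalogue-cong q V {f} {g} f≈g = mk≈ λ κ →
  ≋-trans (expand f κ (ℕ.m≤m⊔n (bound f) (bound g)))
  (≋-trans (∑-cong (partitionsUpTo (bound f ⊔ bound g)) λ λ′ → *ₜ-congʳ (Ψ κ λ′) (coeff-≋ f≈g λ′))
    (≋-sym (expand g κ (ℕ.m≤n⊔m (bound f) (bound g)))))
  where
  Ψ : Partition → Partition → ℚ[t]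
  Ψ κ λ′ = ∑[ (c , μ) ← augmentedMonomial _ (Vec.fromList (parts λ′)) ]
    const (1/multiplicities! (parts λ′)) *ₜ c *ₜ tAnalogue-p q V μ κ
  expand : ∀ f κ {N} → bound f ≤ N → coeff (tAnalogue q V f) κ ≋ (∑[ λ′ ← partitionsUpTo N ] coeff f λ′ *ₜ Ψ κ λ′)
  expand f κ b≤N = ≋-trans (coeff-tAnalogue q V f κ) (≋-trans (∑-inPowerSums f (λ μ → tAnalogue-p q V μ κ))
    (≋-sym (∑-partitionsUpTo-≤ b≤N λ μ b< → *ₜ-zeroˡ (vanishes f μ b<) (Ψ κ μ))))

-- Each term of p_μ[qX + (1 - q)Y] has total degree |μ| in X and Y, and V adds m to the degree in Y.
tAnalogue-homogeneous : ∀ {m n} q V f → (∀ j b → Homogeneous j (coeff b) → Homogeneous (m + j) (coeff (V b))) →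
  Homogeneous n (coeff f) → Homogeneous (m + n) (coeff (tAnalogue q V f))
tAnalogue-homogeneous {m} {n} q V f hV hf κ κ≢ = ≋-trans (coeff-tAnalogue q V f κ)
  (∑-zeroAll (All.map (λ { {c , μ} h → go c μ h (sum μ ≟ n) }) (inPowerSums-homogeneous f hf)))
  where
  open +-*-Solver
  go : ∀ c μ → (sum μ ≢ n → c ≋ 0ₜ) → Dec (sum μ ≡ n) → c *ₜ tAnalogue-p q V μ κ ≋ 0ₜ
  go c μ h (no ≢n)  = *ₜ-zeroˡ (h ≢n) (tAnalogue-p q V μ κ)
  go c μ h (yes ≡n) = *ₜ-zeroʳ′ c (∑-zeroAll (All.map
    (λ { {a , b} (i , j , e , ha , hb) → homogeneous-⊛ {F = coeff a} {coeff (V b)} ha (hV j b hb) κ λ e′ →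
      κ≢ (trans e′ (trans (solve 3 (λ i m j → i :+ (m :+ j) := m :+ (i :+ j)) refl i m j)
        (cong (λ k → m + k) (trans e ≡n)))) })
    (p[qX+[1-q]Y]-homogeneous q μ)))

-- Skewing by degree n lowers the degree by n. The sum n + |λ| avoids the difference d - n, which
-- may be negative.
⊥-homogeneous : ∀ {n d} P f → Homogeneous n P → Homogeneous d (coeff f) → ∀ λ′ → n + ∣ λ′ ∣ ≢ d → coeff ((P ^⊥) f) λ′ ≋ 0ₜ
⊥-homogeneous {n} {d} P f hP hf λ′ λ≢ = ≋-trans
  (coeff-∑Λ Ps (λ μ → ⟨ f , P ⊛ coeff (s μ) ⟩ ·Λ s μ) λ′)
  (∑-zero Ps λ μ → ≋-trans (coeff-·Λ ⟨ f , P ⊛ coeff (s μ) ⟩ (s μ) λ′) (go μ (∣ μ ∣ ≟ ∣ λ′ ∣)))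
  where
  Ps = partitionsUpTo (bound f)
  pairing : ∀ μ τ → ∣ μ ∣ ≡ ∣ λ′ ∣ → Dec (∣ τ ∣ ≡ d) → coord f τ *ₜ schurCoord (P ⊛ coeff (s μ)) τ ≋ 0ₜ
  pairing μ τ e (no ≢d)  = *ₜ-zeroˡ (schurCoord-0 τ λ κ e′ → hf κ (≢d ∘ trans (sym e′))) (schurCoord (P ⊛ coeff (s μ)) τ)
  pairing μ τ e (yes ≡d) = *ₜ-zeroʳ′ (coord f τ) (schurCoord-0 τ λ κ e′ →
    homogeneous-⊛ {F = P} {coeff (s μ)} hP (λ ν ν≢ → s-degree μ ν (ν≢ ∘ sym)) κ
      λ e″ → λ≢ (trans (cong (λ k → n + k) (sym e)) (trans (sym e″) (trans e′ ≡d))))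
  go : ∀ μ → Dec (∣ μ ∣ ≡ ∣ λ′ ∣) → ⟨ f , P ⊛ coeff (s μ) ⟩ *ₜ coeff (s μ) λ′ ≋ 0ₜ
  go μ (no ≢λ)  = *ₜ-zeroʳ′ ⟨ f , P ⊛ coeff (s μ) ⟩ (s-degree μ λ′ ≢λ)
  go μ (yes ≡λ) = *ₜ-zeroˡ (∑-zero Ps λ τ → pairing μ τ ≡λ (∣ τ ∣ ≟ d)) (coeff (s μ) λ′)

-- Every term of B_r skews by degree n and then multiplies by degree r + n.
B-homogeneous : ∀ {d} r f → Homogeneous d (coeff f) → Homogeneous (r + d) (coeff (B (+ r) f))
B-homogeneous {d} r f hf λ′ λ≢ = ≋-trans
  (coeff-∑Λ (upTo (suc (bound f))) (λ n → (Ω[zX] (+ r ℤ.+ + n)) *Λ (coeff (Ω₋ n) ^⊥) f) λ′)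
  (∑-zero (upTo (suc (bound f))) λ n → ≋-trans (coeff-*Λ (Ω[zX] (+ r ℤ.+ + n)) ((coeff (Ω₋ n) ^⊥) f) λ′)
    (⊛-zero {coeff (homogeneousPart (r + n) (Ω X))} {coeff ((coeff (Ω₋ n) ^⊥) f)} λ′ λ β γ e → go n β γ e (∣ β ∣ ≟ r + n)))
  where
  Ω₋ : ℕ → Λ
  Ω₋ n = homogeneousPart n (Ω (0∞ ⊖ X))
  go : ∀ n β γ → ∣ β ∣ + ∣ γ ∣ ≡ ∣ λ′ ∣ → Dec (∣ β ∣ ≡ r + n) →
    coeff (homogeneousPart (r + n) (Ω X)) β ≋ 0ₜ ⊎ coeff ((coeff (Ω₋ n) ^⊥) f) γ ≋ 0ₜ
  go n β γ e (no ≢rn)  = inj₁ (homogeneous-homogeneousPart (r + n) (Ω X) β ≢rn)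
  go n β γ e (yes ≡rn) = inj₂ (⊥-homogeneous (coeff (Ω₋ n)) f (homogeneous-homogeneousPart n (Ω (0∞ ⊖ X))) hf γ
    λ e′ → λ≢ (trans (sym e) (trans (cong (_+ ∣ γ ∣) ≡rn) (trans (ℕ.+-assoc r n ∣ γ ∣) (cong (λ k → r + k) e′)))))

B*-homogeneous : ∀ {d} ns f → Homogeneous d (coeff f) → Homogeneous (sum ns + d) (coeff (B* (map +_ ns) f))
B*-homogeneous []       f hf = hf
B*-homogeneous {d} (r ∷ ns) f hf = subst (λ n → Homogeneous n (coeff (B (+ r) (B* (map +_ ns) f)))) (sym (ℕ.+-assoc r (sum ns) d))
  (B-homogeneous r (B* (map +_ ns) f) (B*-homogeneous ns f hf))

-- Telescoping

-- The common form of `H* ◇` and of its counterpart built from `B̃`, in which ◇ no longer occurs.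
iterate : (List ℤ → Λ → Λ) → List Partition → Λ
iterate V R = foldr (λ Rᵢ g → V (toℤs Rᵢ) g) 1Λ R

B̃ : List ℤ → Λ → Λ
B̃ ν = tAnalogue (t^ 2) (B* ν)

iterate-homogeneous : ∀ V → (∀ Rᵢ {n} g → Homogeneous n (coeff g) → Homogeneous (∣ Rᵢ ∣ + n) (coeff (V (toℤs Rᵢ) g))) →
  ∀ R → Homogeneous ∥ R ∥ (coeff (iterate V R))
iterate-homogeneous V h []       = homogeneous-1Λ
iterate-homogeneous V h (Rᵢ ∷ R) = h Rᵢ (iterate V R) (iterate-homogeneous V h R)

B̃-homogeneous : ∀ Rᵢ {n} g → Homogeneous n (coeff g) → Homogeneous (∣ Rᵢ ∣ + n) (coeff (B̃ (toℤs Rᵢ) g))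
B̃-homogeneous Rᵢ g = tAnalogue-homogeneous (t^ 2) (B* (toℤs Rᵢ)) g (λ j b → B*-homogeneous (parts Rᵢ) b)

≈-refl : ∀ {f} → f ≈ f
≈-refl = mk≈ λ _ → ≋-refl

≈-sym : ∀ {f g} → f ≈ g → g ≈ f
≈-sym e = mk≈ λ λ′ → ≋-sym (coeff-≋ e λ′)

≈-trans : ∀ {f g h} → f ≈ g → g ≈ h → f ≈ h
≈-trans e e′ = mk≈ λ λ′ → ≋-trans (coeff-≋ e λ′) (coeff-≋ e′ λ′)

1∞-s : coeff 1Λ ≋∞ coeff (s (toPartition []))
1∞-s μ = ≋-trans (coeff-1Λ μ) (≋-trans (1∞-𝟙 μ) (≋-sym (≋-trans (coeff-s (toPartition []) μ) (go (∣ μ ∣ ≟ 0)))))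
  where
  go : Dec (∣ μ ∣ ≡ 0) → κ [] (parts μ) ≋ 𝟙 (∣ μ ∣ ≟ 0)
  go (yes e) = ≋-trans (≡⇒≋ (cong (κ []) (empty-parts μ e))) (≋-sym (𝟙-yes (∣ μ ∣ ≟ 0) e))
  go (no λ≢)  = ≋-trans (κ-degree [] (parts μ) (λ≢ ∘ sym)) (≋-sym (𝟙-no (∣ μ ∣ ≟ 0) λ≢))

-- Pairing with 1 sees the constant term only: a product P s_λ has constant term 0 unless λ is
-- empty, when it is that of P.
⊥-1Λ : ∀ P → P (toPartition []) ≋ 1ₜ → (P ^⊥) 1Λ ≈ 1Λ
⊥-1Λ P P[∅]≋1 = ≈-coord λ λ′ → begin
  coord ((P ^⊥) 1Λ) λ′
    ≈⟨ coord-⊥ {0} P 1Λ λ′ z≤n ⟩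
  coord 1Λ e *ₜ schurCoord (P ⊛ coeff (s λ′)) e +ₜ 0ₜ
    ≈⟨ +ₜ-identityʳ (coord 1Λ e *ₜ schurCoord (P ⊛ coeff (s λ′)) e) ⟩
  coord 1Λ e *ₜ schurCoord (P ⊛ coeff (s λ′)) e
    ≈⟨ *ₜ-congʳ (schurCoord (P ⊛ coeff (s λ′)) e) (≋-trans (coord-1Λ e) (𝟙-yes (e ≡ₚ? e) refl)) ⟩
  1ₜ *ₜ schurCoord (P ⊛ coeff (s λ′)) e
    ≈⟨ *ₜ-identityˡ (schurCoord (P ⊛ coeff (s λ′)) e) ⟩
  schurCoord (P ⊛ coeff (s λ′)) e
    ≈⟨ constant (P ⊛ coeff (s λ′)) ⟨
  P e *ₜ coeff (s λ′) e +ₜ 0ₜ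
    ≈⟨ ≋-trans (+ₜ-identityʳ (P e *ₜ coeff (s λ′) e)) (≋-trans (*ₜ-congʳ (coeff (s λ′) e) P[∅]≋1) (*ₜ-identityˡ (coeff (s λ′) e))) ⟩
  coeff (s λ′) e
    ≈⟨ ≋-trans (coeff-s λ′ e) (κ-[] (parts λ′)) ⟩
  𝟙 (∣ λ′ ∣ ≟ 0)
    ≈⟨ 𝟙-⇔ (∣ λ′ ∣ ≟ 0) (e ≡ₚ? λ′) (sym ∘ empty-parts λ′) (cong sum ∘ sym) ⟩
  𝟙 (e ≡ₚ? λ′)
    ≈⟨ coord-1Λ λ′ ⟨
  coord 1Λ λ′ ∎
  where
  open ≋-Reasoning
  e = toPartition []
  coord-1Λ : ∀ λ′ → coord 1Λ λ′ ≋ 𝟙 (e ≡ₚ? λ′)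
  coord-1Λ λ′ = ≋-trans (schurCoord-cong λ′ λ μ _ → 1∞-s μ) (schurCoord-s e λ′)
  constant : ∀ F → F e ≋ schurCoord F e
  constant F = ≋-trans (schur-expansion {0} F e z≤n) (≋-trans (+ₜ-identityʳ (schurCoord F e *ₜ coeff (s e) e))
    (≋-trans (*ₜ-congˡ (schurCoord F e) (s-diag e)) (*ₜ-identityʳ (schurCoord F e))))

⊖-⊕-⊖ : ∀ F G → (F ⊖ G) ⊕ (G ⊖ F) ≋∞ 0∞
⊖-⊕-⊖ F G λ′ = begin
  F λ′ +ₜ (-ₜ G λ′) +ₜ (G λ′ +ₜ (-ₜ F λ′))   ≈⟨ +ₜ-assoc (F λ′) (-ₜ G λ′) (G λ′ +ₜ (-ₜ F λ′)) ⟩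
  F λ′ +ₜ ((-ₜ G λ′) +ₜ (G λ′ +ₜ (-ₜ F λ′))) ≈⟨ +ₜ-congˡ (F λ′) (+ₜ-assoc (-ₜ G λ′) (G λ′) (-ₜ F λ′)) ⟨
  F λ′ +ₜ ((-ₜ G λ′) +ₜ G λ′ +ₜ (-ₜ F λ′))   ≈⟨ +ₜ-congˡ (F λ′) (+ₜ-congʳ (-ₜ F λ′) (-ₜ-inverseˡ (G λ′))) ⟩
  F λ′ +ₜ (-ₜ F λ′)                          ≈⟨ -ₜ-inverseʳ (F λ′) ⟩
  0ₜ                                         ∎
  where open ≋-Reasoning

-- Between neighbouring factors C meets A. The rightmost C meets none; it is A 1 = 1 that supplies
-- one there.
iterate-conjugate : ∀ (V T : List ℤ → Λ → Λ) (A C : Λ → Λ) → (∀ ν g → V ν g ≡ A (T ν (C g))) →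
  (∀ {f g} → f ≈ g → A f ≈ A g) → (∀ ν {f g} → f ≈ g → T ν f ≈ T ν g) → (∀ {f g} → f ≈ g → C f ≈ C g) →
  A 1Λ ≈ 1Λ → (∀ g → C (A g) ≈ g) → ∀ R → iterate V R ≈ A (iterate T R)
iterate-conjugate V T A C V≡ A-cong T-cong C-cong A1 CA []       = ≈-sym A1
iterate-conjugate V T A C V≡ A-cong T-cong C-cong A1 CA (Rᵢ ∷ R) =
  subst (_≈ A (T (toℤs Rᵢ) (iterate T R))) (sym (V≡ (toℤs Rᵢ) (iterate V R)))
    (A-cong (T-cong (toℤs Rᵢ) (≈-trans
      (C-cong (iterate-conjugate V T A C V≡ A-cong T-cong C-cong A1 CA R)) (CA (iterate T R)))))

[tX]⊖-inverse : ∀ F → Ω (F [tX] ⊖ F) ⊛ Ω (F ⊖ F [tX]) ≋∞ 1∞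
[tX]⊖-inverse F μ = ≋-trans (≋-sym (Ω-⊕ (F [tX] ⊖ F) (F ⊖ F [tX]) μ))
  (Ω-0 {(F [tX] ⊖ F) ⊕ (F ⊖ F [tX])} (⊖-⊕-⊖ (F [tX]) F) μ)

H*-conjugate : ∀ ◇ R → H* ◇ R ≈ (Ω (f[ ◇ ] [tX] ⊖ f[ ◇ ]) ^⊥) (iterate B̃ R)
H*-conjugate ◇ = iterate-conjugate (H ◇) B̃ (P ^⊥) (Q ^⊥) (λ ν g → refl)
  (λ {f} {g} → ⊥-cong {P} {P} {f} {g} (λ _ → ≋-refl))
  (λ ν {f} {g} → tAnalogue-cong (t^ 2) (B* ν) {f} {g})
  (λ {f} {g} → ⊥-cong {Q} {Q} {f} {g} (λ _ → ≋-refl))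
  (⊥-1Λ P (Ω-const (f[ ◇ ] [tX] ⊖ f[ ◇ ]) (toPartition []) refl))
  (λ g → ≈-trans {(Q ^⊥) ((P ^⊥) g)} {((P ⊛ Q) ^⊥) g} {g} (⊥-∘ Q P g) (⊥-1 g ([tX]⊖-inverse f[ ◇ ])))
  where
  P Q : Λ∞
  P = Ω (f[ ◇ ] [tX] ⊖ f[ ◇ ])
  Q = Ω (f[ ◇ ] ⊖ f[ ◇ ] [tX])

-- The functions f_◇ in terms of monomial symmetric functions

-- The monomial symmetric function of the rectangle with n parts k. All f_◇ are sums of such
-- functions, and the family is stable under every p_k and, essentially, under fixing the exponent
-- of one variable.
m⟨_^_⟩ : ℕ → ℕ → Λ∞
m⟨ k ^ n ⟩ λ′ = 𝟙 (≡-dec _≟_ (parts λ′) (replicate n k))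

sum-replicate′ : ∀ n k → sum (replicate n k) ≡ n * k
sum-replicate′ zero    k = refl
sum-replicate′ (suc n) k = cong (λ m → k + m) (sum-replicate′ n k)

homogeneous-m : ∀ k n → Homogeneous (n * k) m⟨ k ^ n ⟩
homogeneous-m k n λ′ λ≢ = 𝟙-no (≡-dec _≟_ (parts λ′) (replicate n k)) λ e → λ≢ (trans (cong sum e) (sum-replicate′ n k))

homogeneous-≋∞ : ∀ n {F G} → Homogeneous n F → Homogeneous n G → All (λ λ′ → F λ′ ≋ G λ′) (partitionsOf n) → F ≋∞ G
homogeneous-≋∞ n {F} {G} hF hG h λ′ = go (∣ λ′ ∣ ≟ n)
  where
  go : Dec (∣ λ′ ∣ ≡ n) → F λ′ ≋ G λ′
  go (yes refl) = All.lookup h (∈-partitionsOf λ′)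
  go (no λ≢)    = ≋-trans (hF λ′ λ≢) (≋-sym (hG λ′ λ≢))

homogeneous-s : ∀ λ′ → Homogeneous ∣ λ′ ∣ (coeff (s λ′))
homogeneous-s λ′ μ μ≢ = s-degree λ′ μ (μ≢ ∘ sym)

homogeneous-⊕ : ∀ {n F G} → Homogeneous n F → Homogeneous n G → Homogeneous n (F ⊕ G)
homogeneous-⊕ hF hG λ′ λ≢ = +ₜ-0 (hF λ′ λ≢) (hG λ′ λ≢)

s-1 : coeff (s ⟦1⟧) ≋∞ m⟨ 1 ^ 1 ⟩
s-1 = homogeneous-≋∞ 1 (homogeneous-s ⟦1⟧) (homogeneous-m 1 1) (≋-refl ∷ [])

s-2 : coeff (s ⟦2⟧) ≋∞ m⟨ 2 ^ 1 ⟩ ⊕ m⟨ 1 ^ 2 ⟩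
s-2 = homogeneous-≋∞ 2 (homogeneous-s ⟦2⟧) (homogeneous-⊕ (homogeneous-m 2 1) (homogeneous-m 1 2)) (≋-refl ∷ ≋-refl ∷ [])

s-11 : coeff (s ⟦1,1⟧) ≋∞ m⟨ 1 ^ 2 ⟩
-- At the partition (2) the Kostka number 0 is the list `0ℚ ∷ []`, which is equal to `0ₜ` only up to
-- a trailing zero.
s-11 = homogeneous-≋∞ 2 (homogeneous-s ⟦1,1⟧) (homogeneous-m 1 2) (0∷0 ∷ ≋-refl ∷ [])

linked-const : ∀ n k → Linked _≥_ (replicate n k)
linked-const zero          k = []
linked-const (suc zero)    k = [-]
linked-const (suc (suc n)) k = ℕ.≤-refl ∷ linked-const (suc n) k

1ₜ-[t↦t^] : ∀ k .{{_ : NonZero k}} → 1ₜ [t↦t^ k ] ≋ 1ₜ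
1ₜ-[t↦t^] k = ∷-cong refl (shift-0 (ℕ.pred k))

p[]-m : ∀ k .{{_ : NonZero k}} d n → 0 < d → p[ k ] m⟨ d ^ n ⟩ ≋∞ m⟨ d * k ^ n ⟩
p[]-m k d n 0<d λ′ = go (all? (k ∣?_) ps)
  where
  ps = parts λ′
  scaled : All (k ℕ.∣_) ps → map (_* k) (map (ℕ._/ k) ps) ≡ ps
  scaled k∣ = trans (sym (List.map-∘ ps)) (unscale k∣)
    where
    unscale : ∀ {α} → All (k ℕ.∣_) α → map (λ a → a ℕ./ k * k) α ≡ α
    unscale []         = refl
    unscale (k∣a ∷ k∣) = cong₂ _∷_ (ℕ.m/n*n≡m k∣a) (unscale k∣)
  quotients : All (k ℕ.∣_) ps → parts (toPartition (map (ℕ._/ k) ps)) ≡ map (ℕ._/ k) ps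
  quotients k∣ = cong parts (toPartition-parts (mkPartition (map (ℕ._/ k) ps)
    (Linked.map⁺ (Linked.map (ℕ./-monoˡ-≤ k) (decreasing λ′)))
    (All.map⁺ (All.zipWith (λ { (k∣a , 0<a) → ℕ.m≥n⇒m/n>0 (ℕ.∣⇒≤ {{ℕ.>-nonZero 0<a}} k∣a) }) (k∣ , positive λ′)))))
  go : (dec : Dec (All (k ℕ.∣_) ps)) →
    (if does dec then m⟨ d ^ n ⟩ (toPartition (map (ℕ._/ k) ps)) [t↦t^ k ] else 0ₜ) ≋ m⟨ d * k ^ n ⟩ λ′
  go (no k∤) = ≋-sym (𝟙-no (≡-dec _≟_ ps (replicate n (d * k))) λ e → k∤ (subst (All (k ℕ.∣_)) (sym e)
    (All.replicate⁺ n (divides-refl d))))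
  go (yes k∣) with ≡-dec _≟_ ps (replicate n (d * k))
  ... | yes e = ≋-trans ([t↦t^]-cong k (𝟙-yes (≡-dec _≟_ (parts (toPartition (map (ℕ._/ k) ps))) (replicate n d))
      (trans (quotients k∣) (trans (cong (map (ℕ._/ k)) e) (trans (List.map-replicate (ℕ._/ k) n (d * k))
        (cong (replicate n) (ℕ.m*n/n≡m d k))))))) (1ₜ-[t↦t^] k)
  ... | no ≢  = [t↦t^]-zero k (𝟙-no (≡-dec _≟_ (parts (toPartition (map (ℕ._/ k) ps))) (replicate n d))
      λ e → ≢ (trans (sym (scaled k∣)) (trans (cong (map (_* k)) (trans (sym (quotients k∣)) e)) (List.map-replicate (_* k) n d))))

toPartition-∷-replicate : ∀ k n a α → 0 < a → 0 < k →
  parts (toPartition (a ∷ α)) ≡ replicate (suc n) k → a ≡ k × parts (toPartition α) ≡ replicate n k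
toPartition-∷-replicate k n a@(suc _) α 0<a 0<k e = a≡k , decreasing-↭ (decreasing (toPartition α)) (linked-const n k)
  (↭-trans (parts-toPartition-↭ α) (↭.drop-∷ (subst (λ b → b ∷ filter (0 <?_) α ↭ k ∷ replicate n k) a≡k tail↭)))
  where
  tail↭ : a ∷ filter (0 <?_) α ↭ replicate (suc n) k
  tail↭ = ↭-trans (↭-sym (parts-toPartition-↭ (a ∷ α))) (subst (_↭ replicate (suc n) k) (sym e) ↭-refl)
  a≡k : a ≡ k
  a≡k = All.lookup (All.replicate⁺ {P = _≡ k} (suc n) refl) (↭.∈-resp-↭ tail↭ (here refl))

-- All variables that occur in a monomial of m_(k,...,k) have exponent k, so one that occurs can be
-- removed together with one part.
hat-m-∷ : ∀ k n a α → 0 < a → 0 < k → hat m⟨ k ^ suc n ⟩ (a ∷ α) ≋ 𝟙 (a ≟ k) *ₜ hat m⟨ k ^ n ⟩ α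
hat-m-∷ k n a@(suc _) α 0<a 0<k = ≋-trans
  (𝟙-⇔ (≡-dec _≟_ (parts (toPartition (a ∷ α))) (replicate (suc n) k))
    ((a ≟ k) ×-dec (≡-dec _≟_ (parts (toPartition α)) (replicate n k)))
    (toPartition-∷-replicate k n a α 0<a 0<k)
    λ { (refl , e) → decreasing-↭ (decreasing (toPartition (a ∷ α))) (linked-const (suc n) k)
      (↭-trans (parts-toPartition-↭ (a ∷ α)) (prep a (↭-trans (↭-sym (parts-toPartition-↭ α)) (subst (_↭ replicate n k) (sym e) ↭-refl)))) })
  (𝟙-× (a ≟ k) (≡-dec _≟_ (parts (toPartition α)) (replicate n k)))

hat-m-0 : ∀ k → hat m⟨ k ^ 0 ⟩ ≗ one
hat-m-0 k = hat-1∞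

-- The sum of all power sums p_k, k ≥ 1.
power : ListFun
power []          = 0ₜ
power (zero ∷ α)  = power α
power (suc a ∷ α) = one α

hat-m-1 : ∀ k → 0 < k → ∀ α → hat m⟨ k ^ 1 ⟩ α ≋ 𝟙 (sum α ≟ k) *ₜ power α
hat-m-1 (suc k) 0<k []         = ≋-refl
hat-m-1 k 0<k (zero ∷ α)       = hat-m-1 k 0<k α
hat-m-1 k 0<k (suc a ∷ α)      = ≋-trans (hat-m-∷ k 0 (suc a) α (s≤s z≤n) 0<k)
  (≋-trans (*ₜ-congˡ (𝟙 (suc a ≟ k)) (hat-m-0 k α)) (≋-trans (*ₜ-comm (𝟙 (suc a ≟ k)) (one α))
    (≋-trans (𝟙-*-cong (sum α ≟ 0) λ e → ≡⇒≋ (cong (λ m → 𝟙 (m ≟ k)) (trans (sym (ℕ.+-identityʳ (suc a))) (cong (λ m → suc a + m) (sym e)))))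
      (*ₜ-comm (one α) (𝟙 (suc a + sum α ≟ k))))))

-- Newton's identity

num-one : ∀ n → (∑[ i ← upTo n ] 1ₜ) ≋ num n
num-one zero    = ≋-sym num-0
num-one (suc n) = ≋-trans (∑-upTo-suc n (λ _ → 1ₜ)) (≋-trans (+ₜ-congˡ 1ₜ (num-one n)) (≋-sym (num-+ 1 n)))

-- A way to write x^α as x_i^j times a monomial, with j positive, consists of a variable and an
-- exponent from 1 to α_i; there are |α| of them.
power-⋆-1 : ∀ α → (power ⋆ (λ _ → 1ₜ)) α ≋ num (sum α)
power-⋆-1 []      = ≋-sym num-0
power-⋆-1 (a ∷ α) = begin
  (power ⋆ (λ _ → 1ₜ)) (a ∷ α)
    ≈⟨ ⋆-∷ power (λ _ → 1ₜ) a α ⟩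
  (∑[ i ← upTo (suc a) ] ((i ∷ᶠ power) ⋆ (λ _ → 1ₜ)) α)
    ≈⟨ ∑-upTo-suc a (λ i → ((i ∷ᶠ power) ⋆ (λ _ → 1ₜ)) α) ⟩
  (power ⋆ (λ _ → 1ₜ)) α +ₜ (∑[ i ← upTo a ] (one ⋆ (λ _ → 1ₜ)) α)
    ≈⟨ +ₜ-cong (power-⋆-1 α) (≋-trans (∑-cong (upTo a) λ _ → ⋆-identityˡ (λ _ → 1ₜ) α) (num-one a)) ⟩
  num (sum α) +ₜ num a
    ≈⟨ ≋-trans (+ₜ-comm (num (sum α)) (num a)) (≋-sym (num-+ a (sum α))) ⟩
  num (a + sum α) ∎
  where open ≋-Reasoning

antidiag-δδ : ∀ m x y → antidiag m (λ i j → 𝟙 (x ≟ i) *ₜ 𝟙 (y ≟ j)) ≋ 𝟙 (x + y ≟ m)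
antidiag-δδ m x y = go (x ≤? m)
  where
  go : Dec (x ≤ m) → antidiag m (λ i j → 𝟙 (x ≟ i) *ₜ 𝟙 (y ≟ j)) ≋ 𝟙 (x + y ≟ m)
  go (no x≰m)  = ≋-trans
    (antidiag-zero m λ i j e → 𝟙-no* (x ≟ i) (λ { refl → x≰m (ℕ.≤-trans (ℕ.m≤m+n i j) (ℕ.≤-reflexive e)) }) (𝟙 (y ≟ j)))
    (≋-sym (𝟙-no (x + y ≟ m) λ e → x≰m (ℕ.≤-trans (ℕ.m≤m+n x y) (ℕ.≤-reflexive e))))
  go (yes x≤m) = ≋-trans
    (∑-upTo-δ (suc m) x {λ i → 𝟙 (x ≟ i) *ₜ 𝟙 (y ≟ m ∸ i)} (s≤s x≤m) λ i i≢x → 𝟙-no* (x ≟ i) (i≢x ∘ sym) (𝟙 (y ≟ m ∸ i)))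
    (≋-trans (𝟙-yes* (x ≟ x) refl (𝟙 (y ≟ m ∸ x)))
      (𝟙-⇔ (y ≟ m ∸ x) (x + y ≟ m) (λ e → trans (cong (λ z → x + z) e) (ℕ.m+[n∸m]≡n x≤m))
        λ e → trans (sym (ℕ.m+n∸m≡n x y)) (cong (_∸ x) e)))

-- h_n is complete homogeneous; p′ n is the power sum p_n (and 0 for n = 0).
h p′ : ℕ → ListFun
h n α = 𝟙 (sum α ≟ n)
p′ n α = 𝟙 (sum α ≟ n) *ₜ power α

-- This is the part of degree m in the product of the sum of all p_i by the sum of all h_n, whose
-- coefficients `power-⋆-1` gives.
newton : ∀ m α → antidiag m (λ i n → (p′ i ⋆ h n) α) ≋ num m *ₜ h m α
newton m α = begin
  antidiag m (λ i n → (p′ i ⋆ h n) α)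
    ≈⟨ ∑-swap (upTo (suc m)) (splittings α) (λ i (β , γ) → p′ i β *ₜ h (m ∸ i) γ) ⟩
  (∑[ (β , γ) ← splittings α ] antidiag m λ i n → p′ i β *ₜ h n γ)
    ≈⟨ ∑-congAll (All.map (λ { {β , γ} e → term β γ e }) (sum-splittings α)) ⟩
  (∑[ (β , γ) ← splittings α ] h m α *ₜ (power β *ₜ 1ₜ))
    ≈⟨ ∑-*ˡ (splittings α) (h m α) (λ (β , γ) → power β *ₜ 1ₜ) ⟨
  h m α *ₜ (power ⋆ (λ _ → 1ₜ)) α
    ≈⟨ *ₜ-congˡ (h m α) (power-⋆-1 α) ⟩
  h m α *ₜ num (sum α)
    ≈⟨ 𝟙-*-cong (sum α ≟ m) (λ e → ≡⇒≋ (cong num e)) ⟩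
  h m α *ₜ num m
    ≈⟨ *ₜ-comm (h m α) (num m) ⟩
  num m *ₜ h m α ∎
  where
  open ≋-Reasoning
  term : ∀ β γ → sum β + sum γ ≡ sum α → antidiag m (λ i n → p′ i β *ₜ h n γ) ≋ h m α *ₜ (power β *ₜ 1ₜ)
  term β γ e = begin
    antidiag m (λ i n → 𝟙 (sum β ≟ i) *ₜ power β *ₜ 𝟙 (sum γ ≟ n))
      ≈⟨ antidiag-cong m (λ i n _ → *ₜ-right (𝟙 (sum β ≟ i)) (power β) (𝟙 (sum γ ≟ n))) ⟩
    antidiag m (λ i n → 𝟙 (sum β ≟ i) *ₜ 𝟙 (sum γ ≟ n) *ₜ (power β *ₜ 1ₜ))
      ≈⟨ ∑-*ʳ (upTo (suc m)) (power β *ₜ 1ₜ) (λ i → 𝟙 (sum β ≟ i) *ₜ 𝟙 (sum γ ≟ m ∸ i)) ⟨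
    antidiag m (λ i n → 𝟙 (sum β ≟ i) *ₜ 𝟙 (sum γ ≟ n)) *ₜ (power β *ₜ 1ₜ)
      ≈⟨ *ₜ-congʳ (power β *ₜ 1ₜ) (≋-trans (antidiag-δδ m (sum β) (sum γ)) (≡⇒≋ (cong (λ k → 𝟙 (k ≟ m)) e))) ⟩
    h m α *ₜ (power β *ₜ 1ₜ) ∎
    where
    *ₜ-right : ∀ x y z → x *ₜ y *ₜ z ≋ x *ₜ z *ₜ (y *ₜ 1ₜ)
    *ₜ-right x y z = ≋-trans (≋-Solver.solve 3 (λ x y z → (x ⊠ y) ⊠ z ⊜ (x ⊠ z) ⊠ y) ≋-refl x y z)
      (*ₜ-congˡ (x *ₜ z) (≋-sym (*ₜ-identityʳ y)))

-- Splitting off one variable from Ω[f]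

open Derivation

firstExponent : Weight
firstExponent = record { weight = first ; additive = additive ; null = null }
  where
  first : List ℕ → ℕ
  first []      = 0
  first (a ∷ _) = a
  additive : ∀ α → All (λ (β , γ) → first β + first γ ≡ first α) (splittings α)
  additive = All-splittings (λ α β γ → first β + first γ ≡ first α) refl λ i+j≡a _ → i+j≡a
  null : ∀ α → sum α ≡ 0 → first α ≡ 0
  null []      e = refl
  null (a ∷ α) e = ℕ.m+n≡0⇒m≡0 a e

power-null : ∀ α → sum α ≡ 0 → power α ≋ 0ₜ
power-null []         e = ≋-refl
power-null (zero ∷ α) e = power-null α e

*ₜ-antidiag : ∀ c n φ → c *ₜ antidiag n φ ≋ antidiag n (λ i j → c *ₜ φ i j)
*ₜ-antidiag c n φ = ∑-*ˡ (upTo (suc n)) c (λ i → φ i (n ∸ i))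

antidiag-* : ∀ n φ c → antidiag n φ *ₜ c ≋ antidiag n (λ i j → φ i j *ₜ c)
antidiag-* n φ c = ∑-*ʳ (upTo (suc n)) c (λ i → φ i (n ∸ i))

-- The coefficient of x₁^a in C(x₁) ∏_{j>1} 1/(1 - x₁ xⱼ), where C has the coefficients χ; h_n is
-- the coefficient of x₁^n in the product over j.
q⟨_⟩ : (ℕ → ℚ[t]) → ℕ → ListFun
q⟨ χ ⟩ a β = antidiag a λ c n → χ c *ₜ h n β

-- Ω f = ∏ᵢ C(xᵢ) ∏_{i<j} 1/(1 - xᵢ xⱼ), where C(x) = Σ_c χ(c) x^c and
-- x C′(x)/C(x) = Σ_i ψ(i) x^i.
record Littlewood (f : Λ∞) (χ ψ : ℕ → ℚ[t]) : Set where
  field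
    χ-0 : χ 0 ≋ 1ₜ
    ψ-0 : ψ 0 ≋ 0ₜ
    ψ-χ : ∀ m → antidiag m (λ i c → ψ i *ₜ χ c) ≋ num m *ₜ χ m
    log : ∀ a α → 0 < a → num a *ₜ hat (∑p/k f) (a ∷ α) ≋ ψ a *ₜ one α +ₜ p′ a α

module _ {f χ ψ} (L : Littlewood f χ ψ) where
  open Littlewood L

  private
    g e A y : ListFun
    g = hat (∑p/k f)
    e = hat (Ω f)
    A = D firstExponent g
    -- The claimed factorisation: the factors containing x₁ times Ω f in the other variables.
    y []      = e []
    y (a ∷ α) = (q⟨ χ ⟩ a ⋆ e) α
    q = q⟨ χ ⟩

    A-∷ : ∀ i β → A (i ∷ β) ≋ ψ i *ₜ one β +ₜ p′ i β
    A-∷ zero β = ≋-trans (*ₜ-zeroˡ num-0 (g (0 ∷ β))) (≋-sym (+ₜ-0 (*ₜ-zeroˡ ψ-0 (one β))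
      (𝟙-*-zero (sum β ≟ 0) (power-null β))))
    A-∷ (suc i) β = log (suc i) β (s≤s z≤n)

    -- The product rule for C(x₁) ∏ 1/(1 - x₁ xⱼ): the logarithmic derivative of C is governed by
    -- `ψ-χ`, that of the product over j by Newton's identity in the remaining variables.
    A-⋆-q : ∀ a β → antidiag a (λ i j → ((i ∷ᶠ A) ⋆ q j) β) ≋ num a *ₜ q a β
    A-⋆-q a β = begin
      antidiag a (λ i j → ((i ∷ᶠ A) ⋆ q j) β)
        ≈⟨ antidiag-cong a (λ i j _ → ≋-trans (⋆-cong {g = q j} (A-∷ i) (λ _ → ≋-refl) β)
             (≋-trans (⋆-+ˡ (λ β → ψ i *ₜ one β) (p′ i) (q j) β)
               (+ₜ-congʳ ((p′ i ⋆ q j) β) (≋-trans (⋆-*ˡ (ψ i) one (q j) β) (*ₜ-congˡ (ψ i) (⋆-identityˡ (q j) β)))))) ⟩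
      antidiag a (λ i j → ψ i *ₜ q j β +ₜ (p′ i ⋆ q j) β)
        ≈⟨ antidiag-+ a (λ i j → ψ i *ₜ q j β) (λ i j → (p′ i ⋆ q j) β) ⟩
      antidiag a (λ i j → ψ i *ₜ q j β) +ₜ antidiag a (λ i j → (p′ i ⋆ q j) β)
        ≈⟨ +ₜ-cong diagonal off-diagonal ⟩
      antidiag a (λ c n → num c *ₜ χ c *ₜ h n β) +ₜ antidiag a (λ c n → χ c *ₜ (num n *ₜ h n β))
        ≈⟨ antidiag-+ a (λ c n → num c *ₜ χ c *ₜ h n β) (λ c n → χ c *ₜ (num n *ₜ h n β)) ⟨
      antidiag a (λ c n → num c *ₜ χ c *ₜ h n β +ₜ χ c *ₜ (num n *ₜ h n β))
        ≈⟨ antidiag-cong a (λ c n c+n≡a → ≋-trans (collect (num c) (num n) (χ c) (h n β))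
             (*ₜ-congʳ (χ c *ₜ h n β) (≋-trans (≋-sym (num-+ c n)) (≡⇒≋ (cong num c+n≡a))))) ⟩
      antidiag a (λ c n → num a *ₜ (χ c *ₜ h n β))
        ≈⟨ *ₜ-antidiag (num a) a (λ c n → χ c *ₜ h n β) ⟨
      num a *ₜ q a β ∎
      where
      open ≋-Reasoning
      collect : ∀ m n x z → m *ₜ x *ₜ z +ₜ x *ₜ (n *ₜ z) ≋ (m +ₜ n) *ₜ (x *ₜ z)
      collect = ≋-Solver.solve 4 (λ m n x z → m ⊠ x ⊠ z ⊹ x ⊠ (n ⊠ z) ⊜ (m ⊹ n) ⊠ (x ⊠ z)) ≋-refl
      diagonal : antidiag a (λ i j → ψ i *ₜ q j β) ≋ antidiag a (λ c n → num c *ₜ χ c *ₜ h n β)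
      diagonal = begin
        antidiag a (λ i j → ψ i *ₜ q j β)
          ≈⟨ antidiag-cong a (λ i j _ → ≋-trans (*ₜ-antidiag (ψ i) j λ c n → χ c *ₜ h n β)
               (antidiag-cong j λ c n _ → ≋-sym (*ₜ-assoc (ψ i) (χ c) (h n β)))) ⟩
        antidiag a (λ i j → antidiag j λ c n → ψ i *ₜ χ c *ₜ h n β)
          ≈⟨ antidiag-assoc a (λ i c n → ψ i *ₜ χ c *ₜ h n β) ⟨
        antidiag a (λ m n → antidiag m λ i c → ψ i *ₜ χ c *ₜ h n β)
          ≈⟨ antidiag-cong a (λ m n _ → ≋-trans (≋-sym (antidiag-* m (λ i c → ψ i *ₜ χ c) (h n β)))
               (*ₜ-congʳ (h n β) (ψ-χ m))) ⟩
        antidiag a (λ c n → num c *ₜ χ c *ₜ h n β) ∎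
      off-diagonal : antidiag a (λ i j → (p′ i ⋆ q j) β) ≋ antidiag a (λ c n → χ c *ₜ (num n *ₜ h n β))
      off-diagonal = begin
        antidiag a (λ i j → (p′ i ⋆ q j) β)
          ≈⟨ antidiag-cong a (λ i j _ → ≋-trans (⋆-∑ʳ (upTo (suc j)) (p′ i) (λ c β → χ c *ₜ h (j ∸ c) β) β)
               (antidiag-cong j λ c n _ → ⋆-*ʳ (χ c) (p′ i) (h n) β)) ⟩
        antidiag a (λ i j → antidiag j λ c n → χ c *ₜ (p′ i ⋆ h n) β)
          ≈⟨ antidiag-cong a (λ i j _ → antidiag-comm j λ c n → χ c *ₜ (p′ i ⋆ h n) β) ⟩
        antidiag a (λ i j → antidiag j λ n c → χ c *ₜ (p′ i ⋆ h n) β)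
          ≈⟨ antidiag-assoc a (λ i n c → χ c *ₜ (p′ i ⋆ h n) β) ⟨
        antidiag a (λ m c → antidiag m λ i n → χ c *ₜ (p′ i ⋆ h n) β)
          ≈⟨ antidiag-cong a (λ m c _ → ≋-trans (≋-sym (*ₜ-antidiag (χ c) m λ i n → (p′ i ⋆ h n) β))
               (*ₜ-congˡ (χ c) (newton m β))) ⟩
        antidiag a (λ m c → χ c *ₜ (num m *ₜ h m β))
          ≈⟨ antidiag-comm a (λ m c → χ c *ₜ (num m *ₜ h m β)) ⟩
        antidiag a (λ c m → χ c *ₜ (num m *ₜ h m β)) ∎

    D-y : D firstExponent y ≗ A ⋆ y
    D-y []      = ≋-trans (*ₜ-zeroˡ num-0 (e []))
      (≋-sym (≋-trans (+ₜ-identityʳ (A [] *ₜ e [])) (*ₜ-zeroˡ (*ₜ-zeroˡ num-0 (g [])) (e []))))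
    D-y (a ∷ α) = begin
      num a *ₜ (q a ⋆ e) α
        ≈⟨ ⋆-*ˡ (num a) (q a) e α ⟨
      ((λ β → num a *ₜ q a β) ⋆ e) α
        ≈⟨ ⋆-cong {g = e} (A-⋆-q a) (λ _ → ≋-refl) α ⟨
      ((λ β → antidiag a λ i j → ((i ∷ᶠ A) ⋆ q j) β) ⋆ e) α
        ≈⟨ ⋆-∑ˡ (upTo (suc a)) (λ i → (i ∷ᶠ A) ⋆ q (a ∸ i)) e α ⟩
      antidiag a (λ i j → (((i ∷ᶠ A) ⋆ q j) ⋆ e) α)
        ≈⟨ antidiag-cong a (λ i j _ → ⋆-assoc (i ∷ᶠ A) (q j) e α) ⟩
      antidiag a (λ i j → ((i ∷ᶠ A) ⋆ (j ∷ᶠ y)) α)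
        ≈⟨ ⋆-∷ A y a α ⟨
      (A ⋆ y) (a ∷ α) ∎
      where open ≋-Reasoning

    D-e : D firstExponent e ≗ A ⋆ e
    D-e α = ≋-trans (D-cong firstExponent (hat-exp (∑p/k f)) α)
      (≋-trans (D-exp firstExponent {g} (∑p/k-noConst f) α)
        (⋆-cong {f = A} (λ _ → ≋-refl) (λ β → ≋-sym (hat-exp (∑p/k f) β)) α))

    e-0 : ∀ α → Weight.weight firstExponent α ≡ 0 → e α ≋ y α
    e-0 []         _ = ≋-refl
    e-0 (zero ∷ α) _ = ≋-sym (≋-trans (⋆-cong {g = e} (λ β → ≋-trans (+ₜ-identityʳ (χ 0 *ₜ h 0 β))
        (≋-trans (*ₜ-congʳ (h 0 β) χ-0) (*ₜ-identityˡ (h 0 β)))) (λ _ → ≋-refl) α)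
      (⋆-identityˡ e α))

  Ω-∷ : ∀ a α → hat (Ω f) (a ∷ α) ≋ (q⟨ χ ⟩ a ⋆ hat (Ω f)) α
  Ω-∷ a α = D-unique firstExponent {A} {e} {y} (λ β → D-null firstExponent g β) D-e D-y e-0 (a ∷ α)

-- Logarithmic derivatives for the three nonempty shapes

num-half : ∀ d .{{_ : NonZero d}} → num (d + d) *ₜ const (+ 1 ℚ./ d) ≋ num 2
num-half d = begin
  num (d + d) *ₜ const (+ 1 ℚ./ d)                                     ≈⟨ *ₜ-congʳ (const (+ 1 ℚ./ d)) (num-+ d d) ⟩
  (num d +ₜ num d) *ₜ const (+ 1 ℚ./ d)                                ≈⟨ *ₜ-distribʳ (const (+ 1 ℚ./ d)) (num d) (num d) ⟩
  num d *ₜ const (+ 1 ℚ./ d) +ₜ num d *ₜ const (+ 1 ℚ./ d)             ≈⟨ +ₜ-cong inverse inverse ⟩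
  1ₜ +ₜ 1ₜ                                                             ≈⟨ num-+ 1 1 ⟨
  num 2                                                                ∎
  where
  open ≋-Reasoning
  inverse : num d *ₜ const (+ 1 ℚ./ d) ≋ 1ₜ
  inverse = num-inverse d 1 d (ℕ.*-identityʳ d)

hat-∑p/k : ∀ A α → hat (∑p/k A) α ≋ (∑[ j ← upTo (sum α) ] const (+ 1 ℚ./ suc j) *ₜ hat (p[ suc j ] A) α)
hat-∑p/k A α rewrite ∣toPartition∣ α = ≋-refl

hat-∑p/k-m : ∀ d n a α → 0 < d → 0 < a → hat (∑p/k m⟨ d ^ suc n ⟩) (a ∷ α) ≋
  (∑[ j ← upTo (a + sum α) ] const (+ 1 ℚ./ suc j) *ₜ (𝟙 (a ≟ d * suc j) *ₜ hat m⟨ d * suc j ^ n ⟩ α))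
hat-∑p/k-m d n a α 0<d 0<a = ≋-trans (hat-∑p/k m⟨ d ^ suc n ⟩ (a ∷ α))
  (∑-cong (upTo (a + sum α)) λ j → *ₜ-congˡ (const (+ 1 ℚ./ suc j)) (≋-trans
    (p[]-m (suc j) d (suc n) 0<d (toPartition (a ∷ α)))
    (hat-m-∷ (d * suc j) n a α 0<a (ℕ.<-≤-trans 0<d (ℕ.m≤m*n d (suc j))))))

-- Since p_k replaces the parts 1 by k, only k = a produces x₁^a, and the factor a cancels 1/k.
log-m-1 : ∀ n a α → 0 < a → num a *ₜ hat (∑p/k m⟨ 1 ^ suc n ⟩) (a ∷ α) ≋ hat m⟨ a ^ n ⟩ α
log-m-1 n (suc a) α 0<a = begin
  num (suc a) *ₜ hat (∑p/k m⟨ 1 ^ suc n ⟩) (suc a ∷ α)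
    ≈⟨ *ₜ-congˡ (num (suc a)) (≋-trans (hat-∑p/k-m 1 n (suc a) α (s≤s z≤n) 0<a)
         (∑-upTo-δ (suc a + sum α) a (s≤s (ℕ.m≤m+n a (sum α))) λ j j≢a → *ₜ-zeroʳ′ (const (+ 1 ℚ./ suc j))
           (𝟙-no* (suc a ≟ 1 * suc j) (λ e → j≢a (sym (ℕ.suc-injective (trans e (ℕ.*-identityˡ (suc j))))))
             (hat m⟨ 1 * suc j ^ n ⟩ α)))) ⟩
  num (suc a) *ₜ (const (+ 1 ℚ./ suc a) *ₜ (𝟙 (suc a ≟ 1 * suc a) *ₜ hat m⟨ 1 * suc a ^ n ⟩ α))
    ≈⟨ *ₜ-assoc (num (suc a)) (const (+ 1 ℚ./ suc a)) (𝟙 (suc a ≟ 1 * suc a) *ₜ hat m⟨ 1 * suc a ^ n ⟩ α) ⟨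
  num (suc a) *ₜ const (+ 1 ℚ./ suc a) *ₜ (𝟙 (suc a ≟ 1 * suc a) *ₜ hat m⟨ 1 * suc a ^ n ⟩ α)
    ≈⟨ *ₜ-cong (num-inverse (suc a) 1 (suc a) (ℕ.*-identityʳ (suc a)))
         (𝟙-yes* (suc a ≟ 1 * suc a) (sym (ℕ.*-identityˡ (suc a))) (hat m⟨ 1 * suc a ^ n ⟩ α)) ⟩
  1ₜ *ₜ hat m⟨ 1 * suc a ^ n ⟩ α
    ≈⟨ *ₜ-identityˡ (hat m⟨ 1 * suc a ^ n ⟩ α) ⟩
  hat m⟨ 1 * suc a ^ n ⟩ α
    ≡⟨ cong (λ k → hat m⟨ k ^ n ⟩ α) (ℕ.*-identityˡ (suc a)) ⟩
  hat m⟨ suc a ^ n ⟩ α ∎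
  where open ≋-Reasoning

-- Coefficients of 1/(1 - x²) and of its logarithmic derivative 2x²/(1 - x²).
χ-even ψ-even : ℕ → ℚ[t]
χ-even 0             = 1ₜ
χ-even 1             = 0ₜ
χ-even (suc (suc n)) = χ-even n
ψ-even 0             = 0ₜ
ψ-even 1             = 0ₜ
ψ-even (suc (suc n)) = num 2 *ₜ χ-even n

-- As `χ-even` has period 2, taking off the last two terms lowers m by 2; of these two only the one
-- with χ(0) is nonzero.
ψ-χ-even : ∀ m → antidiag m (λ i c → ψ-even i *ₜ χ-even c) ≋ num m *ₜ χ-even m
ψ-χ-even 0 = ≋-sym (*ₜ-zeroˡ num-0 1ₜ)
ψ-χ-even 1 = ≋-sym (*ₜ-zeroʳ (num 1))
ψ-χ-even (suc (suc m)) = begin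
  antidiag (2 + m) (λ i c → ψ-even i *ₜ χ-even c)
    ≈⟨ antidiag-last (suc m) (λ i c → ψ-even i *ₜ χ-even c) ⟩
  antidiag (suc m) (λ i c → ψ-even i *ₜ χ-even (suc c)) +ₜ num 2 *ₜ χ-even m *ₜ 1ₜ
    ≈⟨ +ₜ-cong (antidiag-last m (λ i c → ψ-even i *ₜ χ-even (suc c))) (*ₜ-identityʳ (num 2 *ₜ χ-even m)) ⟩
  antidiag m (λ i c → ψ-even i *ₜ χ-even c) +ₜ ψ-even (suc m) *ₜ 0ₜ +ₜ num 2 *ₜ χ-even m
    ≈⟨ +ₜ-congʳ (num 2 *ₜ χ-even m) (≋-trans (+ₜ-congˡ (antidiag m λ i c → ψ-even i *ₜ χ-even c) (*ₜ-zeroʳ (ψ-even (suc m))))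
         (+ₜ-identityʳ (antidiag m λ i c → ψ-even i *ₜ χ-even c))) ⟩
  antidiag m (λ i c → ψ-even i *ₜ χ-even c) +ₜ num 2 *ₜ χ-even m
    ≈⟨ +ₜ-congʳ (num 2 *ₜ χ-even m) (ψ-χ-even m) ⟩
  num m *ₜ χ-even m +ₜ num 2 *ₜ χ-even m
    ≈⟨ *ₜ-distribʳ (χ-even m) (num m) (num 2) ⟨
  (num m +ₜ num 2) *ₜ χ-even m
    ≈⟨ *ₜ-congʳ (χ-even m) (≋-trans (≋-sym (num-+ m 2)) (≡⇒≋ (cong num (ℕ.+-comm m 2)))) ⟩
  num (2 + m) *ₜ χ-even m ∎
  where open ≋-Reasoning

data Parity : ℕ → Set where
  even : ∀ b → Parity (b + b)
  odd  : ∀ b → Parity (suc (b + b))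

parity : ∀ n → Parity n
parity zero = even 0
parity (suc n) with parity n
... | even b = odd b
... | odd b  = subst Parity (cong suc (ℕ.+-suc b b)) (even (suc b))

χ-even-even : ∀ b → χ-even (b + b) ≋ 1ₜ
χ-even-even zero    = ≋-refl
χ-even-even (suc b) = ≋-trans (≡⇒≋ (cong (χ-even ∘ suc) (ℕ.+-suc b b))) (χ-even-even b)

χ-even-odd : ∀ b → χ-even (suc (b + b)) ≋ 0ₜ
χ-even-odd zero    = ≋-refl
χ-even-odd (suc b) = ≋-trans (≡⇒≋ (cong (χ-even ∘ suc ∘ suc) (ℕ.+-suc b b))) (χ-even-odd b)

2*-≡ : ∀ b → 2 * b ≡ b + b
2*-≡ b = cong (λ n → b + n) (ℕ.+-identityʳ b)

double-injective : ∀ {b c} → b + b ≡ c + c → b ≡ c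
double-injective {zero}  {zero}  e = refl
double-injective {suc b} {suc c} e = cong suc (double-injective (ℕ.suc-injective
  (trans (sym (ℕ.+-suc b b)) (trans (ℕ.suc-injective e) (ℕ.+-suc c c)))))

double-≢ : ∀ {b c} → suc (b + b) ≢ c + c
double-≢ {b} {suc c} e = double-≢ {c} {b} (sym (trans (ℕ.suc-injective e) (ℕ.+-suc c c)))

-- Since p_k[m_2] = m_(2k), only k = a/2 contributes, with a · 1/k = 2. This is the 2 in `ψ-even`.
log-m-2 : ∀ a α → 0 < a → num a *ₜ hat (∑p/k m⟨ 2 ^ 1 ⟩) (a ∷ α) ≋ ψ-even a *ₜ one α
log-m-2 a α 0<a = ≋-trans (*ₜ-congˡ (num a) (≋-trans (hat-∑p/k-m 2 0 a α (s≤s z≤n) 0<a)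
    (∑-cong (upTo (a + sum α)) λ j → *ₜ-congˡ (const (+ 1 ℚ./ suc j)) (*ₜ-congˡ (𝟙 (a ≟ 2 * suc j)) (hat-m-0 (2 * suc j) α)))))
  (go a (parity a) 0<a)
  where
  open ≋-Reasoning
  go : ∀ a → Parity a → 0 < a →
    num a *ₜ (∑[ j ← upTo (a + sum α) ] const (+ 1 ℚ./ suc j) *ₜ (𝟙 (a ≟ 2 * suc j) *ₜ one α)) ≋ ψ-even a *ₜ one α
  go _ (odd b) _ = ≋-trans
    (*ₜ-zeroʳ′ (num (suc (b + b))) (∑-zero (upTo (suc (b + b) + sum α)) λ j → *ₜ-zeroʳ′ (const (+ 1 ℚ./ suc j))
      (𝟙-no* (suc (b + b) ≟ 2 * suc j) (λ e → double-≢ {b} {suc j} (trans e (2*-≡ (suc j)))) (one α))))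
    (≋-sym (*ₜ-zeroˡ (ψ-odd b) (one α)))
    where
    ψ-odd : ∀ b → ψ-even (suc (b + b)) ≋ 0ₜ
    ψ-odd zero    = ≋-refl
    ψ-odd (suc b) = *ₜ-zeroʳ′ (num 2) (≋-trans (≡⇒≋ (cong χ-even (ℕ.+-suc b b))) (χ-even-odd b))
  go _ (even (suc b)) _ = begin
    num d+d *ₜ (∑[ j ← upTo (d+d + sum α) ] const (+ 1 ℚ./ suc j) *ₜ (𝟙 (d+d ≟ 2 * suc j) *ₜ one α))
      ≈⟨ *ₜ-congˡ (num d+d) (∑-upTo-δ (d+d + sum α) b {λ j → const (+ 1 ℚ./ suc j) *ₜ (𝟙 (d+d ≟ 2 * suc j) *ₜ one α)}
           (s≤s (ℕ.≤-trans (ℕ.m≤m+n b (suc b)) (ℕ.m≤m+n (b + suc b) (sum α))))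
           λ j j≢b → *ₜ-zeroʳ′ (const (+ 1 ℚ./ suc j)) (𝟙-no* (d+d ≟ 2 * suc j)
             (λ e → j≢b (sym (ℕ.suc-injective (double-injective {suc b} {suc j} (trans e (2*-≡ (suc j))))))) (one α))) ⟩
    num d+d *ₜ (const (+ 1 ℚ./ suc b) *ₜ (𝟙 (d+d ≟ 2 * suc b) *ₜ one α))
      ≈⟨ *ₜ-assoc (num d+d) (const (+ 1 ℚ./ suc b)) (𝟙 (d+d ≟ 2 * suc b) *ₜ one α) ⟨
    num d+d *ₜ const (+ 1 ℚ./ suc b) *ₜ (𝟙 (d+d ≟ 2 * suc b) *ₜ one α)
      ≈⟨ *ₜ-cong (num-half (suc b)) (𝟙-yes* (d+d ≟ 2 * suc b) (sym (2*-≡ (suc b))) (one α)) ⟩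
    num 2 *ₜ one α
      ≈⟨ *ₜ-congʳ (one α) (≋-trans (*ₜ-congˡ (num 2) (≋-trans (≡⇒≋ (cong (χ-even ∘ ℕ.pred) (ℕ.+-suc b b))) (χ-even-even b)))
           (*ₜ-identityʳ (num 2))) ⟨
    num 2 *ₜ χ-even (ℕ.pred (b + suc b)) *ₜ one α
      ≡⟨ cong (λ n → num 2 *ₜ χ-even (ℕ.pred n) *ₜ one α) (ℕ.+-suc b b) ⟩
    num 2 *ₜ χ-even (b + b) *ₜ one α
      ≡⟨ cong (λ n → ψ-even (suc n) *ₜ one α) (ℕ.+-suc b b) ⟨
    ψ-even d+d *ₜ one α ∎
    where d+d = suc b + suc b

log-cong : ∀ {f f′} → f ≋∞ f′ → ∀ a α → num a *ₜ hat (∑p/k f) (a ∷ α) ≋ num a *ₜ hat (∑p/k f′) (a ∷ α)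
log-cong e a α = *ₜ-congˡ (num a) (∑p/k-cong e (toPartition (a ∷ α)))

log-⊕ : ∀ f f′ a α → num a *ₜ hat (∑p/k (f ⊕ f′)) (a ∷ α) ≋
  num a *ₜ hat (∑p/k f) (a ∷ α) +ₜ num a *ₜ hat (∑p/k f′) (a ∷ α)
log-⊕ f f′ a α = ≋-trans (*ₜ-congˡ (num a) (∑p/k-⊕ f f′ (toPartition (a ∷ α))))
  (*ₜ-distribˡ (num a) (hat (∑p/k f) (a ∷ α)) (hat (∑p/k f′) (a ∷ α)))

χ-zero : ℕ → ℚ[t]
χ-zero c = 𝟙 (c ≟ 0)

χ-all ψ-all : ℕ → ℚ[t]
χ-all _       = 1ₜ
ψ-all zero    = 0ₜ
ψ-all (suc _) = 1ₜ

log-m-11 : ∀ a α → 0 < a → num a *ₜ hat (∑p/k m⟨ 1 ^ 2 ⟩) (a ∷ α) ≋ p′ a α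
log-m-11 a α 0<a = ≋-trans (log-m-1 1 a α 0<a) (hat-m-1 a 0<a α)

-- In all three cases m_(1,1) yields the factors 1/(1 - xᵢ xⱼ). What is left of f, namely 0, m_2 and
-- m_1 for ▯, ▭ and □, yields C = 1, 1/(1 - x²) and 1/(1 - x).
littlewood-▯ : Littlewood f[ ▯ ] χ-zero (λ _ → 0ₜ)
littlewood-▯ = record
  { χ-0 = ≋-refl
  ; ψ-0 = ≋-refl
  ; ψ-χ = λ m → ≋-trans (antidiag-zero m λ i c _ → ≋-refl) (≋-sym (zero-product m))
  ; log = λ a α 0<a → ≋-trans (log-cong s-11 a α) (log-m-11 a α 0<a)
  }
  where
  zero-product : ∀ m → num m *ₜ χ-zero m ≋ 0ₜ
  zero-product zero    = *ₜ-zeroˡ num-0 1ₜ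
  zero-product (suc m) = *ₜ-zeroʳ (num (suc m))

littlewood-▭ : Littlewood f[ ▭ ] χ-even ψ-even
littlewood-▭ = record
  { χ-0 = ≋-refl
  ; ψ-0 = ≋-refl
  ; ψ-χ = ψ-χ-even
  ; log = λ a α 0<a → ≋-trans (log-cong s-2 a α) (≋-trans (log-⊕ m⟨ 2 ^ 1 ⟩ m⟨ 1 ^ 2 ⟩ a α)
      (+ₜ-cong (log-m-2 a α 0<a) (log-m-11 a α 0<a)))
  }

littlewood-□ : Littlewood f[ □ ] χ-all ψ-all
littlewood-□ = record
  { χ-0 = ≋-refl
  ; ψ-0 = ≋-refl
  ; ψ-χ = λ m → ≋-trans (antidiag-cong m λ i _ _ → *ₜ-identityʳ (ψ-all i))
      (≋-trans (∑-upTo-suc m ψ-all) (≋-trans (num-one m) (≋-sym (*ₜ-identityʳ (num m)))))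
  ; log = λ a α 0<a → ≋-trans (log-⊕ (coeff (s ⟦1⟧)) (coeff (s ⟦1,1⟧)) a α)
      (+ₜ-cong (≋-trans (log-cong s-1 a α) (≋-trans (log-m-1 0 a α 0<a) (≋-trans (hat-m-0 a α) (≋-sym (ψ-one a α 0<a)))))
        (≋-trans (log-cong s-11 a α) (log-m-11 a α 0<a)))
  }
  where
  ψ-one : ∀ a α → 0 < a → ψ-all a *ₜ one α ≋ one α
  ψ-one (suc a) α _ = *ₜ-identityˡ (one α)

-- Interlacing shapes

le : ℕ → ℕ → ℚ[t]
le m n = 𝟙 (m ≤? n)

le-⊓ : ∀ r m n → le r (m ⊓ n) ≋ le r m *ₜ le r n
le-⊓ r m n = ≋-trans (𝟙-⇔ (r ≤? m ⊓ n) ((r ≤? m) ×-dec (r ≤? n))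
    (λ r≤ → ℕ.≤-trans r≤ (ℕ.m⊓n≤m m n) , ℕ.≤-trans r≤ (ℕ.m⊓n≤n m n)) λ (r≤m , r≤n) → ℕ.⊓-glb r≤m r≤n)
  (𝟙-× (r ≤? m) (r ≤? n))

le-⊔ : ∀ m n x → le (m ⊔ n) x ≋ le m x *ₜ le n x
le-⊔ m n x = ≋-trans (𝟙-⇔ (m ⊔ n ≤? x) ((m ≤? x) ×-dec (n ≤? x))
    (λ ≤x → ℕ.≤-trans (ℕ.m≤m⊔n m n) ≤x , ℕ.≤-trans (ℕ.m≤n⊔m m n) ≤x) λ (m≤x , n≤x) → ℕ.⊔-lub m≤x n≤x)
  (𝟙-× (m ≤? x) (n ≤? x))

-- Shapes are summed over as arbitrary vectors with n rows below N, interlacing being left to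
-- indicators, so that sums can be taken row by row. N only has to exceed all sizes that occur.
box : ℕ → ℕ → List (List ℕ)
box N zero    = [] ∷ []
box N (suc n) = concatMap (λ i → map (i ∷_) (box N n)) (upTo N)

∑-box-suc : ∀ N n (g : ListFun) → ∑ (box N (suc n)) g ≋ (∑[ i ← upTo N ] ∑[ α ← box N n ] g (i ∷ α))
∑-box-suc N n g = ≋-trans (∑-concatMap (λ i → map (i ∷_) (box N n)) (upTo N) g)
  (∑-cong (upTo N) λ i → ∑-map (i ∷_) (box N n) g)

InBox : ℕ → ℕ → List ℕ → Set
InBox N n α = length α ≡ n × All (_< N) α

box-sound : ∀ N n → All (InBox N n) (box N n)
box-sound N zero    = (refl , []) ∷ []
box-sound N (suc n) = All.concat⁺ (All.map⁺ (All.applyUpTo⁺₁ id N λ i<N →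
  All.map⁺ (All.map (λ (e , <N) → cong suc e , i<N ∷ <N) (box-sound N n))))

∑-box-congᴵ : ∀ {N n} {f g : ListFun} → (∀ α → InBox N n α → f α ≋ g α) → ∑ (box N n) f ≋ ∑ (box N n) g
∑-box-congᴵ {N} {n} e = ∑-congAll (All.map (λ {α} → e α) (box-sound N n))

-- For shapes padded by zeros, Up μ λ says that λ/μ is a horizontal strip when
-- λ has one more row than μ, and Down λ μ says the same when they have equally
-- many rows.
cap : ℕ → List ℕ → ℚ[t]
cap x []      = 1ₜ
cap x (l ∷ _) = le l x

Up Down : List ℕ → List ℕ → ℚ[t]
Up []      λ′       = 1ₜ
Up (m ∷ μ) []       = 0ₜ
Up (m ∷ μ) (l ∷ λ′) = le m l *ₜ (cap m λ′ *ₜ Up μ λ′)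
Down []       ρ = 1ₜ
Down (x ∷ μ) ρ = cap x ρ *ₜ Up μ ρ

within : (los his ρ : List ℕ) → ℚ[t]
within (lo ∷ los) (hi ∷ his) (r ∷ ρ) = le lo r *ₜ le r hi *ₜ within los his ρ
within _          _          _       = 1ₜ

-- For a shape obtained from both ν and λ by adding horizontal strips, `top` is the least possible
-- first row, which has no upper bound; `los` and `his` bound the rows below it.
top : (ν λ′ : List ℕ) → ℕ
top _       []      = 0
top []      (l ∷ _) = l
top (m ∷ _) (l ∷ _) = m ⊔ l

los his : (ν λ′ : List ℕ) → List ℕ
los (m ∷ ν) (l ∷ λ′) = top ν λ′ ∷ los ν λ′
los _       _        = []
his (m ∷ ν) (l ∷ λ′) = m ⊓ l ∷ his ν λ′
his _       _        = []

mutual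
  -- The interlacing conditions decouple into one interval for each row. The shapes above ν and λ,
  -- without their first row x, and the shapes ρ below ν and λ have the same intervals, from
  -- max(νᵢ₊₁, λᵢ₊₁) to min(νᵢ, λᵢ). This coincidence is why strips can be interchanged.
  Up-Down : ∀ ν l λ′ x μ → length λ′ ≡ length ν → length μ ≡ length ν →
    Up ν (x ∷ μ) *ₜ Down (x ∷ μ) (l ∷ λ′) ≋ le (top ν (l ∷ λ′)) x *ₜ within (los ν (l ∷ λ′)) (his ν (l ∷ λ′)) μ
  Up-Down []      l λ′ x []      eλ eμ = *ₜ-identityˡ (le l x *ₜ 1ₜ)
  Up-Down (m ∷ ν) l λ′ x μ       eλ eμ = begin
    le m x *ₜ (cap m μ *ₜ Up ν μ) *ₜ (le l x *ₜ Up μ (l ∷ λ′))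
      ≈⟨ *ₜ-interchange (le m x) (cap m μ *ₜ Up ν μ) (le l x) (Up μ (l ∷ λ′)) ⟩
    le m x *ₜ le l x *ₜ (Down (m ∷ ν) μ *ₜ Up μ (l ∷ λ′))
      ≈⟨ *ₜ-cong (≋-sym (le-⊔ m l x)) (Down-Up (m ∷ ν) μ (l ∷ λ′) eμ (cong suc eλ)) ⟩
    le (m ⊔ l) x *ₜ within (los (m ∷ ν) (l ∷ λ′)) (his (m ∷ ν) (l ∷ λ′)) μ ∎
    where open ≋-Reasoning

  Down-Up : ∀ ν ρ λ′ → length ρ ≡ length ν → length λ′ ≡ suc (length ν) →
    Down ν ρ *ₜ Up ρ λ′ ≋ within (los ν λ′) (his ν λ′) ρ
  Down-Up []      []      (l ∷ [])      eρ eλ = *ₜ-identityˡ 1ₜ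
  Down-Up (m ∷ ν) (r ∷ ρ) (l ∷ l′ ∷ λ′) eρ eλ = begin
    le r m *ₜ Up ν (r ∷ ρ) *ₜ (le r l *ₜ Down (r ∷ ρ) (l′ ∷ λ′))
      ≈⟨ *ₜ-interchange (le r m) (Up ν (r ∷ ρ)) (le r l) (Down (r ∷ ρ) (l′ ∷ λ′)) ⟩
    le r m *ₜ le r l *ₜ (Up ν (r ∷ ρ) *ₜ Down (r ∷ ρ) (l′ ∷ λ′))
      ≈⟨ *ₜ-cong (≋-sym (le-⊓ r m l)) (Up-Down ν l′ λ′ r ρ (ℕ.suc-injective (ℕ.suc-injective eλ)) (ℕ.suc-injective eρ)) ⟩
    le r (m ⊓ l) *ₜ (le t r *ₜ W)
      ≈⟨ ≋-trans (≋-sym (*ₜ-assoc (le r (m ⊓ l)) (le t r) W)) (*ₜ-congʳ W (*ₜ-comm (le r (m ⊓ l)) (le t r))) ⟩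
    le t r *ₜ le r (m ⊓ l) *ₜ W ∎
    where
    open ≋-Reasoning
    t = top ν (l′ ∷ λ′)
    W = within (los ν (l′ ∷ λ′)) (his ν (l′ ∷ λ′)) ρ

⊔+⊓ : ∀ m n → (m ⊔ n) + (m ⊓ n) ≡ m + n
⊔+⊓ m n with ℕ.≤-total m n
... | inj₁ m≤n = trans (cong₂ _+_ (ℕ.m≤n⇒m⊔n≡n m≤n) (ℕ.m≤n⇒m⊓n≡m m≤n)) (ℕ.+-comm n m)
... | inj₂ n≤m = cong₂ _+_ (ℕ.m≥n⇒m⊔n≡m n≤m) (ℕ.m≥n⇒m⊓n≡n n≤m)

-- Each pair of rows contributes its maximum to `top` or `los` and its minimum to `his`; the last
-- row of λ has no partner and contributes itself.
top+los+his : ∀ ν λ′ → length λ′ ≡ suc (length ν) →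
  top ν λ′ + (sum (los ν λ′) + sum (his ν λ′)) ≡ sum ν + sum λ′
top+los+his []      (l ∷ [])  e = refl
top+los+his (m ∷ ν) (l ∷ λ′) e = begin
  (m ⊔ l) + (t + L + ((m ⊓ l) + H′))
    ≡⟨ solve 5 (λ x t L y H → x :+ (t :+ L :+ (y :+ H)) := (x :+ y) :+ (t :+ (L :+ H))) refl (m ⊔ l) t L (m ⊓ l) H′ ⟩
  (m ⊔ l) + (m ⊓ l) + (t + (L + H′))
    ≡⟨ cong₂ _+_ (⊔+⊓ m l) (top+los+his ν λ′ (ℕ.suc-injective e)) ⟩
  m + l + (sum ν + sum λ′)
    ≡⟨ solve 4 (λ m l x y → (m :+ l) :+ (x :+ y) := (m :+ x) :+ (l :+ y)) refl m l (sum ν) (sum λ′) ⟩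
  m + sum ν + (l + sum λ′) ∎
  where
  open ≡-Reasoning
  open +-*-Solver
  t = top ν λ′
  L = sum (los ν λ′)
  H′ = sum (his ν λ′)

his≤ : ∀ ν λ′ → sum (his ν λ′) ≤ sum ν
his≤ []      λ′       = z≤n
his≤ (m ∷ ν) []       = z≤n
his≤ (m ∷ ν) (l ∷ λ′) = ℕ.+-mono-≤ (ℕ.m⊓n≤m m l) (his≤ ν λ′)

his< : ∀ {N} ν λ′ → All (_< N) λ′ → All (_< N) (his ν λ′)
his< []      λ′       λ<N         = []
his< (m ∷ ν) []       λ<N         = []
his< (m ∷ ν) (l ∷ λ′) (l<N ∷ λ<N) = ℕ.≤-<-trans (ℕ.m⊓n≤n m l) l<N ∷ his< ν λ′ λ<N

length-los-his : ∀ ν λ′ → length (los ν λ′) ≡ length (his ν λ′)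
length-los-his []      λ′       = refl
length-los-his (m ∷ ν) []       = refl
length-los-his (m ∷ ν) (l ∷ λ′) = cong suc (length-los-his ν λ′)

length-his : ∀ ν λ′ → length λ′ ≡ suc (length ν) → length (his ν λ′) ≡ length ν
length-his []      λ′       e = refl
length-his (m ∷ ν) (l ∷ λ′) e = cong suc (length-his ν λ′ (ℕ.suc-injective e))

-- Reflection of intervals

∑-upTo-shift : ∀ k n (f : ℕ → ℚ[t]) → (∀ i → i < k → f i ≋ 0ₜ) → ∑ (upTo (k + n)) f ≋ (∑[ i ← upTo n ] f (k + i))
∑-upTo-shift zero    n f z = ≋-refl
∑-upTo-shift (suc k) n f z = ≋-trans (∑-upTo-suc (k + n) f)
  (+ₜ-cong (z 0 (s≤s z≤n)) (∑-upTo-shift k n (f ∘ suc) λ i i<k → z (suc i) (s≤s i<k)))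

∑-interval : ∀ {N lo hi} (φ : ℕ → ℚ[t]) → lo ≤ hi → hi < N →
  (∑[ r ← upTo N ] le lo r *ₜ le r hi *ₜ φ r) ≋ antidiag (hi ∸ lo) (λ p q → φ (lo + p))
∑-interval {N} {lo} {hi} φ lo≤hi hi<N = begin
  ∑ (upTo N) f
    ≈⟨ ∑-upTo-≤ f hi<N (λ r hi<r _ → *ₜ-zeroˡ (*ₜ-zeroʳ′ (le lo r) (𝟙-no (r ≤? hi) (ℕ.<⇒≱ hi<r))) (φ r)) ⟩
  ∑ (upTo (suc hi)) f
    ≡⟨ cong (λ n → ∑ (upTo n) f) (sym (trans (ℕ.+-suc lo (hi ∸ lo)) (cong suc (ℕ.m+[n∸m]≡n lo≤hi)))) ⟩
  ∑ (upTo (lo + suc (hi ∸ lo))) f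
    ≈⟨ ∑-upTo-shift lo (suc (hi ∸ lo)) f (λ r r<lo → *ₜ-zeroˡ (𝟙-no* (lo ≤? r) (ℕ.<⇒≱ r<lo) (le r hi)) (φ r)) ⟩
  (∑[ p ← upTo (suc (hi ∸ lo)) ] f (lo + p))
    ≈⟨ ∑-upTo-cong (suc (hi ∸ lo)) (λ { p (s≤s p≤) → ≋-trans
         (*ₜ-congʳ (φ (lo + p)) (≋-trans (𝟙-yes* (lo ≤? lo + p) (ℕ.m≤m+n lo p) (le (lo + p) hi))
           (𝟙-yes (lo + p ≤? hi) (ℕ.≤-trans (ℕ.+-monoʳ-≤ lo p≤) (ℕ.≤-reflexive (ℕ.m+[n∸m]≡n lo≤hi))))))
         (*ₜ-identityˡ (φ (lo + p))) }) ⟩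
  antidiag (hi ∸ lo) (λ p q → φ (lo + p)) ∎
  where
  open ≋-Reasoning
  f : ℕ → ℚ[t]
  f r = le lo r *ₜ le r hi *ₜ φ r

-- The substitution r ↦ lo + hi - r. The bound r′ ≤ hi is passed on because it later guarantees that
-- the shape below is not larger than the one from which its strip is removed.
interval-reflection : ∀ {N lo hi} {φ φ′ : ℕ → ℚ[t]} → hi < N → (∀ r r′ → r + r′ ≡ lo + hi → r′ ≤ hi → φ r ≋ φ′ r′) →
  (∑[ r ← upTo N ] le lo r *ₜ le r hi *ₜ φ r) ≋ (∑[ r ← upTo N ] le lo r *ₜ le r hi *ₜ φ′ r)
interval-reflection {N} {lo} {hi} {φ} {φ′} hi<N e = go (lo ≤? hi)
  where
  empty-interval : ∀ (ψ : ℕ → ℚ[t]) → ¬ (lo ≤ hi) → (∑[ r ← upTo N ] le lo r *ₜ le r hi *ₜ ψ r) ≋ 0ₜ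
  empty-interval ψ lo≰hi = ∑-zero (upTo N) λ r → *ₜ-zeroˡ (𝟙-*-zero (lo ≤? r) λ lo≤r →
    𝟙-no (r ≤? hi) λ r≤hi → lo≰hi (ℕ.≤-trans lo≤r r≤hi)) (ψ r)
  go : Dec (lo ≤ hi) → (∑[ r ← upTo N ] le lo r *ₜ le r hi *ₜ φ r) ≋ (∑[ r ← upTo N ] le lo r *ₜ le r hi *ₜ φ′ r)
  go (no lo≰hi)  = ≋-trans (empty-interval φ lo≰hi) (≋-sym (empty-interval φ′ lo≰hi))
  go (yes lo≤hi) = ≋-trans (∑-interval φ lo≤hi hi<N) (≋-trans
    (antidiag-cong (hi ∸ lo) λ p q p+q → e (lo + p) (lo + q)
      (trans (solve 3 (λ l p q → l :+ p :+ (l :+ q) := l :+ (l :+ (p :+ q))) refl lo p q)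
        (cong (λ n → lo + n) (trans (cong (λ n → lo + n) p+q) (ℕ.m+[n∸m]≡n lo≤hi))))
      (ℕ.≤-trans (ℕ.+-monoʳ-≤ lo (ℕ.≤-trans (ℕ.m≤n+m q p) (ℕ.≤-reflexive p+q))) (ℕ.≤-reflexive (ℕ.m+[n∸m]≡n lo≤hi))))
    (≋-trans (antidiag-comm (hi ∸ lo) λ p q → φ′ (lo + q)) (≋-sym (∑-interval φ′ lo≤hi hi<N))))
    where open +-*-Solver

∑-within-∷ : ∀ N n lo los hi his (Φ : ℕ → ℚ[t]) →
  (∑[ ρ ← box N (suc n) ] within (lo ∷ los) (hi ∷ his) ρ *ₜ Φ (sum ρ)) ≋
  (∑[ r ← upTo N ] le lo r *ₜ le r hi *ₜ (∑[ ρ ← box N n ] within los his ρ *ₜ Φ (r + sum ρ)))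
∑-within-∷ N n lo los hi his Φ = ≋-trans
  (∑-box-suc N n (λ ρ → within (lo ∷ los) (hi ∷ his) ρ *ₜ Φ (sum ρ)))
  (∑-cong (upTo N) λ r → ≋-trans
    (∑-cong (box N n) λ ρ → *ₜ-assoc (le lo r *ₜ le r hi) (within los his ρ) (Φ (r + sum ρ)))
    (≋-sym (∑-*ˡ (box N n) (le lo r *ₜ le r hi) (λ ρ → within los his ρ *ₜ Φ (r + sum ρ)))))

-- All rows are reflected at once, which turns the total p into sum los + sum his - p; hence Φ and
-- Φ′ are compared at such pairs only.
reflection : ∀ {N} los his {Φ Φ′ : ℕ → ℚ[t]} → length los ≡ length his → All (_< N) his →
  (∀ p q → p + q ≡ sum los + sum his → q ≤ sum his → Φ p ≋ Φ′ q) →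
  (∑[ ρ ← box N (length his) ] within los his ρ *ₜ Φ (sum ρ)) ≋ (∑[ ρ ← box N (length his) ] within los his ρ *ₜ Φ′ (sum ρ))
reflection []         []         l≡ his<N e = +ₜ-congʳ 0ₜ (*ₜ-congˡ 1ₜ (e 0 0 refl z≤n))
reflection {N} (lo ∷ los) (hi ∷ his) {Φ} {Φ′} l≡ (hi<N ∷ his<N) e =
  ≋-trans (∑-within-∷ N (length his) lo los hi his Φ) (≋-trans
    (interval-reflection {N} {lo} {hi} {λ r → ∑[ ρ ← box N (length his) ] within los his ρ *ₜ Φ (r + sum ρ)} {λ r → ∑[ ρ ← box N (length his) ] within los his ρ *ₜ Φ′ (r + sum ρ)} hi<N λ r r′ r+r′ r′≤hi → reflection los his {λ p → Φ (r + p)} {λ q → Φ′ (r′ + q)}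
      (ℕ.suc-injective l≡) his<N λ p q p+q q≤ → e (r + p) (r′ + q)
        (trans (solve 4 (λ r p r′ q → (r :+ p) :+ (r′ :+ q) := (r :+ r′) :+ (p :+ q)) refl r p r′ q)
          (trans (cong₂ _+_ r+r′ p+q) (solve 4 (λ a b c d → (a :+ b) :+ (c :+ d) := (a :+ c) :+ (b :+ d)) refl lo hi (sum los) (sum his))))
        (ℕ.+-mono-≤ r′≤hi q≤))
    (≋-sym (∑-within-∷ N (length his) lo los hi his Φ′)))
  where open +-*-Solver

antidiag-δ : ∀ n k {φ} → k ≤ n → (∀ i j → i + j ≡ n → i ≢ k → φ i j ≋ 0ₜ) → antidiag n φ ≋ φ k (n ∸ k)
antidiag-δ n k {φ} k≤n z = ≋-trans
  (antidiag-cong n λ i j i+j → pick i j i+j (i ≟ k))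
  (≋-trans (∑-upTo-δ (suc n) k {λ i → 𝟙 (i ≟ k) *ₜ φ i (n ∸ i)} (s≤s k≤n) λ i i≢k → 𝟙-no* (i ≟ k) i≢k (φ i (n ∸ i)))
    (𝟙-yes* (k ≟ k) refl (φ k (n ∸ k))))
  where
  pick : ∀ i j → i + j ≡ n → Dec (i ≡ k) → φ i j ≋ 𝟙 (i ≟ k) *ₜ φ i j
  pick i j i+j (yes i≡k) = ≋-sym (𝟙-yes* (i ≟ k) i≡k (φ i j))
  pick i j i+j (no i≢k)  = ≋-trans (z i j i+j i≢k) (≋-sym (𝟙-no* (i ≟ k) i≢k (φ i j)))

-- The left side forces x = b + Λ′ - p and the right side k = b + q - V. The relation between p and
-- q makes the former exceed t by exactly the latter, so either candidate is admissible precisely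
-- when V ≤ b + q.
∑-≤-δ : ∀ {N} t V Λ′ b p q → t + (p + q) ≡ V + Λ′ → q ≤ V → b + Λ′ < N →
  (∑[ x ← upTo N ] le t x *ₜ 𝟙 (b + Λ′ ≟ x + p)) ≋ antidiag b (λ k k′ → 𝟙 (k′ + q ≟ V))
∑-≤-δ {N} t V Λ′ b p q tpq q≤V bΛ<N = go (V ≤? b + q)
  where
  open +-*-Solver
  go : Dec (V ≤ b + q) → (∑[ x ← upTo N ] le t x *ₜ 𝟙 (b + Λ′ ≟ x + p)) ≋ antidiag b (λ k k′ → 𝟙 (k′ + q ≟ V))
  go (no V≰) = ≋-trans
    (∑-zero (upTo N) λ x → 𝟙-*-zero (t ≤? x) λ t≤x → 𝟙-no (b + Λ′ ≟ x + p) λ e → V≰ (ℕ.+-cancelʳ-≤ Λ′ V (b + q)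
      (ℕ.≤-trans (ℕ.≤-reflexive (sym tpq)) (ℕ.≤-trans (ℕ.+-monoˡ-≤ (p + q) t≤x)
        (ℕ.≤-reflexive (trans (sym (ℕ.+-assoc x p q)) (trans (cong (_+ q) (sym e))
          (solve 3 (λ b l q → b :+ l :+ q := b :+ q :+ l) refl b Λ′ q))))))))
    (≋-sym (antidiag-zero b λ k k′ k+k′ → 𝟙-no (k′ + q ≟ V) λ e → V≰
      (ℕ.≤-trans (ℕ.≤-reflexive (sym e)) (ℕ.+-monoˡ-≤ q (ℕ.≤-trans (ℕ.m≤n+m k′ k) (ℕ.≤-reflexive k+k′))))))
  go (yes V≤) = ≋-trans
    (≋-trans (∑-upTo-δ N (t + u) {λ x → le t x *ₜ 𝟙 (b + Λ′ ≟ x + p)}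
        (ℕ.≤-<-trans (ℕ.≤-trans (ℕ.m≤m+n (t + u) p) (ℕ.≤-reflexive x₀)) bΛ<N)
        λ x x≢ → *ₜ-zeroʳ′ (le t x) (𝟙-no (b + Λ′ ≟ x + p) λ e → x≢ (ℕ.+-cancelʳ-≡ p x (t + u) (trans (sym e) (sym x₀)))))
      (≋-trans (𝟙-yes* (t ≤? t + u) (ℕ.m≤m+n t u) (𝟙 (b + Λ′ ≟ t + u + p))) (𝟙-yes (b + Λ′ ≟ t + u + p) (sym x₀))))
    (≋-sym (≋-trans (antidiag-δ b u {λ k k′ → 𝟙 (k′ + q ≟ V)} u≤b λ k k′ k+k′ k≢u → 𝟙-no (k′ + q ≟ V) λ e →
        k≢u (ℕ.+-cancelʳ-≡ V k u (trans (trans (cong (λ n → k + n) (sym e)) (trans (sym (ℕ.+-assoc k k′ q)) (cong (_+ q) k+k′))) (sym u+V))))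
      (𝟙-yes (b ∸ u + q ≟ V) (trans (sym (ℕ.+-∸-comm q u≤b)) (trans (cong (_∸ u) (sym u+V)) (ℕ.m+n∸m≡n u V))))))
    where
    u = b + q ∸ V
    u+V : u + V ≡ b + q
    u+V = ℕ.m∸n+n≡m V≤
    u≤b : u ≤ b
    u≤b = ℕ.+-cancelʳ-≤ q u b (ℕ.≤-trans (ℕ.+-monoʳ-≤ u q≤V) (ℕ.≤-reflexive u+V))
    x₀ : t + u + p ≡ b + Λ′
    x₀ = ℕ.+-cancelʳ-≡ q (t + u + p) (b + Λ′) (trans
      (solve 4 (λ t u p q → t :+ u :+ p :+ q := u :+ (t :+ (p :+ q))) refl t u p q)
      (trans (cong (λ n → u + n) tpq) (trans (sym (ℕ.+-assoc u V Λ′)) (trans (cong (_+ Λ′) u+V)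
        (solve 3 (λ b q l → b :+ q :+ l := b :+ l :+ q) refl b q Λ′)))))

-- Adding a horizontal strip and then removing one of given size amounts to
-- removing a smaller strip first and then adding one.
strips-commute : ∀ {N} b ν λ′ → length λ′ ≡ suc (length ν) → All (_< N) λ′ → b + sum λ′ < N →
  (∑[ μ ← box N (suc (length ν)) ] Up ν μ *ₜ Down μ λ′ *ₜ 𝟙 (b + sum λ′ ≟ sum μ)) ≋
  antidiag b (λ k k′ → ∑[ ρ ← box N (length ν) ] Down ν ρ *ₜ Up ρ λ′ *ₜ 𝟙 (k′ + sum ρ ≟ sum ν))
strips-commute {N} b ν λ′@(l ∷ λ″) e λ<N small = begin
  (∑[ μ ← box N (suc n) ] Up ν μ *ₜ Down μ λ′ *ₜ 𝟙 (b + sum λ′ ≟ sum μ))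
    ≈⟨ ∑-box-suc N n (λ μ → Up ν μ *ₜ Down μ λ′ *ₜ 𝟙 (b + sum λ′ ≟ sum μ)) ⟩
  (∑[ x ← upTo N ] ∑[ ρ ← box N n ] Up ν (x ∷ ρ) *ₜ Down (x ∷ ρ) λ′ *ₜ 𝟙 (b + sum λ′ ≟ x + sum ρ))
    ≈⟨ ∑-cong (upTo N) (λ x → ∑-box-congᴵ {N} {n} λ ρ (eρ , _) → ≋-trans
         (*ₜ-congʳ (𝟙 (b + sum λ′ ≟ x + sum ρ)) (Up-Down ν l λ″ x ρ (ℕ.suc-injective e) eρ))
         (rotate (le t x) (W ρ) (𝟙 (b + sum λ′ ≟ x + sum ρ)))) ⟩
  (∑[ x ← upTo N ] ∑[ ρ ← box N n ] W ρ *ₜ (le t x *ₜ 𝟙 (b + sum λ′ ≟ x + sum ρ)))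
    ≈⟨ ∑-swap (upTo N) (box N n) (λ x ρ → W ρ *ₜ (le t x *ₜ 𝟙 (b + sum λ′ ≟ x + sum ρ))) ⟩
  (∑[ ρ ← box N n ] ∑[ x ← upTo N ] W ρ *ₜ (le t x *ₜ 𝟙 (b + sum λ′ ≟ x + sum ρ)))
    ≈⟨ ∑-cong (box N n) (λ ρ → ≋-sym (∑-*ˡ (upTo N) (W ρ) λ x → le t x *ₜ 𝟙 (b + sum λ′ ≟ x + sum ρ))) ⟩
  (∑[ ρ ← box N n ] W ρ *ₜ Φ (sum ρ))
    ≡⟨ cong (λ k → ∑[ ρ ← box N k ] W ρ *ₜ Φ (sum ρ)) (sym n≡) ⟩
  (∑[ ρ ← box N (length (his ν λ′)) ] W ρ *ₜ Φ (sum ρ))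
    ≈⟨ reflection (los ν λ′) (his ν λ′) {Φ} {Φ′} (length-los-his ν λ′) (his< ν λ′ λ<N)
         (λ p q p+q q≤ → ∑-≤-δ t (sum ν) (sum λ′) b p q
           (trans (cong (λ n → t + n) p+q) (top+los+his ν λ′ e)) (ℕ.≤-trans q≤ (his≤ ν λ′)) small) ⟩
  (∑[ ρ ← box N (length (his ν λ′)) ] W ρ *ₜ Φ′ (sum ρ))
    ≡⟨ cong (λ k → ∑[ ρ ← box N k ] W ρ *ₜ Φ′ (sum ρ)) n≡ ⟩
  (∑[ ρ ← box N n ] W ρ *ₜ Φ′ (sum ρ))
    ≈⟨ ∑-box-congᴵ {N} {n} (λ ρ (eρ , _) → ≋-trans (*ₜ-congʳ (Φ′ (sum ρ)) (≋-sym (Down-Up ν ρ λ′ eρ e)))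
         (*ₜ-antidiag (Down ν ρ *ₜ Up ρ λ′) b (λ k k′ → 𝟙 (k′ + sum ρ ≟ sum ν)))) ⟩
  (∑[ ρ ← box N n ] antidiag b λ k k′ → Down ν ρ *ₜ Up ρ λ′ *ₜ 𝟙 (k′ + sum ρ ≟ sum ν))
    ≈⟨ ∑-swap (box N n) (upTo (suc b)) (λ ρ k → Down ν ρ *ₜ Up ρ λ′ *ₜ 𝟙 (b ∸ k + sum ρ ≟ sum ν)) ⟩
  antidiag b (λ k k′ → ∑[ ρ ← box N n ] Down ν ρ *ₜ Up ρ λ′ *ₜ 𝟙 (k′ + sum ρ ≟ sum ν)) ∎
  where
  open ≋-Reasoning
  n = length ν
  t = top ν λ′
  n≡ : length (his ν λ′) ≡ n
  n≡ = length-his ν λ′ e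
  W : ListFun
  W ρ = within (los ν λ′) (his ν λ′) ρ
  Φ Φ′ : ℕ → ℚ[t]
  Φ p = ∑[ x ← upTo N ] le t x *ₜ 𝟙 (b + sum λ′ ≟ x + p)
  Φ′ q = antidiag b λ k k′ → 𝟙 (k′ + q ≟ sum ν)
  rotate : ∀ x y z → x *ₜ y *ₜ z ≋ y *ₜ (x *ₜ z)
  rotate x y z = ≋-trans (*ₜ-congʳ z (*ₜ-comm x y)) (*ₜ-assoc y x z)

-- Kostka numbers, with all shapes padded to the same number of rows.
K : ℕ → (α λ′ : List ℕ) → ℚ[t]
K N []      λ′ = 𝟙 (sum λ′ ≟ 0)
K N (a ∷ α) λ′ = ∑[ μ ← box N (length λ′) ] Down λ′ μ *ₜ (𝟙 (a + sum μ ≟ sum λ′) *ₜ K N α μ)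

-- The Pieri rule for padded shapes

K-degree : ∀ N α λ′ → sum λ′ ≢ sum α → K N α λ′ ≋ 0ₜ
K-degree N []      λ′ λ≢ = 𝟙-no (sum λ′ ≟ 0) λ≢
K-degree N (a ∷ α) λ′ λ≢ = ∑-zero (box N (length λ′)) λ μ → *ₜ-zeroʳ′ (Down λ′ μ) (𝟙-*-zero (a + sum μ ≟ sum λ′)
  λ e → K-degree N α μ λ e′ → λ≢ (trans (sym e) (cong (λ n → a + n) e′)))

∑-box-zero : ∀ {N} n (φ : ListFun) → 0 < N → (∑[ μ ← box N n ] φ μ *ₜ 𝟙 (sum μ ≟ 0)) ≋ φ (replicate n 0)
∑-box-zero zero φ 0<N = ≋-trans (+ₜ-identityʳ (φ [] *ₜ 1ₜ)) (*ₜ-identityʳ (φ []))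
∑-box-zero {N} (suc n) φ 0<N = ≋-trans (∑-box-suc N n (λ μ → φ μ *ₜ 𝟙 (sum μ ≟ 0)))
  (≋-trans (∑-upTo-δ N 0 {λ i → ∑[ μ ← box N n ] φ (i ∷ μ) *ₜ 𝟙 (i + sum μ ≟ 0)} 0<N λ i i≢0 →
      ∑-zero (box N n) λ μ → *ₜ-zeroʳ′ (φ (i ∷ μ)) (𝟙-no (i + sum μ ≟ 0) (i≢0 ∘ ℕ.m+n≡0⇒m≡0 i)))
    (∑-box-zero n (0 ∷ᶠ φ) 0<N))

Up-zeros : ∀ ν n → length ν ≤ n → Up ν (replicate n 0) ≋ 𝟙 (sum ν ≟ 0)
Up-zeros []          n       ≤n = ≋-refl
Up-zeros (suc m ∷ ν) (suc n) ≤n = ≋-refl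
Up-zeros (zero ∷ ν)  (suc n) (s≤s ≤n) = ≋-trans (*ₜ-identityˡ (cap 0 (replicate n 0) *ₜ Up ν (replicate n 0)))
  (≋-trans (*ₜ-congʳ (Up ν (replicate n 0)) (cap-zeros n)) (≋-trans (*ₜ-identityˡ (Up ν (replicate n 0))) (Up-zeros ν n ≤n)))
  where
  cap-zeros : ∀ n → cap 0 (replicate n 0) ≋ 1ₜ
  cap-zeros zero    = ≋-refl
  cap-zeros (suc n) = ≋-refl

-- This is multiplication of s_ν by the sum of all h_n, each coefficient of which is 1, so that β
-- contributes no factor. The added strip is moved past the strip of the first letter, and induction
-- on the letters applies.
pieri : ∀ {N} α ν → sum α < N →
  (∑[ μ ← box N (suc (length ν)) ] Up ν μ *ₜ K N α μ) ≋ (∑[ (β , γ) ← splittings α ] K N γ ν)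
pieri {N} [] ν α<N = ≋-trans (∑-box-zero (suc (length ν)) (Up ν) α<N)
  (≋-trans (Up-zeros ν (suc (length ν)) (ℕ.n≤1+n (length ν))) (≋-sym (+ₜ-identityʳ (𝟙 (sum ν ≟ 0)))))
pieri {N} (b ∷ α) ν bα<N = begin
  (∑[ μ ← Bₙ₊₁ ] Up ν μ *ₜ (∑[ λ′ ← box N (length μ) ] Down μ λ′ *ₜ (𝟙 (b + sum λ′ ≟ sum μ) *ₜ K N α λ′)))
    ≈⟨ ∑-box-congᴵ {N} {suc n} (λ μ (eμ , _) → ≋-trans
         (≡⇒≋ (cong (λ k → Up ν μ *ₜ (∑[ λ′ ← box N k ] Down μ λ′ *ₜ (𝟙 (b + sum λ′ ≟ sum μ) *ₜ K N α λ′))) eμ))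
         (≋-trans (∑-*ˡ Bₙ₊₁ (Up ν μ) (λ λ′ → Down μ λ′ *ₜ (𝟙 (b + sum λ′ ≟ sum μ) *ₜ K N α λ′)))
           (∑-cong Bₙ₊₁ λ λ′ → front (Up ν μ) (Down μ λ′) (𝟙 (b + sum λ′ ≟ sum μ)) (K N α λ′)))) ⟩
  (∑[ μ ← Bₙ₊₁ ] ∑[ λ′ ← Bₙ₊₁ ] K N α λ′ *ₜ (Up ν μ *ₜ Down μ λ′ *ₜ 𝟙 (b + sum λ′ ≟ sum μ)))
    ≈⟨ ∑-swap Bₙ₊₁ Bₙ₊₁ (λ μ λ′ → K N α λ′ *ₜ (Up ν μ *ₜ Down μ λ′ *ₜ 𝟙 (b + sum λ′ ≟ sum μ))) ⟩
  (∑[ λ′ ← Bₙ₊₁ ] ∑[ μ ← Bₙ₊₁ ] K N α λ′ *ₜ (Up ν μ *ₜ Down μ λ′ *ₜ 𝟙 (b + sum λ′ ≟ sum μ)))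
    ≈⟨ ∑-box-congᴵ {N} {suc n} (λ λ′ (eλ , λ<N) → ≋-trans
         (≋-sym (∑-*ˡ Bₙ₊₁ (K N α λ′) (λ μ → Up ν μ *ₜ Down μ λ′ *ₜ 𝟙 (b + sum λ′ ≟ sum μ))))
         (commute λ′ eλ λ<N (sum λ′ ≟ sum α))) ⟩
  (∑[ λ′ ← Bₙ₊₁ ] K N α λ′ *ₜ antidiag b (λ k k′ → ∑[ ρ ← Bₙ ] Down ν ρ *ₜ Up ρ λ′ *ₜ 𝟙 (k′ + sum ρ ≟ sum ν)))
    ≈⟨ ∑-cong Bₙ₊₁ (λ λ′ → *ₜ-antidiag (K N α λ′) b (λ k k′ → ∑[ ρ ← Bₙ ] Down ν ρ *ₜ Up ρ λ′ *ₜ 𝟙 (k′ + sum ρ ≟ sum ν))) ⟩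
  (∑[ λ′ ← Bₙ₊₁ ] antidiag b (λ k k′ → K N α λ′ *ₜ (∑[ ρ ← Bₙ ] Down ν ρ *ₜ Up ρ λ′ *ₜ 𝟙 (k′ + sum ρ ≟ sum ν))))
    ≈⟨ ∑-swap Bₙ₊₁ (upTo (suc b)) (λ λ′ k → K N α λ′ *ₜ (∑[ ρ ← Bₙ ] Down ν ρ *ₜ Up ρ λ′ *ₜ 𝟙 (b ∸ k + sum ρ ≟ sum ν))) ⟩
  antidiag b (λ k k′ → ∑[ λ′ ← Bₙ₊₁ ] K N α λ′ *ₜ (∑[ ρ ← Bₙ ] Down ν ρ *ₜ Up ρ λ′ *ₜ 𝟙 (k′ + sum ρ ≟ sum ν)))
    ≈⟨ antidiag-cong b (λ k k′ _ → step k′) ⟩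
  antidiag b (λ k k′ → ∑[ (β , γ) ← splittings α ] K N (k′ ∷ γ) ν)
    ≈⟨ splittings-∷ b α (λ β γ → K N γ ν) ⟨
  (∑[ (β , γ) ← splittings (b ∷ α) ] K N γ ν) ∎
  where
  open ≋-Reasoning
  n = length ν
  Bₙ = box N n
  Bₙ₊₁ = box N (suc n)
  front : ∀ x y z w → x *ₜ (y *ₜ (z *ₜ w)) ≋ w *ₜ (x *ₜ y *ₜ z)
  front = ≋-Solver.solve 4 (λ x y z w → x ⊠ (y ⊠ (z ⊠ w)) ⊜ w ⊠ (x ⊠ y ⊠ z)) ≋-refl
  front′ : ∀ w x y z → w *ₜ (x *ₜ y *ₜ z) ≋ x *ₜ z *ₜ (y *ₜ w)
  front′ = ≋-Solver.solve 4 (λ w x y z → w ⊠ (x ⊠ y ⊠ z) ⊜ x ⊠ z ⊠ (y ⊠ w)) ≋-refl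
  commute : ∀ λ′ → length λ′ ≡ suc n → All (_< N) λ′ → Dec (sum λ′ ≡ sum α) →
    K N α λ′ *ₜ (∑[ μ ← Bₙ₊₁ ] Up ν μ *ₜ Down μ λ′ *ₜ 𝟙 (b + sum λ′ ≟ sum μ)) ≋
    K N α λ′ *ₜ antidiag b (λ k k′ → ∑[ ρ ← Bₙ ] Down ν ρ *ₜ Up ρ λ′ *ₜ 𝟙 (k′ + sum ρ ≟ sum ν))
  -- The box is known to be large enough for `strips-commute` only when |λ| = |α|; otherwise K
  -- vanishes.
  commute λ′ eλ λ<N (yes e)  = *ₜ-congˡ (K N α λ′) (strips-commute b ν λ′ eλ λ<N (subst (λ k → b + k < N) (sym e) bα<N))
  commute λ′ eλ λ<N (no λ≢) = ≋-trans (*ₜ-zeroˡ (K-degree N α λ′ λ≢) _) (≋-sym (*ₜ-zeroˡ (K-degree N α λ′ λ≢) _))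
  step : ∀ k′ → (∑[ λ′ ← Bₙ₊₁ ] K N α λ′ *ₜ (∑[ ρ ← Bₙ ] Down ν ρ *ₜ Up ρ λ′ *ₜ 𝟙 (k′ + sum ρ ≟ sum ν))) ≋
    (∑[ (β , γ) ← splittings α ] K N (k′ ∷ γ) ν)
  step k′ = begin
    (∑[ λ′ ← Bₙ₊₁ ] K N α λ′ *ₜ (∑[ ρ ← Bₙ ] Down ν ρ *ₜ Up ρ λ′ *ₜ δ ρ))
      ≈⟨ ∑-cong Bₙ₊₁ (λ λ′ → ≋-trans (∑-*ˡ Bₙ (K N α λ′) (λ ρ → Down ν ρ *ₜ Up ρ λ′ *ₜ δ ρ))
           (∑-cong Bₙ λ ρ → front′ (K N α λ′) (Down ν ρ) (Up ρ λ′) (δ ρ))) ⟩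
    (∑[ λ′ ← Bₙ₊₁ ] ∑[ ρ ← Bₙ ] Down ν ρ *ₜ δ ρ *ₜ (Up ρ λ′ *ₜ K N α λ′))
      ≈⟨ ∑-swap Bₙ₊₁ Bₙ (λ λ′ ρ → Down ν ρ *ₜ δ ρ *ₜ (Up ρ λ′ *ₜ K N α λ′)) ⟩
    (∑[ ρ ← Bₙ ] ∑[ λ′ ← Bₙ₊₁ ] Down ν ρ *ₜ δ ρ *ₜ (Up ρ λ′ *ₜ K N α λ′))
      ≈⟨ ∑-box-congᴵ {N} {n} (λ ρ (eρ , _) → ≋-trans (≋-sym (∑-*ˡ Bₙ₊₁ (Down ν ρ *ₜ δ ρ) (λ λ′ → Up ρ λ′ *ₜ K N α λ′)))
           (≋-trans (*ₜ-congˡ (Down ν ρ *ₜ δ ρ) (≋-trans (≡⇒≋ (cong (λ k → ∑[ λ′ ← box N (suc k) ] Up ρ λ′ *ₜ K N α λ′) (sym eρ)))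
               (pieri α ρ (ℕ.≤-<-trans (ℕ.m≤n+m (sum α) b) bα<N))))
             (≋-trans (∑-*ˡ (splittings α) (Down ν ρ *ₜ δ ρ) (λ (β , γ) → K N γ ρ))
               (∑-cong (splittings α) λ (β , γ) → *ₜ-assoc (Down ν ρ) (δ ρ) (K N γ ρ))))) ⟩
    (∑[ ρ ← Bₙ ] ∑[ (β , γ) ← splittings α ] Down ν ρ *ₜ (δ ρ *ₜ K N γ ρ))
      ≈⟨ ∑-swap Bₙ (splittings α) (λ ρ (β , γ) → Down ν ρ *ₜ (δ ρ *ₜ K N γ ρ)) ⟩
    (∑[ (β , γ) ← splittings α ] K N (k′ ∷ γ) ν) ∎
    where
    δ : ListFun
    δ ρ = 𝟙 (k′ + sum ρ ≟ sum ν)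

-- Exchanging an added strip for a removed one

last : List ℕ → ℕ
last []          = 0
last (m ∷ [])    = m
last (_ ∷ m ∷ μ) = last (m ∷ μ)

front : List ℕ → List ℕ
front []          = []
front (m ∷ [])    = []
front (m ∷ k ∷ μ) = m ∷ front (k ∷ μ)

sum-front : ∀ μ → sum (front μ) + last μ ≡ sum μ
sum-front []          = refl
sum-front (m ∷ [])    = sym (ℕ.+-identityʳ m)
sum-front (m ∷ k ∷ μ) = trans (ℕ.+-assoc m (sum (front (k ∷ μ))) (last (k ∷ μ))) (cong (λ n → m + n) (sum-front (k ∷ μ)))

length-front : ∀ m μ → length (front (m ∷ μ)) ≡ length μ
length-front m []      = refl
length-front m (k ∷ μ) = cong suc (length-front k μ)

All-front : ∀ {P : ℕ → Set} μ → All P μ → All P (front μ)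
All-front []          []             = []
All-front (m ∷ [])    _              = []
All-front (m ∷ k ∷ μ) (pm ∷ pμ) = pm ∷ All-front (k ∷ μ) pμ

-- Removing a horizontal strip leaves each row between itself and the row below it: the lower ends
-- are all rows but the first, the upper ends all rows but the last.
Up-within : ∀ ν m μ → length μ ≡ length ν → Up ν (m ∷ μ) ≋ within μ (front (m ∷ μ)) ν
Up-within []      m []      e = ≋-refl
Up-within (k ∷ ν) m (l ∷ μ) e = ≋-trans
  (*ₜ-congˡ (le k m) (*ₜ-congˡ (le l k) (Up-within ν l μ (ℕ.suc-injective e))))
  (≋-trans (≋-sym (*ₜ-assoc (le k m) (le l k) (within μ (front (l ∷ μ)) ν)))
    (*ₜ-congʳ (within μ (front (l ∷ μ)) ν) (*ₜ-comm (le k m) (le l k))))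

Up-Down-cap : ∀ λ′ m μ → Up λ′ (m ∷ μ) ≋ cap m λ′ *ₜ Down λ′ μ
Up-Down-cap []       m μ = ≋-sym (*ₜ-identityˡ 1ₜ)
Up-Down-cap (l ∷ λ′) m μ = ≋-refl

-- With λ ranging over the shapes weighted by 𝓔, the ways to reach them by
-- adding a horizontal strip of size a to μ correspond to the ways to reach
-- them by removing a smaller strip, the difference c of the sizes being
-- weighted by χ.
StripExchange : ListFun → (ℕ → ℚ[t]) → Set
StripExchange 𝓔 χ = ∀ N a n μ → InBox N (suc n) μ → last μ ≡ 0 → a + sum μ < N →
  (∑[ λ′ ← box N (suc n) ] 𝓔 λ′ *ₜ (Down λ′ μ *ₜ 𝟙 (a + sum μ ≟ sum λ′))) ≋
  (∑[ ν ← box N n ] 𝓔 ν *ₜ (Up ν μ *ₜ antidiag a λ c k → χ c *ₜ 𝟙 (sum ν + k ≟ sum μ)))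

-- The rows of λ below the first one and the rows of ν range over the same intervals between
-- consecutive rows of μ. As the last row of μ is 0, the ends of these intervals add up to 2|μ| -
-- μ₁, and after reflection `∑-≤-δ` applies with t = μ₁ and V = Λ′ = |μ|.
exchange-all : StripExchange (λ _ → 1ₜ) χ-all
exchange-all N a n μ@(m ∷ μ′) (eμ , μ<N) last≡0 small = begin
  (∑[ λ′ ← box N (suc n) ] 1ₜ *ₜ (Down λ′ μ *ₜ 𝟙 (a + sum μ ≟ sum λ′)))
    ≈⟨ ∑-box-suc N n (λ λ′ → 1ₜ *ₜ (Down λ′ μ *ₜ 𝟙 (a + sum μ ≟ sum λ′))) ⟩
  (∑[ x ← upTo N ] ∑[ ν ← box N n ] 1ₜ *ₜ (le m x *ₜ Up ν μ *ₜ 𝟙 (a + sum μ ≟ x + sum ν)))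
    ≈⟨ ∑-cong (upTo N) (λ x → ∑-box-congᴵ {N} {n} λ ν (eν , _) → ≋-trans
         (*ₜ-identityˡ (le m x *ₜ Up ν μ *ₜ 𝟙 (a + sum μ ≟ x + sum ν)))
         (≋-trans (*ₜ-congʳ (𝟙 (a + sum μ ≟ x + sum ν)) (≋-trans (*ₜ-congˡ (le m x) (up≋W ν eν)) (*ₜ-comm (le m x) (W ν))))
           (*ₜ-assoc (W ν) (le m x) (𝟙 (a + sum μ ≟ x + sum ν))))) ⟩
  (∑[ x ← upTo N ] ∑[ ν ← box N n ] W ν *ₜ (le m x *ₜ 𝟙 (a + sum μ ≟ x + sum ν)))
    ≈⟨ ∑-swap (upTo N) (box N n) (λ x ν → W ν *ₜ (le m x *ₜ 𝟙 (a + sum μ ≟ x + sum ν))) ⟩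
  (∑[ ν ← box N n ] ∑[ x ← upTo N ] W ν *ₜ (le m x *ₜ 𝟙 (a + sum μ ≟ x + sum ν)))
    ≈⟨ ∑-cong (box N n) (λ ν → ≋-sym (∑-*ˡ (upTo N) (W ν) λ x → le m x *ₜ 𝟙 (a + sum μ ≟ x + sum ν))) ⟩
  (∑[ ν ← box N n ] W ν *ₜ Φ (sum ν))
    ≡⟨ cong (λ k → ∑[ ν ← box N k ] W ν *ₜ Φ (sum ν)) (sym n≡) ⟩
  (∑[ ν ← box N (length (front μ)) ] W ν *ₜ Φ (sum ν))
    ≈⟨ reflection μ′ (front μ) {Φ} {Φ′} (sym (length-front m μ′)) (All-front μ μ<N) (λ p q p+q q≤ →
         ∑-≤-δ m (sum μ) (sum μ) a p q (trans (cong (λ k → m + k) p+q)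
             (trans (sym (ℕ.+-assoc m (sum μ′) (sum (front μ)))) (cong (λ k → sum μ + k) sum-front≡)))
           (ℕ.≤-trans q≤ (ℕ.≤-reflexive sum-front≡)) small) ⟩
  (∑[ ν ← box N (length (front μ)) ] W ν *ₜ Φ′ (sum ν))
    ≡⟨ cong (λ k → ∑[ ν ← box N k ] W ν *ₜ Φ′ (sum ν)) n≡ ⟩
  (∑[ ν ← box N n ] W ν *ₜ Φ′ (sum ν))
    ≈⟨ ∑-box-congᴵ {N} {n} (λ ν (eν , _) → ≋-trans
         (*ₜ-cong (≋-sym (up≋W ν eν)) (antidiag-cong a λ c k _ → ≋-trans
           (≡⇒≋ (cong (λ j → 𝟙 (j ≟ sum μ)) (ℕ.+-comm k (sum ν)))) (≋-sym (*ₜ-identityˡ (𝟙 (sum ν + k ≟ sum μ))))))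
         (≋-sym (*ₜ-identityˡ (Up ν μ *ₜ antidiag a λ c k → 1ₜ *ₜ 𝟙 (sum ν + k ≟ sum μ))))) ⟩
  (∑[ ν ← box N n ] 1ₜ *ₜ (Up ν μ *ₜ antidiag a λ c k → 1ₜ *ₜ 𝟙 (sum ν + k ≟ sum μ))) ∎
  where
  open ≋-Reasoning
  n≡ : length (front μ) ≡ n
  n≡ = trans (length-front m μ′) (ℕ.suc-injective eμ)
  sum-front≡ : sum (front μ) ≡ sum μ
  sum-front≡ = trans (sym (ℕ.+-identityʳ (sum (front μ)))) (trans (cong (λ k → sum (front μ) + k) (sym last≡0)) (sum-front μ))
  W : ListFun
  W ν = within μ′ (front μ) ν
  up≋W : ∀ ν → length ν ≡ n → Up ν μ ≋ W ν
  up≋W ν eν = Up-within ν m μ′ (trans (ℕ.suc-injective eμ) (sym eν))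
  Φ Φ′ : ℕ → ℚ[t]
  Φ p = ∑[ x ← upTo N ] le m x *ₜ 𝟙 (a + sum μ ≟ x + p)
  Φ′ q = antidiag a λ k k′ → 𝟙 (k′ + q ≟ sum μ)

-- Shapes with even rows

evenRows : ListFun
evenRows []      = 1ₜ
evenRows (x ∷ λ′) = χ-even x *ₜ evenRows λ′

χ-even-∑ : ∀ {N} r → r < N → χ-even r ≋ (∑[ i ← upTo N ] 𝟙 (r ≟ i + i))
χ-even-∑ {N} r r<N = go (parity r) r<N
  where
  go : ∀ {r} → Parity r → r < N → χ-even r ≋ (∑[ i ← upTo N ] 𝟙 (r ≟ i + i))
  go (even b) r<N = ≋-trans (χ-even-even b) (≋-sym (≋-trans
    (∑-upTo-δ N b {λ i → 𝟙 (b + b ≟ i + i)} (ℕ.≤-<-trans (ℕ.m≤m+n b b) r<N) λ i i≢b →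
      𝟙-no (b + b ≟ i + i) λ e → i≢b (sym (double-injective {b} {i} e)))
    (𝟙-yes (b + b ≟ b + b) refl)))
  go (odd b) r<N = ≋-trans (χ-even-odd b) (≋-sym (∑-zero (upTo N) λ i →
    𝟙-no (suc (b + b) ≟ i + i) (double-≢ {b} {i})))

∑-even : ∀ N (f : ℕ → ℚ[t]) → (∑[ r ← upTo N ] χ-even r *ₜ f r) ≋ (∑[ i ← upTo N ] 𝟙 (i + i <? N) *ₜ f (i + i))
∑-even N f = begin
  (∑[ r ← upTo N ] χ-even r *ₜ f r)
    ≈⟨ ∑-upTo-cong N (λ r r<N → ≋-trans (*ₜ-congʳ (f r) (χ-even-∑ r r<N)) (∑-*ʳ (upTo N) (f r) λ i → 𝟙 (r ≟ i + i))) ⟩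
  (∑[ r ← upTo N ] ∑[ i ← upTo N ] 𝟙 (r ≟ i + i) *ₜ f r)
    ≈⟨ ∑-swap (upTo N) (upTo N) (λ r i → 𝟙 (r ≟ i + i) *ₜ f r) ⟩
  (∑[ i ← upTo N ] ∑[ r ← upTo N ] 𝟙 (r ≟ i + i) *ₜ f r)
    ≈⟨ ∑-cong (upTo N) (λ i → pick i (i + i <? N)) ⟩
  (∑[ i ← upTo N ] 𝟙 (i + i <? N) *ₜ f (i + i)) ∎
  where
  open ≋-Reasoning
  pick : ∀ i → Dec (i + i < N) → (∑[ r ← upTo N ] 𝟙 (r ≟ i + i) *ₜ f r) ≋ 𝟙 (i + i <? N) *ₜ f (i + i)
  pick i (yes i+i<N) = ≋-trans
    (∑-upTo-δ N (i + i) {λ r → 𝟙 (r ≟ i + i) *ₜ f r} i+i<N λ r r≢ → 𝟙-no* (r ≟ i + i) r≢ (f r))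
    (≋-trans (𝟙-yes* (i + i ≟ i + i) refl (f (i + i))) (≋-sym (𝟙-yes* (i + i <? N) i+i<N (f (i + i)))))
  pick i (no i+i≮N)  = ≋-trans
    (∑-upTo-zero N λ r r<N → 𝟙-no* (r ≟ i + i) (λ e → i+i≮N (subst (_< N) e r<N)) (f r))
    (≋-sym (𝟙-no* (i + i <? N) i+i≮N (f (i + i))))

⌈/2⌉≤⇔ : ∀ m i → (ℕ.⌈ m /2⌉ ≤ i → m ≤ i + i) × (m ≤ i + i → ℕ.⌈ m /2⌉ ≤ i)
⌈/2⌉≤⇔ m i = (λ h → ℕ.≤-trans (ℕ.≤-reflexive (sym (ℕ.⌊n/2⌋+⌈n/2⌉≡n m)))
    (ℕ.+-mono-≤ (ℕ.≤-trans (ℕ.⌊n/2⌋≤⌈n/2⌉ m) h) h))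
  , (λ h → ℕ.≤-trans (ℕ.⌈n/2⌉-mono h) (ℕ.≤-reflexive (sym (ℕ.n≡⌈n+n/2⌉ i))))

≤⌊/2⌋⇔ : ∀ i m → (i ≤ ℕ.⌊ m /2⌋ → i + i ≤ m) × (i + i ≤ m → i ≤ ℕ.⌊ m /2⌋)
≤⌊/2⌋⇔ i m = (λ h → ℕ.≤-trans (ℕ.+-mono-≤ h (ℕ.≤-trans h (ℕ.⌊n/2⌋≤⌈n/2⌉ m))) (ℕ.≤-reflexive (ℕ.⌊n/2⌋+⌈n/2⌉≡n m)))
  , (λ h → ℕ.≤-trans (ℕ.≤-reflexive (ℕ.n≡⌊n+n/2⌋ i)) (ℕ.⌊n/2⌋-mono h))

∑-even-interval : ∀ {N} lo hi (φ : ℕ → ℚ[t]) → hi < N →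
  (∑[ r ← upTo N ] χ-even r *ₜ (le lo r *ₜ le r hi *ₜ φ r)) ≋
  (∑[ i ← upTo N ] le (ℕ.⌈ lo /2⌉) i *ₜ le i (ℕ.⌊ hi /2⌋) *ₜ φ (i + i))
∑-even-interval {N} lo hi φ hi<N = ≋-trans (∑-even N (λ r → le lo r *ₜ le r hi *ₜ φ r))
  (∑-cong (upTo N) λ i → ≋-trans
    (≋-sym (*ₜ-assoc (𝟙 (i + i <? N)) (le lo (i + i) *ₜ le (i + i) hi) (φ (i + i))))
    (*ₜ-congʳ (φ (i + i)) (≋-trans (drop i (i + i ≤? hi))
      (*ₜ-cong (𝟙-⇔ (lo ≤? i + i) (ℕ.⌈ lo /2⌉ ≤? i) (proj₂ (⌈/2⌉≤⇔ lo i)) (proj₁ (⌈/2⌉≤⇔ lo i)))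
        (𝟙-⇔ (i + i ≤? hi) (i ≤? ℕ.⌊ hi /2⌋) (proj₂ (≤⌊/2⌋⇔ i hi)) (proj₁ (≤⌊/2⌋⇔ i hi)))))))
  where
  drop : ∀ i → Dec (i + i ≤ hi) → 𝟙 (i + i <? N) *ₜ (le lo (i + i) *ₜ le (i + i) hi) ≋ le lo (i + i) *ₜ le (i + i) hi
  drop i (yes h) = 𝟙-yes* (i + i <? N) (ℕ.≤-<-trans h hi<N) (le lo (i + i) *ₜ le (i + i) hi)
  drop i (no h)  = ≋-trans (*ₜ-zeroʳ′ (𝟙 (i + i <? N)) z) (≋-sym z)
    where
    z : le lo (i + i) *ₜ le (i + i) hi ≋ 0ₜ
    z = *ₜ-zeroʳ′ (le lo (i + i)) (𝟙-no (i + i ≤? hi) h)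

-- The even numbers from lo to hi are the doubles of those from ⌈lo/2⌉ to ⌊hi/2⌋. In this form they
-- can be reflected even if lo + hi is odd.
halve : ∀ {N} los his (Φ : ℕ → ℚ[t]) → length los ≡ length his → All (_< N) his →
  (∑[ ρ ← box N (length his) ] evenRows ρ *ₜ within los his ρ *ₜ Φ (sum ρ)) ≋
  (∑[ σ ← box N (length his) ] within (map ℕ.⌈_/2⌉ los) (map ℕ.⌊_/2⌋ his) σ *ₜ Φ (sum σ + sum σ))
halve []         []         Φ l≡ his<N = +ₜ-congʳ 0ₜ (*ₜ-congʳ (Φ 0) (*ₜ-identityˡ 1ₜ))
halve {N} (lo ∷ los) (hi ∷ his) Φ l≡ (hi<N ∷ his<N) = begin
  (∑[ ρ ← box N (suc n) ] evenRows ρ *ₜ within (lo ∷ los) (hi ∷ his) ρ *ₜ Φ (sum ρ))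
    ≈⟨ ∑-box-suc N n (λ ρ → evenRows ρ *ₜ within (lo ∷ los) (hi ∷ his) ρ *ₜ Φ (sum ρ)) ⟩
  (∑[ r ← upTo N ] ∑[ ρ ← box N n ] χ-even r *ₜ evenRows ρ *ₜ (le lo r *ₜ le r hi *ₜ within los his ρ) *ₜ Φ (r + sum ρ))
    ≈⟨ ∑-cong (upTo N) (λ r → ≋-trans
         (∑-cong (box N n) λ ρ → regroup (χ-even r) (evenRows ρ) (le lo r *ₜ le r hi) (within los his ρ) (Φ (r + sum ρ)))
         (≋-trans (≋-sym (∑-*ˡ (box N n) (χ-even r *ₜ (le lo r *ₜ le r hi)) (λ ρ → evenRows ρ *ₜ within los his ρ *ₜ Φ (r + sum ρ))))
           (≋-trans (*ₜ-congˡ (χ-even r *ₜ (le lo r *ₜ le r hi)) (halve los his (λ p → Φ (r + p)) (ℕ.suc-injective l≡) his<N))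
             (*ₜ-assoc (χ-even r) (le lo r *ₜ le r hi) (φ r))))) ⟩
  (∑[ r ← upTo N ] χ-even r *ₜ (le lo r *ₜ le r hi *ₜ φ r))
    ≈⟨ ∑-even-interval lo hi φ hi<N ⟩
  (∑[ i ← upTo N ] le (ℕ.⌈ lo /2⌉) i *ₜ le i (ℕ.⌊ hi /2⌋) *ₜ φ (i + i))
    ≈⟨ ∑-cong (upTo N) (λ i → *ₜ-congˡ (le (ℕ.⌈ lo /2⌉) i *ₜ le i (ℕ.⌊ hi /2⌋)) (∑-cong (box N n) λ σ →
         *ₜ-congˡ (W σ) (≡⇒≋ (cong Φ (solve 2 (λ i s → (i :+ i) :+ (s :+ s) := (i :+ s) :+ (i :+ s)) refl i (sum σ)))))) ⟩
  (∑[ i ← upTo N ] le (ℕ.⌈ lo /2⌉) i *ₜ le i (ℕ.⌊ hi /2⌋) *ₜ (∑[ σ ← box N n ] W σ *ₜ Φ (i + sum σ + (i + sum σ))))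
    ≈⟨ ∑-within-∷ N n (ℕ.⌈ lo /2⌉) (map ℕ.⌈_/2⌉ los) (ℕ.⌊ hi /2⌋) (map ℕ.⌊_/2⌋ his) (λ p → Φ (p + p)) ⟨
  (∑[ σ ← box N (suc n) ] within (map ℕ.⌈_/2⌉ (lo ∷ los)) (map ℕ.⌊_/2⌋ (hi ∷ his)) σ *ₜ Φ (sum σ + sum σ)) ∎
  where
  open ≋-Reasoning
  open +-*-Solver
  n = length his
  W : ListFun
  W = within (map ℕ.⌈_/2⌉ los) (map ℕ.⌊_/2⌋ his)
  φ : ℕ → ℚ[t]
  φ r = ∑[ σ ← box N n ] W σ *ₜ Φ (r + (sum σ + sum σ))
  regroup : ∀ x e l w y → x *ₜ e *ₜ (l *ₜ w) *ₜ y ≋ x *ₜ l *ₜ (e *ₜ w *ₜ y)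
  regroup = ≋-Solver.solve 5 (λ x e l w y → x ⊠ e ⊠ (l ⊠ w) ⊠ y ⊜ x ⊠ l ⊠ (e ⊠ w ⊠ y)) ≋-refl

-- Each row occurs once rounded up, as a lower end, and once rounded down, as an upper end, except
-- for the last one, which is 0.
sum-⌈⌉-⌊front⌋ : ∀ m μ → last (m ∷ μ) ≡ 0 →
  ℕ.⌈ m /2⌉ + (sum (map ℕ.⌈_/2⌉ μ) + sum (map ℕ.⌊_/2⌋ (front (m ∷ μ)))) ≡ m + sum μ
sum-⌈⌉-⌊front⌋ m []      e rewrite e = refl
sum-⌈⌉-⌊front⌋ m (k ∷ μ) e = begin
  c + (c′ + x + (f + y))      ≡⟨ solve 5 (λ c c′ x f y → c :+ (c′ :+ x :+ (f :+ y)) := (f :+ c) :+ (c′ :+ (x :+ y))) refl c c′ x f y ⟩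
  f + c + (c′ + (x + y))      ≡⟨ cong₂ _+_ (ℕ.⌊n/2⌋+⌈n/2⌉≡n m) (sum-⌈⌉-⌊front⌋ k μ e) ⟩
  m + (k + sum μ)             ∎
  where
  open ≡-Reasoning
  open +-*-Solver
  c = ℕ.⌈ m /2⌉
  f = ℕ.⌊ m /2⌋
  c′ = ℕ.⌈ k /2⌉
  x = sum (map ℕ.⌈_/2⌉ μ)
  y = sum (map ℕ.⌊_/2⌋ (front (k ∷ μ)))

sum-⌊⌋-double : ∀ μ → sum (map ℕ.⌊_/2⌋ μ) + sum (map ℕ.⌊_/2⌋ μ) ≤ sum μ
sum-⌊⌋-double []      = z≤n
sum-⌊⌋-double (m ∷ μ) = ℕ.≤-trans
  (ℕ.≤-reflexive (solve 2 (λ f x → (f :+ x) :+ (f :+ x) := (f :+ f) :+ (x :+ x)) refl ℕ.⌊ m /2⌋ (sum (map ℕ.⌊_/2⌋ μ))))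
  (ℕ.+-mono-≤ (proj₁ (≤⌊/2⌋⇔ (ℕ.⌊ m /2⌋) m) ℕ.≤-refl) (sum-⌊⌋-double μ))
  where open +-*-Solver

-- Both sides are 1 when a + S = 2h is even and ⌈m/2⌉ + p ≤ h, and 0 otherwise.
∑-even-δ : ∀ {N} m S a p q → ℕ.⌈ m /2⌉ + (p + q) ≡ S → q + q ≤ S → a + S < N →
  (∑[ x ← upTo N ] χ-even x *ₜ (le m x *ₜ 𝟙 (a + S ≟ x + (p + p)))) ≋
  antidiag a (λ c k → χ-even c *ₜ 𝟙 (q + q + k ≟ S))
∑-even-δ {N} m S a p q cpq q+q≤S small = ≋-trans (∑-even N (λ x → le m x *ₜ 𝟙 (a + S ≟ x + (p + p))))
  (go (a + S) refl (parity (a + S)))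
  where
  open +-*-Solver
  c₀ = ℕ.⌈ m /2⌉
  swap₄ : ∀ i p → i + i + (p + p) ≡ (i + p) + (i + p)
  swap₄ = solve 2 (λ i p → i :+ i :+ (p :+ p) := (i :+ p) :+ (i :+ p)) refl
  size : ∀ {c k} → c + k ≡ a → q + q + k ≡ S → a + S ≡ c + ((q + k) + (q + k))
  size {c} {k} ck qk = trans (cong₂ _+_ (sym ck) (sym qk))
    (solve 3 (λ c k q → (c :+ k) :+ (q :+ q :+ k) := c :+ ((q :+ k) :+ (q :+ k))) refl c k q)
  go : ∀ n → n ≡ a + S → Parity n →
    (∑[ i ← upTo N ] 𝟙 (i + i <? N) *ₜ (le m (i + i) *ₜ 𝟙 (a + S ≟ i + i + (p + p)))) ≋
    antidiag a (λ c k → χ-even c *ₜ 𝟙 (q + q + k ≟ S))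
  go _ odd≡ (odd b) = ≋-trans
    (∑-zero (upTo N) λ i → *ₜ-zeroʳ′ (𝟙 (i + i <? N)) (*ₜ-zeroʳ′ (le m (i + i)) (𝟙-no (a + S ≟ i + i + (p + p))
      λ e → double-≢ {b} {i + p} (trans odd≡ (trans e (swap₄ i p))))))
    (≋-sym (antidiag-zero a λ c k ck → ≋-trans (*ₜ-comm (χ-even c) (𝟙 (q + q + k ≟ S)))
      (𝟙-*-zero (q + q + k ≟ S) λ qk → χ-odd {r = q + k} (parity c) (trans odd≡ (size ck qk)))))
    where
    χ-odd : ∀ {c r} → Parity c → suc (b + b) ≡ c + (r + r) → χ-even c ≋ 0ₜ
    χ-odd {r = r} (even d) e = contradiction (trans e (swap₄ d r)) (double-≢ {b} {d + r})
    χ-odd (odd d)  e = χ-even-odd d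
  go _ even≡ (even h′) = decide (c₀ + p ≤? h′)
    where
    2q : a + (q + q) + S ≡ (h′ + q) + (h′ + q)
    2q = trans (solve 3 (λ a q S → a :+ (q :+ q) :+ S := (a :+ S) :+ (q :+ q)) refl a q S)
      (trans (cong (_+ (q + q)) (sym even≡)) (swap₄ h′ q))
    to : c₀ + p ≤ h′ → S ≤ a + (q + q)
    to h = ℕ.+-cancelʳ-≤ S S (a + (q + q)) (ℕ.≤-trans (ℕ.+-mono-≤ S≤ S≤) (ℕ.≤-reflexive (sym 2q)))
      where
      S≤ : S ≤ h′ + q
      S≤ = ℕ.≤-trans (ℕ.≤-reflexive (trans (sym cpq) (sym (ℕ.+-assoc c₀ p q)))) (ℕ.+-monoˡ-≤ q h)
    from : S ≤ a + (q + q) → c₀ + p ≤ h′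
    from h = ℕ.+-cancelʳ-≤ q (c₀ + p) h′ (ℕ.≤-trans (ℕ.≤-reflexive (trans (ℕ.+-assoc c₀ p q) cpq)) (halves S (h′ + q)
      (ℕ.≤-trans (ℕ.+-monoˡ-≤ S h) (ℕ.≤-reflexive 2q))))
      where
      halves : ∀ x y → x + x ≤ y + y → x ≤ y
      halves x y xx≤yy = ℕ.≤-trans (ℕ.≤-reflexive (ℕ.n≡⌊n+n/2⌋ x)) (ℕ.≤-trans (ℕ.⌊n/2⌋-mono xx≤yy) (ℕ.≤-reflexive (sym (ℕ.n≡⌊n+n/2⌋ y))))
    decide : Dec (c₀ + p ≤ h′) →
      (∑[ i ← upTo N ] 𝟙 (i + i <? N) *ₜ (le m (i + i) *ₜ 𝟙 (a + S ≟ i + i + (p + p)))) ≋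
      antidiag a (λ c k → χ-even c *ₜ 𝟙 (q + q + k ≟ S))
    decide (no h) = ≋-trans
      (∑-zero (upTo N) λ i → *ₜ-zeroʳ′ (𝟙 (i + i <? N)) (𝟙-*-zero (m ≤? i + i) λ m≤ → 𝟙-no (a + S ≟ i + i + (p + p))
        λ e → h (ℕ.≤-trans (ℕ.+-monoˡ-≤ p (proj₂ (⌈/2⌉≤⇔ m i) m≤))
          (ℕ.≤-reflexive (double-injective {i + p} {h′} (sym (trans even≡ (trans e (swap₄ i p)))))))))
      (≋-sym (antidiag-zero a λ c k ck → *ₜ-zeroʳ′ (χ-even c) (𝟙-no (q + q + k ≟ S) λ qk → h (from
        (ℕ.≤-trans (ℕ.≤-reflexive (trans (sym qk) (ℕ.+-comm (q + q) k))) (ℕ.+-monoˡ-≤ (q + q) (ℕ.≤-trans (ℕ.m≤n+m k c) (ℕ.≤-reflexive ck))))))))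
    decide (yes h) = ≋-trans
      (≋-trans (∑-upTo-δ N i₀ {λ i → 𝟙 (i + i <? N) *ₜ (le m (i + i) *ₜ 𝟙 (a + S ≟ i + i + (p + p)))} (ℕ.≤-<-trans (ℕ.m≤m+n i₀ i₀) i₀<N)
          λ i i≢ → *ₜ-zeroʳ′ (𝟙 (i + i <? N)) (*ₜ-zeroʳ′ (le m (i + i)) (𝟙-no (a + S ≟ i + i + (p + p)) λ e →
            i≢ (ℕ.+-cancelʳ-≡ p i i₀ (trans (double-injective {i + p} {h′} (trans (sym (swap₄ i p)) (trans (sym e) (sym even≡)))) (sym i₀+p))))))
        (≋-trans (𝟙-yes* (i₀ + i₀ <? N) i₀<N (le m (i₀ + i₀) *ₜ 𝟙 (a + S ≟ i₀ + i₀ + (p + p))))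
          (≋-trans (𝟙-yes* (m ≤? i₀ + i₀) (proj₁ (⌈/2⌉≤⇔ m i₀) (ℕ.+-cancelʳ-≤ p c₀ i₀ (ℕ.≤-trans h (ℕ.≤-reflexive (sym i₀+p)))))
              (𝟙 (a + S ≟ i₀ + i₀ + (p + p))))
            (𝟙-yes (a + S ≟ i₀ + i₀ + (p + p)) (sym (trans (swap₄ i₀ p) (trans (cong₂ _+_ i₀+p i₀+p) even≡)))))))
      (≋-sym (≋-trans (antidiag-δ a u {λ c k → χ-even c *ₜ 𝟙 (q + q + k ≟ S)} u≤a λ c k ck c≢u →
          *ₜ-zeroʳ′ (χ-even c) (𝟙-no (q + q + k ≟ S) λ qk → c≢u (ℕ.+-cancelʳ-≡ S c u
            (trans (trans (cong (λ n → c + n) (trans (sym qk) (ℕ.+-comm (q + q) k))) (trans (sym (ℕ.+-assoc c k (q + q))) (cong (_+ (q + q)) ck))) (sym u+S)))))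
        (≋-trans (*ₜ-cong (χ-u (parity u) (trans (sym (ℕ.+-assoc u S S)) (trans (cong (_+ S) u+S) 2q)))
            (𝟙-yes (q + q + (a ∸ u) ≟ S) qau))
          (*ₜ-identityˡ 1ₜ))))
      where
      -- Twice `i₀` is the only possible x, as i₀ + p has to be half of a + S; likewise `u` below is
      -- the only c with c + k = a and 2q + k = S.
      i₀ = h′ ∸ p
      i₀+p : i₀ + p ≡ h′
      i₀+p = ℕ.m∸n+n≡m (ℕ.≤-trans (ℕ.m≤n+m p c₀) h)
      i₀<N : i₀ + i₀ < N
      i₀<N = ℕ.≤-<-trans (ℕ.+-mono-≤ (ℕ.m∸n≤m h′ p) (ℕ.m∸n≤m h′ p)) (subst (_< N) (sym even≡) small)
      u = a + (q + q) ∸ S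
      u+S : u + S ≡ a + (q + q)
      u+S = ℕ.m∸n+n≡m (to h)
      u≤a : u ≤ a
      u≤a = ℕ.+-cancelʳ-≤ S u a (ℕ.≤-trans (ℕ.≤-reflexive u+S) (ℕ.+-monoʳ-≤ a q+q≤S))
      qau : q + q + (a ∸ u) ≡ S
      qau = ℕ.+-cancelˡ-≡ u (q + q + (a ∸ u)) S (trans
        (solve 3 (λ u q d → u :+ (q :+ d) := (u :+ d) :+ q) refl u (q + q) (a ∸ u))
        (trans (cong (_+ (q + q)) (ℕ.m+[n∸m]≡n u≤a)) (sym u+S)))
      χ-u : ∀ {u} → Parity u → u + (S + S) ≡ (h′ + q) + (h′ + q) → χ-even u ≋ 1ₜ
      χ-u (even d) e = χ-even-even d
      χ-u (odd d)  e = contradiction (trans (cong suc (sym (swap₄ d S))) e) (double-≢ {d + S} {h′ + q})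

-- The first row x of λ is kept apart; the rows below it are halved, reflected and doubled again.
-- What remains is to match the even values of x with the even values of c.
exchange-even : StripExchange evenRows χ-even
exchange-even N a n μ@(m ∷ μ′) (eμ , μ<N) last≡0 small = begin
  (∑[ λ′ ← box N (suc n) ] evenRows λ′ *ₜ (Down λ′ μ *ₜ 𝟙 (a + sum μ ≟ sum λ′)))
    ≈⟨ ∑-box-suc N n (λ λ′ → evenRows λ′ *ₜ (Down λ′ μ *ₜ 𝟙 (a + sum μ ≟ sum λ′))) ⟩
  (∑[ x ← upTo N ] ∑[ ν ← box N n ] χ-even x *ₜ evenRows ν *ₜ (le m x *ₜ Up ν μ *ₜ 𝟙 (a + sum μ ≟ x + sum ν)))
    ≈⟨ ∑-cong (upTo N) (λ x → ∑-box-congᴵ {N} {n} λ ν (eν , _) → ≋-trans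
         (regroup (χ-even x) (evenRows ν) (le m x) (Up ν μ) (𝟙 (a + sum μ ≟ x + sum ν)))
         (*ₜ-congʳ (χ-even x *ₜ (le m x *ₜ 𝟙 (a + sum μ ≟ x + sum ν))) (*ₜ-congˡ (evenRows ν) (up≋W ν eν)))) ⟩
  (∑[ x ← upTo N ] ∑[ ν ← box N n ] evenRows ν *ₜ W ν *ₜ (χ-even x *ₜ (le m x *ₜ 𝟙 (a + sum μ ≟ x + sum ν))))
    ≈⟨ ∑-swap (upTo N) (box N n) (λ x ν → evenRows ν *ₜ W ν *ₜ (χ-even x *ₜ (le m x *ₜ 𝟙 (a + sum μ ≟ x + sum ν)))) ⟩
  (∑[ ν ← box N n ] ∑[ x ← upTo N ] evenRows ν *ₜ W ν *ₜ (χ-even x *ₜ (le m x *ₜ 𝟙 (a + sum μ ≟ x + sum ν))))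
    ≈⟨ ∑-cong (box N n) (λ ν → ≋-sym (∑-*ˡ (upTo N) (evenRows ν *ₜ W ν) λ x → χ-even x *ₜ (le m x *ₜ 𝟙 (a + sum μ ≟ x + sum ν)))) ⟩
  (∑[ ν ← box N n ] evenRows ν *ₜ W ν *ₜ Φ (sum ν))
    ≡⟨ cong (λ k → ∑[ ν ← box N k ] evenRows ν *ₜ W ν *ₜ Φ (sum ν)) (sym n≡) ⟩
  (∑[ ν ← box N (length (front μ)) ] evenRows ν *ₜ W ν *ₜ Φ (sum ν))
    ≈⟨ halve μ′ (front μ) Φ (sym (length-front m μ′)) (All-front μ μ<N) ⟩
  (∑[ σ ← box N (length (front μ)) ] W/2 σ *ₜ Φ (sum σ + sum σ))
    ≡⟨ cong (λ k → ∑[ σ ← box N k ] W/2 σ *ₜ Φ (sum σ + sum σ)) (sym (List.length-map ℕ.⌊_/2⌋ (front μ))) ⟩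
  (∑[ σ ← box N (length (map ℕ.⌊_/2⌋ (front μ))) ] W/2 σ *ₜ Φ (sum σ + sum σ))
    ≈⟨ reflection (map ℕ.⌈_/2⌉ μ′) (map ℕ.⌊_/2⌋ (front μ)) {λ p → Φ (p + p)} {λ q → Φ′ (q + q)}
         (trans (List.length-map ℕ.⌈_/2⌉ μ′) (trans (sym (length-front m μ′)) (sym (List.length-map ℕ.⌊_/2⌋ (front μ)))))
         (All.map⁺ (All.map (ℕ.≤-<-trans (ℕ.⌊n/2⌋≤n _)) (All-front μ μ<N)))
         (λ p q p+q q≤ → ∑-even-δ m (sum μ) a p q
           (trans (cong (λ k → ℕ.⌈ m /2⌉ + k) p+q) (sum-⌈⌉-⌊front⌋ m μ′ last≡0))
           (ℕ.≤-trans (ℕ.+-mono-≤ q≤ q≤) (ℕ.≤-trans (sum-⌊⌋-double (front μ)) (ℕ.≤-reflexive sum-front≡))) small) ⟩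
  (∑[ σ ← box N (length (map ℕ.⌊_/2⌋ (front μ))) ] W/2 σ *ₜ Φ′ (sum σ + sum σ))
    ≡⟨ cong (λ k → ∑[ σ ← box N k ] W/2 σ *ₜ Φ′ (sum σ + sum σ)) (List.length-map ℕ.⌊_/2⌋ (front μ)) ⟩
  (∑[ σ ← box N (length (front μ)) ] W/2 σ *ₜ Φ′ (sum σ + sum σ))
    ≈⟨ halve μ′ (front μ) Φ′ (sym (length-front m μ′)) (All-front μ μ<N) ⟨
  (∑[ ν ← box N (length (front μ)) ] evenRows ν *ₜ W ν *ₜ Φ′ (sum ν))
    ≡⟨ cong (λ k → ∑[ ν ← box N k ] evenRows ν *ₜ W ν *ₜ Φ′ (sum ν)) n≡ ⟩
  (∑[ ν ← box N n ] evenRows ν *ₜ W ν *ₜ Φ′ (sum ν))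
    ≈⟨ ∑-box-congᴵ {N} {n} (λ ν (eν , _) → ≋-trans
         (*ₜ-congʳ (Φ′ (sum ν)) (*ₜ-congˡ (evenRows ν) (≋-sym (up≋W ν eν))))
         (*ₜ-assoc (evenRows ν) (Up ν μ) (Φ′ (sum ν)))) ⟩
  (∑[ ν ← box N n ] evenRows ν *ₜ (Up ν μ *ₜ Φ′ (sum ν))) ∎
  where
  open ≋-Reasoning
  n≡ : length (front μ) ≡ n
  n≡ = trans (length-front m μ′) (ℕ.suc-injective eμ)
  sum-front≡ : sum (front μ) ≡ sum μ
  sum-front≡ = trans (sym (ℕ.+-identityʳ (sum (front μ)))) (trans (cong (λ k → sum (front μ) + k) (sym last≡0)) (sum-front μ))
  W W/2 : ListFun
  W ν = within μ′ (front μ) ν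
  W/2 σ = within (map ℕ.⌈_/2⌉ μ′) (map ℕ.⌊_/2⌋ (front μ)) σ
  up≋W : ∀ ν → length ν ≡ n → Up ν μ ≋ W ν
  up≋W ν eν = Up-within ν m μ′ (trans (ℕ.suc-injective eμ) (sym eν))
  Φ Φ′ : ℕ → ℚ[t]
  Φ p = ∑[ x ← upTo N ] χ-even x *ₜ (le m x *ₜ 𝟙 (a + sum μ ≟ x + p))
  Φ′ q = antidiag a λ c k → χ-even c *ₜ 𝟙 (q + k ≟ sum μ)
  regroup : ∀ x e l u d → x *ₜ e *ₜ (l *ₜ u *ₜ d) ≋ e *ₜ u *ₜ (x *ₜ (l *ₜ d))
  regroup = ≋-Solver.solve 5 (λ x e l u d → x ⊠ e ⊠ (l ⊠ u ⊠ d) ⊜ e ⊠ u ⊠ (x ⊠ (l ⊠ d))) ≋-refl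

-- Shapes with even columns

-- All columns have even length exactly when the rows of a partition come in equal pairs; an
-- unpaired last row has to be 0.
evenColumns : ListFun
evenColumns []           = 1ₜ
evenColumns (x ∷ [])     = 𝟙 (x ≟ 0)
evenColumns (x ∷ y ∷ λ′) = 𝟙 (x ≟ y) *ₜ evenColumns λ′

∑-pair-δ : ∀ {N} c (F : ℕ → ℕ → ℚ[t]) → c < N → (∀ x y → ¬ (x ≡ c × y ≡ c) → F x y ≋ 0ₜ) →
  (∑[ x ← upTo N ] ∑[ y ← upTo N ] F x y) ≋ F c c
∑-pair-δ {N} c F c<N z = ≋-trans
  (∑-upTo-δ N c {λ x → ∑[ y ← upTo N ] F x y} c<N λ x x≢c → ∑-zero (upTo N) λ y → z x y (x≢c ∘ proj₁))
  (∑-upTo-δ N c c<N λ y y≢c → z c y (y≢c ∘ proj₂))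

∑-pair-box-δ : ∀ {N} n c (F : ListFun) → c < N → (∀ x y ρ → ¬ (x ≡ c × y ≡ c) → F (x ∷ y ∷ ρ) ≋ 0ₜ) →
  ∑ (box N (suc (suc n))) F ≋ (∑[ ρ ← box N n ] F (c ∷ c ∷ ρ))
∑-pair-box-δ {N} n c F c<N z = ≋-trans (∑-box-suc N (suc n) F)
  (≋-trans (∑-cong (upTo N) λ x → ∑-box-suc N n (x ∷ᶠ F))
    (∑-pair-δ c (λ x y → ∑[ ρ ← box N n ] F (x ∷ y ∷ ρ)) c<N λ x y ≢c → ∑-zero (box N n) λ ρ → z x y ρ ≢c))

-- The only shape with even columns that arises from μ by adding a horizontal
-- strip is (μ₁, μ₁, μ₃, μ₃, …), the only one that arises by removing a
-- horizontal strip is (μ₂, μ₂, μ₄, μ₄, …).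
exchange-columns : ∀ {N} M μ {Φ Φ′ : ℕ → ℚ[t]} → 0 < N → All (_< N) μ → last μ ≡ 0 →
  (∀ p q → p + q ≡ sum μ + sum μ → Φ p ≋ Φ′ q) →
  (∑[ λ′ ← box N (length μ) ] evenColumns λ′ *ₜ (cap M λ′ *ₜ Down λ′ μ) *ₜ Φ (sum λ′)) ≋
  cap M μ *ₜ (∑[ ν ← box N (ℕ.pred (length μ)) ] evenColumns ν *ₜ Up ν μ *ₜ Φ′ (sum ν))
exchange-columns M [] {Φ} {Φ′} 0<N μ<N last≡0 e = ≋-trans
  (≋-trans (+ₜ-identityʳ (1ₜ *ₜ (1ₜ *ₜ 1ₜ) *ₜ Φ 0)) (≋-trans (*ₜ-congʳ (Φ 0) (≋-trans (*ₜ-identityˡ (1ₜ *ₜ 1ₜ)) (*ₜ-identityˡ 1ₜ)))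
    (≋-trans (*ₜ-identityˡ (Φ 0)) (e 0 0 refl))))
  (≋-sym (≋-trans (*ₜ-identityˡ (1ₜ *ₜ 1ₜ *ₜ Φ′ 0 +ₜ 0ₜ)) (≋-trans (+ₜ-identityʳ (1ₜ *ₜ 1ₜ *ₜ Φ′ 0))
    (≋-trans (*ₜ-congʳ (Φ′ 0) (*ₜ-identityˡ 1ₜ)) (*ₜ-identityˡ (Φ′ 0))))))
exchange-columns {N} M (zero ∷ []) {Φ} {Φ′} 0<N μ<N last≡0 e = ≋-trans
  (≋-trans (∑-box-suc N 0 F)
    (≋-trans (∑-upTo-δ N 0 {λ x → F (x ∷ []) +ₜ 0ₜ} 0<N λ x x≢0 → ≋-trans (+ₜ-identityʳ (F (x ∷ [])))
        (*ₜ-zeroˡ (𝟙-no* (x ≟ 0) x≢0 (le x M *ₜ (le 0 x *ₜ 1ₜ))) (Φ (x + 0))))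
      (≋-trans (+ₜ-identityʳ (F (0 ∷ []))) (≋-trans (*ₜ-congʳ (Φ 0) (≋-trans (*ₜ-identityˡ (1ₜ *ₜ (1ₜ *ₜ 1ₜ)))
          (≋-trans (*ₜ-identityˡ (1ₜ *ₜ 1ₜ)) (*ₜ-identityˡ 1ₜ))))
        (≋-trans (*ₜ-identityˡ (Φ 0)) (e 0 0 refl))))))
  (≋-sym (≋-trans (*ₜ-identityˡ (1ₜ *ₜ 1ₜ *ₜ Φ′ 0 +ₜ 0ₜ)) (≋-trans (+ₜ-identityʳ (1ₜ *ₜ 1ₜ *ₜ Φ′ 0))
    (≋-trans (*ₜ-congʳ (Φ′ 0) (*ₜ-identityˡ 1ₜ)) (*ₜ-identityˡ (Φ′ 0))))))
  where
  F : ListFun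
  F λ′ = evenColumns λ′ *ₜ (cap M λ′ *ₜ Down λ′ (0 ∷ [])) *ₜ Φ (sum λ′)
exchange-columns {N} M (m ∷ k ∷ μ) {Φ} {Φ′} 0<N (m<N ∷ k<N ∷ μ<N) last≡0 e = begin
  ∑ (box N (suc (suc n))) F
    ≈⟨ ∑-pair-box-δ n m F m<N vanish ⟩
  (∑[ ρ ← box N n ] F (m ∷ m ∷ ρ))
    ≈⟨ ∑-cong (box N n) (λ ρ → ≋-trans (*ₜ-congʳ (Φ (m + (m + sum ρ))) (*ₜ-cong
         (𝟙-yes* (m ≟ m) refl (evenColumns ρ))
         (*ₜ-congˡ (le m M) (≋-trans (𝟙-yes* (m ≤? m) ℕ.≤-refl (le m m *ₜ (le k m *ₜ Up ρ (k ∷ μ))))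
           (≋-trans (𝟙-yes* (m ≤? m) ℕ.≤-refl (le k m *ₜ Up ρ (k ∷ μ))) (*ₜ-congˡ (le k m) (Up-Down-cap ρ k μ)))))))
         (regroup (evenColumns ρ) (le m M) (le k m) (cap k ρ *ₜ Down ρ μ) (Φ (m + (m + sum ρ))))) ⟩
  (∑[ ρ ← box N n ] le m M *ₜ le k m *ₜ (evenColumns ρ *ₜ (cap k ρ *ₜ Down ρ μ) *ₜ Φ (m + (m + sum ρ))))
    ≈⟨ ∑-*ˡ (box N n) (le m M *ₜ le k m) (λ ρ → evenColumns ρ *ₜ (cap k ρ *ₜ Down ρ μ) *ₜ Φ (m + (m + sum ρ))) ⟨
  le m M *ₜ le k m *ₜ (∑[ ρ ← box N n ] evenColumns ρ *ₜ (cap k ρ *ₜ Down ρ μ) *ₜ Φ (m + (m + sum ρ)))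
    ≈⟨ *ₜ-congˡ (le m M *ₜ le k m) (exchange-columns k μ {λ p → Φ (m + (m + p))} {λ q → Φ′ (k + (k + q))} 0<N μ<N (last-tail μ last≡0)
         λ p q p+q → e (m + (m + p)) (k + (k + q)) (trans
           (solve 4 (λ m k p q → (m :+ (m :+ p)) :+ (k :+ (k :+ q)) := (m :+ m) :+ (k :+ k) :+ (p :+ q)) refl m k p q)
           (trans (cong (λ z → m + m + (k + k) + z) p+q)
             (solve 3 (λ m k s → (m :+ m) :+ (k :+ k) :+ (s :+ s) := (m :+ (k :+ s)) :+ (m :+ (k :+ s))) refl m k (sum μ))))) ⟩
  le m M *ₜ le k m *ₜ (cap k μ *ₜ (∑[ ν ← box N (ℕ.pred n) ] evenColumns ν *ₜ Up ν μ *ₜ Φ′ (k + (k + sum ν))))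
    ≈⟨ *ₜ-assoc (le m M) (le k m) (cap k μ *ₜ (∑[ ν ← box N (ℕ.pred n) ] evenColumns ν *ₜ Up ν μ *ₜ Φ′ (k + (k + sum ν)))) ⟩
  le m M *ₜ (le k m *ₜ (cap k μ *ₜ (∑[ ν ← box N (ℕ.pred n) ] evenColumns ν *ₜ Up ν μ *ₜ Φ′ (k + (k + sum ν)))))
    ≈⟨ *ₜ-congˡ (le m M) (removal μ last≡0) ⟨
  le m M *ₜ (∑[ ν ← box N (suc n) ] evenColumns ν *ₜ Up ν (m ∷ k ∷ μ) *ₜ Φ′ (sum ν)) ∎
  where
  open ≋-Reasoning
  open +-*-Solver
  n = length μ
  F : ListFun
  F λ′ = evenColumns λ′ *ₜ (cap M λ′ *ₜ Down λ′ (m ∷ k ∷ μ)) *ₜ Φ (sum λ′)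
  last-tail : ∀ {k} μ → last (k ∷ μ) ≡ 0 → last μ ≡ 0
  last-tail []      _ = refl
  last-tail (_ ∷ _) e = e
  regroup : ∀ x a b c d → x *ₜ (a *ₜ (b *ₜ c)) *ₜ d ≋ a *ₜ b *ₜ (x *ₜ c *ₜ d)
  regroup = ≋-Solver.solve 5 (λ x a b c d → x ⊠ (a ⊠ (b ⊠ c)) ⊠ d ⊜ a ⊠ b ⊠ (x ⊠ c ⊠ d)) ≋-refl
  vanish : ∀ x y ρ → ¬ (x ≡ m × y ≡ m) → F (x ∷ y ∷ ρ) ≋ 0ₜ
  vanish x y ρ ≢m = *ₜ-zeroˡ (≋-trans (*ₜ-assoc (𝟙 (x ≟ y)) (evenColumns ρ) Z) (𝟙-*-zero (x ≟ y) λ { refl →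
      *ₜ-zeroʳ′ (evenColumns ρ) (*ₜ-zeroʳ′ (le x M) (𝟙-*-zero (m ≤? x) λ m≤x → 𝟙-no* (x ≤? m)
        (λ x≤m → ≢m (ℕ.≤-antisym x≤m m≤x , ℕ.≤-antisym x≤m m≤x)) (le k x *ₜ Up ρ (k ∷ μ)))) })) (Φ (x + (y + sum ρ)))
    where Z = le x M *ₜ (le m x *ₜ (le y m *ₜ (le k y *ₜ Up ρ (k ∷ μ))))
  removal : ∀ μ → last (k ∷ μ) ≡ 0 →
    (∑[ ν ← box N (suc (length μ)) ] evenColumns ν *ₜ Up ν (m ∷ k ∷ μ) *ₜ Φ′ (sum ν)) ≋
    le k m *ₜ (cap k μ *ₜ (∑[ ν ← box N (ℕ.pred (length μ)) ] evenColumns ν *ₜ Up ν μ *ₜ Φ′ (k + (k + sum ν))))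
  removal [] refl = ≋-trans (∑-box-suc N 0 G)
    (≋-trans (∑-upTo-δ N 0 {λ x → G (x ∷ []) +ₜ 0ₜ} 0<N λ x x≢0 → ≋-trans (+ₜ-identityʳ (G (x ∷ [])))
        (*ₜ-zeroˡ (𝟙-no* (x ≟ 0) x≢0 (le x m *ₜ (le 0 x *ₜ 1ₜ))) (Φ′ (x + 0))))
      (≋-trans (+ₜ-identityʳ (1ₜ *ₜ (1ₜ *ₜ (1ₜ *ₜ 1ₜ)) *ₜ Φ′ 0)) (≋-trans (simplify (Φ′ 0))
        (≋-sym (*ₜ-congˡ 1ₜ (*ₜ-congˡ 1ₜ (+ₜ-identityʳ (1ₜ *ₜ 1ₜ *ₜ Φ′ 0))))))))
    where
    G : ListFun
    G ν = evenColumns ν *ₜ Up ν (m ∷ 0 ∷ []) *ₜ Φ′ (sum ν)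
    simplify : ∀ z → 1ₜ *ₜ (1ₜ *ₜ (1ₜ *ₜ 1ₜ)) *ₜ z ≋ 1ₜ *ₜ (1ₜ *ₜ (1ₜ *ₜ 1ₜ *ₜ z))
    simplify z = ≋-Solver.solve 2 (λ u z → u ⊠ (u ⊠ (u ⊠ u)) ⊠ z ⊜ u ⊠ (u ⊠ (u ⊠ u ⊠ z))) ≋-refl 1ₜ z
  removal (j ∷ μ) _ = begin
    ∑ (box N (suc (suc (length μ)))) G
      ≈⟨ ∑-pair-box-δ (length μ) k G k<N vanish′ ⟩
    (∑[ ν ← box N (length μ) ] G (k ∷ k ∷ ν))
      ≈⟨ ∑-cong (box N (length μ)) (λ ν → ≋-trans (*ₜ-congʳ (Φ′ (k + (k + sum ν))) (*ₜ-cong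
           (𝟙-yes* (k ≟ k) refl (evenColumns ν))
           (*ₜ-congˡ (le k m) (≋-trans (𝟙-yes* (k ≤? k) ℕ.≤-refl (le k k *ₜ (le j k *ₜ Up ν (j ∷ μ))))
             (𝟙-yes* (k ≤? k) ℕ.≤-refl (le j k *ₜ Up ν (j ∷ μ)))))))
           (≋-trans (regroup (evenColumns ν) (le k m) (le j k) (Up ν (j ∷ μ)) (Φ′ (k + (k + sum ν))))
             (*ₜ-assoc (le k m) (le j k) (evenColumns ν *ₜ Up ν (j ∷ μ) *ₜ Φ′ (k + (k + sum ν)))))) ⟩
    (∑[ ν ← box N (length μ) ] le k m *ₜ (le j k *ₜ (evenColumns ν *ₜ Up ν (j ∷ μ) *ₜ Φ′ (k + (k + sum ν)))))
      ≈⟨ ≋-trans (*ₜ-congˡ (le k m) (∑-*ˡ (box N (length μ)) (le j k) λ ν → evenColumns ν *ₜ Up ν (j ∷ μ) *ₜ Φ′ (k + (k + sum ν))))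
           (∑-*ˡ (box N (length μ)) (le k m) λ ν → le j k *ₜ (evenColumns ν *ₜ Up ν (j ∷ μ) *ₜ Φ′ (k + (k + sum ν)))) ⟨
    le k m *ₜ (le j k *ₜ (∑[ ν ← box N (length μ) ] evenColumns ν *ₜ Up ν (j ∷ μ) *ₜ Φ′ (k + (k + sum ν)))) ∎
    where
    G : ListFun
    G ν = evenColumns ν *ₜ Up ν (m ∷ k ∷ j ∷ μ) *ₜ Φ′ (sum ν)
    vanish′ : ∀ x y ρ → ¬ (x ≡ k × y ≡ k) → G (x ∷ y ∷ ρ) ≋ 0ₜ
    vanish′ x y ρ ≢k = *ₜ-zeroˡ (≋-trans (*ₜ-assoc (𝟙 (x ≟ y)) (evenColumns ρ) Z) (𝟙-*-zero (x ≟ y) λ { refl →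
        *ₜ-zeroʳ′ (evenColumns ρ) (*ₜ-zeroʳ′ (le x m) (𝟙-*-zero (k ≤? x) λ k≤x → 𝟙-no* (x ≤? k)
          (λ x≤k → ≢k (ℕ.≤-antisym x≤k k≤x , ℕ.≤-antisym x≤k k≤x)) (le j x *ₜ Up ρ (j ∷ μ)))) })) (Φ′ (x + (y + sum ρ)))
      where Z = le x m *ₜ (le k x *ₜ (le y k *ₜ (le j y *ₜ Up ρ (j ∷ μ))))

-- Here C = 1 forces c = 0. The two possible shapes have sizes adding up to 2|μ|, so λ arises by
-- adding a cells exactly when ν arises by removing a cells. The recursion in `exchange-columns`
-- needs a bound on the first row; the bound N is vacuous inside the box.
exchange-even-columns : StripExchange evenColumns χ-zero
exchange-even-columns N a n μ@(m ∷ μ′) (eμ , m<N ∷ μ′<N) last≡0 small = begin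
  (∑[ λ′ ← box N (suc n) ] evenColumns λ′ *ₜ (Down λ′ μ *ₜ 𝟙 (a + sum μ ≟ sum λ′)))
    ≈⟨ ∑-box-congᴵ {N} {suc n} (λ λ′ (_ , λ<N) → ≋-trans
         (≋-sym (*ₜ-assoc (evenColumns λ′) (Down λ′ μ) (𝟙 (a + sum μ ≟ sum λ′))))
         (*ₜ-congʳ (𝟙 (a + sum μ ≟ sum λ′)) (*ₜ-congˡ (evenColumns λ′)
           (≋-sym (≋-trans (*ₜ-congʳ (Down λ′ μ) (cap-N λ′ λ<N)) (*ₜ-identityˡ (Down λ′ μ))))))) ⟩
  (∑[ λ′ ← box N (suc n) ] evenColumns λ′ *ₜ (cap N λ′ *ₜ Down λ′ μ) *ₜ 𝟙 (a + sum μ ≟ sum λ′))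
    ≡⟨ cong (λ k → ∑[ λ′ ← box N k ] evenColumns λ′ *ₜ (cap N λ′ *ₜ Down λ′ μ) *ₜ 𝟙 (a + sum μ ≟ sum λ′)) (sym eμ) ⟩
  (∑[ λ′ ← box N (length μ) ] evenColumns λ′ *ₜ (cap N λ′ *ₜ Down λ′ μ) *ₜ 𝟙 (a + sum μ ≟ sum λ′))
    ≈⟨ exchange-columns N μ {λ p → 𝟙 (a + sum μ ≟ p)} {Φ′} (ℕ.≤-<-trans z≤n small) (m<N ∷ μ′<N) last≡0 (λ p q p+q → ≋-trans
         (𝟙-⇔ (a + sum μ ≟ p) (q + a ≟ sum μ)
           (λ e → ℕ.+-cancelˡ-≡ (sum μ) (q + a) (sum μ) (trans (solve 3 (λ s q a → s :+ (q :+ a) := (a :+ s) :+ q) refl (sum μ) q a) (trans (cong (_+ q) e) p+q)))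
           (λ e → ℕ.+-cancelʳ-≡ q (a + sum μ) p (trans (solve 3 (λ s q a → (a :+ s) :+ q := s :+ (q :+ a)) refl (sum μ) q a) (trans (cong (λ k → sum μ + k) e) (sym p+q)))))
         (≋-sym (≋-trans (antidiag-δ a 0 {λ c k → χ-zero c *ₜ 𝟙 (q + k ≟ sum μ)} z≤n λ c k _ c≢0 → 𝟙-no* (c ≟ 0) c≢0 (𝟙 (q + k ≟ sum μ)))
           (*ₜ-identityˡ (𝟙 (q + a ≟ sum μ)))))) ⟩
  cap N μ *ₜ (∑[ ν ← box N (length μ′) ] evenColumns ν *ₜ Up ν μ *ₜ Φ′ (sum ν))
    ≈⟨ ≋-trans (*ₜ-congʳ (∑[ ν ← box N (length μ′) ] evenColumns ν *ₜ Up ν μ *ₜ Φ′ (sum ν)) (cap-N μ (m<N ∷ μ′<N)))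
         (*ₜ-identityˡ (∑[ ν ← box N (length μ′) ] evenColumns ν *ₜ Up ν μ *ₜ Φ′ (sum ν))) ⟩
  (∑[ ν ← box N (length μ′) ] evenColumns ν *ₜ Up ν μ *ₜ Φ′ (sum ν))
    ≡⟨ cong (λ k → ∑[ ν ← box N k ] evenColumns ν *ₜ Up ν μ *ₜ Φ′ (sum ν)) (ℕ.suc-injective eμ) ⟩
  (∑[ ν ← box N n ] evenColumns ν *ₜ Up ν μ *ₜ Φ′ (sum ν))
    ≈⟨ ∑-cong (box N n) (λ ν → *ₜ-assoc (evenColumns ν) (Up ν μ) (Φ′ (sum ν))) ⟩
  (∑[ ν ← box N n ] evenColumns ν *ₜ (Up ν μ *ₜ Φ′ (sum ν))) ∎
  where
  open ≋-Reasoning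
  open +-*-Solver
  Φ′ : ℕ → ℚ[t]
  Φ′ q = antidiag a λ c k → χ-zero c *ₜ 𝟙 (q + k ≟ sum μ)
  cap-N : ∀ λ′ → All (_< N) λ′ → cap N λ′ ≋ 1ₜ
  cap-N []       _         = ≋-refl
  cap-N (l ∷ λ′) (l<N ∷ _) = 𝟙-yes (l ≤? N) (ℕ.<⇒≤ l<N)

-- Sums of Schur functions weighted by 𝓔

nth : List ℕ → ℕ → ℕ
nth []      _       = 0
nth (a ∷ α) zero    = a
nth (a ∷ α) (suc j) = nth α j

nth-last : ∀ μ n → length μ ≡ suc n → nth μ n ≡ last μ
nth-last (m ∷ [])    zero    e = refl
nth-last (m ∷ k ∷ μ) (suc n) e = nth-last (k ∷ μ) n (ℕ.suc-injective e)

nth≤sum : ∀ μ j → nth μ j ≤ sum μ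
nth≤sum []      j       = z≤n
nth≤sum (m ∷ μ) zero    = ℕ.m≤m+n m (sum μ)
nth≤sum (m ∷ μ) (suc j) = ℕ.≤-trans (nth≤sum μ j) (ℕ.m≤n+m (sum μ) m)

Up-nth : ∀ μ ρ j → nth ρ j < nth μ j → Up μ ρ ≋ 0ₜ
Up-nth (m ∷ μ) []      j       h = ≋-refl
Up-nth (m ∷ μ) (r ∷ ρ) zero    h = 𝟙-no* (m ≤? r) (ℕ.<⇒≱ h) (cap m ρ *ₜ Up μ ρ)
Up-nth (m ∷ μ) (r ∷ ρ) (suc j) h = *ₜ-zeroʳ′ (le m r) (*ₜ-zeroʳ′ (cap m ρ) (Up-nth μ ρ j h))

-- Removing a horizontal strip lowers the number of nonempty rows by at most one, so a tableau has
-- at most as many rows as letters. Rows are counted from 0.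
K-rows : ∀ N α μ → 0 < nth μ (length α) → K N α μ ≋ 0ₜ
K-rows N []      μ       h = 𝟙-no (sum μ ≟ 0) λ e → ℕ.<⇒≱ h (ℕ.≤-trans (nth≤sum μ 0) (ℕ.≤-reflexive e))
K-rows N (a ∷ α) (m ∷ μ) h = ∑-zero (box N (suc (length μ))) λ ρ → go ρ (0 <? nth ρ (length α))
  where
  go : ∀ ρ → Dec (0 < nth ρ (length α)) → Down (m ∷ μ) ρ *ₜ (𝟙 (a + sum ρ ≟ m + sum μ) *ₜ K N α ρ) ≋ 0ₜ
  go ρ (yes 0<) = *ₜ-zeroʳ′ (Down (m ∷ μ) ρ) (*ₜ-zeroʳ′ (𝟙 (a + sum ρ ≟ m + sum μ)) (K-rows N α ρ 0<))
  go ρ (no 0≮)  = *ₜ-zeroˡ (*ₜ-zeroʳ′ (cap m ρ) (Up-nth μ ρ (length α) (ℕ.≤-<-trans (ℕ.≮⇒≥ 0≮) h)))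
    (𝟙 (a + sum ρ ≟ m + sum μ) *ₜ K N α ρ)

-- The coefficient of x^α in the sum of 𝓔(λ) s_λ.
weightedSchur : ListFun → ℕ → ListFun
weightedSchur 𝓔 N α = ∑[ λ′ ← box N (length α) ] 𝓔 λ′ *ₜ K N α λ′

-- The counterpart of `Ω-∷`. The strip of the first letter, which leads from μ up to λ, is exchanged
-- for one leading down to ν, and Pieri's rule sums over μ. The exchange demands an empty last row;
-- a shape μ with n + 1 nonempty rows has no tableau in the n letters of α.
weightedSchur-∷ : ∀ {𝓔 χ} → StripExchange 𝓔 χ → ∀ N a α → a + sum α < N →
  weightedSchur 𝓔 N (a ∷ α) ≋ (q⟨ χ ⟩ a ⋆ weightedSchur 𝓔 N) α
weightedSchur-∷ {𝓔} {χ} exchange N a α small = begin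
  (∑[ λ′ ← Bₙ₊₁ ] 𝓔 λ′ *ₜ (∑[ μ ← box N (length λ′) ] Down λ′ μ *ₜ (𝟙 (a + sum μ ≟ sum λ′) *ₜ K N α μ)))
    ≈⟨ ∑-box-congᴵ {N} {suc n} (λ λ′ (eλ , _) → ≋-trans
         (≡⇒≋ (cong (λ k → 𝓔 λ′ *ₜ (∑[ μ ← box N k ] Down λ′ μ *ₜ (𝟙 (a + sum μ ≟ sum λ′) *ₜ K N α μ))) eλ))
         (≋-trans (∑-*ˡ Bₙ₊₁ (𝓔 λ′) (λ μ → Down λ′ μ *ₜ (𝟙 (a + sum μ ≟ sum λ′) *ₜ K N α μ)))
           (∑-cong Bₙ₊₁ λ μ → toFront (𝓔 λ′) (Down λ′ μ) (𝟙 (a + sum μ ≟ sum λ′)) (K N α μ)))) ⟩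
  (∑[ λ′ ← Bₙ₊₁ ] ∑[ μ ← Bₙ₊₁ ] K N α μ *ₜ (𝓔 λ′ *ₜ (Down λ′ μ *ₜ 𝟙 (a + sum μ ≟ sum λ′))))
    ≈⟨ ∑-swap Bₙ₊₁ Bₙ₊₁ (λ λ′ μ → K N α μ *ₜ (𝓔 λ′ *ₜ (Down λ′ μ *ₜ 𝟙 (a + sum μ ≟ sum λ′)))) ⟩
  (∑[ μ ← Bₙ₊₁ ] ∑[ λ′ ← Bₙ₊₁ ] K N α μ *ₜ (𝓔 λ′ *ₜ (Down λ′ μ *ₜ 𝟙 (a + sum μ ≟ sum λ′))))
    ≈⟨ ∑-box-congᴵ {N} {suc n} (λ μ μ∈ → ≋-trans
         (≋-sym (∑-*ˡ Bₙ₊₁ (K N α μ) (λ λ′ → 𝓔 λ′ *ₜ (Down λ′ μ *ₜ 𝟙 (a + sum μ ≟ sum λ′)))))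
         (≋-trans (step μ μ∈ (sum μ ≟ sum α) (last μ ≟ 0)) (≋-trans
           (∑-*ˡ Bₙ (K N α μ) (λ ν → 𝓔 ν *ₜ (Up ν μ *ₜ Q (sum ν))))
           (∑-cong Bₙ λ ν → toBack (K N α μ) (𝓔 ν) (Up ν μ) (Q (sum ν)))))) ⟩
  (∑[ μ ← Bₙ₊₁ ] ∑[ ν ← Bₙ ] 𝓔 ν *ₜ Q (sum ν) *ₜ (Up ν μ *ₜ K N α μ))
    ≈⟨ ∑-swap Bₙ₊₁ Bₙ (λ μ ν → 𝓔 ν *ₜ Q (sum ν) *ₜ (Up ν μ *ₜ K N α μ)) ⟩
  (∑[ ν ← Bₙ ] ∑[ μ ← Bₙ₊₁ ] 𝓔 ν *ₜ Q (sum ν) *ₜ (Up ν μ *ₜ K N α μ))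
    ≈⟨ ∑-box-congᴵ {N} {n} (λ ν (eν , _) → ≋-trans (≋-sym (∑-*ˡ Bₙ₊₁ (𝓔 ν *ₜ Q (sum ν)) (λ μ → Up ν μ *ₜ K N α μ)))
         (≋-trans (*ₜ-congˡ (𝓔 ν *ₜ Q (sum ν)) (≋-trans
             (≡⇒≋ (cong (λ k → ∑[ μ ← box N (suc k) ] Up ν μ *ₜ K N α μ) (sym eν)))
             (pieri α ν (ℕ.≤-<-trans (ℕ.m≤n+m (sum α) a) small))))
           (∑-*ˡ (splittings α) (𝓔 ν *ₜ Q (sum ν)) (λ (β , γ) → K N γ ν)))) ⟩
  (∑[ ν ← Bₙ ] ∑[ (β , γ) ← splittings α ] 𝓔 ν *ₜ Q (sum ν) *ₜ K N γ ν)
    ≈⟨ ∑-swap Bₙ (splittings α) (λ ν (β , γ) → 𝓔 ν *ₜ Q (sum ν) *ₜ K N γ ν) ⟩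
  (∑[ (β , γ) ← splittings α ] ∑[ ν ← Bₙ ] 𝓔 ν *ₜ Q (sum ν) *ₜ K N γ ν)
    ≈⟨ ∑-congAll (All.zipWith (λ { {β , γ} (e , (_ , eγ)) → ≋-trans
           (∑-cong Bₙ λ ν → split β γ ν e (sum ν ≟ sum γ))
           (≋-trans (≋-sym (∑-*ˡ Bₙ (q⟨ χ ⟩ a β) (λ ν → 𝓔 ν *ₜ K N γ ν)))
             (≡⇒≋ (cong (λ k → q⟨ χ ⟩ a β *ₜ (∑[ ν ← box N k ] 𝓔 ν *ₜ K N γ ν)) (sym eγ)))) })
         (sum-splittings α , length-splittings α)) ⟩
  (q⟨ χ ⟩ a ⋆ weightedSchur 𝓔 N) α ∎
  where
  open ≋-Reasoning
  n = length α
  Bₙ = box N n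
  Bₙ₊₁ = box N (suc n)
  Q : ℕ → ℚ[t]
  Q x = antidiag a λ c k → χ c *ₜ 𝟙 (x + k ≟ sum α)
  toFront : ∀ e d i k → e *ₜ (d *ₜ (i *ₜ k)) ≋ k *ₜ (e *ₜ (d *ₜ i))
  toFront = ≋-Solver.solve 4 (λ e d i k → e ⊠ (d ⊠ (i ⊠ k)) ⊜ k ⊠ (e ⊠ (d ⊠ i))) ≋-refl
  toBack : ∀ k e u q → k *ₜ (e *ₜ (u *ₜ q)) ≋ e *ₜ q *ₜ (u *ₜ k)
  toBack = ≋-Solver.solve 4 (λ k e u q → k ⊠ (e ⊠ (u ⊠ q)) ⊜ e ⊠ q ⊠ (u ⊠ k)) ≋-refl
  step : ∀ μ → InBox N (suc n) μ → Dec (sum μ ≡ sum α) → Dec (last μ ≡ 0) →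
    K N α μ *ₜ (∑[ λ′ ← Bₙ₊₁ ] 𝓔 λ′ *ₜ (Down λ′ μ *ₜ 𝟙 (a + sum μ ≟ sum λ′))) ≋
    K N α μ *ₜ (∑[ ν ← Bₙ ] 𝓔 ν *ₜ (Up ν μ *ₜ Q (sum ν)))
  step μ μ∈ (yes e) (yes last≡0) = *ₜ-congˡ (K N α μ) (≋-trans
    (exchange N a n μ μ∈ last≡0 (subst (λ k → a + k < N) (sym e) small))
    (≡⇒≋ (cong (λ S → ∑[ ν ← Bₙ ] 𝓔 ν *ₜ (Up ν μ *ₜ antidiag a λ c k → χ c *ₜ 𝟙 (sum ν + k ≟ S))) e)))
  step μ μ∈ (no μ≢) _ = ≋-trans (*ₜ-zeroˡ (K-degree N α μ μ≢) _) (≋-sym (*ₜ-zeroˡ (K-degree N α μ μ≢) _))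
  step μ (eμ , _) (yes _) (no last≢0) = ≋-trans (*ₜ-zeroˡ K≋0 _) (≋-sym (*ₜ-zeroˡ K≋0 _))
    where
    K≋0 : K N α μ ≋ 0ₜ
    K≋0 = K-rows N α μ (subst (0 <_) (sym (nth-last μ n eμ)) (ℕ.n≢0⇒n>0 last≢0))
  split : ∀ β γ ν → sum β + sum γ ≡ sum α → Dec (sum ν ≡ sum γ) →
    𝓔 ν *ₜ Q (sum ν) *ₜ K N γ ν ≋ q⟨ χ ⟩ a β *ₜ (𝓔 ν *ₜ K N γ ν)
  split β γ ν e (no ν≢) = ≋-trans (*ₜ-zeroʳ′ (𝓔 ν *ₜ Q (sum ν)) (K-degree N γ ν ν≢))
    (≋-sym (*ₜ-zeroʳ′ (q⟨ χ ⟩ a β) (*ₜ-zeroʳ′ (𝓔 ν) (K-degree N γ ν ν≢))))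
  -- With |ν| = |γ| the condition |ν| + k = |α| becomes |β| = k, which is the factor h_k in
  -- `q⟨ χ ⟩ a`.
  split β γ ν e (yes ν≡) = ≋-trans (*ₜ-congʳ (K N γ ν) (≋-trans (*ₜ-comm (𝓔 ν) (Q (sum ν))) (*ₜ-congʳ (𝓔 ν)
      (antidiag-cong a λ c k _ → *ₜ-congˡ (χ c) (𝟙-⇔ (sum ν + k ≟ sum α) (sum β ≟ k)
        (λ e′ → sym (ℕ.+-cancelˡ-≡ (sum γ) k (sum β) (trans (cong (_+ k) (sym ν≡)) (trans e′ (trans (sym e) (ℕ.+-comm (sum β) (sum γ)))))))
        λ { refl → trans (cong (_+ k) ν≡) (trans (ℕ.+-comm (sum γ) (sum β)) e) })))))
    (*ₜ-assoc (q⟨ χ ⟩ a β) (𝓔 ν) (K N γ ν))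

-- Both sides obey the same recursion in the first exponent and equal 1 without variables. N stays
-- fixed while α shrinks, hence an inequality in place of a choice of N.
weightedSchur-Ω : ∀ {f 𝓔 χ ψ} → 𝓔 [] ≋ 1ₜ → StripExchange 𝓔 χ → Littlewood f χ ψ →
  ∀ N α → sum α < N → weightedSchur 𝓔 N α ≋ hat (Ω f) α
weightedSchur-Ω {f} {𝓔} {χ} 𝓔[] exchange L N α = go (length α) α refl
  where
  go : ∀ n α → length α ≡ n → sum α < N → weightedSchur 𝓔 N α ≋ hat (Ω f) α
  go zero    []      _  _     = ≋-trans (+ₜ-identityʳ (𝓔 [] *ₜ 1ₜ)) (≋-trans (*ₜ-identityʳ (𝓔 []))
    (≋-trans 𝓔[] (≋-sym (Ω-const f (toPartition []) refl))))
  go (suc n) (a ∷ α) eα small = ≋-trans (weightedSchur-∷ {𝓔} {χ} exchange N a α small) (≋-trans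
    (∑-congAll (All.zipWith (λ { {β , γ} (e , (_ , eγ)) → *ₜ-congˡ (q⟨ χ ⟩ a β) (go n γ (trans eγ (ℕ.suc-injective eα))
        (ℕ.≤-<-trans (ℕ.≤-trans (ℕ.m≤n+m (sum γ) (sum β)) (ℕ.≤-trans (ℕ.≤-reflexive e) (ℕ.m≤n+m (sum α) a))) small)) })
      (sum-splittings α , length-splittings α)))
    (≋-sym (Ω-∷ L a α)))

-- Comparison of the two versions of Kostka numbers

∑-horizontalStrips-box : ∀ {N} x μ (g : ListFun) → Linked _≥_ (x ∷ μ) → x < N →
  ∑ (horizontalStrips (x ∷ μ)) g ≋ (∑[ ρ ← box N (suc (length μ)) ] Down (x ∷ μ) ρ *ₜ g ρ)
∑-horizontalStrips-box {N} x [] g _ x<N = begin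
  ∑ (map (_∷ []) (upTo (suc x))) g
    ≈⟨ ∑-map (_∷ []) (upTo (suc x)) g ⟩
  (∑[ i ← upTo (suc x) ] g (i ∷ []))
    ≈⟨ ∑-upTo-cong (suc x) (λ { i (s≤s i≤x) → ≋-trans (≋-sym (*ₜ-identityˡ (g (i ∷ []))))
         (≋-trans (*ₜ-congʳ (g (i ∷ [])) (≋-sym (≋-trans (*ₜ-identityʳ (le i x)) (𝟙-yes (i ≤? x) i≤x))))
           (≋-sym (+ₜ-identityʳ (le i x *ₜ 1ₜ *ₜ g (i ∷ []))))) }) ⟩
  (∑[ i ← upTo (suc x) ] le i x *ₜ 1ₜ *ₜ g (i ∷ []) +ₜ 0ₜ)
    ≈⟨ ∑-upTo-≤ (λ i → le i x *ₜ 1ₜ *ₜ g (i ∷ []) +ₜ 0ₜ) x<N (λ i x<i _ → +ₜ-0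
         (*ₜ-zeroˡ (𝟙-no* (i ≤? x) (ℕ.<⇒≱ x<i) 1ₜ) (g (i ∷ []))) ≋-refl) ⟨
  (∑[ i ← upTo N ] le i x *ₜ 1ₜ *ₜ g (i ∷ []) +ₜ 0ₜ)
    ≈⟨ ∑-box-suc N 0 (λ ρ → Down (x ∷ []) ρ *ₜ g ρ) ⟨
  (∑[ ρ ← box N 1 ] Down (x ∷ []) ρ *ₜ g ρ) ∎
  where open ≋-Reasoning
∑-horizontalStrips-box {N} x (b ∷ μ) g (x≥b ∷ μ↘) x<N = begin
  ∑ (horizontalStrips (x ∷ b ∷ μ)) g
    ≈⟨ ∑-concatMap (λ i → map ((b + i) ∷_) (horizontalStrips (b ∷ μ))) (upTo (suc (x ∸ b))) g ⟩
  (∑[ i ← upTo (suc (x ∸ b)) ] ∑ (map ((b + i) ∷_) (horizontalStrips (b ∷ μ))) g)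
    ≈⟨ ∑-cong (upTo (suc (x ∸ b))) (λ i → ≋-trans (∑-map ((b + i) ∷_) (horizontalStrips (b ∷ μ)) g)
         (∑-horizontalStrips-box b μ ((b + i) ∷ᶠ g) μ↘ (ℕ.≤-<-trans x≥b x<N))) ⟩
  antidiag (x ∸ b) (λ p q → φ (b + p))
    ≈⟨ ∑-interval φ x≥b x<N ⟨
  (∑[ r ← upTo N ] le b r *ₜ le r x *ₜ φ r)
    ≈⟨ ∑-cong (upTo N) (λ r → ≋-trans (∑-*ˡ Bₙ (le b r *ₜ le r x) (λ ρ → Down (b ∷ μ) ρ *ₜ g (r ∷ ρ)))
         (∑-cong Bₙ λ ρ → regroup (le b r) (le r x) (Down (b ∷ μ) ρ) (g (r ∷ ρ)))) ⟩
  (∑[ r ← upTo N ] ∑[ ρ ← Bₙ ] Down (x ∷ b ∷ μ) (r ∷ ρ) *ₜ g (r ∷ ρ))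
    ≈⟨ ∑-box-suc N (suc (length μ)) (λ ρ → Down (x ∷ b ∷ μ) ρ *ₜ g ρ) ⟨
  (∑[ ρ ← box N (suc (suc (length μ))) ] Down (x ∷ b ∷ μ) ρ *ₜ g ρ) ∎
  where
  open ≋-Reasoning
  Bₙ = box N (suc (length μ))
  φ : ℕ → ℚ[t]
  φ r = ∑[ ρ ← Bₙ ] Down (b ∷ μ) ρ *ₜ g (r ∷ ρ)
  regroup : ∀ l r d g → l *ₜ r *ₜ (d *ₜ g) ≋ r *ₜ (l *ₜ d) *ₜ g
  regroup = ≋-Solver.solve 4 (λ l r d g → l ⊠ r ⊠ (d ⊠ g) ⊜ r ⊠ (l ⊠ d) ⊠ g) ≋-refl

-- Two consecutive rows of either shape are separated by a row of the other. Vectors in the box that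
-- are not decreasing therefore drop out of the sums.
Down-linked : ∀ μ ρ → length ρ ≡ length μ → Down μ ρ ≋ 0ₜ ⊎ (Linked _≥_ μ × Linked _≥_ ρ)
Down-linked []          []           e = inj₂ ([] , [])
Down-linked (x ∷ [])    (r ∷ [])     e = inj₂ ([-] , [-])
Down-linked (x ∷ y ∷ μ) (r ∷ r′ ∷ ρ) e
  with r ≤? x | y ≤? r | r′ ≤? y | Down-linked (y ∷ μ) (r′ ∷ ρ) (ℕ.suc-injective e)
... | no r≰x  | _       | _        | _              = inj₁ (*ₜ-zeroˡ (𝟙-no (r ≤? x) r≰x) (Up (y ∷ μ) (r ∷ r′ ∷ ρ)))
... | yes _   | no y≰r  | _        | _              = inj₁ (*ₜ-zeroʳ′ (le r x) (𝟙-no* (y ≤? r) y≰r (Down (y ∷ μ) (r′ ∷ ρ))))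
... | yes _   | yes _   | _        | inj₁ z         = inj₁ (*ₜ-zeroʳ′ (le r x) (*ₜ-zeroʳ′ (le y r) z))
... | yes _   | yes _   | no r′≰y  | inj₂ _         = inj₁ (*ₜ-zeroʳ′ (le r x) (*ₜ-zeroʳ′ (le y r) (𝟙-no* (r′ ≤? y) r′≰y (Up μ (r′ ∷ ρ)))))
... | yes r≤x | yes y≤r | yes r′≤y | inj₂ (μ↘ , ρ↘) = inj₂ (ℕ.≤-trans y≤r r≤x ∷ μ↘ , ℕ.≤-trans r′≤y y≤r ∷ ρ↘)

κ-K : ∀ {N} α μ → Linked _≥_ μ → All (_< N) μ → κ μ α ≋ K N α μ
κ-K []      μ       μ↘ μ<N = κ-[] μ
κ-K (a ∷ α) []      μ↘ μ<N = ≋-trans (κ-∷ [] a α) (+ₜ-congʳ 0ₜ (≋-trans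
  (*ₜ-congˡ (𝟙 (a + 0 ≟ 0)) (κ-K α [] [] [])) (≋-sym (*ₜ-identityˡ (𝟙 (a + 0 ≟ 0) *ₜ K _ α [])))))
κ-K {N} (a ∷ α) μ@(x ∷ μ′) μ↘ (x<N ∷ _) = ≋-trans (κ-∷ μ a α)
  (≋-trans (∑-horizontalStrips-box x μ′ (λ ρ → 𝟙 (a + sum ρ ≟ sum μ) *ₜ κ ρ α) μ↘ x<N)
    (∑-box-congᴵ {N} {length μ} λ ρ (eρ , ρ<N) → go ρ ρ<N (Down-linked μ ρ eρ)))
  where
  go : ∀ ρ → All (_< N) ρ → Down μ ρ ≋ 0ₜ ⊎ (Linked _≥_ μ × Linked _≥_ ρ) →
    Down μ ρ *ₜ (𝟙 (a + sum ρ ≟ sum μ) *ₜ κ ρ α) ≋ Down μ ρ *ₜ (𝟙 (a + sum ρ ≟ sum μ) *ₜ K N α ρ)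
  go ρ ρ<N (inj₁ z)        = ≋-trans (*ₜ-zeroˡ z _) (≋-sym (*ₜ-zeroˡ z _))
  go ρ ρ<N (inj₂ (_ , ρ↘)) = *ₜ-congˡ (Down μ ρ) (*ₜ-congˡ (𝟙 (a + sum ρ ≟ sum μ)) (κ-K α ρ ρ↘ ρ<N))

K-unlinked : ∀ {N} α λ′ → length λ′ ≡ length α → ¬ Linked _≥_ λ′ → K N α λ′ ≋ 0ₜ
K-unlinked     []      []       e ¬↘ = contradiction [] ¬↘
K-unlinked {N} (a ∷ α) (x ∷ λ′) e ¬↘ = ∑-zeroAll (All.map
  (λ {ρ} (eρ , _) → go ρ (Down-linked (x ∷ λ′) ρ eρ)) (box-sound N (suc (length λ′))))
  where
  go : ∀ ρ → Down (x ∷ λ′) ρ ≋ 0ₜ ⊎ (Linked _≥_ (x ∷ λ′) × Linked _≥_ ρ) →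
    Down (x ∷ λ′) ρ *ₜ (𝟙 (a + sum ρ ≟ x + sum λ′) *ₜ K N α ρ) ≋ 0ₜ
  go ρ (inj₁ z)       = *ₜ-zeroˡ z _
  go ρ (inj₂ (↘ , _)) = contradiction ↘ ¬↘

∑-horizontalStrips-++0 : ∀ μ (g : ListFun) →
  ∑ (horizontalStrips (μ ++ 0 ∷ [])) g ≋ (∑[ ρ ← horizontalStrips μ ] g (ρ ++ 0 ∷ []))
∑-horizontalStrips-++0 []          g = ≋-refl
∑-horizontalStrips-++0 (x ∷ [])    g = ≋-trans
  (∑-concatMap (λ i → map (i ∷_) (horizontalStrips (0 ∷ []))) (upTo (suc x)) g)
  (≋-trans (∑-cong (upTo (suc x)) λ i → +ₜ-identityʳ (g (i ∷ 0 ∷ [])))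
    (≋-sym (∑-map (_∷ []) (upTo (suc x)) (λ ρ → g (ρ ++ 0 ∷ [])))))
∑-horizontalStrips-++0 (x ∷ b ∷ μ) g = ≋-trans
  (∑-concatMap (λ i → map ((b + i) ∷_) (horizontalStrips (b ∷ μ ++ 0 ∷ []))) (upTo (suc (x ∸ b))) g)
  (≋-trans (∑-cong (upTo (suc (x ∸ b))) λ i → ≋-trans (∑-map ((b + i) ∷_) (horizontalStrips (b ∷ μ ++ 0 ∷ [])) g)
      (≋-trans (∑-horizontalStrips-++0 (b ∷ μ) ((b + i) ∷ᶠ g))
        (≋-sym (∑-map ((b + i) ∷_) (horizontalStrips (b ∷ μ)) (λ ρ → g (ρ ++ 0 ∷ []))))))
    (≋-sym (∑-concatMap (λ i → map ((b + i) ∷_) (horizontalStrips (b ∷ μ))) (upTo (suc (x ∸ b))) (λ ρ → g (ρ ++ 0 ∷ [])))))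

sum-++0 : ∀ μ → sum (μ ++ 0 ∷ []) ≡ sum μ
sum-++0 μ = trans (sum-++ μ (0 ∷ [])) (ℕ.+-identityʳ (sum μ))

κ-++0 : ∀ μ α → κ (μ ++ 0 ∷ []) α ≋ κ μ α
κ-++0 μ []      = ≋-trans (κ-[] (μ ++ 0 ∷ [])) (≋-trans (≡⇒≋ (cong (λ n → 𝟙 (n ≟ 0)) (sum-++0 μ))) (≋-sym (κ-[] μ)))
κ-++0 μ (a ∷ α) = ≋-trans (κ-∷ (μ ++ 0 ∷ []) a α)
  (≋-trans (∑-horizontalStrips-++0 μ (λ ρ → 𝟙 (a + sum ρ ≟ sum (μ ++ 0 ∷ [])) *ₜ κ ρ α))
    (≋-trans (∑-cong (horizontalStrips μ) λ ρ → *ₜ-cong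
        (≡⇒≋ (cong₂ (λ m n → 𝟙 (a + m ≟ n)) (sum-++0 ρ) (sum-++0 μ))) (κ-++0 ρ α))
      (≋-sym (κ-∷ μ a α))))

κ-++zeros : ∀ μ k α → κ (μ ++ replicate k 0) α ≋ κ μ α
κ-++zeros μ zero    α = ≡⇒≋ (cong (λ ν → κ ν α) (List.++-identityʳ μ))
κ-++zeros μ (suc k) α = ≋-trans (≡⇒≋ (cong (λ ν → κ ν α) (sym (List.++-assoc μ (0 ∷ []) (replicate k 0)))))
  (≋-trans (κ-++zeros (μ ++ 0 ∷ []) k α) (κ-++0 μ α))

-- Padding partitions by zeros

box-complete : ∀ {N n α} → InBox N n α → α ∈ box N n
box-complete {n = zero}  {[]}    _ = here refl
box-complete {N} {suc n} {a ∷ α} (e , a<N ∷ α<N) = ∈.∈-concatMap⁺ (λ i → map (i ∷_) (box N n))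
  (lose (∈.∈-upTo⁺ a<N) (∈.∈-map⁺ (a ∷_) (box-complete (ℕ.suc-injective e , α<N))))

box-unique : ∀ N n → AllPairs _≢_ (box N n)
box-unique N zero    = [] ∷ []
box-unique N (suc n) = AllPairs.concat⁺
  (All.map⁺ (All.universal (λ i → AllPairs.map⁺ (AllPairs.map (λ α≢β e → α≢β (List.∷-injectiveʳ e)) (box-unique N n))) (upTo N)))
  (AllPairs.map⁺ (AllPairs.applyUpTo⁺₁ id N λ i<j _ → All.map⁺ (All.universal (λ α → All.map⁺
    (All.universal (λ β e → ℕ.<⇒≢ i<j (List.∷-injectiveˡ e)) (box N n))) (box N n))))

filter-zeros : ∀ {α} → All (_≤ 0) α → filter (0 <?_) α ≡ [] × α ≡ replicate (length α) 0
filter-zeros []            = refl , refl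
filter-zeros (z≤n ∷ α≤0) = proj₁ (filter-zeros α≤0) , cong (0 ∷_) (proj₂ (filter-zeros α≤0))

linked-zeros : ∀ {α} → Linked _≥_ α → α ≡ filter (0 <?_) α ++ replicate (length α ∸ length (filter (0 <?_) α)) 0
linked-zeros {[]}        α↘ = refl
linked-zeros {zero ∷ α}  α↘ with linked-≤-head α↘ z≤n
... | _ ∷ α≤0 rewrite proj₁ (filter-zeros α≤0) = cong (0 ∷_) (proj₂ (filter-zeros α≤0))
linked-zeros {suc a ∷ α} α↘ = cong (suc a ∷_) (linked-zeros (Linked.tail α↘))

filter-linked : ∀ {α} → Linked _≥_ α → filter (0 <?_) α ≡ parts (toPartition α)
filter-linked {α} α↘ = decreasing-↭ (Linked.filter⁺ (0 <?_) (λ a≥b b≥c → ℕ.≤-trans b≥c a≥b) α↘) (decreasing (toPartition α))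
  (↭-sym (parts-toPartition-↭ α))

pad : ℕ → Partition → List ℕ
pad m μ = parts μ ++ replicate (m ∸ length (parts μ)) 0

pad-unique : ∀ {m μ λ′} → Linked _≥_ λ′ → length λ′ ≡ m → parts μ ≡ parts (toPartition λ′) → λ′ ≡ pad m μ
pad-unique {m} {μ} {λ′} λ↘ refl e = trans (linked-zeros λ↘)
  (cong (λ α → α ++ replicate (length λ′ ∸ length α) 0) (trans (filter-linked λ↘) (sym e)))

linked-++zeros : ∀ {α} k → Linked _≥_ α → Linked _≥_ (α ++ replicate k 0)
linked-++zeros {[]}        k       α↘        = linked-const k 0
linked-++zeros {a ∷ []}    zero    α↘        = [-]
linked-++zeros {a ∷ []}    (suc k) α↘        = z≤n ∷ linked-const (suc k) 0
linked-++zeros {a ∷ b ∷ α} k       (a≥b ∷ α↘) = a≥b ∷ linked-++zeros k α↘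

toPartition-pad : ∀ m μ → toPartition (pad m μ) ≡ μ
toPartition-pad m μ = partition-≡ (trans (sym (filter-linked (linked-++zeros (m ∸ length (parts μ)) (decreasing μ))))
  (trans (List.filter-++ (0 <?_) (parts μ) (replicate k 0))
    (trans (cong₂ _++_ (List.filter-all (0 <?_) (positive μ)) (proj₁ (filter-zeros {replicate k 0} (All.replicate⁺ k z≤n))))
      (List.++-identityʳ (parts μ)))))
  where k = m ∸ length (parts μ)

-- Both sums equal a double sum over pairs of a partition and a vector in the box that sorts to it.
-- A partition of the right size with at most m parts has just one decreasing padding to m rows;
-- with more parts it has no tableau in m letters, and unsorted vectors have K = 0.
∑-weightedSchur : ∀ {P : Partition → Set} (P? : Decidable P) (𝓔 : ListFun) →
  (∀ μ k → 𝓔 (parts μ ++ replicate k 0) ≋ 𝟙 (P? μ)) → ∀ {M} α → sum α ≤ M →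
  (∑[ μ ← partitionsUpTo M ] 𝟙 (P? μ) *ₜ κ (parts μ) α) ≋ weightedSchur 𝓔 (suc (sum α)) α
∑-weightedSchur P? 𝓔 𝓔-P {M} α α≤M = begin
  (∑[ μ ← partitionsUpTo M ] 𝟙 (P? μ) *ₜ κ (parts μ) α)
    ≈⟨ ∑-cong (partitionsUpTo M) (λ μ → byShape μ (∣ μ ∣ ≟ sum α) (length (parts μ) ≤? m)) ⟩
  (∑[ μ ← partitionsUpTo M ] ∑[ λ′ ← box N m ] 𝟙 (μ ≡ₚ? toPartition λ′) *ₜ (𝓔 λ′ *ₜ K N α λ′))
    ≈⟨ ∑-swap (partitionsUpTo M) (box N m) (λ μ λ′ → 𝟙 (μ ≡ₚ? toPartition λ′) *ₜ (𝓔 λ′ *ₜ K N α λ′)) ⟩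
  (∑[ λ′ ← box N m ] ∑[ μ ← partitionsUpTo M ] 𝟙 (μ ≡ₚ? toPartition λ′) *ₜ (𝓔 λ′ *ₜ K N α λ′))
    ≈⟨ ∑-cong (box N m) (λ λ′ → byPartition λ′ (sum λ′ ≟ sum α)) ⟩
  (∑[ λ′ ← box N m ] 𝓔 λ′ *ₜ K N α λ′) ∎
  where
  open ≋-Reasoning
  -- The rows of a shape of size |α| are at most |α|, hence below N.
  N = suc (sum α)
  m = length α
  byPartition : ∀ λ′ → Dec (sum λ′ ≡ sum α) →
    (∑[ μ ← partitionsUpTo M ] 𝟙 (μ ≡ₚ? toPartition λ′) *ₜ (𝓔 λ′ *ₜ K N α λ′)) ≋ 𝓔 λ′ *ₜ K N α λ′
  byPartition λ′ (no λ≢) = ≋-trans (∑-zero (partitionsUpTo M) λ μ → *ₜ-zeroʳ′ (𝟙 (μ ≡ₚ? toPartition λ′)) z) (≋-sym z)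
    where
    z : 𝓔 λ′ *ₜ K N α λ′ ≋ 0ₜ
    z = *ₜ-zeroʳ′ (𝓔 λ′) (K-degree N α λ′ λ≢)
  byPartition λ′ (yes λ≡) = ≋-trans
    (∑-partitionsUpTo-δ (toPartition λ′) {λ μ → 𝟙 (μ ≡ₚ? toPartition λ′) *ₜ (𝓔 λ′ *ₜ K N α λ′)}
      (ℕ.≤-trans (ℕ.≤-reflexive (trans (∣toPartition∣ λ′) λ≡)) α≤M)
      λ μ μ≢ → 𝟙-no* (μ ≡ₚ? toPartition λ′) (μ≢ ∘ partition-≡) (𝓔 λ′ *ₜ K N α λ′))
    (𝟙-yes* (toPartition λ′ ≡ₚ? toPartition λ′) refl (𝓔 λ′ *ₜ K N α λ′))
  parts<N : ∀ μ → ∣ μ ∣ ≡ sum α → All (_< N) (parts μ)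
  parts<N μ e = All.map (λ a≤ → s≤s (ℕ.≤-trans a≤ (ℕ.≤-reflexive e))) (all-≤-sum (parts μ))
  nth-positive : ∀ {β} → All (0 <_) β → ∀ j → j < length β → 0 < nth β j
  nth-positive (b>0 ∷ _)   zero    _         = b>0
  nth-positive (_   ∷ β>0) (suc j) (s≤s j<) = nth-positive β>0 j j<
  byShape : ∀ μ → Dec (∣ μ ∣ ≡ sum α) → Dec (length (parts μ) ≤ m) →
    𝟙 (P? μ) *ₜ κ (parts μ) α ≋ (∑[ λ′ ← box N m ] 𝟙 (μ ≡ₚ? toPartition λ′) *ₜ (𝓔 λ′ *ₜ K N α λ′))
  byShape μ (no μ≢) _ = ≋-trans (*ₜ-zeroʳ′ (𝟙 (P? μ)) (κ-degree (parts μ) α μ≢))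
    (≋-sym (∑-zero (box N m) λ λ′ → 𝟙-*-zero (μ ≡ₚ? toPartition λ′) λ e → *ₜ-zeroʳ′ (𝓔 λ′)
      (K-degree N α λ′ λ e′ → μ≢ (trans (cong sum e) (trans (∣toPartition∣ λ′) e′)))))
  byShape μ (yes μ≡) (no μ≰m) = ≋-trans
    (*ₜ-zeroʳ′ (𝟙 (P? μ)) (≋-trans (κ-K {N} α (parts μ) (decreasing μ) (parts<N μ μ≡))
      (K-rows N α (parts μ) (nth-positive (positive μ) m (ℕ.≰⇒> μ≰m)))))
    (≋-sym (∑-zeroAll (All.map (λ {λ′} (eλ , _) → 𝟙-no* (μ ≡ₚ? toPartition λ′)
      (λ e → μ≰m (ℕ.≤-trans (ℕ.≤-reflexive (trans (cong length e) (↭.↭-length (parts-toPartition-↭ λ′))))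
        (ℕ.≤-trans (List.length-filter (0 <?_) λ′) (ℕ.≤-reflexive eλ)))) (𝓔 λ′ *ₜ K N α λ′)) (box-sound N m))))
  byShape μ (yes μ≡) (yes μ≤m) = ≋-sym (≋-trans
    (∑-δ-box (λ λ′ λ∈ λ≢ → other λ′ λ∈ λ≢ (μ ≡ₚ? toPartition λ′) (Linked.linked? (λ a b → b ≤? a) λ′)))
    (≋-trans (𝟙-yes* (μ ≡ₚ? toPartition (pad m μ)) (cong parts (sym (toPartition-pad m μ))) (𝓔 (pad m μ) *ₜ K N α (pad m μ)))
      (*ₜ-cong (𝓔-P μ (m ∸ length (parts μ))) (≋-trans (≋-sym (κ-K α (pad m μ) pad↘ pad<N))
        (κ-++zeros (parts μ) (m ∸ length (parts μ)) α)))))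
    where
    F : ListFun
    F λ′ = 𝟙 (μ ≡ₚ? toPartition λ′) *ₜ (𝓔 λ′ *ₜ K N α λ′)
    pad↘ : Linked _≥_ (pad m μ)
    pad↘ = linked-++zeros (m ∸ length (parts μ)) (decreasing μ)
    pad<N : All (_< N) (pad m μ)
    pad<N = All.++⁺ (parts<N μ μ≡) (All.replicate⁺ (m ∸ length (parts μ)) (s≤s z≤n))
    length-pad : length (pad m μ) ≡ m
    length-pad = trans (List.length-++ (parts μ)) (trans (cong (λ k → length (parts μ) + k) (List.length-replicate (m ∸ length (parts μ))))
      (ℕ.m+[n∸m]≡n μ≤m))
    ∑-δ-box : (∀ λ′ → InBox N m λ′ → λ′ ≢ pad m μ → F λ′ ≋ 0ₜ) → ∑ (box N m) F ≋ F (pad m μ)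
    ∑-δ-box z = ≋-trans (∑-box-congᴵ {N} {m} λ λ′ λ∈ → pick λ′ λ∈ (≡-dec _≟_ λ′ (pad m μ)))
      (≋-trans (∑-δ {f = λ λ′ → 𝟙 (≡-dec _≟_ λ′ (pad m μ)) *ₜ F λ′} (box-unique N m) (box-complete (length-pad , pad<N))
          λ λ′ λ≢ → 𝟙-no* (≡-dec _≟_ λ′ (pad m μ)) λ≢ (F λ′))
        (𝟙-yes* (≡-dec _≟_ (pad m μ) (pad m μ)) refl (F (pad m μ))))
      where
      pick : ∀ λ′ → InBox N m λ′ → Dec (λ′ ≡ pad m μ) → F λ′ ≋ 𝟙 (≡-dec _≟_ λ′ (pad m μ)) *ₜ F λ′
      pick λ′ λ∈ (yes e)  = ≋-sym (𝟙-yes* (≡-dec _≟_ λ′ (pad m μ)) e (F λ′))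
      pick λ′ λ∈ (no λ≢) = ≋-trans (z λ′ λ∈ λ≢) (≋-sym (𝟙-no* (≡-dec _≟_ λ′ (pad m μ)) λ≢ (F λ′)))
    other : ∀ λ′ → InBox N m λ′ → λ′ ≢ pad m μ → Dec (parts μ ≡ parts (toPartition λ′)) → Dec (Linked _≥_ λ′) → F λ′ ≋ 0ₜ
    other λ′ _        λ≢ (no μ≢)  _         = 𝟙-no* (μ ≡ₚ? toPartition λ′) μ≢ (𝓔 λ′ *ₜ K N α λ′)
    other λ′ (eλ , _) λ≢ (yes e)  (no ¬↘)   = *ₜ-zeroʳ′ (𝟙 (μ ≡ₚ? toPartition λ′)) (*ₜ-zeroʳ′ (𝓔 λ′) (K-unlinked α λ′ eλ ¬↘))
    other λ′ (eλ , _) λ≢ (yes e)  (yes λ↘)  = contradiction (pad-unique {μ = μ} λ↘ eλ e) λ≢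

-- The weights as indicators of even rows and even columns

χ-even-𝟙 : ∀ n → χ-even n ≋ 𝟙 (2 ∣? n)
χ-even-𝟙 n = go (parity n)
  where
  go : ∀ {n} → Parity n → χ-even n ≋ 𝟙 (2 ∣? n)
  go (even b) = ≋-trans (χ-even-even b) (≋-sym (𝟙-yes (2 ∣? b + b) (divides b (trans (sym (2*-≡ b)) (ℕ.*-comm 2 b)))))
  go (odd b)  = ≋-trans (χ-even-odd b) (≋-sym (𝟙-no (2 ∣? suc (b + b)) λ { (divides c e) →
    double-≢ {b} {c} (trans e (trans (ℕ.*-comm c 2) (2*-≡ c))) }))

evenRows-𝟙 : ∀ α k → evenRows (α ++ replicate k 0) ≋ 𝟙 (all? (2 ∣?_) α)
evenRows-𝟙 [] zero    = ≋-refl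
evenRows-𝟙 [] (suc k) = ≋-trans (*ₜ-identityˡ (evenRows (replicate k 0))) (evenRows-𝟙 [] k)
evenRows-𝟙 (a ∷ α) k = ≋-trans (*ₜ-cong (χ-even-𝟙 a) (evenRows-𝟙 α k))
  (≋-trans (≋-sym (𝟙-× (2 ∣? a) (all? (2 ∣?_) α)))
    (𝟙-⇔ ((2 ∣? a) ×-dec all? (2 ∣?_) α) (all? (2 ∣?_) (a ∷ α)) (λ (h , hs) → h ∷ hs) λ { (h ∷ hs) → h , hs }))

data PairedRows : List ℕ → Set where
  []   : PairedRows []
  zero : PairedRows (0 ∷ [])
  pair : ∀ x {α} → PairedRows α → PairedRows (x ∷ x ∷ α)

pairedRows? : Decidable PairedRows
pairedRows? []              = yes []
pairedRows? (zero ∷ [])     = yes zero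
pairedRows? (suc x ∷ [])    = no λ ()
pairedRows? (x ∷ y ∷ α) with x ≟ y | pairedRows? α
... | yes refl | yes h = yes (pair x h)
... | yes refl | no ¬h = no λ { (pair _ h) → ¬h h }
... | no x≢y   | _     = no λ { (pair _ _) → x≢y refl }

evenColumns-𝟙 : ∀ α → evenColumns α ≋ 𝟙 (pairedRows? α)
evenColumns-𝟙 []           = ≋-refl
evenColumns-𝟙 (zero ∷ [])  = ≋-refl
evenColumns-𝟙 (suc x ∷ []) = ≋-refl
evenColumns-𝟙 (x ∷ y ∷ α)  = ≋-trans (*ₜ-congˡ (𝟙 (x ≟ y)) (evenColumns-𝟙 α))
  (≋-trans (≋-sym (𝟙-× (x ≟ y) (pairedRows? α)))
    (𝟙-⇔ ((x ≟ y) ×-dec pairedRows? α) (pairedRows? (x ∷ y ∷ α)) (λ { (refl , h) → pair x h }) λ { (pair _ h) → refl , h }))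

column : List ℕ → ℕ → ℕ
column α j = length (filter (j <?_) α)

paired-column : ∀ {α} → PairedRows α → ∀ j → 2 ℕ.∣ column α j
paired-column []               j = divides-refl 0
paired-column zero             j rewrite List.filter-reject (j <?_) {0} {[]} (λ ()) = divides-refl 0
paired-column (pair x {α} h) j with j <? x
... | yes j<x rewrite List.filter-accept (j <?_) {x} {x ∷ α} j<x | List.filter-accept (j <?_) {x} {α} j<x =
  ℕ.∣m∣n⇒∣m+n (divides-refl 1) (paired-column h j)
... | no j≮x rewrite List.filter-reject (j <?_) {x} {x ∷ α} j≮x | List.filter-reject (j <?_) {x} {α} j≮x = paired-column h j

column-≤ : ∀ {α j} → All (_≤ j) α → column α j ≡ 0
column-≤ {α} {j} α≤j = cong length (List.filter-none (j <?_) (All.map ℕ.≤⇒≯ α≤j))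

2∤1 : ¬ (2 ℕ.∣ 1)
2∤1 (divides zero ())
2∤1 (divides (suc _) ())

-- If the first two rows x > y differ, the column with index y meets the first row only and has
-- length 1. Otherwise both rows can be removed without changing the parity of any column.
column-paired : ∀ {α} → Linked _≥_ α → (∀ j → 2 ℕ.∣ column α j) → PairedRows α
column-paired {[]}         _  _ = []
column-paired {zero ∷ []}  _  _ = zero
column-paired {suc x ∷ []} _  h = contradiction (h 0) 2∤1
column-paired {x ∷ y ∷ α} (x≥y ∷ α↘) h with x ≟ y
... | no x≢y = contradiction (subst (2 ℕ.∣_) single (h y)) 2∤1
  where
  single : column (x ∷ y ∷ α) y ≡ 1
  single = trans (cong length (List.filter-accept (y <?_) {x} {y ∷ α} (ℕ.≤∧≢⇒< x≥y (x≢y ∘ sym))))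
    (cong suc (column-≤ (linked-≤-head α↘ ℕ.≤-refl)))
... | yes refl = pair x (column-paired (Linked.tail α↘) rest)
  where
  rest : ∀ j → 2 ℕ.∣ column α j
  rest j with j <? x
  ... | yes j<x = ℕ.∣m+n∣m⇒∣n (subst (2 ℕ.∣_)
      (trans (cong length (List.filter-accept (j <?_) {x} {x ∷ α} j<x)) (cong (suc ∘ length) (List.filter-accept (j <?_) {x} {α} j<x))) (h j))
    (divides-refl 1)
  ... | no j≮x  = subst (2 ℕ.∣_)
      (trans (cong length (List.filter-reject (j <?_) {x} {x ∷ α} j≮x)) (cong length (List.filter-reject (j <?_) {x} {α} j≮x))) (h j)

column-++zeros : ∀ α k j → column (α ++ replicate k 0) j ≡ column α j
column-++zeros α k j = trans (cong length (List.filter-++ (j <?_) α (replicate k 0)))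
  (trans (List.length-++ (filter (j <?_) α)) (trans (cong (λ n → column α j + n) (column-≤ (All.replicate⁺ k z≤n))) (ℕ.+-identityʳ (column α j))))

evenColumns-𝒫 : ∀ μ k → evenColumns (parts μ ++ replicate k 0) ≋ 𝟙 (𝒫? ▯ μ)
evenColumns-𝒫 μ k = ≋-trans (evenColumns-𝟙 (parts μ ++ replicate k 0))
  (𝟙-⇔ (pairedRows? (parts μ ++ replicate k 0)) (𝒫? ▯ μ)
    (λ h → All.universal (λ j → subst (2 ℕ.∣_) (column-++zeros (parts μ) k j) (paired-column h j)) (upTo ∣ μ ∣))
    λ h → column-paired (linked-++zeros k (decreasing μ)) λ j → subst (2 ℕ.∣_) (sym (column-++zeros (parts μ) k j)) (all-columns h j))
  where
  all-columns : 𝒫 ▯ μ → ∀ j → 2 ℕ.∣ column (parts μ) j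
  all-columns h j with j <? ∣ μ ∣
  ... | yes j< = All.lookup h (∈.∈-upTo⁺ j<)
  ... | no j≮  = subst (2 ℕ.∣_) (sym (column-≤ (All.map (λ a≤ → ℕ.≤-trans a≤ (ℕ.≮⇒≥ j≮)) (all-≤-sum (parts μ))))) (divides-refl 0)

-- Littlewood's identity

Ω-weighted : ∀ {P : Partition → Set} (P? : Decidable P) (𝓔 : ListFun) →
  (∀ μ k → 𝓔 (parts μ ++ replicate k 0) ≋ 𝟙 (P? μ)) → ∀ {f χ ψ} → 𝓔 [] ≋ 1ₜ → StripExchange 𝓔 χ → Littlewood f χ ψ →
  ∀ {M} λ′ → ∣ λ′ ∣ ≤ M → Ω f λ′ ≋ (∑[ μ ← partitionsUpTo M ] 𝟙 (P? μ) *ₜ coeff (s μ) λ′)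
Ω-weighted P? 𝓔 𝓔-P {f} {χ} 𝓔[] exchange L {M} λ′ ≤M = ≋-sym (≋-trans
  (∑-cong (partitionsUpTo M) λ μ → *ₜ-congˡ (𝟙 (P? μ)) (coeff-s μ λ′))
  (≋-trans (∑-weightedSchur P? 𝓔 𝓔-P (parts λ′) ≤M)
    (≋-trans (weightedSchur-Ω {f} {𝓔} {χ} 𝓔[] exchange L (suc ∣ λ′ ∣) (parts λ′) ℕ.≤-refl)
      (≡⇒≋ (hat-parts (Ω f) λ′)))))

littlewood-identity : ∀ ◇ {M} λ′ → ∣ λ′ ∣ ≤ M → Ω f[ ◇ ] λ′ ≋ (∑[ μ ← partitionsUpTo M ] 𝟙 (𝒫? ◇ μ) *ₜ coeff (s μ) λ′)
littlewood-identity ∅ {M} λ′ ≤M = ≋-trans (Ω-0 {f[ ∅ ]} (λ _ → ≋-refl) λ′) (≋-trans (≋-sym (coeff-1Λ λ′)) (≋-trans (1∞-s λ′)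
  (≋-sym (≋-trans (∑-partitionsUpTo-δ {M} (toPartition []) {λ μ → 𝟙 (𝒫? ∅ μ) *ₜ coeff (s μ) λ′} z≤n
      λ μ μ≢ → 𝟙-no* (𝒫? ∅ μ) (μ≢ ∘ partition-≡) (coeff (s μ) λ′))
    (𝟙-yes* (𝒫? ∅ (toPartition [])) refl (coeff (s (toPartition [])) λ′))))))
littlewood-identity □ λ′ ≤M = Ω-weighted (𝒫? □) (λ _ → 1ₜ) (λ _ _ → ≋-refl) ≋-refl exchange-all littlewood-□ λ′ ≤M
littlewood-identity ▭ λ′ ≤M = Ω-weighted (𝒫? ▭) evenRows (λ μ → evenRows-𝟙 (parts μ)) ≋-refl exchange-even littlewood-▭ λ′ ≤M
littlewood-identity ▯ λ′ ≤M = Ω-weighted (𝒫? ▯) evenColumns evenColumns-𝒫 ≋-refl exchange-even-columns littlewood-▯ λ′ ≤M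

-- The coefficients K^◇ as Schur coordinates

coord-+Λ : ∀ f g τ → coord (f +Λ g) τ ≋ coord f τ +ₜ coord g τ
coord-+Λ f g τ = ≋-trans (schurCoord-cong τ λ μ _ → coeff-+Λ f g μ)
  (schurElimination-⊕ (partitionsOf ∣ τ ∣) (coeff f) (coeff g) τ)

coord-·Λ : ∀ c f τ → coord (c ·Λ f) τ ≋ c *ₜ coord f τ
coord-·Λ c f τ = ≋-trans (schurCoord-cong τ λ μ _ → coeff-·Λ c f μ)
  (schurElimination-⊙ (partitionsOf ∣ τ ∣) c (coeff f) τ)

coord-⊥-+Λ : ∀ P f g κ → coord ((P ^⊥) (f +Λ g)) κ ≋ coord ((P ^⊥) f) κ +ₜ coord ((P ^⊥) g) κ
coord-⊥-+Λ P f g κ = begin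
  coord ((P ^⊥) (f +Λ g)) κ
    ≈⟨ coord-⊥ {M} P (f +Λ g) κ ℕ.≤-refl ⟩
  (∑[ τ ← partitionsUpTo M ] coord (f +Λ g) τ *ₜ c τ)
    ≈⟨ ∑-cong (partitionsUpTo M) (λ τ → ≋-trans (*ₜ-congʳ (c τ) (coord-+Λ f g τ)) (*ₜ-distribʳ (c τ) (coord f τ) (coord g τ))) ⟩
  (∑[ τ ← partitionsUpTo M ] coord f τ *ₜ c τ +ₜ coord g τ *ₜ c τ)
    ≈⟨ ∑-+ (partitionsUpTo M) (λ τ → coord f τ *ₜ c τ) (λ τ → coord g τ *ₜ c τ) ⟩
  (∑[ τ ← partitionsUpTo M ] coord f τ *ₜ c τ) +ₜ (∑[ τ ← partitionsUpTo M ] coord g τ *ₜ c τ)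
    ≈⟨ +ₜ-cong (coord-⊥ {M} P f κ (ℕ.m≤m⊔n (bound f) (bound g))) (coord-⊥ {M} P g κ (ℕ.m≤n⊔m (bound f) (bound g))) ⟨
  coord ((P ^⊥) f) κ +ₜ coord ((P ^⊥) g) κ ∎
  where
  open ≋-Reasoning
  M = bound f ⊔ bound g
  c : Partition → ℚ[t]
  c τ = schurCoord (P ⊛ coeff (s κ)) τ

coord-⊥-·Λ : ∀ P a f κ → coord ((P ^⊥) (a ·Λ f)) κ ≋ a *ₜ coord ((P ^⊥) f) κ
coord-⊥-·Λ P a f κ = begin
  coord ((P ^⊥) (a ·Λ f)) κ
    ≈⟨ coord-⊥ {bound f} P (a ·Λ f) κ ℕ.≤-refl ⟩
  (∑[ τ ← Ps ] coord (a ·Λ f) τ *ₜ c τ)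
    ≈⟨ ∑-cong Ps (λ τ → ≋-trans (*ₜ-congʳ (c τ) (coord-·Λ a f τ)) (*ₜ-assoc a (coord f τ) (c τ))) ⟩
  (∑[ τ ← Ps ] a *ₜ (coord f τ *ₜ c τ))
    ≈⟨ ∑-*ˡ Ps a (λ τ → coord f τ *ₜ c τ) ⟨
  a *ₜ (∑[ τ ← Ps ] coord f τ *ₜ c τ)
    ≈⟨ *ₜ-congˡ a (coord-⊥ {bound f} P f κ ℕ.≤-refl) ⟨
  a *ₜ coord ((P ^⊥) f) κ ∎
  where
  open ≋-Reasoning
  Ps = partitionsUpTo (bound f)
  c : Partition → ℚ[t]
  c τ = schurCoord (P ⊛ coeff (s κ)) τ

coord-⊥-0Λ : ∀ P κ → coord ((P ^⊥) 0Λ) κ ≋ 0ₜ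
coord-⊥-0Λ P κ = ≋-trans (coord-⊥ {0} P 0Λ κ ℕ.≤-refl) (∑-zero (partitionsUpTo 0) λ τ →
  *ₜ-zeroˡ (schurCoord-0 τ λ μ _ → coeff-0Λ μ) (schurCoord (P ⊛ coeff (s κ)) τ))

coord-⊥-∑Λ : ∀ {A : Set} P (xs : List A) (c : A → ℚ[t]) (g : A → Λ) κ →
  coord ((P ^⊥) (∑Λ[ x ← xs ] c x ·Λ g x)) κ ≋ (∑[ x ← xs ] c x *ₜ coord ((P ^⊥) (g x)) κ)
coord-⊥-∑Λ P []       c g κ = coord-⊥-0Λ P κ
coord-⊥-∑Λ P (x ∷ xs) c g κ = ≋-trans (coord-⊥-+Λ P (c x ·Λ g x) (∑Λ[ x ← xs ] c x ·Λ g x) κ)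
  (+ₜ-cong (coord-⊥-·Λ P (c x) (g x) κ) (coord-⊥-∑Λ P xs c g κ))

coord-Ω-s◇ : ∀ ◇ λ′ κ → coord ((Ω f[ ◇ ] ^⊥) (s◇ ◇ λ′)) κ ≋ 𝟙 (λ′ ≡ₚ? κ)
coord-Ω-s◇ ◇ λ′ κ = ≋-trans
  (coord-cong {(Ω f[ ◇ ] ^⊥) (s◇ ◇ λ′)} {s λ′} (≈-trans {(Ω f[ ◇ ] ^⊥) (s◇ ◇ λ′)} {((Ω (0∞ ⊖ f[ ◇ ]) ⊛ Ω f[ ◇ ]) ^⊥) (s λ′)} {s λ′}
    (⊥-∘ (Ω f[ ◇ ]) (Ω (0∞ ⊖ f[ ◇ ])) (s λ′)) (⊥-1 (s λ′) inverse)) κ)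
  (schurCoord-s λ′ κ)
  where
  inverse : Ω (0∞ ⊖ f[ ◇ ]) ⊛ Ω f[ ◇ ] ≋∞ 1∞
  inverse μ = ≋-trans (≋-sym (Ω-⊕ (0∞ ⊖ f[ ◇ ]) f[ ◇ ] μ)) (Ω-0 {(0∞ ⊖ f[ ◇ ]) ⊕ f[ ◇ ]} (λ ν → -ₜ-inverseˡ (f[ ◇ ] ν)) μ)

-- The hypothesis merely provides some family of coefficients. Skewing by Ω[f] turns the s^◇_λ into
-- Schur functions, whose coordinates are unique, and thereby determines the family; for |κ| > N
-- both sides vanish.
expansion-coord : ∀ ◇ R {𝒦} → IsExpansion ◇ R 𝒦 → ∀ κ → 𝒦 κ ≋ coord ((Ω f[ ◇ ] ^⊥) (H* ◇ R)) κ
expansion-coord ◇ R {𝒦} (N , vanish , expansion) κ = ≋-sym (begin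
  coord ((Ω f[ ◇ ] ^⊥) (H* ◇ R)) κ
    ≈⟨ coord-cong {(Ω f[ ◇ ] ^⊥) (H* ◇ R)} {(Ω f[ ◇ ] ^⊥) E} (⊥-cong {Ω f[ ◇ ]} {Ω f[ ◇ ]} {H* ◇ R} {E} (λ _ → ≋-refl) expansion) κ ⟩
  coord ((Ω f[ ◇ ] ^⊥) E) κ
    ≈⟨ coord-⊥-∑Λ (Ω f[ ◇ ]) (partitionsUpTo N) 𝒦 (s◇ ◇) κ ⟩
  (∑[ λ′ ← partitionsUpTo N ] 𝒦 λ′ *ₜ coord ((Ω f[ ◇ ] ^⊥) (s◇ ◇ λ′)) κ)
    ≈⟨ ∑-cong (partitionsUpTo N) (λ λ′ → *ₜ-congˡ (𝒦 λ′) (coord-Ω-s◇ ◇ λ′ κ)) ⟩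
  (∑[ λ′ ← partitionsUpTo N ] 𝒦 λ′ *ₜ 𝟙 (λ′ ≡ₚ? κ))
    ≈⟨ evaluate (∣ κ ∣ ≤? N) ⟩
  𝒦 κ ∎)
  where
  open ≋-Reasoning
  E : Λ
  E = ∑Λ[ λ′ ← partitionsUpTo N ] 𝒦 λ′ ·Λ s◇ ◇ λ′
  evaluate : Dec (∣ κ ∣ ≤ N) → (∑[ λ′ ← partitionsUpTo N ] 𝒦 λ′ *ₜ 𝟙 (λ′ ≡ₚ? κ)) ≋ 𝒦 κ
  evaluate (yes κ≤N) = ∑-𝟙ˡ 𝒦 κ κ≤N
  evaluate (no κ≰N)  = ≋-trans (∑-𝟙-> 𝒦 κ (ℕ.≰⇒> κ≰N)) (≋-sym (vanish κ (ℕ.≰⇒> κ≰N)))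

[tX]⊖-cancel : ∀ F → Ω (F [tX] ⊖ F) ⊛ Ω F ≋∞ (Ω F) [tX]
[tX]⊖-cancel F μ = ≋-trans (≋-sym (Ω-⊕ (F [tX] ⊖ F) F μ)) (≋-trans (Ω-cong {(F [tX] ⊖ F) ⊕ F} {F [tX]} cancel μ) (Ω-[tX] F μ))
  where
  cancel : (F [tX] ⊖ F) ⊕ F ≋∞ F [tX]
  cancel ν = ≋-trans (+ₜ-assoc ((F [tX]) ν) (-ₜ F ν) (F ν))
    (≋-trans (+ₜ-congˡ ((F [tX]) ν) (-ₜ-inverseˡ (F ν))) (+ₜ-identityʳ ((F [tX]) ν)))

expansion-coord-[tX] : ∀ ◇ R {𝒦} → IsExpansion ◇ R 𝒦 → ∀ κ → 𝒦 κ ≋ coord ((((Ω f[ ◇ ]) [tX]) ^⊥) (iterate B̃ R)) κ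
expansion-coord-[tX] ◇ R {𝒦} expansion κ = ≋-trans (expansion-coord ◇ R expansion κ)
  (coord-cong {(Ω f[ ◇ ] ^⊥) (H* ◇ R)} {(((Ω f[ ◇ ]) [tX]) ^⊥) T}
    (≈-trans {(Ω f[ ◇ ] ^⊥) (H* ◇ R)} {(Ω f[ ◇ ] ^⊥) ((U ^⊥) T)} {(((Ω f[ ◇ ]) [tX]) ^⊥) T}
      (⊥-cong {Ω f[ ◇ ]} {Ω f[ ◇ ]} {H* ◇ R} {(U ^⊥) T} (λ _ → ≋-refl) (H*-conjugate ◇ R))
      (≈-trans {(Ω f[ ◇ ] ^⊥) ((U ^⊥) T)} {((U ⊛ Ω f[ ◇ ]) ^⊥) T} {(((Ω f[ ◇ ]) [tX]) ^⊥) T}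
        (⊥-∘ (Ω f[ ◇ ]) U T)
        (⊥-cong {U ⊛ Ω f[ ◇ ]} {(Ω f[ ◇ ]) [tX]} {T} {T} ([tX]⊖-cancel f[ ◇ ]) (≈-refl {T})))) κ)
  where
  T : Λ
  T = iterate B̃ R
  U : Λ∞
  U = Ω (f[ ◇ ] [tX] ⊖ f[ ◇ ])

-- As f_∅ = 0, the skewing operator is the identity here.
expansion-∅ : ∀ R {𝒦} → IsExpansion ∅ R 𝒦 → ∀ κ → 𝒦 κ ≋ coord (iterate B̃ R) κ
expansion-∅ R expansion κ = ≋-trans (expansion-coord-[tX] ∅ R expansion κ)
  (coord-cong {(((Ω f[ ∅ ]) [tX]) ^⊥) (iterate B̃ R)} {iterate B̃ R} (⊥-1 {(Ω f[ ∅ ]) [tX]} (iterate B̃ R) one[tX]) κ)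
  where
  one[tX] : (Ω f[ ∅ ]) [tX] ≋∞ 1∞
  one[tX] μ = ≋-trans (≋-sym (Ω-[tX] f[ ∅ ] μ)) (Ω-0 {f[ ∅ ] [tX]} (λ ν → *ₜ-zeroʳ (t^ ∣ ν ∣)) μ)

-- By homogeneity of s_ν the factor t^|λ| at the monomial λ may be replaced by t^|ν|, which no
-- longer depends on the monomial.
schurCoord-Ω-[tX] : ∀ ◇ μ → schurCoord ((Ω f[ ◇ ]) [tX]) μ ≋ t^ ∣ μ ∣ *ₜ 𝟙 (𝒫? ◇ μ)
schurCoord-Ω-[tX] ◇ μ = begin
  schurCoord ((Ω f[ ◇ ]) [tX]) μ
    ≈⟨ schurCoord-cong μ (λ λ′ e → ≋-trans (*ₜ-congˡ (t^ ∣ λ′ ∣) (littlewood-identity ◇ {∣ μ ∣} λ′ (ℕ.≤-reflexive e)))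
         (≋-trans (∑-*ˡ Ps (t^ ∣ λ′ ∣) (λ ν → 𝟙 (𝒫? ◇ ν) *ₜ coeff (s ν) λ′)) (∑-cong Ps λ ν → degree-shift ν λ′ (∣ ν ∣ ≟ ∣ λ′ ∣)))) ⟩
  schurCoord (λ λ′ → ∑[ ν ← Ps ] t^ ∣ ν ∣ *ₜ 𝟙 (𝒫? ◇ ν) *ₜ coeff (s ν) λ′) μ
    ≈⟨ schurCoord-∑s ∣ μ ∣ (λ ν → t^ ∣ ν ∣ *ₜ 𝟙 (𝒫? ◇ ν)) μ ⟩
  (∑[ ν ← Ps ] t^ ∣ ν ∣ *ₜ 𝟙 (𝒫? ◇ ν) *ₜ 𝟙 (ν ≡ₚ? μ))
    ≈⟨ ∑-𝟙ˡ (λ ν → t^ ∣ ν ∣ *ₜ 𝟙 (𝒫? ◇ ν)) μ ℕ.≤-refl ⟩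
  t^ ∣ μ ∣ *ₜ 𝟙 (𝒫? ◇ μ) ∎
  where
  open ≋-Reasoning
  Ps = partitionsUpTo ∣ μ ∣
  degree-shift : ∀ ν λ′ → Dec (∣ ν ∣ ≡ ∣ λ′ ∣) →
    t^ ∣ λ′ ∣ *ₜ (𝟙 (𝒫? ◇ ν) *ₜ coeff (s ν) λ′) ≋ t^ ∣ ν ∣ *ₜ 𝟙 (𝒫? ◇ ν) *ₜ coeff (s ν) λ′
  degree-shift ν λ′ (yes e) = ≋-trans (≡⇒≋ (cong (λ n → t^ n *ₜ (𝟙 (𝒫? ◇ ν) *ₜ coeff (s ν) λ′)) (sym e)))
    (≋-sym (*ₜ-assoc (t^ ∣ ν ∣) (𝟙 (𝒫? ◇ ν)) (coeff (s ν) λ′)))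
  degree-shift ν λ′ (no ν≢) = ≋-trans (*ₜ-zeroʳ′ (t^ ∣ λ′ ∣) (*ₜ-zeroʳ′ (𝟙 (𝒫? ◇ ν)) (s-degree ν λ′ ν≢)))
    (≋-sym (*ₜ-zeroʳ′ (t^ ∣ ν ∣ *ₜ 𝟙 (𝒫? ◇ ν)) (s-degree ν λ′ ν≢)))

LR-degree : ∀ τ κ μ → ∣ κ ∣ + ∣ μ ∣ ≢ ∣ τ ∣ → LR τ κ μ ≋ 0ₜ
LR-degree τ κ μ ≢τ = schurCoord-0 τ λ ν e →
  homogeneous-⊛ {F = coeff (s κ)} {coeff (s μ)} (homogeneous-s κ) (homogeneous-s μ) ν λ e′ → ≢τ (trans (sym e′) e)

-- Littlewood-Richardson coefficients vanish unless |κ| + |μ| = |τ|, which makes the power of t the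
-- same in all terms. If |κ| > n, no μ passes the filter, and the truncated subtraction does no
-- harm.
skew-LR : ∀ ◇ κ τ n → ∣ τ ∣ ≡ n → schurCoord ((Ω f[ ◇ ]) [tX] ⊛ coeff (s κ)) τ ≋
  t^ (n ∸ ∣ κ ∣) *ₜ (∑[ μ ← filter (𝒫? ◇) (filter (λ μ → ∣ κ ∣ + ∣ μ ∣ ≟ n) (partitionsUpTo n)) ] LR τ κ μ)
skew-LR ◇ κ τ n τ≡n = begin
  schurCoord (F ⊛ coeff (s κ)) τ
    ≈⟨ schurCoord-cong τ (λ ν _ → ⊛-comm F (coeff (s κ)) ν) ⟩
  schurCoord (coeff (s κ) ⊛ F) τ
    ≈⟨ schurCoord-⊛ {n} (coeff (s κ)) F τ (ℕ.≤-reflexive τ≡n) ⟩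
  (∑[ μ ← partitionsUpTo n ] schurCoord F μ *ₜ LR τ κ μ)
    ≈⟨ ∑-cong (partitionsUpTo n) (λ μ → ≋-trans (*ₜ-congʳ (LR τ κ μ) (schurCoord-Ω-[tX] ◇ μ)) (select μ (∣ κ ∣ + ∣ μ ∣ ≟ n))) ⟩
  (∑[ μ ← partitionsUpTo n ] t^ (n ∸ ∣ κ ∣) *ₜ (𝟙 (∣ κ ∣ + ∣ μ ∣ ≟ n) *ₜ (𝟙 (𝒫? ◇ μ) *ₜ LR τ κ μ)))
    ≈⟨ ∑-*ˡ (partitionsUpTo n) (t^ (n ∸ ∣ κ ∣)) (λ μ → 𝟙 (∣ κ ∣ + ∣ μ ∣ ≟ n) *ₜ (𝟙 (𝒫? ◇ μ) *ₜ LR τ κ μ)) ⟨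
  t^ (n ∸ ∣ κ ∣) *ₜ (∑[ μ ← partitionsUpTo n ] 𝟙 (∣ κ ∣ + ∣ μ ∣ ≟ n) *ₜ (𝟙 (𝒫? ◇ μ) *ₜ LR τ κ μ))
    ≈⟨ *ₜ-congˡ (t^ (n ∸ ∣ κ ∣)) (≋-trans
         (∑-filter (𝒫? ◇) (filter (λ μ → ∣ κ ∣ + ∣ μ ∣ ≟ n) (partitionsUpTo n)) (LR τ κ))
         (∑-filter (λ μ → ∣ κ ∣ + ∣ μ ∣ ≟ n) (partitionsUpTo n) (λ μ → 𝟙 (𝒫? ◇ μ) *ₜ LR τ κ μ))) ⟨
  t^ (n ∸ ∣ κ ∣) *ₜ (∑[ μ ← filter (𝒫? ◇) (filter (λ μ → ∣ κ ∣ + ∣ μ ∣ ≟ n) (partitionsUpTo n)) ] LR τ κ μ) ∎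
  where
  open ≋-Reasoning
  F : Λ∞
  F = (Ω f[ ◇ ]) [tX]
  select : ∀ μ → Dec (∣ κ ∣ + ∣ μ ∣ ≡ n) → t^ ∣ μ ∣ *ₜ 𝟙 (𝒫? ◇ μ) *ₜ LR τ κ μ ≋
    t^ (n ∸ ∣ κ ∣) *ₜ (𝟙 (∣ κ ∣ + ∣ μ ∣ ≟ n) *ₜ (𝟙 (𝒫? ◇ μ) *ₜ LR τ κ μ))
  select μ (yes e) = ≋-trans (*ₜ-assoc (t^ ∣ μ ∣) (𝟙 (𝒫? ◇ μ)) (LR τ κ μ))
    (*ₜ-cong (≡⇒≋ (cong t^_ (trans (sym (ℕ.m+n∸m≡n (∣ κ ∣) (∣ μ ∣))) (cong (_∸ (∣ κ ∣)) e))))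
      (≋-sym (𝟙-yes* (∣ κ ∣ + ∣ μ ∣ ≟ n) e (𝟙 (𝒫? ◇ μ) *ₜ LR τ κ μ))))
  select μ (no ≢n) = ≋-trans (*ₜ-zeroʳ′ (t^ ∣ μ ∣ *ₜ 𝟙 (𝒫? ◇ μ)) (LR-degree τ κ μ λ e → ≢n (trans e τ≡n)))
    (≋-sym (*ₜ-zeroʳ′ (t^ (n ∸ ∣ κ ∣)) (𝟙-no* (∣ κ ∣ + ∣ μ ∣ ≟ n) ≢n (𝟙 (𝒫? ◇ μ) *ₜ LR τ κ μ))))

coord-skew : ∀ ◇ n f → Homogeneous n (coeff f) → ∀ κ → coord ((((Ω f[ ◇ ]) [tX]) ^⊥) f) κ ≋
  t^ (n ∸ ∣ κ ∣) *ₜ (∑[ τ ← partitionsOf n ] coord f τ *ₜ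
    (∑[ μ ← filter (𝒫? ◇) (filter (λ μ → ∣ κ ∣ + ∣ μ ∣ ≟ n) (partitionsUpTo n)) ] LR τ κ μ))
coord-skew ◇ n f hf κ = begin
  coord ((((Ω f[ ◇ ]) [tX]) ^⊥) f) κ
    ≈⟨ coord-⊥ {M} ((Ω f[ ◇ ]) [tX]) f κ (ℕ.m≤m⊔n (bound f) n) ⟩
  (∑[ τ ← partitionsUpTo M ] coord f τ *ₜ c τ)
    ≈⟨ ∑-partitionsUpTo-of {M} {n} (ℕ.m≤n⊔m (bound f) n) (λ τ τ≢n → *ₜ-zeroˡ
         (schurCoord-0 τ λ μ e → hf μ λ e′ → τ≢n (trans (sym e) e′)) (c τ)) ⟩
  (∑[ τ ← partitionsOf n ] coord f τ *ₜ c τ)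
    ≈⟨ ∑-congAll (All.map (λ {τ} τ≡n → ≋-trans (*ₜ-congˡ (coord f τ) (skew-LR ◇ κ τ n τ≡n))
         (*ₜ-swap (coord f τ) (t^ (n ∸ ∣ κ ∣)) (S τ))) (partitionsOf-size n)) ⟩
  (∑[ τ ← partitionsOf n ] t^ (n ∸ ∣ κ ∣) *ₜ (coord f τ *ₜ S τ))
    ≈⟨ ∑-*ˡ (partitionsOf n) (t^ (n ∸ ∣ κ ∣)) (λ τ → coord f τ *ₜ S τ) ⟨
  t^ (n ∸ ∣ κ ∣) *ₜ (∑[ τ ← partitionsOf n ] coord f τ *ₜ S τ) ∎
  where
  open ≋-Reasoning
  M = bound f ⊔ n
  c S : Partition → ℚ[t]
  c τ = schurCoord ((Ω f[ ◇ ]) [tX] ⊛ coeff (s κ)) τ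
  S τ = ∑[ μ ← filter (𝒫? ◇) (filter (λ μ → ∣ κ ∣ + ∣ μ ∣ ≟ n) (partitionsUpTo n)) ] LR τ κ μ

mainTheorem6 : ∀ (◇ : Shape) (R : List Partition) (K◇ K∅ : Partition → ℚ[t]) →
    IsExpansion ◇ R K◇ → IsExpansion ∅ R K∅ →
    ∀ (λ′ : Partition) →
    K◇ λ′ ≋
    t^ (∥ R ∥ ∸ ∣ λ′ ∣) *ₜ
    (∑[ τ ← partitionsOf ∥ R ∥ ]
    K∅ τ *ₜ
    (∑[ μ ← filter (𝒫? ◇) (filter (λ μ → ∣ λ′ ∣ + ∣ μ ∣ ≟ ∥ R ∥) (partitionsUpTo ∥ R ∥)) ]
    LR τ λ′ μ))
mainTheorem6 ◇ R K◇ K∅ expansion◇ expansion∅ λ′ = ≋-trans (expansion-coord-[tX] ◇ R expansion◇ λ′)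
  (≋-trans (coord-skew ◇ ∥ R ∥ (iterate B̃ R) (iterate-homogeneous B̃ B̃-homogeneous R) λ′)
    (*ₜ-congˡ (t^ (∥ R ∥ ∸ ∣ λ′ ∣)) (∑-cong (partitionsOf ∥ R ∥) λ τ →
      *ₜ-congʳ (∑[ μ ← filter (𝒫? ◇) (filter (λ μ → ∣ λ′ ∣ + ∣ μ ∣ ≟ ∥ R ∥) (partitionsUpTo ∥ R ∥)) ] LR τ λ′ μ)
        (≋-sym (expansion-∅ R expansion∅ τ)))))
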